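{- Let $K$ be a quadratic field and $c \in K$. Then the directed graph $G(f_c,K)$ does not contain a subgraph isomorphic to the graph $G_1$.
   Context: For $f_c(z) = z^2 + c$ and a number field $K$, $G(f_c,K)$ is the directed graph whose vertices are the points of $K$ (the point at infinity excluded) that are preperiodic for $f_c$ (i.e. $f_c^{m+n}(x) = f_c^n(x)$ for some $m \ge 1$, $n \ge 0$), with an edge $x \to y$ iff $f_c(x) = y$. The graph $G_1$ has ten vertices $a, a', b, b', p, \bar p, s, \bar s, r, \bar r$ and edges $a \to a$, $b \to a$, $a' \to a'$, $b' \to a'$, $p \to b$, $\bar p \to b$, $s \to b'$, $\bar s \to b'$, $r \to p$, $\bar r \to p$ (equivalently: two distinct fixed points, a point $r$ of preperiodic type $1_3$, i.e. preperiod $3$ and eventual period $1$, and a point $s$ of type $1_2$ whose orbit is disjoint from that of $r$, together with the additional preimages these force). -}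

module Defs where

open import Data.Integer using (ℤ)
open import Data.Rational using (ℚ; _/_)
import Data.Rational as Q
open import Data.Product using (_×_; _,_)
open import Relation.Binary.PropositionalEquality using (_≡_; _≢_)
open import Function.Definitions using (Injective)

ℤ→ℚ : ℤ → ℚ
ℤ→ℚ d = d / 1

-- d is not the square of a rational number; then ℚ(√d) is a quadratic field,
-- and every quadratic field is (isomorphic to) one of these.
NonSquare : ℤ → Set
NonSquare d = ∀ (q : ℚ) → q Q.* q ≢ ℤ→ℚ d

-- Elements of K = ℚ(√d), written a + b√d as the pair (a , b).
-- Since ℚ is normalised, _≡_ on pairs is equality in K.
K : ℤ → Set
K d = ℚ × ℚ

embed : (d : ℤ) → ℚ → K d
embed d a = (a , Q.0ℚ)

addK : (d : ℤ) → K d → K d → K d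
addK d (a , b) (a' , b') = (a Q.+ a' , b Q.+ b')

mulK : (d : ℤ) → K d → K d → K d
mulK d (a , b) (a' , b') = (a Q.* a' Q.+ ℤ→ℚ d Q.* (b Q.* b') , a Q.* b' Q.+ b Q.* a')

f : (d : ℤ) → K d → K d → K d
f d c z = addK d (mulK d z z) c

data V₁ : Set where
  a a' b b' p p̄ s s̄ r r̄ : V₁

next₁ : V₁ → V₁
next₁ a  = a
next₁ b  = a
next₁ a' = a'
next₁ b' = a'
next₁ p  = b
next₁ p̄  = b
next₁ s  = b'
next₁ s̄  = b'
next₁ r  = p
next₁ r̄  = p

-- G(f_c,K) contains a subgraph isomorphic to G₁: an injective vertex map
-- ι : V₁ → K sending each edge v → next₁ v to an edge of G(f_c,K),
-- i.e. f_c(ι v) = ι (next₁ v).  (Such points are automatically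
-- preperiodic, hence vertices of G(f_c,K).)
record ContainsG₁ (d : ℤ) (c : K d) : Set where
  field
    ι     : V₁ → K d
    inj   : Injective _≡_ _≡_ ι
    edges : ∀ (v : V₁) → f d c (ι v) ≡ ι (next₁ v)

module Submission where

-- Let a, a' be the fixed points and p² = −a − c, s² = −a' − c, r² = p − c as in G₁; then a' = 1 − a, p² = a² − 2a and s² = a² − 1.
-- Put q = 1 + p − a, y = 2qr, A = 1 + p + s and B = 1 + p − s.  Then y² = q⁴ + 2q² − 4q + 1, AB = 2q and
-- (A − 2) q (q − A) = A, and B satisfies the same cubic relation as A.
-- The quartic curve has only the rational points with q ∈ {0, 1}; this is a 2-descent over the
-- Euclidean ring ℤ[τ], τ³ = 2τ² − 2.
-- The cubic curve has only the rational points with A = 0; this follows from s⁴ ± s²p² + p⁴ = z² having only trivial solutions.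
-- A quadratic point q of the quartic lies on a parabola y = x² + … meeting the curve in at most one more finite point, a rational one, so its trace and
-- norm satisfy one of two explicit equations; if A ∉ ℚ, then A is a root of a rational cubic whose third root is a rational point.
-- Comparing the two for A and for B leaves q ∈ ℚ.  There s² and r² are rational, and unless both are d times a rational square one of
-- A and q is a forbidden rational point.  If they are, (q² + 1)(q² − 4q + 1) = 4q²s² and y² multiply to a square, so
-- ±4q²s² is a rational square: + makes d a square, − gives a non-trivial point on S⁴ + S²p² + p⁴ = z² with S² = −s².

-- With x = 1/(q - 1) the quartic becomes Y² = 4x³ + 8x² + 4x + 1, a model of X₁(11). It has no
-- rational 2-torsion, so no descent by 2-isogeny is available over ℤ and the 2-descent has to pass
-- to the cubic field of discriminant -44; hence the effort spent on showing that ℤ[τ] is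
-- norm-Euclidean and on determining its units of norm 1 modulo squares. The cubic in A and q has
-- conductor 24 and rational 2-torsion, and its descent stays in ℤ. Both curves have finitely many
-- rational points, yet each has infinitely many conjugate pairs of quadratic points: every rational
-- point is the sum of a one-parameter family of such pairs. Neither curve alone therefore excludes
-- q ∉ ℚ; the way out is that A, B and q give quadratic points on both curves at once, and the
-- families turn out to be incompatible. For q ∈ ℚ the field survives only as a common twist by d in
-- the equations for s² and r². Multiplying the two equations eliminates d, so that one argument
-- serves all quadratic fields.

open import Algebra.Bundles using (CommutativeRing)
open import Algebra.Structures using (IsCommutativeRing)
open import Data.Integer as ℤ using (ℤ; 0ℤ; 1ℤ)
open import Level using (0ℓ)
open import Relation.Binary.PropositionalEquality using (_≡_)

-- Binary quadratic forms of discriminant zero over a Euclidean domain.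

module EuclideanDomain (R : CommutativeRing 0ℓ 0ℓ) where
  open CommutativeRing R
  open import Algebra.Properties.Ring ring using (+-cancelʳ)
  open import Algebra.Solver.Ring.NaturalCoefficients.Default commutativeSemiring
  open import Data.Nat.Base as ℕ using (ℕ)
  open import Data.Nat.Induction using (<-wellFounded)
  import Data.Nat.Properties as ℕ
  open import Data.Product using (∃; ∃-syntax; _×_; _,_)
  open import Data.Sum using ([_,_]′)
  open import Function.Base using (id)
  open import Induction.WellFounded using (Acc; acc)
  open import Relation.Binary.PropositionalEquality as ≡ using (_≡_; _≢_)
  open import Relation.Nullary using (yes; no)
  open import Relation.Binary.Reasoning.Setoid setoid

  module EuclideanNorm
    (N : Carrier → ℕ)
    (N-cong : ∀ {x y} → x ≈ y → N x ≡ N y)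
    (N-* : ∀ x y → N (x * y) ≡ N x ℕ.* N y)
    (N≡0⇒≈0 : ∀ x → N x ≡ 0 → x ≈ 0#)
    (divide : ∀ x y → N y ≢ 0 → ∃[ q ] N (x - q * y) ℕ.< N y)
    where

    -- The quadratic form αX² + 2γXY + βY² of discriminant zero is δ(ξX + ηY)².
    RankOne : Carrier → Carrier → Carrier → Set
    RankOne α β γ = ∃[ δ ] ∃[ ξ ] ∃[ η ]
      α ≈ δ * (ξ * ξ) × β ≈ δ * (η * η) × γ ≈ δ * (ξ * η)

    private
      square-decreases : ∀ {a b c} → b ℕ.* a ≡ c ℕ.* c → c ℕ.< b → a ℕ.< b
      square-decreases {a} {b} {c} ba≡cc c<b = ℕ.≰⇒> λ b≤a →
        ℕ.<-irrefl (≡.sym ba≡cc) (ℕ.<-≤-trans (ℕ.*-mono-< c<b c<b) (ℕ.*-monoʳ-≤ b b≤a))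

      minus-plus : ∀ x c → x ≈ x - c + c
      minus-plus x c = sym (trans (+-assoc x (- c) c) (trans (+-congˡ (-‿inverseˡ c)) (+-identityʳ x)))

    -- Gauss reduction: dividing γ by β and substituting replaces (α , β) by (β , α″)
    -- with α″ of smaller norm than β.
    abstract
      rankOne : ∀ α β γ → α * β ≈ γ * γ → RankOne α β γ
      rankOne α β γ = go α β γ (<-wellFounded (N β))
        where
        go : ∀ α β γ → Acc ℕ._<_ (N β) → α * β ≈ γ * γ → RankOne α β γ
        go α β γ (acc smaller) αβ≈γγ with N β ℕ.≟ 0
        -- A vanishing β forces γ = 0, and the form is αX².
        ... | yes Nβ≡0 = α , 1# , 0# ,
                sym (trans (*-congˡ (*-identityʳ 1#)) (*-identityʳ α)) ,
                trans (N≡0⇒≈0 β Nβ≡0) (sym (trans (*-congˡ (zeroʳ 0#)) (zeroʳ α))) ,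
                trans γ≈0 (sym (trans (*-congˡ (zeroʳ 1#)) (zeroʳ α)))
          where
          NγNγ≡0 : N γ ℕ.* N γ ≡ 0
          NγNγ≡0 = ≡.trans (≡.sym (N-* γ γ)) (≡.trans (≡.sym (N-cong αβ≈γγ))
            (≡.trans (N-* α β) (≡.trans (≡.cong (N α ℕ.*_) Nβ≡0) (ℕ.*-zeroʳ (N α)))))
          γ≈0 : γ ≈ 0#
          γ≈0 = N≡0⇒≈0 γ ([ id , id ]′ (ℕ.m*n≡0⇒m≡0∨n≡0 (N γ) NγNγ≡0))
        ... | no Nβ≢0 with divide γ β Nβ≢0
        ...   | q , Nγ′<Nβ = assemble (go β α″ γ′ (smaller Nα″<Nβ) βα″≈γ′γ′)
          where
          γ′ c α″ : Carrier
          γ′ = γ - q * β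
          -- Thus α - c = α - 2qγ + q²β, the coefficient of X² after the substitution Y ↦ Y - qX.
          c = q * γ′ + q * γ′ + q * q * β
          α″ = α - c
          βα″≈γ′γ′ : β * α″ ≈ γ′ * γ′
          βα″≈γ′γ′ = +-cancelʳ (β * c) _ _ (begin
            β * α″ + β * c                   ≈⟨ solve 3 (λ β a c → β :* a :+ β :* c := (a :+ c) :* β) refl β α″ c ⟩
            (α″ + c) * β                     ≈⟨ *-congʳ (minus-plus α c) ⟨
            α * β                            ≈⟨ αβ≈γγ ⟩
            γ * γ                            ≈⟨ *-cong (minus-plus γ (q * β)) (minus-plus γ (q * β)) ⟩
            (γ′ + q * β) * (γ′ + q * β)      ≈⟨ solve 3 (λ q β g → (g :+ q :* β) :* (g :+ q :* β)
                                                  := g :* g :+ β :* (q :* g :+ q :* g :+ q :* q :* β)) refl q β γ′ ⟩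
            γ′ * γ′ + β * c                  ∎)
          Nα″<Nβ : N α″ ℕ.< N β
          Nα″<Nβ = square-decreases
            (≡.trans (≡.sym (N-* β α″)) (≡.trans (N-cong βα″≈γ′γ′) (N-* γ′ γ′))) Nγ′<Nβ
          assemble : RankOne β α″ γ′ → RankOne α β γ
          -- The recursive call has the two variables exchanged, so its ξ belongs to β and its η to
          -- α″; undoing the substitution adds qξ to η.
          assemble (δ , ξ , η , β≈δξξ , α″≈δηη , γ′≈δξη) = δ , η + q * ξ , ξ , α≈ , β≈δξξ , γ≈
            where
            qγ′≈ : q * γ′ ≈ q * (δ * (ξ * η))
            qγ′≈ = *-congˡ γ′≈δξη
            α≈ : α ≈ δ * ((η + q * ξ) * (η + q * ξ))
            α≈ = begin
              α        ≈⟨ minus-plus α c ⟩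
              α″ + c   ≈⟨ +-cong α″≈δηη (+-cong (+-cong qγ′≈ qγ′≈) (*-congˡ β≈δξξ)) ⟩
              _        ≈⟨ solve 4 (λ δ ξ η q → δ :* (η :* η) :+ (q :* (δ :* (ξ :* η)) :+ q :* (δ :* (ξ :* η)) :+ q :* q :* (δ :* (ξ :* ξ)))
                            := δ :* ((η :+ q :* ξ) :* (η :+ q :* ξ))) refl δ ξ η q ⟩
              _        ∎
            γ≈ : γ ≈ δ * ((η + q * ξ) * ξ)
            γ≈ = begin
              γ            ≈⟨ minus-plus γ (q * β) ⟩
              γ′ + q * β   ≈⟨ +-cong γ′≈δξη (*-congˡ β≈δξξ) ⟩
              _            ≈⟨ solve 4 (λ δ ξ η q → δ :* (ξ :* η) :+ q :* (δ :* (ξ :* ξ)) := δ :* ((η :+ q :* ξ) :* ξ)) refl δ ξ η q ⟩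
              _            ∎

-- Equations as consequences of equations.

module LinearCombination {A : Set} {plus times : A → A → A} {neg : A → A} {0# 1# : A}
  (isCommutativeRing : IsCommutativeRing _≡_ plus times neg 0# 1#) where
  open import Relation.Binary.PropositionalEquality using (trans; cong; cong₂)
  open import Algebra.Bundles using (CommutativeRing)
  open import Level using (0ℓ)

  private
    R : CommutativeRing 0ℓ 0ℓ
    R = record { isCommutativeRing = isCommutativeRing }

  open CommutativeRing R using (+-group; zeroʳ; +-identityˡ)
  open import Algebra.Properties.Group +-group using (x∙y⁻¹≈ε⇒x≈y; x≈y⇒x∙y⁻¹≈ε)

  private
    multiple : ∀ {l r} c → l ≡ r → times c (plus l (neg r)) ≡ 0#
    multiple c l≡r = trans (cong (times c) (x≈y⇒x∙y⁻¹≈ε l≡r)) (zeroʳ c)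

  -- The coefficients are a certificate of ideal membership: once a - b is written as a combination
  -- of the differences of the hypotheses, only a polynomial identity remains, which `solve`
  -- decides.
  combine₁ : ∀ {a b l r} c → l ≡ r → plus a (neg b) ≡ times c (plus l (neg r)) → a ≡ b
  combine₁ c e eq = x∙y⁻¹≈ε⇒x≈y _ _ (trans eq (multiple c e))

  combine₂ : ∀ {a b l r l′ r′} c c′ → l ≡ r → l′ ≡ r′ →
    plus a (neg b) ≡ plus (times c (plus l (neg r))) (times c′ (plus l′ (neg r′))) → a ≡ b
  combine₂ c c′ e e′ eq = x∙y⁻¹≈ε⇒x≈y _ _ (trans eq (trans (cong₂ plus (multiple c e) (multiple c′ e′)) (+-identityˡ 0#)))

  combine₃ : ∀ {a b l r l′ r′ l″ r″} c c′ c″ → l ≡ r → l′ ≡ r′ → l″ ≡ r″ →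
    plus a (neg b) ≡ plus (plus (times c (plus l (neg r))) (times c′ (plus l′ (neg r′)))) (times c″ (plus l″ (neg r″))) → a ≡ b
  combine₃ c c′ c″ e e′ e″ eq = x∙y⁻¹≈ε⇒x≈y _ _ (trans eq (trans (cong₂ plus
    (trans (cong₂ plus (multiple c e) (multiple c′ e′)) (+-identityˡ 0#)) (multiple c″ e″)) (+-identityˡ 0#)))

-- A decision procedure for polynomial identities with integer coefficients.

module Polynomial where
  open import Data.Integer.Base using (ℤ)
  open import Data.Nat.Base using (ℕ)

  infixl 6 _:+_ _:-_
  infixl 7 _:*_
  infix 8 :-_
  infix 4 _:=_

  data Poly : Set where
    var : ℕ → Poly
    con : ℤ → Poly
    _:+_ _:*_ _:-_ : Poly → Poly → Poly
    :-_ : Poly → Poly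

  data Equation : Set where
    _:=_ : Poly → Poly → Equation

module PolynomialIdentity {A : Set} {_+_ _*_ : A → A → A} { -_ : A → A} (φ : ℤ.ℤ → A)
  (isCommutativeRing : IsCommutativeRing _≡_ _+_ _*_ -_ (φ ℤ.0ℤ) (φ ℤ.1ℤ))
  (φ-+ : ∀ m n → φ (m ℤ.+ n) ≡ φ m + φ n) (φ-* : ∀ m n → φ (m ℤ.* n) ≡ φ m * φ n)
  (φ-neg : ∀ m → φ (ℤ.- m) ≡ - φ m) where
  open import Algebra.Bundles using (CommutativeRing)
  open import Data.Bool.Base using (Bool; true; false; T; if_then_else_)
  open import Data.Integer.Base using (ℤ; +_; 0ℤ; 1ℤ)
  open import Data.List.Base using (List; []; _∷_)
  open import Data.Nat.Base as ℕ using (ℕ; zero; suc; _≡ᵇ_; _<ᵇ_)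
  import Data.Nat.Properties as ℕ
  open import Data.Product using (_×_; _,_)
  open import Data.Unit.Base using (tt)
  open import Function.Base using (id)
  open import Level using (0ℓ)
  open Polynomial
  open import Relation.Binary.PropositionalEquality using (refl; sym; trans; cong; cong₂; subst)

  private
    R : CommutativeRing 0ℓ 0ℓ
    R = record { isCommutativeRing = isCommutativeRing }
  open CommutativeRing R using (+-group; ring; +-identityˡ; +-identityʳ; +-assoc; *-assoc; *-identityˡ; *-identityʳ; zeroˡ; zeroʳ; distribˡ; distribʳ; +-commutativeSemigroup; *-commutativeSemigroup)
  open import Algebra.Properties.Group +-group using (x∙y⁻¹≈ε⇒x≈y)
  open import Algebra.Properties.Ring ring using (-‿distribˡ-*; -‿+-comm)
  open import Algebra.Properties.CommutativeSemigroup +-commutativeSemigroup using (interchange; x∙yz≈y∙xz)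
  open import Algebra.Properties.CommutativeSemigroup *-commutativeSemigroup renaming (interchange to *-interchange) using ()

  private
    lookup : List A → ℕ → A
    -- The default value 1 agrees with `evalᵐ`, which drops the exponents beyond the end of the
    -- environment and must stay multiplicative.
    lookup [] i = φ 1ℤ
    lookup (x ∷ ρ) zero = x
    lookup (x ∷ ρ) (suc i) = lookup ρ i

  ⟦_⟧ : Poly → List A → A
  ⟦ var i ⟧ ρ = lookup ρ i
  ⟦ con c ⟧ ρ = φ c
  ⟦ a :+ b ⟧ ρ = ⟦ a ⟧ ρ + ⟦ b ⟧ ρ
  ⟦ a :* b ⟧ ρ = ⟦ a ⟧ ρ * ⟦ b ⟧ ρ
  ⟦ a :- b ⟧ ρ = ⟦ a ⟧ ρ + (- ⟦ b ⟧ ρ)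
  ⟦ :- a ⟧ ρ = - ⟦ a ⟧ ρ

  private
    -- Exponent lists without trailing zeros.
    Monomial : Set
    Monomial = List ℕ

    Normal : Set
    Normal = List (Monomial × ℤ)

    data Order : Set where
      less equal greater : Order

    compare : Monomial → Monomial → Order
    compare [] [] = equal
    compare [] (_ ∷ _) = less
    compare (_ ∷ _) [] = greater
    compare (i ∷ m) (j ∷ n) = if i ≡ᵇ j then compare m n else if i <ᵇ j then less else greater

    -- A function in place of a `with`, so that `eval` can be pushed through the branching in
    -- `eval-add`.
    choose : ∀ {B : Set} → Order → B → B → B → B
    choose less x y z = x
    choose equal x y z = y
    choose greater x y z = z

    power : ℕ → Monomial
    power zero = 1 ∷ []
    power (suc i) = 0 ∷ power i

    _·_ : Monomial → Monomial → Monomial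
    [] · n = n
    (i ∷ m) · [] = i ∷ m
    (i ∷ m) · (j ∷ n) = i ℕ.+ j ∷ m · n

    add : Normal → Normal → Normal
    add [] q = q
    add (t ∷ p) [] = t ∷ p
    add ((m , c) ∷ p) ((n , e) ∷ q) = choose (compare m n)
      ((m , c) ∷ add p ((n , e) ∷ q)) ((m , c ℤ.+ e) ∷ add p q) ((n , e) ∷ add ((m , c) ∷ p) q)

    scale : Monomial → ℤ → Normal → Normal
    scale m c [] = []
    scale m c ((n , e) ∷ p) = (m · n , c ℤ.* e) ∷ scale m c p

    multiply : Normal → Normal → Normal
    multiply [] q = []
    multiply ((m , c) ∷ p) q = add (scale m c q) (multiply p q)

    negate : Normal → Normal
    negate [] = []
    negate ((m , c) ∷ p) = (m , ℤ.- c) ∷ negate p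

    normalise : Poly → Normal
    normalise (var i) = (power i , 1ℤ) ∷ []
    normalise (con c) = ([] , c) ∷ []
    normalise (a :+ b) = add (normalise a) (normalise b)
    normalise (a :* b) = multiply (normalise a) (normalise b)
    normalise (a :- b) = add (normalise a) (negate (normalise b))
    normalise (:- a) = negate (normalise a)

    isZero : Normal → Bool
    isZero [] = true
    isZero ((m , + 0) ∷ p) = isZero p
    isZero ((m , _) ∷ p) = false

    infixr 8 _^_
    _^_ : A → ℕ → A
    x ^ zero = φ 1ℤ
    x ^ suc k = x * (x ^ k)

    evalᵐ : Monomial → List A → A
    evalᵐ [] ρ = φ 1ℤ
    evalᵐ (k ∷ m) [] = φ 1ℤ
    evalᵐ (k ∷ m) (x ∷ ρ) = (x ^ k) * evalᵐ m ρ

    eval : Normal → List A → A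
    eval [] ρ = φ 0ℤ
    eval ((m , c) ∷ p) ρ = (φ c * evalᵐ m ρ) + eval p ρ

    ^-+ : ∀ x i j → x ^ (i ℕ.+ j) ≡ (x ^ i) * (x ^ j)
    ^-+ x zero j = sym (*-identityˡ (x ^ j))
    ^-+ x (suc i) j = trans (cong (λ i → x * i) (^-+ x i j)) (sym (*-assoc x (x ^ i) (x ^ j)))

    evalᵐ-· : ∀ m n ρ → evalᵐ (m · n) ρ ≡ evalᵐ m ρ * evalᵐ n ρ
    evalᵐ-· [] n ρ = sym (*-identityˡ (evalᵐ n ρ))
    evalᵐ-· (i ∷ m) [] ρ = sym (*-identityʳ (evalᵐ (i ∷ m) ρ))
    evalᵐ-· (i ∷ m) (j ∷ n) [] = sym (*-identityˡ (φ 1ℤ))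
    evalᵐ-· (i ∷ m) (j ∷ n) (x ∷ ρ) = trans (cong₂ _*_ (^-+ x i j) (evalᵐ-· m n ρ))
      (*-interchange (x ^ i) (x ^ j) (evalᵐ m ρ) (evalᵐ n ρ))

    evalᵐ-power : ∀ i ρ → lookup ρ i ≡ evalᵐ (power i) ρ
    evalᵐ-power zero [] = refl
    evalᵐ-power zero (x ∷ ρ) = sym (trans (*-identityʳ (x * φ 1ℤ)) (*-identityʳ x))
    evalᵐ-power (suc i) [] = refl
    evalᵐ-power (suc i) (x ∷ ρ) = trans (evalᵐ-power i ρ) (sym (*-identityˡ (evalᵐ (power i) ρ)))

    -- Soundness of `add` rests on the `equal` branch alone, where the two monomials must coincide
    -- for their coefficients to be merged; the other branches only permute summands.
    choose-elim : ∀ {B : Set} m n {x y z v : B} → (x ≡ v) → (m ≡ n → y ≡ v) → (z ≡ v) → choose (compare m n) x y z ≡ v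
    choose-elim [] [] e₁ e₂ e₃ = e₂ refl
    choose-elim [] (_ ∷ _) e₁ e₂ e₃ = e₁
    choose-elim (_ ∷ _) [] e₁ e₂ e₃ = e₃
    choose-elim (i ∷ m) (j ∷ n) e₁ e₂ e₃ with i ≡ᵇ j in i≡j
    ... | true = choose-elim m n e₁ (λ m≡n → e₂ (cong₂ _∷_ (ℕ.≡ᵇ⇒≡ i j (subst T (sym i≡j) tt)) m≡n)) e₃
    ... | false with i <ᵇ j
    ...   | true = e₁
    ...   | false = e₃

    merge-terms : ∀ c e x u v → (φ (c ℤ.+ e) * x) + (u + v) ≡ ((φ c * x) + u) + ((φ e * x) + v)
    merge-terms c e x u v = trans (cong (λ i → i + (u + v)) (trans (cong (λ i → i * x) (φ-+ c e)) (distribʳ x (φ c) (φ e))))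
      (interchange (φ c * x) (φ e * x) u v)

    eval-add : ∀ p q ρ → eval (add p q) ρ ≡ eval p ρ + eval q ρ
    eval-add [] q ρ = sym (+-identityˡ (eval q ρ))
    eval-add (t ∷ p) [] ρ = sym (+-identityʳ (eval (t ∷ p) ρ))
    eval-add ((m , c) ∷ p) ((n , e) ∷ q) ρ = trans (eval-choose (compare m n)) (choose-elim m n
      (trans (cong (λ i → x + i) (eval-add p ((n , e) ∷ q) ρ)) (sym (+-assoc x (eval p ρ) (eval ((n , e) ∷ q) ρ))))
      (λ { refl → trans (cong (λ i → (φ (c ℤ.+ e) * evalᵐ m ρ) + i) (eval-add p q ρ)) (merge-terms c e (evalᵐ m ρ) (eval p ρ) (eval q ρ)) })
      (trans (cong (λ i → y + i) (eval-add ((m , c) ∷ p) q ρ)) (x∙yz≈y∙xz y (x + eval p ρ) (eval q ρ))))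
      where
      x y : A
      x = φ c * evalᵐ m ρ
      y = φ e * evalᵐ n ρ
      eval-choose : ∀ o {p q r} → eval (choose o p q r) ρ ≡ choose o (eval p ρ) (eval q ρ) (eval r ρ)
      eval-choose less = refl
      eval-choose equal = refl
      eval-choose greater = refl

    eval-scale : ∀ m c p ρ → eval (scale m c p) ρ ≡ (φ c * evalᵐ m ρ) * eval p ρ
    eval-scale m c [] ρ = sym (zeroʳ (φ c * evalᵐ m ρ))
    eval-scale m c ((n , e) ∷ p) ρ = trans (cong₂ _+_
        (trans (cong₂ _*_ (φ-* c e) (evalᵐ-· m n ρ)) (*-interchange (φ c) (φ e) (evalᵐ m ρ) (evalᵐ n ρ)))
        (eval-scale m c p ρ))
      (sym (distribˡ (φ c * evalᵐ m ρ) (φ e * evalᵐ n ρ) (eval p ρ)))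

    eval-multiply : ∀ p q ρ → eval (multiply p q) ρ ≡ eval p ρ * eval q ρ
    eval-multiply [] q ρ = sym (zeroˡ (eval q ρ))
    eval-multiply ((m , c) ∷ p) q ρ = trans (eval-add (scale m c q) (multiply p q) ρ)
      (trans (cong₂ _+_ (eval-scale m c q ρ) (eval-multiply p q ρ)) (sym (distribʳ (eval q ρ) (φ c * evalᵐ m ρ) (eval p ρ))))

    eval-negate : ∀ p ρ → eval (negate p) ρ ≡ - eval p ρ
    eval-negate [] ρ = φ-neg 0ℤ
    eval-negate ((m , c) ∷ p) ρ = trans (cong₂ _+_
        (trans (cong (λ i → i * evalᵐ m ρ) (φ-neg c)) (sym (-‿distribˡ-* (φ c) (evalᵐ m ρ)))) (eval-negate p ρ))
      (-‿+-comm (φ c * evalᵐ m ρ) (eval p ρ))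

    eval-normalise : ∀ a ρ → ⟦ a ⟧ ρ ≡ eval (normalise a) ρ
    eval-normalise (var i) ρ = trans (evalᵐ-power i ρ) (sym (trans (+-identityʳ (φ 1ℤ * evalᵐ (power i) ρ)) (*-identityˡ (evalᵐ (power i) ρ))))
    eval-normalise (con c) ρ = sym (trans (+-identityʳ (φ c * φ 1ℤ)) (*-identityʳ (φ c)))
    eval-normalise (a :+ b) ρ = trans (cong₂ _+_ (eval-normalise a ρ) (eval-normalise b ρ)) (sym (eval-add (normalise a) (normalise b) ρ))
    eval-normalise (a :* b) ρ = trans (cong₂ _*_ (eval-normalise a ρ) (eval-normalise b ρ)) (sym (eval-multiply (normalise a) (normalise b) ρ))
    eval-normalise (a :- b) ρ = trans (cong₂ (λ x y → x + (- y)) (eval-normalise a ρ) (eval-normalise b ρ))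
      (sym (trans (eval-add (normalise a) (negate (normalise b)) ρ) (cong (λ i → eval (normalise a) ρ + i) (eval-negate (normalise b) ρ))))
    eval-normalise (:- a) ρ = trans (cong -_ (eval-normalise a ρ)) (sym (eval-negate (normalise a) ρ))

    isZero-sound : ∀ p ρ → T (isZero p) → eval p ρ ≡ φ 0ℤ
    isZero-sound [] ρ t = refl
    isZero-sound ((m , + 0) ∷ p) ρ t = trans (cong₂ _+_ (zeroˡ (evalᵐ m ρ)) (isZero-sound p ρ t)) (+-identityˡ (φ 0ℤ))

  Identity : ℕ → Set
  Identity zero = Equation
  Identity (suc n) = Poly → Identity n

  private
    instantiate : (n : ℕ) → ℕ → Identity n → Equation
    instantiate zero i e = e
    instantiate (suc n) i f = instantiate n (suc i) (f (var i))

    Valid : Equation → Bool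
    Valid (l := r) = isZero (normalise (l :- r))

    -- `env` is a difference list: the values are bound one at a time and still end up in the order
    -- in which `instantiate` numbers the variables.
    Holds : (n : ℕ) → Equation → (List A → List A) → Set
    Holds zero (l := r) env = ⟦ l ⟧ (env []) ≡ ⟦ r ⟧ (env [])
    Holds (suc n) e env = ∀ x → Holds n e (λ ρ → env (x ∷ ρ))

  abstract
    private
      prove : (n : ℕ) (e : Equation) (env : List A → List A) → T (Valid e) → Holds n e env
      prove zero (l := r) env t = x∙y⁻¹≈ε⇒x≈y (⟦ l ⟧ (env [])) (⟦ r ⟧ (env []))
        (trans (eval-normalise (l :- r) (env [])) (isZero-sound (normalise (l :- r)) (env []) t))
      prove (suc n) e env t x = prove n e (λ ρ → env (x ∷ ρ)) t

    -- The implicit argument is evaluated by the type checker: for a valid identity it reduces to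
    -- the unit type and is inferred.
    solve : ∀ n (f : Identity n) {_ : T (Valid (instantiate n 0 f))} → Holds n (instantiate n 0 f) id
    solve n f {t} = prove n (instantiate n 0 f) id t

module IntegerIdentity where
  import Data.Integer.Properties as ℤ
  open import Function.Base using (id)
  open import Relation.Binary.PropositionalEquality using (refl)
  open Polynomial public
  open PolynomialIdentity id ℤ.+-*-isCommutativeRing (λ m n → refl) (λ m n → refl) (λ m → refl) public

-- Positivity certificates over ℤ.

module IntegerOrder where
  open import Data.Integer using (ℤ; +_; -[1+_]; _+_; _*_; -_; _-_; 0ℤ; 1ℤ; _≤_; _<_; +≤+; nonNegative)
  import Data.Integer.Properties as ℤ
  open IntegerIdentity
  open import Data.Nat.Base using (z≤n)
  open import Relation.Binary.PropositionalEquality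

  -- A term built with _+⁺_, _*⁺_, nat and sq determines the expression it bounds.
  record Nonneg (i : ℤ) : Set where
    constructor nonneg
    field 0≤ : 0ℤ ≤ i

  open Nonneg public

  0≤-* : ∀ {i j} → 0ℤ ≤ i → 0ℤ ≤ j → 0ℤ ≤ i * j
  0≤-* {i} {j} 0≤i 0≤j = subst (_≤ i * j) (ℤ.*-zeroʳ i) (ℤ.*-monoˡ-≤-nonNeg i {{nonNegative 0≤i}} 0≤j)

  0≤-square : ∀ i → 0ℤ ≤ i * i
  0≤-square (+ n) = subst (0ℤ ≤_) (ℤ.pos-* n n) (+≤+ z≤n)
  0≤-square -[1+ n ] = +≤+ z≤n

  infixl 6 _+⁺_
  infixl 7 _*⁺_

  _+⁺_ : ∀ {i j} → Nonneg i → Nonneg j → Nonneg (i + j)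
  nonneg p +⁺ nonneg q = nonneg (ℤ.+-mono-≤ p q)

  _*⁺_ : ∀ {i j} → Nonneg i → Nonneg j → Nonneg (i * j)
  nonneg p *⁺ nonneg q = nonneg (0≤-* p q)

  nat : ∀ n → Nonneg (+ n)
  nat n = nonneg (+≤+ z≤n)

  sq : ∀ i → Nonneg (i * i)
  sq i = nonneg (0≤-square i)

  abstract
    0≤-by : ∀ {i j} → Nonneg j → i ≡ j → 0ℤ ≤ i
    0≤-by (nonneg p) eq = subst (0ℤ ≤_) (sym eq) p

  private
    regroup : ∀ i j → j - i - 1ℤ ≡ j - (1ℤ + i)
    regroup = solve 2 (λ i j → j :- i :- con 1ℤ := j :- (con 1ℤ :+ i))

  gap⇒< : ∀ {i j} → 0ℤ ≤ j - i - 1ℤ → i < j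
  gap⇒< {i} {j} p = ℤ.suc[i]≤j⇒i<j (ℤ.0≤i-j⇒j≤i (subst (0ℤ ≤_) (regroup i j) p))

  <⇒gap : ∀ {i j} → i < j → 0ℤ ≤ j - i - 1ℤ
  <⇒gap {i} {j} p = subst (0ℤ ≤_) (sym (regroup i j)) (ℤ.i≤j⇒0≤j-i (ℤ.i<j⇒suc[i]≤j p))

-- Coprimality and division with remainder in ℤ.

module IntegerCoprime where
  open import Data.Integer using (ℤ; +_; -[1+_]; _+_; _*_; -_; _-_; 1ℤ; -1ℤ; ∣_∣)
  open import Data.Integer.DivMod using (_/_; _%_; a≡a%n+[a/n]*n; n%d<d)
  import Data.Integer.Properties as ℤ
  open IntegerIdentity
  open import Data.Nat.Base as ℕ using (ℕ)
  import Data.Nat.Properties as ℕ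
  open import Data.Nat.GCD using (gcd; gcd-GCD; gcd[m,n]∣m; gcd[m,n]∣n; module Bézout)
  import Data.Nat.Coprimality as ℕ
  import Data.Nat.Divisibility as ℕ
  open import Data.Product using (_,_; _×_; ∃-syntax)
  open import Data.Sum using (_⊎_; inj₁; inj₂)
  open import Relation.Binary.PropositionalEquality

  -- Encoded by a Bézout identity and not by common divisors: closure under products, Gauss's lemma
  -- and changes of variables then become polynomial identities in the two coefficients.
  Coprime : ℤ → ℤ → Set
  Coprime i j = ∃[ s ] ∃[ t ] s * i + t * j ≡ 1ℤ

  coprime-sym : ∀ {i j} → Coprime i j → Coprime j i
  coprime-sym {i} {j} (s , t , eq) = t , s , trans (ℤ.+-comm (t * j) (s * i)) eq

  private
    abstract
      product : ∀ a b c s t s′ t′ → s * s′ * (a * b) + (s * a * t′ + t * s′ * b + t * t′ * c) * c ≡ (s * a + t * c) * (s′ * b + t′ * c)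
      product = solve 7 (λ a b c s t s′ t′ →
        s :* s′ :* (a :* b) :+ (s :* a :* t′ :+ t :* s′ :* b :+ t :* t′ :* c) :* c
        := (s :* a :+ t :* c) :* (s′ :* b :+ t′ :* c))
      distribute : ∀ x a b s t → (s * x + t * a) * b ≡ s * b * x + t * (a * b)
      distribute = solve 5 (λ x a b s t → (s :* x :+ t :* a) :* b := s :* b :* x :+ t :* (a :* b))
      collect : ∀ x b s t k → s * b * x + t * (k * x) ≡ (s * b + t * k) * x
      collect = solve 5 (λ x b s t k → s :* b :* x :+ t :* (k :* x) := (s :* b :+ t :* k) :* x)

  coprime-*ˡ : ∀ {a b c} → Coprime a c → Coprime b c → Coprime (a * b) c
  coprime-*ˡ {a} {b} {c} (s , t , eq) (s′ , t′ , eq′) =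
    s * s′ , s * a * t′ + t * s′ * b + t * t′ * c , trans (product a b c s t s′ t′) (cong₂ _*_ eq eq′)

  coprime-*ʳ : ∀ {a b c} → Coprime a b → Coprime a c → Coprime a (b * c)
  coprime-*ʳ p q = coprime-sym (coprime-*ˡ (coprime-sym p) (coprime-sym q))

  gauss : ∀ {x a b} k → Coprime x a → a * b ≡ k * x → ∃[ k′ ] b ≡ k′ * x
  gauss {x} {a} {b} k (s , t , eq) ab≡kx = s * b + t * k , (begin
    b                        ≡⟨ ℤ.*-identityˡ b ⟨
    1ℤ * b                   ≡⟨ cong (_* b) eq ⟨
    (s * x + t * a) * b      ≡⟨ distribute x a b s t ⟩
    s * b * x + t * (a * b)  ≡⟨ cong (λ i → s * b * x + t * i) ab≡kx ⟩
    s * b * x + t * (k * x)  ≡⟨ collect x b s t k ⟩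
    (s * b + t * k) * x      ∎)
    where open ≡-Reasoning

  coprime-divisor : ∀ {a b} g k k′ → Coprime a b → a ≡ k * g → b ≡ k′ * g → ∃[ u ] u * g ≡ 1ℤ
  coprime-divisor g k k′ (s , t , eq) refl refl = s * k + t * k′ , trans (solve 5 (λ s t k k′ g → (s :* k :+ t :* k′) :* g := s :* (k :* g) :+ t :* (k′ :* g)) s t k k′ g) eq

  unit : ∀ u g → u * g ≡ 1ℤ → g ≡ 1ℤ ⊎ g ≡ -1ℤ
  unit u g ug≡1 with ℕ.m*n≡1⇒n≡1 ∣ u ∣ ∣ g ∣ (trans (sym (ℤ.abs-* u g)) (cong ∣_∣ ug≡1))
  unit u (+ .1) _ | refl = inj₁ refl
  unit u -[1+ 0 ] _ | refl = inj₂ refl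

  private
    to-abs : ∀ i → ∃[ σ ] σ * i ≡ + ∣ i ∣
    to-abs (+ n) = 1ℤ , ℤ.*-identityˡ (+ n)
    to-abs i@(-[1+ n ]) = -1ℤ , ℤ.-1*i≡-i i

    from-abs : ∀ i {g} → g ℕ.∣ ∣ i ∣ → ∃[ k ] i ≡ k * + g
    from-abs (+ n) {g} (ℕ.divides k eq) = + k , trans (cong +_ eq) (ℤ.pos-* k g)
    from-abs -[1+ n ] {g} (ℕ.divides k eq) = - + k , trans (cong (λ m → - + m) eq)
      (trans (cong -_ (ℤ.pos-* k g)) (ℤ.neg-distribˡ-* (+ k) (+ g)))

    bézout-ℕ : ∀ m n → ∃[ s ] ∃[ t ] s * + m + t * + n ≡ + gcd m n
    bézout-ℕ m n with Bézout.identity (gcd-GCD m n)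
    ... | Bézout.+- x y eq = + x , - + y , rearrange (cast eq)
      where
      cast : gcd m n ℕ.+ y ℕ.* n ≡ x ℕ.* m → + gcd m n + + y * + n ≡ + x * + m
      cast e = trans (cong (λ i → + gcd m n + i) (sym (ℤ.pos-* y n))) (trans (cong +_ e) (ℤ.pos-* x m))
      lemma : ∀ g y n → g + y * n + - y * n ≡ g
      lemma = solve 3 (λ g y n → g :+ y :* n :+ :- y :* n := g)
      rearrange : + gcd m n + + y * + n ≡ + x * + m → + x * + m + - + y * + n ≡ + gcd m n
      rearrange e = trans (cong (_+ - + y * + n) (sym e)) (lemma (+ gcd m n) (+ y) (+ n))
    ... | Bézout.-+ x y eq = - + x , + y , rearrange (cast eq)
      where
      cast : gcd m n ℕ.+ x ℕ.* m ≡ y ℕ.* n → + gcd m n + + x * + m ≡ + y * + n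
      cast e = trans (cong (λ i → + gcd m n + i) (sym (ℤ.pos-* x m))) (trans (cong +_ e) (ℤ.pos-* y n))
      lemma : ∀ g x m → - x * m + (g + x * m) ≡ g
      lemma = solve 3 (λ g x m → :- x :* m :+ (g :+ x :* m) := g)
      rearrange : + gcd m n + + x * + m ≡ + y * + n → - + x * + m + + y * + n ≡ + gcd m n
      rearrange e = trans (cong (λ i → - + x * + m + i) (sym e)) (lemma (+ gcd m n) (+ x) (+ m))

  bézout : ∀ i j → ∃[ g ] (∃[ i′ ] i ≡ i′ * + g) × (∃[ j′ ] j ≡ j′ * + g) × ∃[ s ] ∃[ t ] s * i + t * j ≡ + g
  bézout i j with to-abs i | to-abs j | bézout-ℕ ∣ i ∣ ∣ j ∣
  ... | σ , σi≡ | τ , τj≡ | s , t , eq = gcd ∣ i ∣ ∣ j ∣ , from-abs i (gcd[m,n]∣m ∣ i ∣ ∣ j ∣) , from-abs j (gcd[m,n]∣n ∣ i ∣ ∣ j ∣) ,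
    s * σ , t * τ , trans (cong₂ _+_ (trans (ℤ.*-assoc s σ i) (cong (s *_) σi≡)) (trans (ℤ.*-assoc t τ j) (cong (t *_) τj≡))) eq

  private
    divide : ∀ x y → ∣ y ∣ ≢ 0 → ∃[ q ] ∣ x - q * y ∣ ℕ.< ∣ y ∣
    divide x y ∣y∣≢0 = x / y , subst (λ i → ∣ i ∣ ℕ.< ∣ y ∣) eq (n%d<d x y)
      where
      instance _ = ℕ.≢-nonZero ∣y∣≢0
      lemma : ∀ r c → r ≡ r + c - c
      lemma = solve 2 (λ r c → r := r :+ c :- c)
      eq : + (x % y) ≡ x - x / y * y
      eq = trans (lemma (+ (x % y)) (x / y * y)) (cong (_- x / y * y) (sym (a≡a%n+[a/n]*n x y)))

  open EuclideanDomain.EuclideanNorm ℤ.+-*-commutativeRing ∣_∣ (cong ∣_∣) ℤ.abs-* (λ i → ℤ.∣i∣≡0⇒i≡0) divide public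

-- The cubic ring ℤ[τ] and its norm.

module CubicRing where
  open import Algebra.Bundles using (CommutativeRing)
  open import Data.Integer using (ℤ; +_; _+_; _*_; -_; _-_; 0ℤ; 1ℤ)
  import Data.Integer.Properties as ℤ
  open IntegerIdentity
  open import Data.Product using (_,_)
  open import Level using (0ℓ)
  open import Relation.Binary.PropositionalEquality

  -- ⟨ a , b , c ⟩ stands for a + bτ + cτ² where τ³ = 2τ² - 2.
  record O : Set where
    no-eta-equality
    pattern
    constructor ⟨_,_,_⟩
    field c₀ c₁ c₂ : ℤ

  infixl 6 _⊕_
  infixl 7 _⊗_

  _⊕_ _⊗_ : O → O → O
  ⟨ a , b , c ⟩ ⊕ ⟨ x , y , z ⟩ = ⟨ a + x , b + y , c + z ⟩
  ⟨ a , b , c ⟩ ⊗ ⟨ x , y , z ⟩ =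
    ⟨ a * x - + 2 * (b * z + c * y) - + 4 * (c * z)
    , a * y + b * x - + 2 * (c * z)
    , a * z + c * x + b * y + + 2 * (b * z + c * y) + + 4 * (c * z) ⟩

  ⊖_ : O → O
  ⊖ ⟨ a , b , c ⟩ = ⟨ - a , - b , - c ⟩

  𝟎 𝟏 : O
  𝟎 = ⟨ 0ℤ , 0ℤ , 0ℤ ⟩
  𝟏 = ⟨ 1ℤ , 0ℤ , 0ℤ ⟩

  O-ext : ∀ {a b c x y z} → a ≡ x → b ≡ y → c ≡ z → ⟨ a , b , c ⟩ ≡ ⟨ x , y , z ⟩
  O-ext refl refl refl = refl

  private
    abstract
      ⊗-comm-₀ : ∀ a b c x y z → a * x - + 2 * (b * z + c * y) - + 4 * (c * z) ≡ x * a - + 2 * (y * c + z * b) - + 4 * (z * c)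
      ⊗-comm-₀ = solve 6 (λ a b c x y z →
        a :* x :- con (+ 2) :* (b :* z :+ c :* y) :- con (+ 4) :* (c :* z)
        := x :* a :- con (+ 2) :* (y :* c :+ z :* b) :- con (+ 4) :* (z :* c))
      ⊗-comm-₁ : ∀ a b c x y z → a * y + b * x - + 2 * (c * z) ≡ x * b + y * a - + 2 * (z * c)
      ⊗-comm-₁ = solve 6 (λ a b c x y z → a :* y :+ b :* x :- con (+ 2) :* (c :* z) := x :* b :+ y :* a :- con (+ 2) :* (z :* c))
      ⊗-comm-₂ : ∀ a b c x y z → a * z + c * x + b * y + + 2 * (b * z + c * y) + + 4 * (c * z)
                        ≡ x * c + z * a + y * b + + 2 * (y * c + z * b) + + 4 * (z * c)
      ⊗-comm-₂ = solve 6 (λ a b c x y z →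
        a :* z :+ c :* x :+ b :* y :+ con (+ 2) :* (b :* z :+ c :* y) :+ con (+ 4) :* (c :* z)
        := x :* c :+ z :* a :+ y :* b :+ con (+ 2) :* (y :* c :+ z :* b) :+ con (+ 4) :* (z :* c))

    ⊗-comm : ∀ α β → α ⊗ β ≡ β ⊗ α
    ⊗-comm ⟨ a , b , c ⟩ ⟨ x , y , z ⟩ = O-ext (⊗-comm-₀ a b c x y z) (⊗-comm-₁ a b c x y z) (⊗-comm-₂ a b c x y z)

    abstract
      ⊗-identityˡ-₀ : ∀ x y z → 1ℤ * x - + 2 * (0ℤ * z + 0ℤ * y) - + 4 * (0ℤ * z) ≡ x
      ⊗-identityˡ-₀ = solve 3 (λ x y z → con 1ℤ :* x :- con (+ 2) :* (con 0ℤ :* z :+ con 0ℤ :* y) :- con (+ 4) :* (con 0ℤ :* z) := x)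
      ⊗-identityˡ-₁ : ∀ x y z → 1ℤ * y + 0ℤ * x - + 2 * (0ℤ * z) ≡ y
      ⊗-identityˡ-₁ = solve 3 (λ x y z → con 1ℤ :* y :+ con 0ℤ :* x :- con (+ 2) :* (con 0ℤ :* z) := y)
      ⊗-identityˡ-₂ : ∀ x y z → 1ℤ * z + 0ℤ * x + 0ℤ * y + + 2 * (0ℤ * z + 0ℤ * y) + + 4 * (0ℤ * z) ≡ z
      ⊗-identityˡ-₂ = solve 3 (λ x y z →
        con 1ℤ :* z :+ con 0ℤ :* x :+ con 0ℤ :* y :+ con (+ 2) :* (con 0ℤ :* z :+ con 0ℤ :* y) :+ con (+ 4) :* (con 0ℤ :* z)
        := z)

    ⊗-identityˡ : ∀ α → 𝟏 ⊗ α ≡ α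
    ⊗-identityˡ ⟨ x , y , z ⟩ = O-ext (⊗-identityˡ-₀ x y z) (⊗-identityˡ-₁ x y z) (⊗-identityˡ-₂ x y z)

    abstract
      distribˡ-₀ : ∀ a b c x y z u v w →
        a * (x + u) - + 2 * (b * (z + w) + c * (y + v)) - + 4 * (c * (z + w))
        ≡ a * x - + 2 * (b * z + c * y) - + 4 * (c * z) + (a * u - + 2 * (b * w + c * v) - + 4 * (c * w))
      distribˡ-₀ = solve 9 (λ a b c x y z u v w →
        a :* (x :+ u) :- con (+ 2) :* (b :* (z :+ w) :+ c :* (y :+ v)) :- con (+ 4) :* (c :* (z :+ w))
        := a :* x :- con (+ 2) :* (b :* z :+ c :* y) :- con (+ 4) :* (c :* z) :+ (a :* u :- con (+ 2) :* (b :* w :+ c :* v) :- con (+ 4) :* (c :* w)))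
      distribˡ-₁ : ∀ a b c x y z u v w → a * (y + v) + b * (x + u) - + 2 * (c * (z + w))
        ≡ a * y + b * x - + 2 * (c * z) + (a * v + b * u - + 2 * (c * w))
      distribˡ-₁ = solve 9 (λ a b c x y z u v w →
        a :* (y :+ v) :+ b :* (x :+ u) :- con (+ 2) :* (c :* (z :+ w))
        := a :* y :+ b :* x :- con (+ 2) :* (c :* z) :+ (a :* v :+ b :* u :- con (+ 2) :* (c :* w)))
      distribˡ-₂ : ∀ a b c x y z u v w →
        a * (z + w) + c * (x + u) + b * (y + v) + + 2 * (b * (z + w) + c * (y + v)) + + 4 * (c * (z + w))
        ≡ a * z + c * x + b * y + + 2 * (b * z + c * y) + + 4 * (c * z)
          + (a * w + c * u + b * v + + 2 * (b * w + c * v) + + 4 * (c * w))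
      distribˡ-₂ = solve 9 (λ a b c x y z u v w →
        a :* (z :+ w) :+ c :* (x :+ u) :+ b :* (y :+ v) :+ con (+ 2) :* (b :* (z :+ w) :+ c :* (y :+ v)) :+ con (+ 4) :* (c :* (z :+ w))
        := a :* z :+ c :* x :+ b :* y :+ con (+ 2) :* (b :* z :+ c :* y) :+ con (+ 4) :* (c :* z) :+ (a :* w :+ c :* u :+ b :* v :+ con (+ 2) :* (b :* w :+ c :* v) :+ con (+ 4) :* (c :* w)))

    distribˡ : ∀ α β γ → α ⊗ (β ⊕ γ) ≡ α ⊗ β ⊕ α ⊗ γ
    distribˡ ⟨ a , b , c ⟩ ⟨ x , y , z ⟩ ⟨ u , v , w ⟩ = O-ext (distribˡ-₀ a b c x y z u v w) (distribˡ-₁ a b c x y z u v w) (distribˡ-₂ a b c x y z u v w)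

    abstract
      ⊗-assoc-₀ : ∀ a b c x y z u v w →
        let d = a * x - + 2 * (b * z + c * y) - + 4 * (c * z); e = a * y + b * x - + 2 * (c * z)
            f = a * z + c * x + b * y + + 2 * (b * z + c * y) + + 4 * (c * z)
            g = x * u - + 2 * (y * w + z * v) - + 4 * (z * w); h = x * v + y * u - + 2 * (z * w)
            i = x * w + z * u + y * v + + 2 * (y * w + z * v) + + 4 * (z * w)
        in d * u - + 2 * (e * w + f * v) - + 4 * (f * w) ≡ a * g - + 2 * (b * i + c * h) - + 4 * (c * i)
      ⊗-assoc-₀ = solve 9 (λ a b c x y z u v w → let d = a :* x :- con (+ 2) :* (b :* z :+ c :* y) :- con (+ 4) :* (c :* z); e = a :* y :+ b :* x :- con (+ 2) :* (c :* z); f = a :* z :+ c :* x :+ b :* y :+ con (+ 2) :* (b :* z :+ c :* y) :+ con (+ 4) :* (c :* z); g = x :* u :- con (+ 2) :* (y :* w :+ z :* v) :- con (+ 4) :* (z :* w); h = x :* v :+ y :* u :- con (+ 2) :* (z :* w); i = x :* w :+ z :* u :+ y :* v :+ con (+ 2) :* (y :* w :+ z :* v) :+ con (+ 4) :* (z :* w) in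
        d :* u :- con (+ 2) :* (e :* w :+ f :* v) :- con (+ 4) :* (f :* w)
        := a :* g :- con (+ 2) :* (b :* i :+ c :* h) :- con (+ 4) :* (c :* i))
      ⊗-assoc-₁ : ∀ a b c x y z u v w →
        let d = a * x - + 2 * (b * z + c * y) - + 4 * (c * z); e = a * y + b * x - + 2 * (c * z)
            f = a * z + c * x + b * y + + 2 * (b * z + c * y) + + 4 * (c * z)
            g = x * u - + 2 * (y * w + z * v) - + 4 * (z * w); h = x * v + y * u - + 2 * (z * w)
            i = x * w + z * u + y * v + + 2 * (y * w + z * v) + + 4 * (z * w)
        in d * v + e * u - + 2 * (f * w) ≡ a * h + b * g - + 2 * (c * i)
      ⊗-assoc-₁ = solve 9 (λ a b c x y z u v w → let d = a :* x :- con (+ 2) :* (b :* z :+ c :* y) :- con (+ 4) :* (c :* z); e = a :* y :+ b :* x :- con (+ 2) :* (c :* z); f = a :* z :+ c :* x :+ b :* y :+ con (+ 2) :* (b :* z :+ c :* y) :+ con (+ 4) :* (c :* z); g = x :* u :- con (+ 2) :* (y :* w :+ z :* v) :- con (+ 4) :* (z :* w); h = x :* v :+ y :* u :- con (+ 2) :* (z :* w); i = x :* w :+ z :* u :+ y :* v :+ con (+ 2) :* (y :* w :+ z :* v) :+ con (+ 4) :* (z :* w) in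
        d :* v :+ e :* u :- con (+ 2) :* (f :* w) := a :* h :+ b :* g :- con (+ 2) :* (c :* i))
      ⊗-assoc-₂ : ∀ a b c x y z u v w →
        let d = a * x - + 2 * (b * z + c * y) - + 4 * (c * z); e = a * y + b * x - + 2 * (c * z)
            f = a * z + c * x + b * y + + 2 * (b * z + c * y) + + 4 * (c * z)
            g = x * u - + 2 * (y * w + z * v) - + 4 * (z * w); h = x * v + y * u - + 2 * (z * w)
            i = x * w + z * u + y * v + + 2 * (y * w + z * v) + + 4 * (z * w)
        in d * w + f * u + e * v + + 2 * (e * w + f * v) + + 4 * (f * w) ≡ a * i + c * g + b * h + + 2 * (b * i + c * h) + + 4 * (c * i)
      ⊗-assoc-₂ = solve 9 (λ a b c x y z u v w → let d = a :* x :- con (+ 2) :* (b :* z :+ c :* y) :- con (+ 4) :* (c :* z); e = a :* y :+ b :* x :- con (+ 2) :* (c :* z); f = a :* z :+ c :* x :+ b :* y :+ con (+ 2) :* (b :* z :+ c :* y) :+ con (+ 4) :* (c :* z); g = x :* u :- con (+ 2) :* (y :* w :+ z :* v) :- con (+ 4) :* (z :* w); h = x :* v :+ y :* u :- con (+ 2) :* (z :* w); i = x :* w :+ z :* u :+ y :* v :+ con (+ 2) :* (y :* w :+ z :* v) :+ con (+ 4) :* (z :* w) in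
        d :* w :+ f :* u :+ e :* v :+ con (+ 2) :* (e :* w :+ f :* v) :+ con (+ 4) :* (f :* w)
        := a :* i :+ c :* g :+ b :* h :+ con (+ 2) :* (b :* i :+ c :* h) :+ con (+ 4) :* (c :* i))

    ⊗-assoc : ∀ α β γ → α ⊗ β ⊗ γ ≡ α ⊗ (β ⊗ γ)
    ⊗-assoc ⟨ a , b , c ⟩ ⟨ x , y , z ⟩ ⟨ u , v , w ⟩ = O-ext (⊗-assoc-₀ a b c x y z u v w) (⊗-assoc-₁ a b c x y z u v w) (⊗-assoc-₂ a b c x y z u v w)

  O-commutativeRing : CommutativeRing 0ℓ 0ℓ
  O-commutativeRing = record
    { Carrier = O ; _≈_ = _≡_ ; _+_ = _⊕_ ; _*_ = _⊗_ ; -_ = ⊖_ ; 0# = 𝟎 ; 1# = 𝟏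
    ; isCommutativeRing = record
      { isRing = record
        { +-isAbelianGroup = record
          { isGroup = record
            { isMonoid = record
              { isSemigroup = record
                { isMagma = record { isEquivalence = isEquivalence ; ∙-cong = cong₂ _⊕_ }
                ; assoc = λ { ⟨ a , b , c ⟩ ⟨ x , y , z ⟩ ⟨ u , v , w ⟩ → O-ext (ℤ.+-assoc a x u) (ℤ.+-assoc b y v) (ℤ.+-assoc c z w) } }
              ; identity = (λ { ⟨ a , b , c ⟩ → O-ext (ℤ.+-identityˡ a) (ℤ.+-identityˡ b) (ℤ.+-identityˡ c) })
                         , (λ { ⟨ a , b , c ⟩ → O-ext (ℤ.+-identityʳ a) (ℤ.+-identityʳ b) (ℤ.+-identityʳ c) }) }
            ; inverse = (λ { ⟨ a , b , c ⟩ → O-ext (ℤ.+-inverseˡ a) (ℤ.+-inverseˡ b) (ℤ.+-inverseˡ c) })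
                      , (λ { ⟨ a , b , c ⟩ → O-ext (ℤ.+-inverseʳ a) (ℤ.+-inverseʳ b) (ℤ.+-inverseʳ c) })
            ; ⁻¹-cong = cong ⊖_ }
          ; comm = λ { ⟨ a , b , c ⟩ ⟨ x , y , z ⟩ → O-ext (ℤ.+-comm a x) (ℤ.+-comm b y) (ℤ.+-comm c z) } }
        ; *-cong = cong₂ _⊗_
        ; *-assoc = ⊗-assoc
        ; *-identity = ⊗-identityˡ , λ α → trans (⊗-comm α 𝟏) (⊗-identityˡ α)
        ; distrib = distribˡ , λ α β γ → trans (⊗-comm (β ⊕ γ) α)
                      (trans (distribˡ α β γ) (cong₂ _⊕_ (⊗-comm α β) (⊗-comm α γ))) }
      ; *-comm = ⊗-comm } }

  -- The determinant of multiplication by a + bτ + cτ² in the basis 1, τ, τ².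
  norm : O → ℤ
  norm ⟨ a , b , c ⟩ =
    a * a * a + + 2 * (a * a * b) + + 4 * (a * a * c) - + 2 * (b * b * b) - + 4 * (b * b * c)
    + + 4 * (c * c * c) + + 6 * (a * b * c) + + 8 * (a * c * c)

  abstract
    norm-⊗-eq : ∀ a b c x y z →
      let p = a * x - + 2 * (b * z + c * y) - + 4 * (c * z); q = a * y + b * x - + 2 * (c * z)
          r = a * z + c * x + b * y + + 2 * (b * z + c * y) + + 4 * (c * z)
      in p * p * p + + 2 * (p * p * q) + + 4 * (p * p * r) - + 2 * (q * q * q) - + 4 * (q * q * r)
           + + 4 * (r * r * r) + + 6 * (p * q * r) + + 8 * (p * r * r)
         ≡ (a * a * a + + 2 * (a * a * b) + + 4 * (a * a * c) - + 2 * (b * b * b) - + 4 * (b * b * c)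
           + + 4 * (c * c * c) + + 6 * (a * b * c) + + 8 * (a * c * c))
         * (x * x * x + + 2 * (x * x * y) + + 4 * (x * x * z) - + 2 * (y * y * y) - + 4 * (y * y * z)
           + + 4 * (z * z * z) + + 6 * (x * y * z) + + 8 * (x * z * z))
    norm-⊗-eq = solve 6 (λ a b c x y z → let p = a :* x :- con (+ 2) :* (b :* z :+ c :* y) :- con (+ 4) :* (c :* z); q = a :* y :+ b :* x :- con (+ 2) :* (c :* z); r = a :* z :+ c :* x :+ b :* y :+ con (+ 2) :* (b :* z :+ c :* y) :+ con (+ 4) :* (c :* z) in
      p :* p :* p :+ con (+ 2) :* (p :* p :* q) :+ con (+ 4) :* (p :* p :* r) :- con (+ 2) :* (q :* q :* q) :- con (+ 4) :* (q :* q :* r) :+ con (+ 4) :* (r :* r :* r) :+ con (+ 6) :* (p :* q :* r) :+ con (+ 8) :* (p :* r :* r)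
      := (a :* a :* a :+ con (+ 2) :* (a :* a :* b) :+ con (+ 4) :* (a :* a :* c) :- con (+ 2) :* (b :* b :* b) :- con (+ 4) :* (b :* b :* c) :+ con (+ 4) :* (c :* c :* c) :+ con (+ 6) :* (a :* b :* c) :+ con (+ 8) :* (a :* c :* c)) :* (x :* x :* x :+ con (+ 2) :* (x :* x :* y) :+ con (+ 4) :* (x :* x :* z) :- con (+ 2) :* (y :* y :* y) :- con (+ 4) :* (y :* y :* z) :+ con (+ 4) :* (z :* z :* z) :+ con (+ 6) :* (x :* y :* z) :+ con (+ 8) :* (x :* z :* z)))

  norm-⊗ : ∀ α β → norm (α ⊗ β) ≡ norm α * norm β
  norm-⊗ ⟨ a , b , c ⟩ ⟨ x , y , z ⟩ = norm-⊗-eq a b c x y z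

  abstract
    norm-⊖-eq : ∀ a b c → - a * - a * - a + + 2 * (- a * - a * - b) + + 4 * (- a * - a * - c) - + 2 * (- b * - b * - b)
        - + 4 * (- b * - b * - c) + + 4 * (- c * - c * - c) + + 6 * (- a * - b * - c) + + 8 * (- a * - c * - c)
      ≡ - (a * a * a + + 2 * (a * a * b) + + 4 * (a * a * c) - + 2 * (b * b * b) - + 4 * (b * b * c)
        + + 4 * (c * c * c) + + 6 * (a * b * c) + + 8 * (a * c * c))
    norm-⊖-eq = solve 3 (λ a b c →
      :- a :* :- a :* :- a :+ con (+ 2) :* (:- a :* :- a :* :- b) :+ con (+ 4) :* (:- a :* :- a :* :- c) :- con (+ 2) :* (:- b :* :- b :* :- b) :- con (+ 4) :* (:- b :* :- b :* :- c) :+ con (+ 4) :* (:- c :* :- c :* :- c) :+ con (+ 6) :* (:- a :* :- b :* :- c) :+ con (+ 8) :* (:- a :* :- c :* :- c)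
      := :- (a :* a :* a :+ con (+ 2) :* (a :* a :* b) :+ con (+ 4) :* (a :* a :* c) :- con (+ 2) :* (b :* b :* b) :- con (+ 4) :* (b :* b :* c) :+ con (+ 4) :* (c :* c :* c) :+ con (+ 6) :* (a :* b :* c) :+ con (+ 8) :* (a :* c :* c)))

  norm-⊖ : ∀ α → norm (⊖ α) ≡ - norm α
  norm-⊖ ⟨ a , b , c ⟩ = norm-⊖-eq a b c

-- Inequalities for the norm form and for the descent on units.

module UnitInequalities where
  open import Data.Integer using (+_; _+_; _*_; -_; _-_; 0ℤ; 1ℤ; _≤_)
  open import Data.Integer.Tactic.RingSolver using (solve)
  open import Data.List.Base using (_∷_; [])
  open IntegerOrder
  -- The cubic is the norm in the coordinates `tri`. The lemmas from here to `x,y<z<x+y` treat the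
  -- pieces of the positive octant on which the descent `good-octant` stops, leaving out (1 , 0 , 0)
  -- and (0 , 0 , 1), which have norm 1. Each piece is parametrised by nonnegative integers, so that
  -- the bound becomes a polynomial with visibly nonnegative terms.
  z≤x∧0<y : ∀ {u p w} → Nonneg u → Nonneg p → Nonneg w → let x = u + w; y = 1ℤ + p; z = w in
    0ℤ ≤ z * z * z - x * z * z - + 2 * (y * z * z) + x * x * z - + 2 * (x * y * z)
         + x * x * x + + 2 * (x * x * y) + + 2 * (x * y * y) + + 2 * (y * y * y) - + 2
  z≤x∧0<y {u} {p} {w} U P W = 0≤-by
     (U *⁺ U *⁺ U +⁺ nat 4 *⁺ (U *⁺ U *⁺ W) +⁺ nat 2 *⁺ (U *⁺ U *⁺ Y) +⁺ nat 4 *⁺ (U *⁺ W *⁺ W) +⁺ nat 2 *⁺ (U *⁺ Y *⁺ W)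
      +⁺ nat 2 *⁺ (U *⁺ Y *⁺ Y) +⁺ nat 2 *⁺ (W *⁺ (sq (w - (1ℤ + p)) +⁺ W *⁺ Y))
      +⁺ nat 2 *⁺ (P *⁺ P *⁺ P +⁺ nat 3 *⁺ (P *⁺ P) +⁺ nat 3 *⁺ P))
     (solve (u ∷ p ∷ w ∷ []))
     where Y = nat 1 +⁺ P

  y≡0∧0<z<x : ∀ {u w} → Nonneg u → Nonneg w → let x = 1ℤ + u + (1ℤ + w); y = 0ℤ; z = 1ℤ + w in
    0ℤ ≤ z * z * z - x * z * z - + 2 * (y * z * z) + x * x * z - + 2 * (x * y * z)
         + x * x * x + + 2 * (x * x * y) + + 2 * (x * y * y) + + 2 * (y * y * y) - + 2
  y≡0∧0<z<x {u} {w} U W = 0≤-by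
     (U′ *⁺ U′ *⁺ U′ +⁺ nat 4 *⁺ (U′ *⁺ U′ *⁺ W′) +⁺ nat 4 *⁺ (U′ *⁺ W′ *⁺ W′) +⁺ nat 2 *⁺ (W *⁺ W *⁺ W +⁺ nat 3 *⁺ (W *⁺ W) +⁺ nat 3 *⁺ W))
     (solve (u ∷ w ∷ []))
     where U′ = nat 1 +⁺ U
           W′ = nat 1 +⁺ W

  y≡z≡0∧1<x : ∀ {k} → Nonneg k → let x = + 2 + k; y = 0ℤ; z = 0ℤ in
    0ℤ ≤ z * z * z - x * z * z - + 2 * (y * z * z) + x * x * z - + 2 * (x * y * z)
         + x * x * x + + 2 * (x * x * y) + + 2 * (x * y * y) + + 2 * (y * y * y) - + 2
  y≡z≡0∧1<x {k} K = 0≤-by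
     (K *⁺ K *⁺ K +⁺ nat 6 *⁺ (K *⁺ K) +⁺ nat 12 *⁺ K +⁺ nat 6)
     (solve (k ∷ []))

  x≡y≡0∧1<z : ∀ {k} → Nonneg k → let x = 0ℤ; y = 0ℤ; z = + 2 + k in
    0ℤ ≤ z * z * z - x * z * z - + 2 * (y * z * z) + x * x * z - + 2 * (x * y * z)
         + x * x * x + + 2 * (x * x * y) + + 2 * (x * y * y) + + 2 * (y * y * y) - + 2
  x≡y≡0∧1<z {k} K = 0≤-by
     (K *⁺ K *⁺ K +⁺ nat 6 *⁺ (K *⁺ K) +⁺ nat 12 *⁺ K +⁺ nat 6)
     (solve (k ∷ []))

  z<y : ∀ {x p q} → Nonneg x → Nonneg p → Nonneg q → let y = p + (1ℤ + q); z = p in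
    0ℤ ≤ z * z * z - x * z * z - + 2 * (y * z * z) + x * x * z - + 2 * (x * y * z)
         + x * x * x + + 2 * (x * x * y) + + 2 * (x * y * y) + + 2 * (y * y * y) - + 2
  z<y {x} {p} {q} X P Q = 0≤-by
     (X *⁺ X *⁺ X +⁺ P *⁺ (sq (x - p) +⁺ nat 2 *⁺ (X *⁺ X) +⁺ X *⁺ P) +⁺ nat 2 *⁺ (X *⁺ X *⁺ Q′) +⁺ nat 2 *⁺ (X *⁺ P *⁺ Q′)
      +⁺ nat 2 *⁺ (X *⁺ Q′ *⁺ Q′) +⁺ nat 4 *⁺ (P *⁺ P *⁺ Q′) +⁺ nat 6 *⁺ (P *⁺ Q′ *⁺ Q′) +⁺ nat 2 *⁺ (Q *⁺ Q *⁺ Q +⁺ nat 3 *⁺ (Q *⁺ Q) +⁺ nat 3 *⁺ Q))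
     (solve (x ∷ p ∷ q ∷ []))
     where Q′ = nat 1 +⁺ Q

  z≡y∧0<x,y : ∀ {a b} → Nonneg a → Nonneg b → let x = 1ℤ + a; y = 1ℤ + b; z = 1ℤ + b in
    0ℤ ≤ z * z * z - x * z * z - + 2 * (y * z * z) + x * x * z - + 2 * (x * y * z)
         + x * x * x + + 2 * (x * x * y) + + 2 * (x * y * y) + + 2 * (y * y * y) - + 2
  z≡y∧0<x,y {a} {b} A B = 0≤-by
     (A *⁺ A *⁺ A +⁺ nat 3 *⁺ (A *⁺ A) +⁺ nat 3 *⁺ A +⁺ P *⁺ (sq (1ℤ + a - (1ℤ + b)) +⁺ X *⁺ P) +⁺ P *⁺ (X *⁺ X)
      +⁺ (P *⁺ (nat 2 *⁺ A +⁺ A *⁺ A) +⁺ B))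
     (solve (a ∷ b ∷ []))
     where X = nat 1 +⁺ A
           P = nat 1 +⁺ B

  -- The part of the cubic free of 1 + u is p³ - 2p²w + 2w³, whose minimum for fixed w is at p =
  -- 4w/3 with value 22w³/27; this is where the square of 3p - 4w, the 22 and the factor 27 come
  -- from.
  x,y<z<x+y : ∀ {u w p} → Nonneg u → Nonneg w → Nonneg p → let x = 1ℤ + u + w; y = 1ℤ + u + p; z = 1ℤ + u + w + p in
    0ℤ ≤ + 27 * (z * z * z - x * z * z - + 2 * (y * z * z) + x * x * z - + 2 * (x * y * z)
         + x * x * x + + 2 * (x * x * y) + + 2 * (x * y * y) + + 2 * (y * y * y) - + 2)
  x,y<z<x+y {u} {w} {p} U W P = 0≤-by
     (nat 27 *⁺ (nat 4 *⁺ (U *⁺ U *⁺ U +⁺ nat 3 *⁺ (U *⁺ U) +⁺ nat 3 *⁺ U) +⁺ nat 2 +⁺ nat 4 *⁺ (U′ *⁺ U′ *⁺ W) +⁺ nat 4 *⁺ (U′ *⁺ U′ *⁺ P)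
        +⁺ U′ *⁺ (nat 3 *⁺ (W *⁺ W) +⁺ P *⁺ P +⁺ sq (w - p)))
      +⁺ (sq (+ 3 * p - + 4 * w) *⁺ (nat 3 *⁺ P +⁺ nat 2 *⁺ W) +⁺ nat 22 *⁺ (W *⁺ W *⁺ W)))
     (solve (u ∷ w ∷ p ∷ []))
     where U′ = nat 1 +⁺ U

  -- In these six cases the value of the form minus its value after a shift is
  -- x² + y² + z² - 2xy - xz - 2yz.
  decrease-ppn : ∀ {a b c} → Nonneg a → Nonneg b → Nonneg c → let x = a; y = b; z = - (1ℤ + c); t = x + y + z in
    0ℤ ≤ + 3 * (x * x) + + 4 * (y * y) + + 2 * (z * z) - + 2 * (x * z) - + 5 * (y * z)
         - (+ 3 * (y * y) + + 4 * (z * z) + + 2 * (t * t) - + 2 * (y * t) - + 5 * (z * t)) - 1ℤ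
  decrease-ppn {a} {b} {c} A B C = 0≤-by
     (sq (a - b) +⁺ (nat 2 *⁺ C +⁺ C *⁺ C) +⁺ A *⁺ C′ +⁺ nat 2 *⁺ (B *⁺ C′))
     (solve (a ∷ b ∷ c ∷ []))
     where C′ = nat 1 +⁺ C

  decrease-pnp : ∀ {a b c} → Nonneg a → Nonneg b → Nonneg c → let x = a; y = - (1ℤ + b); z = c; t = x + y + z in
    0ℤ ≤ + 3 * (x * x) + + 4 * (y * y) + + 2 * (z * z) - + 2 * (x * z) - + 5 * (y * z)
         - (+ 3 * (y * y) + + 4 * (z * z) + + 2 * (t * t) - + 2 * (y * t) - + 5 * (z * t)) - 1ℤ
  decrease-pnp {a} {b} {c} A B C = 0≤-by
     (sq (a - c) +⁺ A *⁺ C +⁺ (nat 2 *⁺ B +⁺ B *⁺ B) +⁺ nat 2 *⁺ (A *⁺ B′) +⁺ nat 2 *⁺ (C *⁺ B′))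
     (solve (a ∷ b ∷ c ∷ []))
     where B′ = nat 1 +⁺ B

  decrease-npp : ∀ {a b c} → Nonneg a → Nonneg b → Nonneg c → let x = - (1ℤ + a); y = b; z = c; t = x + y + z in
    0ℤ ≤ + 3 * (x * x) + + 4 * (y * y) + + 2 * (z * z) - + 2 * (x * z) - + 5 * (y * z)
         - (+ 3 * (y * y) + + 4 * (z * z) + + 2 * (t * t) - + 2 * (y * t) - + 5 * (z * t)) - 1ℤ
  decrease-npp {a} {b} {c} A B C = 0≤-by
     (sq (b - c) +⁺ (nat 2 *⁺ A +⁺ A *⁺ A) +⁺ nat 2 *⁺ (A′ *⁺ B) +⁺ A′ *⁺ C)
     (solve (a ∷ b ∷ c ∷ []))
     where A′ = nat 1 +⁺ A

  decrease-pnn : ∀ {a b c} → Nonneg a → Nonneg b → Nonneg c → let x = 1ℤ + a; y = - (1ℤ + b); z = - (1ℤ + c); t = x + y + z in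
    0ℤ ≤ + 3 * (x * x) + + 4 * (y * y) + + 2 * (z * z) - + 2 * (x * z) - + 5 * (y * z)
         - (+ 3 * (y * y) + + 4 * (z * z) + + 2 * (t * t) - + 2 * (y * t) - + 5 * (z * t)) - 1ℤ
  decrease-pnn {a} {b} {c} A B C = 0≤-by
     (sq (1ℤ + b - (1ℤ + c)) +⁺ (nat 2 *⁺ A +⁺ A *⁺ A) +⁺ nat 2 *⁺ (A′ *⁺ B′) +⁺ A′ *⁺ C′)
     (solve (a ∷ b ∷ c ∷ []))
     where A′ = nat 1 +⁺ A
           B′ = nat 1 +⁺ B
           C′ = nat 1 +⁺ C

  decrease-npn : ∀ {a b c} → Nonneg a → Nonneg b → Nonneg c → let x = - (1ℤ + a); y = b; z = - (1ℤ + c); t = x + y + z in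
    0ℤ ≤ + 3 * (x * x) + + 4 * (y * y) + + 2 * (z * z) - + 2 * (x * z) - + 5 * (y * z)
         - (+ 3 * (y * y) + + 4 * (z * z) + + 2 * (t * t) - + 2 * (y * t) - + 5 * (z * t)) - 1ℤ
  decrease-npn {a} {b} {c} A B C = 0≤-by
     (sq (a - c) +⁺ (A +⁺ C +⁺ A *⁺ C) +⁺ B *⁺ B +⁺ nat 2 *⁺ (A′ *⁺ B) +⁺ nat 2 *⁺ (B *⁺ C′))
     (solve (a ∷ b ∷ c ∷ []))
     where A′ = nat 1 +⁺ A
           C′ = nat 1 +⁺ C

  decrease-nnp : ∀ {a b c} → Nonneg a → Nonneg b → Nonneg c → let x = - (1ℤ + a); y = - (1ℤ + b); z = 1ℤ + c; t = x + y + z in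
    0ℤ ≤ + 3 * (x * x) + + 4 * (y * y) + + 2 * (z * z) - + 2 * (x * z) - + 5 * (y * z)
         - (+ 3 * (y * y) + + 4 * (z * z) + + 2 * (t * t) - + 2 * (y * t) - + 5 * (z * t)) - 1ℤ
  decrease-nnp {a} {b} {c} A B C = 0≤-by
     (sq (a - b) +⁺ (nat 2 *⁺ C +⁺ C *⁺ C) +⁺ A′ *⁺ C′ +⁺ nat 2 *⁺ (B′ *⁺ C′))
     (solve (a ∷ b ∷ c ∷ []))
     where A′ = nat 1 +⁺ A
           B′ = nat 1 +⁺ B
           C′ = nat 1 +⁺ C

-- Units of norm 1 in ℤ[τ], modulo squares.

module Units where
  open import Algebra.Bundles using (module CommutativeRing)
  import Algebra.Properties.Ring
  import Algebra.Solver.Ring.NaturalCoefficients.Default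
  open import Data.Integer using (ℤ; +_; -[1+_]; _+_; _*_; -_; _-_; 0ℤ; 1ℤ; ∣_∣; _≤_; _<_; +≤+; +<+)
  import Data.Integer.Properties as ℤ
  open IntegerIdentity
  open import Data.Nat.Base as ℕ using (ℕ; zero; suc)
  import Data.Nat.Properties as ℕ
  open import Data.Nat.Induction using (<-wellFounded)
  open import Data.Product using (_,_; _×_; ∃-syntax)
  open import Data.Sum using (_⊎_; inj₁; inj₂)
  open import Relation.Binary.PropositionalEquality
  open import Relation.Nullary using (Dec; yes; no; ¬_; contradiction)
  open import Induction.WellFounded using (Acc; acc)
  open CubicRing
  open IntegerOrder
  open UnitInequalities

  private
    module R = CommutativeRing O-commutativeRing
    open Algebra.Properties.Ring R.ring using (-‿distribʳ-*)
    module S = Algebra.Solver.Ring.NaturalCoefficients.Default R.commutativeSemiring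

  -- The unit ε = 1 - τ satisfies ε³ = ε² + ε + 1, the characteristic equation of the tribonacci
  -- recursion.
  ε ε⁻¹ : O
  ε   = ⟨ 1ℤ , - 1ℤ , 0ℤ ⟩
  ε⁻¹ = ⟨ - 1ℤ , - 1ℤ , 1ℤ ⟩

  -- The coordinates in which multiplication by ε is the shift (x , y , z) ↦ (y , z , x + y + z).
  tri : ℤ → ℤ → ℤ → O
  tri x y z = ⟨ z - x , - x - y , x ⟩

  ε⊗tri : ∀ x y z → ε ⊗ tri x y z ≡ tri y z (x + y + z)
  ε⊗tri x y z = O-ext (p x y z) (q x y z) (r x y z)
    where
    p : ∀ x y z → 1ℤ * (z - x) - + 2 * (- 1ℤ * x + 0ℤ * (- x - y)) - + 4 * (0ℤ * x) ≡ x + y + z - y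
    p = solve 3 (λ x y z →
      con 1ℤ :* (z :- x) :- con (+ 2) :* (:- con 1ℤ :* x :+ con 0ℤ :* (:- x :- y)) :- con (+ 4) :* (con 0ℤ :* x)
      := x :+ y :+ z :- y)
    q : ∀ x y z → 1ℤ * (- x - y) + - 1ℤ * (z - x) - + 2 * (0ℤ * x) ≡ - y - z
    q = solve 3 (λ x y z → con 1ℤ :* (:- x :- y) :+ :- con 1ℤ :* (z :- x) :- con (+ 2) :* (con 0ℤ :* x) := :- y :- z)
    r : ∀ x y z → 1ℤ * x + 0ℤ * (z - x) + - 1ℤ * (- x - y) + + 2 * (- 1ℤ * x + 0ℤ * (- x - y)) + + 4 * (0ℤ * x) ≡ y
    r = solve 3 (λ x y z →
      con 1ℤ :* x :+ con 0ℤ :* (z :- x) :+ :- con 1ℤ :* (:- x :- y) :+ con (+ 2) :* (:- con 1ℤ :* x :+ con 0ℤ :* (:- x :- y)) :+ con (+ 4) :* (con 0ℤ :* x)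
      := y)

  tribonacci-form : ℤ → ℤ → ℤ → ℤ
  tribonacci-form x y z = z * z * z - x * z * z - + 2 * (y * z * z) + x * x * z - + 2 * (x * y * z)
      + x * x * x + + 2 * (x * x * y) + + 2 * (x * y * y) + + 2 * (y * y * y)

  norm-tri : ∀ x y z → norm (tri x y z) ≡ tribonacci-form x y z
  norm-tri = solve 3 (λ x y z → let a = z :- x; b = :- x :- y; c = x in
      a :* a :* a :+ con (+ 2) :* (a :* a :* b) :+ con (+ 4) :* (a :* a :* c) :- con (+ 2) :* (b :* b :* b) :- con (+ 4) :* (b :* b :* c) :+ con (+ 4) :* (c :* c :* c) :+ con (+ 6) :* (a :* b :* c) :+ con (+ 8) :* (a :* c :* c)
      := z :* z :* z :- x :* z :* z :- con (+ 2) :* (y :* z :* z) :+ x :* x :* z :- con (+ 2) :* (x :* y :* z) :+ x :* x :* x :+ con (+ 2) :* (x :* x :* y) :+ con (+ 2) :* (x :* y :* y) :+ con (+ 2) :* (y :* y :* y))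

  ⊖-tri : ∀ x y z → ⊖ tri x y z ≡ tri (- x) (- y) (- z)
  ⊖-tri x y z = O-ext (p x z) (p′ x y) refl
    where
    p : ∀ x z → - (z - x) ≡ - z - - x
    p = solve 2 (λ x z → :- (z :- x) := :- z :- :- x)
    p′ : ∀ x y → - (- x - y) ≡ - - x - - y
    p′ = solve 2 (λ x y → :- (:- x :- y) := :- :- x :- :- y)

  -- The two classes of powers of ε modulo squares: the descent on the curve only needs the parity
  -- of the exponent.
  SquareClass : O → Set
  SquareClass v = ∃[ κ ] (v ≡ κ ⊗ κ ⊎ v ≡ ε ⊗ (κ ⊗ κ))

  -- Positivity of the norm and the square class are carried together because both are unchanged, up
  -- to exchanging the two classes, when v is multiplied or divided by ε.
  Good : O → Set
  Good v = 0ℤ < norm v × (norm v ≡ 1ℤ → SquareClass v)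

  private
    ⊗-cancel-ε : ∀ v w → ε ⊗ v ≡ w → v ≡ ε⁻¹ ⊗ w
    ⊗-cancel-ε v w εv≡w = begin
      v                ≡⟨ R.*-identityˡ v ⟨
      ε⁻¹ ⊗ ε ⊗ v      ≡⟨ R.*-assoc ε⁻¹ ε v ⟩
      ε⁻¹ ⊗ (ε ⊗ v)    ≡⟨ cong (ε⁻¹ ⊗_) εv≡w ⟩
      ε⁻¹ ⊗ w          ∎
      where open ≡-Reasoning

    norm-shift : ∀ v → norm (ε ⊗ v) ≡ norm v
    norm-shift v = trans (norm-⊗ ε v) (ℤ.*-identityˡ (norm v))

    shift-square : ∀ v → SquareClass v → SquareClass (ε ⊗ v)
    shift-square v (κ , inj₁ v≡κκ) = κ , inj₂ (cong (ε ⊗_) v≡κκ)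
    shift-square v (κ , inj₂ v≡εκκ) = ε ⊗ κ , inj₁ (trans (cong (ε ⊗_) v≡εκκ) (rearrange ε κ))
      where
      rearrange : ∀ e k → e ⊗ (e ⊗ (k ⊗ k)) ≡ (e ⊗ k) ⊗ (e ⊗ k)
      rearrange = S.solve 2 (λ e k → e S.:* (e S.:* (k S.:* k)) S.:= (e S.:* k) S.:* (e S.:* k)) refl

    unshift-square : ∀ v → SquareClass (ε ⊗ v) → SquareClass v
    unshift-square v (κ , inj₂ εv≡εκκ) = κ , inj₁ (trans (⊗-cancel-ε v _ εv≡εκκ) (sym (⊗-cancel-ε (κ ⊗ κ) _ refl)))
    unshift-square v (κ , inj₁ εv≡κκ) = ε⁻¹ ⊗ κ , inj₂ (trans (⊗-cancel-ε v _ εv≡κκ) (begin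
      ε⁻¹ ⊗ (κ ⊗ κ)                ≡⟨ R.*-identityˡ _ ⟨
      (ε ⊗ ε⁻¹) ⊗ (ε⁻¹ ⊗ (κ ⊗ κ))  ≡⟨ rearrange ε ε⁻¹ κ ⟩
      ε ⊗ ((ε⁻¹ ⊗ κ) ⊗ (ε⁻¹ ⊗ κ))  ∎))
      where
      open ≡-Reasoning
      rearrange : ∀ e i k → (e ⊗ i) ⊗ (i ⊗ (k ⊗ k)) ≡ e ⊗ ((i ⊗ k) ⊗ (i ⊗ k))
      rearrange = S.solve 3 (λ e i k → (e S.:* i) S.:* (i S.:* (k S.:* k)) S.:= e S.:* ((i S.:* k) S.:* (i S.:* k))) refl

    good-shift : ∀ v → Good v → Good (ε ⊗ v)
    good-shift v (0<N , sq) = subst (0ℤ <_) (sym (norm-shift v)) 0<N ,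
      λ N≡1 → shift-square v (sq (trans (sym (norm-shift v)) N≡1))

    good-unshift : ∀ v → Good (ε ⊗ v) → Good v
    good-unshift v (0<N , sq) = subst (0ℤ <_) (norm-shift v) 0<N ,
      λ N≡1 → unshift-square v (sq (trans (norm-shift v) N≡1))

    good-large : ∀ x y z → 0ℤ ≤ tribonacci-form x y z - + 2 → Good (tri x y z)
    good-large x y z 0≤N-2 = ℤ.<-≤-trans (+<+ (ℕ.s≤s ℕ.z≤n)) 2≤N ,
      λ N≡1 → contradiction (subst (+ 2 ≤_) N≡1 2≤N) λ { (+≤+ (ℕ.s≤s ())) }
      where
      2≤N : + 2 ≤ norm (tri x y z)
      2≤N = subst (+ 2 ≤_) (sym (norm-tri x y z)) (ℤ.0≤i-j⇒j≤i 0≤N-2)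

    good-z≤x∧0<y : ∀ {u p w} → Nonneg u → Nonneg p → Nonneg w → Good (tri (u + w) (1ℤ + p) w)
    good-z≤x∧0<y {u} {p} {w} U P W = good-large (u + w) (1ℤ + p) w (z≤x∧0<y U P W)

    good-y≡0∧0<z<x : ∀ {u w} → Nonneg u → Nonneg w → Good (tri (1ℤ + u + (1ℤ + w)) 0ℤ (1ℤ + w))
    good-y≡0∧0<z<x {u} {w} U W = good-large (1ℤ + u + (1ℤ + w)) 0ℤ (1ℤ + w) (y≡0∧0<z<x U W)

    good-y≡z≡0∧1<x : ∀ {k} → Nonneg k → Good (tri (+ 2 + k) 0ℤ 0ℤ)
    good-y≡z≡0∧1<x {k} K = good-large (+ 2 + k) 0ℤ 0ℤ (y≡z≡0∧1<x K)

    good-x≡y≡0∧1<z : ∀ {k} → Nonneg k → Good (tri 0ℤ 0ℤ (+ 2 + k))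
    good-x≡y≡0∧1<z {k} K = good-large 0ℤ 0ℤ (+ 2 + k) (x≡y≡0∧1<z K)

    good-z<y : ∀ {x p q} → Nonneg x → Nonneg p → Nonneg q → Good (tri x (p + (1ℤ + q)) p)
    good-z<y {x} {p} {q} X P Q = good-large x (p + (1ℤ + q)) p (z<y X P Q)

    good-z≡y∧0<x,y : ∀ {a b} → Nonneg a → Nonneg b → Good (tri (1ℤ + a) (1ℤ + b) (1ℤ + b))
    good-z≡y∧0<x,y {a} {b} A B = good-large (1ℤ + a) (1ℤ + b) (1ℤ + b) (z≡y∧0<x,y A B)

    good-x,y<z<x+y : ∀ {u w p} → Nonneg u → Nonneg w → Nonneg p → Good (tri (1ℤ + u + w) (1ℤ + u + p) (1ℤ + u + w + p))
    good-x,y<z<x+y {u} {w} {p} U W P = good-large (1ℤ + u + w) (1ℤ + u + p) (1ℤ + u + w + p) (ℤ.*-cancelˡ-≤-pos 0ℤ _ (+ 27) (x,y<z<x+y U W P))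

    good-octant-base : ∀ x y z → z ℕ.< x ℕ.+ y → Good (tri (+ x) (+ y) (+ z))
    good-octant-base x y z z<x+y with z ℕ.≤? x
    good-octant-base x zero z z<x+y | yes z≤x with ℕ.m≤n⇒∃[o]m+o≡n (subst (z ℕ.<_) (ℕ.+-identityʳ x) z<x+y)
    -- The vector (1 , 0 , 0) is ε⁻¹ itself, which is ε times the square of ε⁻¹.
    good-octant-base _ zero zero z<x+y | yes z≤x | zero , refl = (+<+ (ℕ.s≤s ℕ.z≤n)) , λ _ → ε⁻¹ , inj₂ refl
    good-octant-base _ zero zero z<x+y | yes z≤x | suc u , refl = good-y≡z≡0∧1<x (nat u)
    good-octant-base _ zero (suc w) z<x+y | yes z≤x | u , refl =
      subst (λ x → Good (tri x 0ℤ (+ suc w))) (cong +_ (trans (ℕ.+-comm (suc u) (suc w)) (ℕ.+-suc (suc w) u)))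
        (good-y≡0∧0<z<x (nat u) (nat w))
    good-octant-base x (suc p) z z<x+y | yes z≤x with ℕ.m≤n⇒∃[o]m+o≡n z≤x
    ... | u , refl = subst (λ x → Good (tri x (+ suc p) (+ z))) (cong +_ (ℕ.+-comm u z))
        (good-z≤x∧0<y (nat u) (nat p) (nat z))
    good-octant-base x y z z<x+y | no z≰x with z ℕ.≤? y
    good-octant-base x y z z<x+y | no z≰x | yes z≤y with ℕ.m≤n⇒∃[o]m+o≡n z≤y
    ... | suc q , refl = good-z<y (nat x) (nat z) (nat q)
    good-octant-base zero _ z z<x+y | no z≰x | yes z≤y | zero , refl =
      contradiction (subst (z ℕ.<_) (ℕ.+-identityʳ z) z<x+y) (ℕ.<-irrefl refl)
    good-octant-base (suc a) _ zero z<x+y | no z≰x | yes z≤y | zero , refl = contradiction ℕ.z≤n z≰x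
    good-octant-base (suc a) _ (suc b) z<x+y | no z≰x | yes z≤y | zero , refl =
      subst (λ y → Good (tri (+ suc a) y (+ suc b))) (cong +_ (sym (ℕ.+-identityʳ (suc b))))
        (good-z≡y∧0<x,y (nat a) (nat b))
    good-octant-base x y z z<x+y | no z≰x | no z≰y
      with ℕ.m≤n⇒∃[o]m+o≡n (ℕ.<⇒≤ (ℕ.≰⇒> z≰x)) | ℕ.m≤n⇒∃[o]m+o≡n (ℕ.<⇒≤ (ℕ.≰⇒> z≰y)) | ℕ.m≤n⇒∃[o]m+o≡n z<x+y
    -- Here p = z - x, w = z - y and u + 1 = x + y - z are the distances to the walls of the
    -- remaining region; x, y and z are recovered from them.
    ... | p , x+p≡z | w , y+w≡z | u , z+1+u≡x+y =
      good-subst x≡ y≡ z≡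
        (good-x,y<z<x+y (nat u) (nat w) (nat p))
      where
      good-subst : ∀ {x x′ y y′ z z′} → x ≡ x′ → y ≡ y′ → z ≡ z′ → Good (tri (+ x) (+ y) (+ z)) → Good (tri (+ x′) (+ y′) (+ z′))
      good-subst refl refl refl g = g
      x≡ : suc u ℕ.+ w ≡ x
      x≡ = ℕ.+-cancelˡ-≡ y _ _ (begin
        y ℕ.+ (suc u ℕ.+ w)   ≡⟨ cong (y ℕ.+_) (ℕ.+-comm (suc u) w) ⟩
        y ℕ.+ (w ℕ.+ suc u)   ≡⟨ ℕ.+-assoc y w (suc u) ⟨
        y ℕ.+ w ℕ.+ suc u     ≡⟨ cong (ℕ._+ suc u) y+w≡z ⟩
        z ℕ.+ suc u           ≡⟨ ℕ.+-suc z u ⟩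
        suc z ℕ.+ u           ≡⟨ z+1+u≡x+y ⟩
        x ℕ.+ y               ≡⟨ ℕ.+-comm x y ⟩
        y ℕ.+ x               ∎)
        where open ≡-Reasoning
      y≡ : suc u ℕ.+ p ≡ y
      y≡ = ℕ.+-cancelˡ-≡ x _ _ (begin
        x ℕ.+ (suc u ℕ.+ p)   ≡⟨ cong (x ℕ.+_) (ℕ.+-comm (suc u) p) ⟩
        x ℕ.+ (p ℕ.+ suc u)   ≡⟨ ℕ.+-assoc x p (suc u) ⟨
        x ℕ.+ p ℕ.+ suc u     ≡⟨ cong (ℕ._+ suc u) x+p≡z ⟩
        z ℕ.+ suc u           ≡⟨ ℕ.+-suc z u ⟩
        suc z ℕ.+ u           ≡⟨ z+1+u≡x+y ⟩
        x ℕ.+ y               ∎)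
        where open ≡-Reasoning
      z≡ : suc u ℕ.+ w ℕ.+ p ≡ z
      z≡ = trans (cong (ℕ._+ p) x≡) x+p≡z

    Nonzero : ℕ → ℕ → ℕ → Set
    Nonzero x y z = ¬ (x ≡ 0 × y ≡ 0 × z ≡ 0)

    good-step : ∀ x y w → Good (tri (+ w) (+ x) (+ y)) → Good (tri (+ x) (+ y) (+ (x ℕ.+ y ℕ.+ w)))
    good-step x y w g = subst (λ z → Good (tri (+ x) (+ y) z)) (cong +_ (trans (ℕ.+-assoc w x y) (ℕ.+-comm w (x ℕ.+ y))))
      (subst Good (ε⊗tri (+ w) (+ x) (+ y)) (good-shift (tri (+ w) (+ x) (+ y)) g))

    -- Division by ε takes (x , y , z) to (z - x - y , x , y). It stays in the octant as long as x +
    -- y ≤ z and lowers the sum of the coordinates from x + y + z to z.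
    good-octant : ∀ x y z → Nonzero x y z → Acc ℕ._<_ (x ℕ.+ y ℕ.+ z) → Good (tri (+ x) (+ y) (+ z))
    good-octant x y z nz (acc smaller) with x ℕ.+ y ℕ.≤? z
    good-octant x y z nz (acc smaller) | no x+y≰z = good-octant-base x y z (ℕ.≰⇒> x+y≰z)
    good-octant x y z nz (acc smaller) | yes x+y≤z with ℕ.m≤n⇒∃[o]m+o≡n x+y≤z
    good-octant x y _ nz (acc smaller) | yes _ | w , refl with x ℕ.+ y ℕ.≟ 0
    ... | no x+y≢0 = good-step x y w (good-octant w x y nz′ (smaller decreases))
      where
      nz′ : Nonzero w x y
      nz′ (_ , refl , refl) = x+y≢0 refl
      decreases : w ℕ.+ x ℕ.+ y ℕ.< x ℕ.+ y ℕ.+ (x ℕ.+ y ℕ.+ w)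
      decreases = ℕ.≤-<-trans (ℕ.≤-reflexive (trans (ℕ.+-assoc w x y) (ℕ.+-comm w (x ℕ.+ y))))
                              (ℕ.m<n+m _ (ℕ.n≢0⇒n>0 x+y≢0))
    good-octant x y _ nz _ | yes _ | w , refl | yes x+y≡0
      with ℕ.m+n≡0⇒m≡0 x x+y≡0 | ℕ.m+n≡0⇒n≡0 x x+y≡0
    good-octant _ _ _ nz _ | yes _ | zero , refl | yes _ | refl | refl = contradiction (refl , refl , refl) nz
    good-octant _ _ _ nz _ | yes _ | suc zero , refl | yes _ | refl | refl = +<+ (ℕ.s≤s ℕ.z≤n) , λ _ → 𝟏 , inj₁ refl
    good-octant _ _ _ nz _ | yes _ | suc (suc k) , refl | yes _ | refl | refl = good-x≡y≡0∧1<z (nat k)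

    -- A positive definite form that drops strictly under multiplication by ε when the signs of the
    -- coordinates are mixed. It takes the place of estimates with the real and complex embeddings.
    form : ℤ → ℤ → ℤ → ℤ
    form x y z = + 3 * (x * x) + + 4 * (y * y) + + 2 * (z * z) - + 2 * (x * z) - + 5 * (y * z)

    0≤form : ∀ x y z → 0ℤ ≤ form x y z
    0≤form x y z = ℤ.*-cancelˡ-≤-pos 0ℤ (form x y z) (+ 48)
      (0≤-by (nat 3 *⁺ sq (+ 8 * y - + 5 * z) +⁺ nat 16 *⁺ sq (+ 3 * x - z) +⁺ nat 5 *⁺ sq z) (solve 3 (λ x y z →
        con (+ 48) :* (con (+ 3) :* (x :* x) :+ con (+ 4) :* (y :* y) :+ con (+ 2) :* (z :* z) :- con (+ 2) :* (x :* z) :- con (+ 5) :* (y :* z))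
        := con (+ 3) :* ((con (+ 8) :* y :- con (+ 5) :* z) :* (con (+ 8) :* y :- con (+ 5) :* z)) :+ con (+ 16) :* ((con (+ 3) :* x :- z) :* (con (+ 3) :* x :- z)) :+ con (+ 5) :* (z :* z)) x y z))

    measure : ℤ → ℤ → ℤ → ℕ
    measure x y z = ∣ form x y z ∣

    record Decreases (x y z : ℤ) : Set where
      constructor decreases
      field gap : 0ℤ ≤ form x y z - form y z (x + y + z) - 1ℤ

    abs-decreases : ∀ x y z → Decreases x y z → measure y z (x + y + z) ℕ.< measure x y z
    abs-decreases x y z (decreases d) = ℤ.drop‿+<+ (subst₂ _<_ (sym (ℤ.0≤i⇒+∣i∣≡i (0≤form y z _))) (sym (ℤ.0≤i⇒+∣i∣≡i (0≤form x y z)))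
      (ℤ.suc[i]≤j⇒i<j (ℤ.0≤i-j⇒j≤i (subst (0ℤ ≤_) (solve 2 (λ i j → i :- j :- con 1ℤ := i :- (con 1ℤ :+ j)) (form x y z) (form y z (x + y + z))) d))))

    decreases-ppn : ∀ {a b c} → Nonneg a → Nonneg b → Nonneg c → Decreases a b (- (1ℤ + c))
    decreases-ppn A B C = decreases (decrease-ppn A B C)

    decreases-pnp : ∀ {a b c} → Nonneg a → Nonneg b → Nonneg c → Decreases a (- (1ℤ + b)) c
    decreases-pnp A B C = decreases (decrease-pnp A B C)

    decreases-npp : ∀ {a b c} → Nonneg a → Nonneg b → Nonneg c → Decreases (- (1ℤ + a)) b c
    decreases-npp A B C = decreases (decrease-npp A B C)

    decreases-pnn : ∀ {a b c} → Nonneg a → Nonneg b → Nonneg c → Decreases (1ℤ + a) (- (1ℤ + b)) (- (1ℤ + c))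
    decreases-pnn A B C = decreases (decrease-pnn A B C)

    decreases-npn : ∀ {a b c} → Nonneg a → Nonneg b → Nonneg c → Decreases (- (1ℤ + a)) b (- (1ℤ + c))
    decreases-npn A B C = decreases (decrease-npn A B C)

    decreases-nnp : ∀ {a b c} → Nonneg a → Nonneg b → Nonneg c → Decreases (- (1ℤ + a)) (- (1ℤ + b)) (1ℤ + c)
    decreases-nnp A B C = decreases (decrease-nnp A B C)

    Reached : O → Set
    Reached v = Good v ⊎ Good (⊖ v)

    reached-unshift : ∀ v → Reached (ε ⊗ v) → Reached v
    reached-unshift v (inj₁ g) = inj₁ (good-unshift v g)
    reached-unshift v (inj₂ g) = inj₂ (good-unshift (⊖ v) (subst Good (-‿distribʳ-* ε v) g))

    Nonzeroℤ : ℤ → ℤ → ℤ → Set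
    Nonzeroℤ x y z = ¬ (x ≡ 0ℤ × y ≡ 0ℤ × z ≡ 0ℤ)

    nonzero-shift : ∀ x y z → Nonzeroℤ x y z → Nonzeroℤ y z (x + y + z)
    nonzero-shift x y z nz (refl , refl , x+0+0≡0) = nz (trans (sym (trans (ℤ.+-identityʳ _) (ℤ.+-identityʳ x))) x+0+0≡0 , refl , refl)

    opposite-octant : ∀ x y z → Nonzero x y z → Reached (tri (- + x) (- + y) (- + z))
    opposite-octant x y z nz = inj₂ (subst Good eq (good-octant x y z nz (<-wellFounded _)))
      where
      eq : tri (+ x) (+ y) (+ z) ≡ ⊖ tri (- + x) (- + y) (- + z)
      eq = sym (trans (⊖-tri (- + x) (- + y) (- + z))
        (cong₃ tri (ℤ.neg-involutive (+ x)) (ℤ.neg-involutive (+ y)) (ℤ.neg-involutive (+ z))))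
        where
        cong₃ : ∀ (f : ℤ → ℤ → ℤ → O) {a b c x y z} → a ≡ x → b ≡ y → c ≡ z → f a b c ≡ f x y z
        cong₃ f refl refl refl = refl

    -- Repeated multiplication by ε drives a vector towards the dominant eigenvector of the shift,
    -- whose coordinates have one sign; so after finitely many shifts v or -v lies in the positive
    -- octant.
    reached : ∀ x y z → Nonzeroℤ x y z → Acc ℕ._<_ (measure x y z) → Reached (tri x y z)
    shifted : ∀ x y z → Nonzeroℤ x y z → Acc ℕ._<_ (measure x y z) → Decreases x y z → Reached (tri x y z)

    shifted x y z nz (acc smaller) d = reached-unshift (tri x y z)
      (subst Reached (sym (ε⊗tri x y z)) (reached y z (x + y + z) (nonzero-shift x y z nz) (smaller (abs-decreases x y z d))))

    reached (+ x) (+ y) (+ z) nz _ = inj₁ (good-octant x y z (λ { (refl , refl , refl) → nz (refl , refl , refl) }) (<-wellFounded _))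
    reached (+ a) (+ b) -[1+ c ] nz ac = shifted _ _ _ nz ac (decreases-ppn (nat a) (nat b) (nat c))
    reached (+ a) -[1+ b ] (+ c) nz ac = shifted _ _ _ nz ac (decreases-pnp (nat a) (nat b) (nat c))
    reached -[1+ a ] (+ b) (+ c) nz ac = shifted _ _ _ nz ac (decreases-npp (nat a) (nat b) (nat c))
    reached (+ suc a) -[1+ b ] -[1+ c ] nz ac = shifted _ _ _ nz ac (decreases-pnn (nat a) (nat b) (nat c))
    reached -[1+ a ] (+ b) -[1+ c ] nz ac = shifted _ _ _ nz ac (decreases-npn (nat a) (nat b) (nat c))
    reached -[1+ a ] -[1+ b ] (+ suc c) nz ac = shifted _ _ _ nz ac (decreases-nnp (nat a) (nat b) (nat c))
    reached (+ zero) -[1+ b ] -[1+ c ] nz _ = opposite-octant 0 (suc b) (suc c) λ { (_ , () , _) }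
    reached -[1+ a ] -[1+ b ] (+ zero) nz _ = opposite-octant (suc a) (suc b) 0 λ { (() , _) }
    reached -[1+ a ] -[1+ b ] -[1+ c ] nz _ = opposite-octant (suc a) (suc b) (suc c) λ { (() , _) }

    as-tri : ∀ a b c → tri c (- b - c) (a + c) ≡ ⟨ a , b , c ⟩
    as-tri a b c = O-ext (p a c) (q b c) refl
      where
      p : ∀ a c → a + c - c ≡ a
      p = solve 2 (λ a c → a :+ c :- c := a)
      q : ∀ b c → - c - (- b - c) ≡ b
      q = solve 2 (λ b c → :- c :- (:- b :- c) := b)

    reached-nonzero : ∀ v → v ≢ 𝟎 → Reached v
    reached-nonzero ⟨ a , b , c ⟩ v≢0 = subst Reached (as-tri a b c) (reached c (- b - c) (a + c) nz (<-wellFounded _))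
      where
      nz : Nonzeroℤ c (- b - c) (a + c)
      nz (c≡0 , -b-c≡0 , a+c≡0) = v≢0 (trans (sym (as-tri a b c)) (lemma c≡0 -b-c≡0 a+c≡0))
        where
        lemma : ∀ {x y z} → x ≡ 0ℤ → y ≡ 0ℤ → z ≡ 0ℤ → tri x y z ≡ 𝟎
        lemma refl refl refl = refl

  _≟𝟎 : ∀ v → Dec (v ≡ 𝟎)
  ⟨ a , b , c ⟩ ≟𝟎 with a ℤ.≟ 0ℤ | b ℤ.≟ 0ℤ | c ℤ.≟ 0ℤ
  ... | yes refl | yes refl | yes refl = yes refl
  ... | no a≢0 | _ | _ = no λ { refl → a≢0 refl }
  ... | _ | no b≢0 | _ = no λ { refl → b≢0 refl }
  ... | _ | _ | no c≢0 = no λ { refl → c≢0 refl }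

  abstract
    -- Anisotropy of the norm form is a by-product of the same descent: for v nonzero, v or -v has
    -- positive norm.
    norm≡0⇒≡𝟎 : ∀ v → norm v ≡ 0ℤ → v ≡ 𝟎
    norm≡0⇒≡𝟎 v N≡0 with v ≟𝟎
    ... | yes v≡𝟎 = v≡𝟎
    ... | no v≢𝟎 with reached-nonzero v v≢𝟎
    ...   | inj₁ (0<N , _) = contradiction (sym N≡0) (ℤ.<⇒≢ 0<N)
    ...   | inj₂ (0<-N , _) = contradiction (sym (trans (norm-⊖ v) (cong -_ N≡0))) (ℤ.<⇒≢ 0<-N)

    norm≡1⇒squareClass : ∀ v → norm v ≡ 1ℤ → SquareClass v
    norm≡1⇒squareClass v N≡1 with reached-nonzero v (λ { refl → contradiction N≡1 λ () })
    ... | inj₁ (_ , class) = class N≡1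
    ... | inj₂ (0<-N , _) = contradiction (subst (0ℤ <_) (trans (norm-⊖ v) (cong -_ N≡1)) 0<-N) λ ()

-- A bound for the norm form on a box.

module CubicBound where
  open import Data.Integer using (ℤ; +_; -[1+_]; _+_; _*_; -_; _-_; 0ℤ; 1ℤ; _≤_)
  import Data.Integer.Properties as ℤ
  open import Data.Integer.Tactic.RingSolver using (solve)
  open import Data.List.Base using (_∷_; [])
  open import Data.Nat.Base as ℕ using (ℕ; suc)
  import Data.Nat.Properties as ℕ
  open import Data.Product using (_,_; _×_)
  open import Data.Sum using (_⊎_; inj₁; inj₂)
  open import Relation.Binary.PropositionalEquality
  open CubicRing
  open IntegerOrder

  record Within (L x : ℤ) : Set where
    constructor within
    field
      below : Nonneg (L - x)
      above : Nonneg (L + x)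

  module _ {L : ℤ} where
    cube-bound : ∀ {a b c} → Nonneg a → Nonneg b → Nonneg c →
      Nonneg (L - a) → Nonneg (L - b) → Nonneg (L - c) → Nonneg (L * L * L - a * b * c)
    cube-bound {a} {b} {c} A B C A′ B′ C′ = nonneg (0≤-by
      (A′ *⁺ (A′ +⁺ A) *⁺ (A′ +⁺ A) +⁺ A *⁺ B′ *⁺ (A′ +⁺ A) +⁺ A *⁺ B *⁺ C′)
      (solve (L ∷ a ∷ b ∷ c ∷ [])))

    private
      -- Once the signs are fixed, every monomial either helps or is at most its coefficient times
      -- L³. The worst case is `bound-ppn`, where the harmful coefficients 27 + 18 + 102 + 18 + 34 =
      -- 199 still stay below 216.
      bound-ppp : ∀ {x y z} → Nonneg x → Nonneg y → Nonneg z →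
        Nonneg (L - x) → Nonneg (L - y) → Nonneg (L - z) → Nonneg (L * L * L - 1ℤ) →
        0ℤ ≤ L * L * L * + 216 - (+ 27 * (x * x * x) + + 18 * (x * y * y) - x * y * z * + 102 - + 18 * (x * x * z)
          + + 34 * (y * y * y) + + 4 * (y * y * z) + + 44 * (z * z * z)) - 1ℤ
      bound-ppp {x} {y} {z} A B C A′ B′ C′ O = 0≤-by
        (cube-bound A A A A′ A′ A′ *⁺ nat 27
        +⁺ cube-bound A B B A′ B′ B′ *⁺ nat 18
        +⁺ A *⁺ B *⁺ C *⁺ nat 102
        +⁺ A *⁺ A *⁺ C *⁺ nat 18
        +⁺ cube-bound B B B B′ B′ B′ *⁺ nat 34
        +⁺ cube-bound B B C B′ B′ C′ *⁺ nat 4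
        +⁺ cube-bound C C C C′ C′ C′ *⁺ nat 44
        +⁺ O *⁺ nat 89
        +⁺ nat 88)
        (solve (L ∷ x ∷ y ∷ z ∷ []))

      bound-ppn : ∀ {x y z} → Nonneg x → Nonneg y → Nonneg (- z) →
        Nonneg (L - x) → Nonneg (L - y) → Nonneg (L - (- z)) → Nonneg (L * L * L - 1ℤ) →
        0ℤ ≤ L * L * L * + 216 - (+ 27 * (x * x * x) + + 18 * (x * y * y) - x * y * z * + 102 - + 18 * (x * x * z)
          + + 34 * (y * y * y) + + 4 * (y * y * z) + + 44 * (z * z * z)) - 1ℤ
      bound-ppn {x} {y} {z} A B C A′ B′ C′ O = 0≤-by
        (cube-bound A A A A′ A′ A′ *⁺ nat 27
        +⁺ cube-bound A B B A′ B′ B′ *⁺ nat 18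
        +⁺ cube-bound A B C A′ B′ C′ *⁺ nat 102
        +⁺ cube-bound A A C A′ A′ C′ *⁺ nat 18
        +⁺ cube-bound B B B B′ B′ B′ *⁺ nat 34
        +⁺ B *⁺ B *⁺ C *⁺ nat 4
        +⁺ C *⁺ C *⁺ C *⁺ nat 44
        +⁺ O *⁺ nat 17
        +⁺ nat 16)
        (solve (L ∷ x ∷ y ∷ z ∷ []))

      bound-pnp : ∀ {x y z} → Nonneg x → Nonneg (- y) → Nonneg z →
        Nonneg (L - x) → Nonneg (L - (- y)) → Nonneg (L - z) → Nonneg (L * L * L - 1ℤ) →
        0ℤ ≤ L * L * L * + 216 - (+ 27 * (x * x * x) + + 18 * (x * y * y) - x * y * z * + 102 - + 18 * (x * x * z)
          + + 34 * (y * y * y) + + 4 * (y * y * z) + + 44 * (z * z * z)) - 1ℤ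
      bound-pnp {x} {y} {z} A B C A′ B′ C′ O = 0≤-by
        (cube-bound A A A A′ A′ A′ *⁺ nat 27
        +⁺ cube-bound A B B A′ B′ B′ *⁺ nat 18
        +⁺ cube-bound A B C A′ B′ C′ *⁺ nat 102
        +⁺ A *⁺ A *⁺ C *⁺ nat 18
        +⁺ B *⁺ B *⁺ B *⁺ nat 34
        +⁺ cube-bound B B C B′ B′ C′ *⁺ nat 4
        +⁺ cube-bound C C C C′ C′ C′ *⁺ nat 44
        +⁺ O *⁺ nat 21
        +⁺ nat 20)
        (solve (L ∷ x ∷ y ∷ z ∷ []))

      bound-pnn : ∀ {x y z} → Nonneg x → Nonneg (- y) → Nonneg (- z) →
        Nonneg (L - x) → Nonneg (L - (- y)) → Nonneg (L - (- z)) → Nonneg (L * L * L - 1ℤ) →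
        0ℤ ≤ L * L * L * + 216 - (+ 27 * (x * x * x) + + 18 * (x * y * y) - x * y * z * + 102 - + 18 * (x * x * z)
          + + 34 * (y * y * y) + + 4 * (y * y * z) + + 44 * (z * z * z)) - 1ℤ
      bound-pnn {x} {y} {z} A B C A′ B′ C′ O = 0≤-by
        (cube-bound A A A A′ A′ A′ *⁺ nat 27
        +⁺ cube-bound A B B A′ B′ B′ *⁺ nat 18
        +⁺ A *⁺ B *⁺ C *⁺ nat 102
        +⁺ cube-bound A A C A′ A′ C′ *⁺ nat 18
        +⁺ B *⁺ B *⁺ B *⁺ nat 34
        +⁺ B *⁺ B *⁺ C *⁺ nat 4
        +⁺ C *⁺ C *⁺ C *⁺ nat 44
        +⁺ O *⁺ nat 153
        +⁺ nat 152)
        (solve (L ∷ x ∷ y ∷ z ∷ []))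

      bound-npp : ∀ {x y z} → Nonneg (- x) → Nonneg y → Nonneg z →
        Nonneg (L - (- x)) → Nonneg (L - y) → Nonneg (L - z) → Nonneg (L * L * L - 1ℤ) →
        0ℤ ≤ L * L * L * + 216 - (+ 27 * (x * x * x) + + 18 * (x * y * y) - x * y * z * + 102 - + 18 * (x * x * z)
          + + 34 * (y * y * y) + + 4 * (y * y * z) + + 44 * (z * z * z)) - 1ℤ
      bound-npp {x} {y} {z} A B C A′ B′ C′ O = 0≤-by
        (A *⁺ A *⁺ A *⁺ nat 27
        +⁺ A *⁺ B *⁺ B *⁺ nat 18
        +⁺ cube-bound A B C A′ B′ C′ *⁺ nat 102
        +⁺ A *⁺ A *⁺ C *⁺ nat 18
        +⁺ cube-bound B B B B′ B′ B′ *⁺ nat 34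
        +⁺ cube-bound B B C B′ B′ C′ *⁺ nat 4
        +⁺ cube-bound C C C C′ C′ C′ *⁺ nat 44
        +⁺ O *⁺ nat 32
        +⁺ nat 31)
        (solve (L ∷ x ∷ y ∷ z ∷ []))

      bound-npn : ∀ {x y z} → Nonneg (- x) → Nonneg y → Nonneg (- z) →
        Nonneg (L - (- x)) → Nonneg (L - y) → Nonneg (L - (- z)) → Nonneg (L * L * L - 1ℤ) →
        0ℤ ≤ L * L * L * + 216 - (+ 27 * (x * x * x) + + 18 * (x * y * y) - x * y * z * + 102 - + 18 * (x * x * z)
          + + 34 * (y * y * y) + + 4 * (y * y * z) + + 44 * (z * z * z)) - 1ℤ
      bound-npn {x} {y} {z} A B C A′ B′ C′ O = 0≤-by
        (A *⁺ A *⁺ A *⁺ nat 27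
        +⁺ A *⁺ B *⁺ B *⁺ nat 18
        +⁺ A *⁺ B *⁺ C *⁺ nat 102
        +⁺ cube-bound A A C A′ A′ C′ *⁺ nat 18
        +⁺ cube-bound B B B B′ B′ B′ *⁺ nat 34
        +⁺ B *⁺ B *⁺ C *⁺ nat 4
        +⁺ C *⁺ C *⁺ C *⁺ nat 44
        +⁺ O *⁺ nat 164
        +⁺ nat 163)
        (solve (L ∷ x ∷ y ∷ z ∷ []))

      bound-nnp : ∀ {x y z} → Nonneg (- x) → Nonneg (- y) → Nonneg z →
        Nonneg (L - (- x)) → Nonneg (L - (- y)) → Nonneg (L - z) → Nonneg (L * L * L - 1ℤ) →
        0ℤ ≤ L * L * L * + 216 - (+ 27 * (x * x * x) + + 18 * (x * y * y) - x * y * z * + 102 - + 18 * (x * x * z)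
          + + 34 * (y * y * y) + + 4 * (y * y * z) + + 44 * (z * z * z)) - 1ℤ
      bound-nnp {x} {y} {z} A B C A′ B′ C′ O = 0≤-by
        (A *⁺ A *⁺ A *⁺ nat 27
        +⁺ A *⁺ B *⁺ B *⁺ nat 18
        +⁺ A *⁺ B *⁺ C *⁺ nat 102
        +⁺ A *⁺ A *⁺ C *⁺ nat 18
        +⁺ B *⁺ B *⁺ B *⁺ nat 34
        +⁺ cube-bound B B C B′ B′ C′ *⁺ nat 4
        +⁺ cube-bound C C C C′ C′ C′ *⁺ nat 44
        +⁺ O *⁺ nat 168
        +⁺ nat 167)
        (solve (L ∷ x ∷ y ∷ z ∷ []))

      bound-nnn : ∀ {x y z} → Nonneg (- x) → Nonneg (- y) → Nonneg (- z) →
        Nonneg (L - (- x)) → Nonneg (L - (- y)) → Nonneg (L - (- z)) → Nonneg (L * L * L - 1ℤ) →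
        0ℤ ≤ L * L * L * + 216 - (+ 27 * (x * x * x) + + 18 * (x * y * y) - x * y * z * + 102 - + 18 * (x * x * z)
          + + 34 * (y * y * y) + + 4 * (y * y * z) + + 44 * (z * z * z)) - 1ℤ
      bound-nnn {x} {y} {z} A B C A′ B′ C′ O = 0≤-by
        (A *⁺ A *⁺ A *⁺ nat 27
        +⁺ A *⁺ B *⁺ B *⁺ nat 18
        +⁺ cube-bound A B C A′ B′ C′ *⁺ nat 102
        +⁺ cube-bound A A C A′ A′ C′ *⁺ nat 18
        +⁺ B *⁺ B *⁺ B *⁺ nat 34
        +⁺ B *⁺ B *⁺ C *⁺ nat 4
        +⁺ C *⁺ C *⁺ C *⁺ nat 44
        +⁺ O *⁺ nat 96
        +⁺ nat 95)
        (solve (L ∷ x ∷ y ∷ z ∷ []))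

    record Bounded (x y z : ℤ) : Set where
      constructor bounded
      field
        gap : 0ℤ ≤ L * L * L * + 216 - (+ 27 * (x * x * x) + + 18 * (x * y * y) - x * y * z * + 102 - + 18 * (x * x * z)
            + + 34 * (y * y * y) + + 4 * (y * y * z) + + 44 * (z * z * z)) - 1ℤ

    private
      split : ∀ x → Within L x → (Nonneg x × Nonneg (L - x)) ⊎ (Nonneg (- x) × Nonneg (L - - x))
      split (+ n) (within p _) = inj₁ (nat n , p)
      split -[1+ n ] (within _ q) = inj₂ (nat (suc n) , q)

      Signed : ℤ → Set
      Signed x = (Nonneg x × Nonneg (L - x)) ⊎ (Nonneg (- x) × Nonneg (L - - x))

      bound-signed : ∀ {x y z} → Nonneg (L * L * L - 1ℤ) → Signed x → Signed y → Signed z → Bounded x y z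
      bound-signed o (inj₁ (a , a′)) (inj₁ (b , b′)) (inj₁ (c , c′)) = bounded (bound-ppp a b c a′ b′ c′ o)
      bound-signed o (inj₁ (a , a′)) (inj₁ (b , b′)) (inj₂ (c , c′)) = bounded (bound-ppn a b c a′ b′ c′ o)
      bound-signed o (inj₁ (a , a′)) (inj₂ (b , b′)) (inj₁ (c , c′)) = bounded (bound-pnp a b c a′ b′ c′ o)
      bound-signed o (inj₁ (a , a′)) (inj₂ (b , b′)) (inj₂ (c , c′)) = bounded (bound-pnn a b c a′ b′ c′ o)
      bound-signed o (inj₂ (a , a′)) (inj₁ (b , b′)) (inj₁ (c , c′)) = bounded (bound-npp a b c a′ b′ c′ o)
      bound-signed o (inj₂ (a , a′)) (inj₁ (b , b′)) (inj₂ (c , c′)) = bounded (bound-npn a b c a′ b′ c′ o)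
      bound-signed o (inj₂ (a , a′)) (inj₂ (b , b′)) (inj₁ (c , c′)) = bounded (bound-nnp a b c a′ b′ c′ o)
      bound-signed o (inj₂ (a , a′)) (inj₂ (b , b′)) (inj₂ (c , c′)) = bounded (bound-nnn a b c a′ b′ c′ o)

    bound : ∀ x y z → Nonneg (L * L * L - 1ℤ) → Within L x → Within L y → Within L z → Bounded x y z
    bound x y z o wx wy wz = bound-signed o (split x wx) (split y wy) (split z wz)

-- Rounding to a lattice point of ℤ[τ].

module CubicDivision where
  open import Data.Integer using (ℤ; +_; -[1+_]; _+_; _*_; -_; _-_; 0ℤ; 1ℤ; _≤_; _<_; ∣_∣; +≤+; +<+)
  import Data.Integer.Properties as ℤ
  open import Data.Integer.DivMod using (_/ℕ_; _%ℕ_; a≡a%ℕn+[a/ℕn]*n; n%ℕd<d)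
  open IntegerIdentity
  open import Data.Nat.Base as ℕ using (ℕ; suc; zero)
  import Data.Nat.Properties as ℕ
  open import Data.Product using (_,_; _×_; ∃-syntax)
  open import Relation.Binary.PropositionalEquality
  open CubicRing
  open IntegerOrder

  open CubicBound

  private
    within-neg : ∀ {L} x → Within L x → Within L (- x)
    within-neg {L} x (within p q) = within (subst (λ i → Nonneg (L + i)) (sym (ℤ.neg-involutive x)) q) p

    scale : ∀ {L M x y} k → + k * L ≡ M → + k * x ≡ y → Within L x → Within M y
    scale {L} {x = x} k refl refl (within p q) = within (nonneg (0≤-by (nat k *⁺ p) (distrib- (+ k) L x))) (nonneg (0≤-by (nat k *⁺ q) (distrib+ (+ k) L x)))
      where
      distrib- : ∀ k L x → k * L - k * x ≡ k * (L - x)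
      distrib- = solve 3 (λ k L x → k :* L :- k :* x := k :* (L :- x))
      distrib+ : ∀ k L x → k * L + k * x ≡ k * (L + x)
      distrib+ = solve 3 (λ k L x → k :* L :+ k :* x := k :* (L :+ x))

  -- The Gram–Schmidt coordinates of a + bτ + cτ² for the trace form in the basis 1, τ² - τ - 1, -τ,
  -- with rational approximations of the shears.
  Reduced : ℤ → O → Set
  Reduced q ⟨ a , b , c ⟩ =
    Within (+ 9 * q) (+ 2 * (+ 9 * a + + 4 * b + + 10 * c)) × Within (+ 3 * q) (+ 2 * (+ 2 * c - b)) × Within q (+ 2 * (- b - c))

  private
    abstract
      -- Since 157464 = 216 · 9³, the bound on the box of size L = 9q reads norm v < q³.
      norm-in-coordinates : ∀ q a b c →
        let L = + 9 * q; x = + 2 * (+ 9 * a + + 4 * b + + 10 * c); y = + 3 * (+ 2 * (+ 2 * c - b)); z = + 9 * (+ 2 * (- b - c)) in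
        L * L * L * + 216 - (+ 27 * (x * x * x) + + 18 * (x * y * y) - x * y * z * + 102 - + 18 * (x * x * z)
          + + 34 * (y * y * y) + + 4 * (y * y * z) + + 44 * (z * z * z))
        ≡ (q * q * q - (a * a * a + + 2 * (a * a * b) + + 4 * (a * a * c) - + 2 * (b * b * b) - + 4 * (b * b * c)
            + + 4 * (c * c * c) + + 6 * (a * b * c) + + 8 * (a * c * c))) * + 157464
      norm-in-coordinates = solve 4 (λ q a b c → let L = con (+ 9) :* q; x = con (+ 2) :* (con (+ 9) :* a :+ con (+ 4) :* b :+ con (+ 10) :* c); y = con (+ 3) :* (con (+ 2) :* (con (+ 2) :* c :- b)); z = con (+ 9) :* (con (+ 2) :* (:- b :- c)) in
        L :* L :* L :* con (+ 216) :- (con (+ 27) :* (x :* x :* x) :+ con (+ 18) :* (x :* y :* y) :- x :* y :* z :* con (+ 102) :- con (+ 18) :* (x :* x :* z) :+ con (+ 34) :* (y :* y :* y) :+ con (+ 4) :* (y :* y :* z) :+ con (+ 44) :* (z :* z :* z))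
        := (q :* q :* q :- (a :* a :* a :+ con (+ 2) :* (a :* a :* b) :+ con (+ 4) :* (a :* a :* c) :- con (+ 2) :* (b :* b :* b) :- con (+ 4) :* (b :* b :* c) :+ con (+ 4) :* (c :* c :* c) :+ con (+ 6) :* (a :* b :* c) :+ con (+ 8) :* (a :* c :* c))) :* con (+ 157464))

      cube-nonneg : ∀ l → + 9 * (1ℤ + l) * (+ 9 * (1ℤ + l)) * (+ 9 * (1ℤ + l)) - 1ℤ ≡ (l * l * l + + 3 * (l * l) + + 3 * l) * + 729 + + 728
      cube-nonneg = solve 1 (λ l →
        con (+ 9) :* (con 1ℤ :+ l) :* (con (+ 9) :* (con 1ℤ :+ l)) :* (con (+ 9) :* (con 1ℤ :+ l)) :- con 1ℤ
        := (l :* l :* l :+ con (+ 3) :* (l :* l) :+ con (+ 3) :* l) :* con (+ 729) :+ con (+ 728))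

      triple : ∀ q → + 3 * (+ 3 * q) ≡ + 9 * q
      triple = solve 1 (λ q → con (+ 3) :* (con (+ 3) :* q) := con (+ 9) :* q)

    abstract
      neg-x : ∀ a b c → - (+ 2 * (+ 9 * a + + 4 * b + + 10 * c)) ≡ + 2 * (+ 9 * - a + + 4 * - b + + 10 * - c)
      neg-x = solve 3 (λ a b c →
        :- (con (+ 2) :* (con (+ 9) :* a :+ con (+ 4) :* b :+ con (+ 10) :* c))
        := con (+ 2) :* (con (+ 9) :* :- a :+ con (+ 4) :* :- b :+ con (+ 10) :* :- c))
      neg-y : ∀ b c → - (+ 2 * (+ 2 * c - b)) ≡ + 2 * (+ 2 * - c - - b)
      neg-y = solve 2 (λ b c → :- (con (+ 2) :* (con (+ 2) :* c :- b)) := con (+ 2) :* (con (+ 2) :* :- c :- :- b))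
      neg-z : ∀ b c → - (+ 2 * (- b - c)) ≡ + 2 * (- - b - - c)
      neg-z = solve 2 (λ b c → :- (con (+ 2) :* (:- b :- c)) := con (+ 2) :* (:- :- b :- :- c))

      upper-gap : ∀ n d r → d - + 2 * (n - d * r) ≡ + 2 * d + r * (+ 2 * d) - (+ 2 * n + d)
      upper-gap = solve 3 (λ n d r → d :- con (+ 2) :* (n :- d :* r) := con (+ 2) :* d :+ r :* (con (+ 2) :* d) :- (con (+ 2) :* n :+ d))
      lower-gap : ∀ n d r → d + + 2 * (n - d * r) ≡ + 2 * n + d - r * (+ 2 * d)
      lower-gap = solve 3 (λ n d r → d :+ con (+ 2) :* (n :- d :* r) := con (+ 2) :* n :+ d :- r :* (con (+ 2) :* d))
      cancel : ∀ x y z → x + y - (z + y) ≡ x - z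
      cancel = solve 3 (λ x y z → x :+ y :- (z :+ y) := x :- z)
      cancel′ : ∀ x y → x + y - y ≡ x
      cancel′ = solve 2 (λ x y → x :+ y :- y := x)

      x-eq : ∀ q a b c r t u → + 2 * (+ 9 * a + + 4 * (b - q * (u - t)) + + 10 * (c - q * t) - + 9 * q * r)
        ≡ + 2 * (+ 9 * (a + - (q * r)) + + 4 * (b + - (q * (u - t))) + + 10 * (c + - (q * t)))
      x-eq = solve 7 (λ q a b c r t u →
        con (+ 2) :* (con (+ 9) :* a :+ con (+ 4) :* (b :- q :* (u :- t)) :+ con (+ 10) :* (c :- q :* t) :- con (+ 9) :* q :* r)
        := con (+ 2) :* (con (+ 9) :* (a :+ :- (q :* r)) :+ con (+ 4) :* (b :+ :- (q :* (u :- t))) :+ con (+ 10) :* (c :+ :- (q :* t))))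
      y-eq : ∀ q b c t u → + 2 * (+ 3 * c - (b + c - q * u) - + 3 * q * t) ≡ + 2 * (+ 2 * (c + - (q * t)) - (b + - (q * (u - t))))
      y-eq = solve 5 (λ q b c t u →
        con (+ 2) :* (con (+ 3) :* c :- (b :+ c :- q :* u) :- con (+ 3) :* q :* t)
        := con (+ 2) :* (con (+ 2) :* (c :+ :- (q :* t)) :- (b :+ :- (q :* (u :- t)))))
      z-eq : ∀ q b c t u → - (+ 2 * (b + c - q * u)) ≡ + 2 * (- (b + - (q * (u - t))) - (c + - (q * t)))
      z-eq = solve 5 (λ q b c t u →
        :- (con (+ 2) :* (b :+ c :- q :* u)) := con (+ 2) :* (:- (b :+ :- (q :* (u :- t))) :- (c :+ :- (q :* t))))

    upper : ∀ n d r m → + 2 * n + d ≡ m + r * (+ 2 * d) → d - + 2 * (n - d * r) ≡ + 2 * d - m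
    upper n d r m eq = trans (upper-gap n d r) (trans (cong (λ i → + 2 * d + r * (+ 2 * d) - i) eq) (cancel (+ 2 * d) (r * (+ 2 * d)) m))

    lower : ∀ n d r m → + 2 * n + d ≡ m + r * (+ 2 * d) → d + + 2 * (n - d * r) ≡ m
    lower n d r m eq = trans (lower-gap n d r) (trans (cong (_- r * (+ 2 * d)) eq) (cancel′ m (r * (+ 2 * d))))

    cube-of-positive : ∀ q → 0ℤ < q → Nonneg (+ 9 * q * (+ 9 * q) * (+ 9 * q) - 1ℤ)
    cube-of-positive (+ suc l) _ = nonneg (0≤-by ((nat l *⁺ nat l *⁺ nat l +⁺ nat 3 *⁺ (nat l *⁺ nat l) +⁺ nat 3 *⁺ nat l) *⁺ nat 729 +⁺ nat 728) (cube-nonneg (+ l)))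
    cube-of-positive (+ zero) (+<+ ())

    norm-reduced : ∀ q v → 0ℤ < q → Reduced q v → norm v < q * q * q
    norm-reduced q v@(⟨ a , b , c ⟩) 0<q (wx , wy , wz) = gap⇒< (<⇒gap′ (ℤ.*-cancelʳ-<-nonNeg {0ℤ} {q * q * q - norm v} (+ 157464) (gap⇒< {0ℤ} {(q * q * q - norm v) * + 157464} 0≤gap)))
      where
      0≤gap : 0ℤ ≤ (q * q * q - norm v) * + 157464 - 0ℤ - 1ℤ
      0≤gap = subst (0ℤ ≤_) (cong (_- 1ℤ) (trans (norm-in-coordinates q a b c) (sym (ℤ.+-identityʳ _))))
        (Bounded.gap (bound _ _ _ (cube-of-positive q 0<q) wx (scale 3 (triple q) refl wy) (scale 9 refl refl wz)))
      <⇒gap′ : 0ℤ < q * q * q - norm v → 0ℤ ≤ q * q * q - norm v - 1ℤ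
      <⇒gap′ p = subst (0ℤ ≤_) (cong (_- 1ℤ) (ℤ.+-identityʳ (q * q * q - norm v))) (<⇒gap p)

    reduced-neg : ∀ q v → Reduced q v → Reduced q (⊖ v)
    reduced-neg q ⟨ a , b , c ⟩ (wx , wy , wz) =
      subst (Within _) (neg-x a b c) (within-neg _ wx) , subst (Within _) (neg-y b c) (within-neg _ wy) , subst (Within _) (neg-z b c) (within-neg _ wz)

  norm-reduced-abs : ∀ q v → 0ℤ < q → Reduced q v → ∣ norm v ∣ ℕ.< ∣ q * q * q ∣
  norm-reduced-abs q v 0<q red = abs-< _ _ (norm-reduced q v 0<q red)
    (subst (_< q * q * q) (norm-⊖ v) (norm-reduced q (⊖ v) 0<q (reduced-neg q v red)))
    where
    abs-< : ∀ i j → i < j → - i < j → ∣ i ∣ ℕ.< ∣ j ∣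
    abs-< (+ m) (+ n) (+<+ m<n) _ = m<n
    abs-< -[1+ m ] (+ n) _ (+<+ m<n) = m<n

  private
    nearest : ∀ n d → 0ℤ < d → ∃[ r ] Within d (+ 2 * (n - d * r))
    nearest n d@(+ suc k) _ = r , within (nonneg (0≤-by (nonneg (ℤ.i≤j⇒0≤j-i (+≤+ (ℕ.<⇒≤ (n%ℕd<d m D))))) (upper n d r rem m≡)))
                                          (nonneg (0≤-by (nat (m %ℕ D)) (lower n d r rem m≡)))
      where
      D = 2 ℕ.* suc k
      -- The quotient r is the floor of n/d + 1/2, computed as the integer quotient of 2n + d by 2d.
      m = + 2 * n + d
      r = m /ℕ D
      rem = + (m %ℕ D)
      m≡ : + 2 * n + d ≡ rem + r * (+ 2 * d)
      m≡ = a≡a%ℕn+[a/ℕn]*n m D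
    nearest n (+ zero) (+<+ ())

    0<-* : ∀ k q → 0ℤ < q → 0ℤ < + suc k * q
    0<-* k (+ suc n) _ = +<+ (ℕ.s≤s ℕ.z≤n)
    0<-* k (+ zero) (+<+ ())

  _⊙_ : ℤ → O → O
  q ⊙ ⟨ a , b , c ⟩ = ⟨ q * a , q * b , q * c ⟩

  -- The three conditions are triangular in the basis 1, τ² - τ - 1, -τ. So the coordinates are
  -- rounded one after another, beginning with b + c, and each rounding leaves the conditions
  -- already met unchanged.
  reduce : ∀ q v → 0ℤ < q → ∃[ ρ ] Reduced q (v ⊕ ⊖ (q ⊙ ρ))
  reduce q ⟨ a , b , c ⟩ 0<q with nearest (b + c) q 0<q
  ... | u , wu with nearest (+ 3 * c - (b + c - q * u)) (+ 3 * q) (0<-* 2 q 0<q)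
  ...   | t , wt with nearest (+ 9 * a + + 4 * (b - q * (u - t)) + + 10 * (c - q * t)) (+ 9 * q) (0<-* 8 q 0<q)
  ...     | r , wr = ⟨ r , u - t , t ⟩ ,
            subst (Within _) (x-eq q a b c r t u) wr ,
            subst (Within _) (y-eq q b c t u) wt ,
            subst (Within _) (z-eq q b c t u) (within-neg _ wu)

-- The ring ℤ[τ] is norm-Euclidean.

module CubicEuclid where
  open import Algebra.Bundles using (module CommutativeRing)
  import Algebra.Properties.Ring
  open import Data.Integer using (ℤ; +_; -[1+_]; _+_; _*_; -_; _-_; 0ℤ; _<_; ∣_∣; +<+)
  import Data.Integer.Properties as ℤ
  open IntegerIdentity
  open import Data.Nat.Base as ℕ using (ℕ)
  import Data.Nat.Properties as ℕ
  open import Data.Product using (_,_; ∃-syntax)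
  open import Relation.Binary.PropositionalEquality
  open CubicRing
  open IntegerOrder
  open CubicBound
  open CubicDivision
  open Units

  embed : ℤ → O
  embed n = ⟨ n , 0ℤ , 0ℤ ⟩

  -- The product of the two other conjugates, which lies in ℤ[τ] again.
  adj : O → O
  adj ⟨ a , b , c ⟩ =
    ⟨ a * a + + 2 * (a * b) + + 4 * (a * c) + + 2 * (b * c) + + 4 * (c * c)
    , - (a * b) - + 2 * (b * b) - + 4 * (b * c) - + 2 * (c * c)
    , b * b + + 2 * (b * c) - a * c ⟩

  private
    abstract
      adj-₀ : ∀ a b c → let x = a * a + + 2 * (a * b) + + 4 * (a * c) + + 2 * (b * c) + + 4 * (c * c)
                            y = - (a * b) - + 2 * (b * b) - + 4 * (b * c) - + 2 * (c * c); z = b * b + + 2 * (b * c) - a * c in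
        a * x - + 2 * (b * z + c * y) - + 4 * (c * z)
        ≡ a * a * a + + 2 * (a * a * b) + + 4 * (a * a * c) - + 2 * (b * b * b) - + 4 * (b * b * c)
          + + 4 * (c * c * c) + + 6 * (a * b * c) + + 8 * (a * c * c)
      adj-₀ = solve 3 (λ a b c → let x = a :* a :+ con (+ 2) :* (a :* b) :+ con (+ 4) :* (a :* c) :+ con (+ 2) :* (b :* c) :+ con (+ 4) :* (c :* c); y = :- (a :* b) :- con (+ 2) :* (b :* b) :- con (+ 4) :* (b :* c) :- con (+ 2) :* (c :* c); z = b :* b :+ con (+ 2) :* (b :* c) :- a :* c in
        a :* x :- con (+ 2) :* (b :* z :+ c :* y) :- con (+ 4) :* (c :* z)
        := a :* a :* a :+ con (+ 2) :* (a :* a :* b) :+ con (+ 4) :* (a :* a :* c) :- con (+ 2) :* (b :* b :* b) :- con (+ 4) :* (b :* b :* c) :+ con (+ 4) :* (c :* c :* c) :+ con (+ 6) :* (a :* b :* c) :+ con (+ 8) :* (a :* c :* c))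
      adj-₁ : ∀ a b c → let x = a * a + + 2 * (a * b) + + 4 * (a * c) + + 2 * (b * c) + + 4 * (c * c)
                            y = - (a * b) - + 2 * (b * b) - + 4 * (b * c) - + 2 * (c * c); z = b * b + + 2 * (b * c) - a * c in
        a * y + b * x - + 2 * (c * z) ≡ 0ℤ
      adj-₁ = solve 3 (λ a b c → let x = a :* a :+ con (+ 2) :* (a :* b) :+ con (+ 4) :* (a :* c) :+ con (+ 2) :* (b :* c) :+ con (+ 4) :* (c :* c); y = :- (a :* b) :- con (+ 2) :* (b :* b) :- con (+ 4) :* (b :* c) :- con (+ 2) :* (c :* c); z = b :* b :+ con (+ 2) :* (b :* c) :- a :* c in
        a :* y :+ b :* x :- con (+ 2) :* (c :* z) := con 0ℤ)
      adj-₂ : ∀ a b c → let x = a * a + + 2 * (a * b) + + 4 * (a * c) + + 2 * (b * c) + + 4 * (c * c)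
                            y = - (a * b) - + 2 * (b * b) - + 4 * (b * c) - + 2 * (c * c); z = b * b + + 2 * (b * c) - a * c in
        a * z + c * x + b * y + + 2 * (b * z + c * y) + + 4 * (c * z) ≡ 0ℤ
      adj-₂ = solve 3 (λ a b c → let x = a :* a :+ con (+ 2) :* (a :* b) :+ con (+ 4) :* (a :* c) :+ con (+ 2) :* (b :* c) :+ con (+ 4) :* (c :* c); y = :- (a :* b) :- con (+ 2) :* (b :* b) :- con (+ 4) :* (b :* c) :- con (+ 2) :* (c :* c); z = b :* b :+ con (+ 2) :* (b :* c) :- a :* c in
        a :* z :+ c :* x :+ b :* y :+ con (+ 2) :* (b :* z :+ c :* y) :+ con (+ 4) :* (c :* z) := con 0ℤ)

      embed⊗-₀ : ∀ n a b c → n * a - + 2 * (0ℤ * c + 0ℤ * b) - + 4 * (0ℤ * c) ≡ n * a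
      embed⊗-₀ = solve 4 (λ n a b c → n :* a :- con (+ 2) :* (con 0ℤ :* c :+ con 0ℤ :* b) :- con (+ 4) :* (con 0ℤ :* c) := n :* a)
      embed⊗-₁ : ∀ n a b c → n * b + 0ℤ * a - + 2 * (0ℤ * c) ≡ n * b
      embed⊗-₁ = solve 4 (λ n a b c → n :* b :+ con 0ℤ :* a :- con (+ 2) :* (con 0ℤ :* c) := n :* b)
      embed⊗-₂ : ∀ n a b c → n * c + 0ℤ * a + 0ℤ * b + + 2 * (0ℤ * c + 0ℤ * b) + + 4 * (0ℤ * c) ≡ n * c
      embed⊗-₂ = solve 4 (λ n a b c →
        n :* c :+ con 0ℤ :* a :+ con 0ℤ :* b :+ con (+ 2) :* (con 0ℤ :* c :+ con 0ℤ :* b) :+ con (+ 4) :* (con 0ℤ :* c)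
        := n :* c)

      norm-embed-eq : ∀ n → n * n * n + + 2 * (n * n * 0ℤ) + + 4 * (n * n * 0ℤ) - 0ℤ - 0ℤ + 0ℤ + + 6 * (n * 0ℤ * 0ℤ) + + 8 * (n * 0ℤ * 0ℤ) ≡ n * n * n
      norm-embed-eq = solve 1 (λ n →
        n :* n :* n :+ con (+ 2) :* (n :* n :* con 0ℤ) :+ con (+ 4) :* (n :* n :* con 0ℤ) :- con 0ℤ :- con 0ℤ :+ con 0ℤ :+ con (+ 6) :* (n :* con 0ℤ :* con 0ℤ) :+ con (+ 8) :* (n :* con 0ℤ :* con 0ℤ)
        := n :* n :* n)

  ⊗-adj : ∀ v → v ⊗ adj v ≡ embed (norm v)
  ⊗-adj ⟨ a , b , c ⟩ = O-ext (adj-₀ a b c) (adj-₁ a b c) (adj-₂ a b c)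

  embed⊗ : ∀ n v → embed n ⊗ v ≡ n ⊙ v
  embed⊗ n ⟨ a , b , c ⟩ = O-ext (embed⊗-₀ n a b c) (embed⊗-₁ n a b c) (embed⊗-₂ n a b c)

  norm-embed : ∀ n → norm (embed n) ≡ n * n * n
  norm-embed = norm-embed-eq

  private
    module R = CommutativeRing O-commutativeRing
    open Algebra.Properties.Ring R.ring using (-‿distribˡ-*)

    ⊙-sign : ∀ n ρ → ∃[ ρ′ ] (+ ∣ n ∣) ⊙ ρ ≡ embed n ⊗ ρ′
    ⊙-sign (+ n) ρ = ρ , sym (embed⊗ (+ n) ρ)
    ⊙-sign n@(-[1+ _ ]) ρ@(⟨ a , b , c ⟩) = ⊖ ρ , sym (trans (embed⊗ n (⊖ ρ)) (O-ext (neg a) (neg b) (neg c)))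
      where
      neg : ∀ a → n * - a ≡ - n * a
      neg a = trans (sym (ℤ.neg-distribʳ-* n a)) (ℤ.neg-distribˡ-* n a)

    factor : ∀ x y ȳ ρ → x ⊗ ȳ ⊕ ⊖ ((y ⊗ ȳ) ⊗ ρ) ≡ (x ⊕ ⊖ (ρ ⊗ y)) ⊗ ȳ
    factor x y ȳ ρ = sym (trans (R.distribʳ ȳ x (⊖ (ρ ⊗ y)))
      (cong (x ⊗ ȳ ⊕_) (trans (sym (-‿distribˡ-* (ρ ⊗ y) ȳ))
        (cong ⊖_ (trans (R.*-assoc ρ y ȳ) (R.*-comm ρ (y ⊗ ȳ)))))))

    0<∣_∣ : ∀ n → ∣ n ∣ ≢ 0 → 0ℤ < + ∣ n ∣
    0<∣ n ∣ ∣n∣≢0 = +<+ (ℕ.n≢0⇒n>0 ∣n∣≢0)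

  N : O → ℕ
  N v = ∣ norm v ∣

  N-⊗ : ∀ x y → N (x ⊗ y) ≡ N x ℕ.* N y
  N-⊗ x y = trans (cong ∣_∣ (norm-⊗ x y)) (ℤ.abs-* (norm x) (norm y))

  -- The quotient x/y is x · adj y divided by the integer norm y. Reducing x · adj y modulo that
  -- integer leaves z · adj y with norm below |norm y|³ = |norm y| · |norm (adj y)| in absolute
  -- value, and the factor belonging to adj y cancels.
  divide : ∀ x y → N y ≢ 0 → ∃[ ρ ] N (x ⊕ ⊖ (ρ ⊗ y)) ℕ.< N y
  divide x y Ny≢0 with reduce (+ N y) (x ⊗ adj y) (0<∣ norm y ∣ Ny≢0)
  ... | ρ , red with ⊙-sign (norm y) ρ
  ...   | ρ′ , eq = ρ′ , ℕ.*-cancelʳ-< _ _ _ (subst₂ ℕ._<_ lhs rhs (norm-reduced-abs (+ N y) _ (0<∣ norm y ∣ Ny≢0) red))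
    where
    open ≡-Reasoning
    n = norm y
    z = x ⊕ ⊖ (ρ′ ⊗ y)
    lhs : N (x ⊗ adj y ⊕ ⊖ ((+ N y) ⊙ ρ)) ≡ N z ℕ.* N (adj y)
    lhs = trans (cong N (begin
      x ⊗ adj y ⊕ ⊖ ((+ N y) ⊙ ρ)         ≡⟨ cong (λ i → x ⊗ adj y ⊕ ⊖ i) eq ⟩
      x ⊗ adj y ⊕ ⊖ (embed n ⊗ ρ′)        ≡⟨ cong (λ i → x ⊗ adj y ⊕ ⊖ (i ⊗ ρ′)) (⊗-adj y) ⟨
      x ⊗ adj y ⊕ ⊖ ((y ⊗ adj y) ⊗ ρ′)    ≡⟨ factor x y (adj y) ρ′ ⟩
      z ⊗ adj y                           ∎)) (N-⊗ z (adj y))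
    cube : ∀ i j k → ∣ i * j * k ∣ ≡ ∣ i ∣ ℕ.* ∣ j ∣ ℕ.* ∣ k ∣
    cube i j k = trans (ℤ.abs-* (i * j) k) (cong (ℕ._* ∣ k ∣) (ℤ.abs-* i j))
    rhs : ∣ (+ N y) * (+ N y) * (+ N y) ∣ ≡ N y ℕ.* N (adj y)
    rhs = begin
      ∣ (+ N y) * (+ N y) * (+ N y) ∣   ≡⟨ cube (+ N y) (+ N y) (+ N y) ⟩
      N y ℕ.* N y ℕ.* N y               ≡⟨ cube n n n ⟨
      ∣ n * n * n ∣                     ≡⟨ cong ∣_∣ (norm-embed n) ⟨
      N (embed n)                       ≡⟨ cong N (⊗-adj y) ⟨
      N (y ⊗ adj y)                     ≡⟨ N-⊗ y (adj y) ⟩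
      N y ℕ.* N (adj y)                 ∎

  open EuclideanDomain.EuclideanNorm O-commutativeRing N (cong N) N-⊗ (λ v e → norm≡0⇒≡𝟎 v (ℤ.∣i∣≡0⇒i≡0 e)) divide public

-- Elements of square norm are squares up to units.

module CubicSquares where
  open import Algebra.Bundles using (module CommutativeRing)
  import Algebra.Solver.Ring.NaturalCoefficients.Default
  open import Data.Integer using (ℤ; +_; _+_; _*_; -_; _-_; 0ℤ; 1ℤ; -1ℤ; ∣_∣; _≤_)
  import Data.Integer.Properties as ℤ
  open IntegerIdentity
  open import Data.Nat.Base as ℕ using (ℕ; suc)
  import Data.Nat.Properties as ℕ
  open import Data.Product using (_,_; ∃-syntax)
  open import Data.Sum using (inj₁; inj₂; [_,_]′)
  open import Relation.Binary.PropositionalEquality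
  open import Relation.Nullary using (contradiction)
  open CubicRing
  open IntegerOrder
  open IntegerCoprime using (Coprime; coprime-*ˡ; coprime-*ʳ; coprime-sym; gauss; bézout; unit)
  open Units
  open CubicEuclid
  open LinearCombination ℤ.+-*-isCommutativeRing

  private
    module R = CommutativeRing O-commutativeRing
    module S = Algebra.Solver.Ring.NaturalCoefficients.Default R.commutativeSemiring

  private
    square-divides-11 : ∀ k g → k ℕ.* (g ℕ.* g) ≡ 11 → g ≡ 1
    square-divides-11 k 0 eq = contradiction (trans (sym (ℕ.*-zeroʳ k)) eq) λ ()
    square-divides-11 k 1 _ = refl
    square-divides-11 0 2 ()
    square-divides-11 1 2 ()
    square-divides-11 2 2 ()
    square-divides-11 (suc (suc (suc k))) 2 ()
    square-divides-11 0 3 ()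
    square-divides-11 1 3 ()
    square-divides-11 (suc (suc k)) 3 ()
    square-divides-11 (suc k) (suc (suc (suc (suc g)))) eq =
      contradiction (ℕ.≤-trans (ℕ.≤-trans sixteen (ℕ.m≤m+n _ (k ℕ.* _))) (ℕ.≤-reflexive eq)) λ { (ℕ.s≤s (ℕ.s≤s (ℕ.s≤s (ℕ.s≤s (ℕ.s≤s (ℕ.s≤s (ℕ.s≤s (ℕ.s≤s (ℕ.s≤s (ℕ.s≤s (ℕ.s≤s ()))))))))))) }
      where
      sixteen : 16 ℕ.≤ (4 ℕ.+ g) ℕ.* (4 ℕ.+ g)
      sixteen = ℕ.*-mono-≤ {4} {4 ℕ.+ g} {4} {4 ℕ.+ g} (ℕ.m≤m+n 4 g) (ℕ.m≤m+n 4 g)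

    coprime-⁶ : ∀ {p q} → Coprime p q → Coprime (p * p * p * (p * p * p)) (q * q * q * (q * q * q))
    coprime-⁶ c = coprime-sym (power (coprime-sym (power c)))
      where
      power : ∀ {p q} → Coprime p q → Coprime (p * p * p * (p * p * p)) q
      power c = coprime-*ˡ (coprime-*ˡ (coprime-*ˡ c c) c) (coprime-*ˡ (coprime-*ˡ c c) c)

    abstract
      pull : ∀ A B y d g → A * (y * g * (y * g)) + B * (d * g * (d * g)) ≡ (A * (y * y) + B * (d * d)) * (g * g)
      pull = solve 5 (λ A B y d g →
        A :* (y :* g :* (y :* g)) :+ B :* (d :* g :* (d :* g)) := (A :* (y :* y) :+ B :* (d :* d)) :* (g :* g))

      combination : ∀ {s t k k″ P Q G} c → s * P + t * Q ≡ 1ℤ → P * c ≡ k * G → Q * c ≡ k″ * G → c ≡ (s * k + t * k″) * G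
      combination {s} {t} {k} {k″} {P} {Q} {G} c e₁ e₂ e₃ = combine₃ (- c) s t e₁ e₂ e₃ (solve 8 (λ s t k k″ P Q G c →
          c :- (s :* k :+ t :* k″) :* G
          := :- c :* (s :* P :+ t :* Q :- con 1ℤ) :+ s :* (P :* c :- k :* G) :+ t :* (Q :* c :- k″ :* G)) s t k k″ P Q G c)

      coprime-256 : ∀ g → Coprime g (+ 2) → Coprime (g * g) (+ 256)
      coprime-256 g g⊥2 = coprime-*ˡ {g} {g} {+ 256} g⊥256 g⊥256
        where
        g⊥4 : Coprime g (+ 4)
        g⊥4 = coprime-*ʳ {g} {+ 2} {+ 2} g⊥2 g⊥2
        g⊥16 : Coprime g (+ 16)
        g⊥16 = coprime-*ʳ {g} {+ 4} {+ 4} g⊥4 g⊥4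
        g⊥256 : Coprime g (+ 256)
        g⊥256 = coprime-*ʳ {g} {+ 16} {+ 16} g⊥16 g⊥16

      -- Here 2816 = 11 · 256 and g is odd, so g² divides both 11P and 11Q; coprimality of P and Q
      -- leaves 11.
      square-divides : ∀ g {P Q k k′} → Coprime P Q → Coprime g (+ 2) → P * + 11 ≡ k * (g * g) → Q * + 2816 ≡ k′ * (g * g) →
        ∃[ u ] + 11 ≡ u * (g * g)
      square-divides g {P} {Q} {k} {k′} (s , t , e) g⊥2 e₁ e₂ =
        let k″ , e₃ = gauss {g * g} {+ 256} {Q * + 11} k′ (coprime-256 g g⊥2) (trans regroup e₂)
        in s * k + t * k″ , combination {s} {t} {k} {k″} {P} {Q} (+ 11) e e₁ e₃
        where
        regroup : + 256 * (Q * + 11) ≡ Q * + 2816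
        regroup = trans (ℤ.*-comm (+ 256) (Q * + 11)) (ℤ.*-assoc Q (+ 11) (+ 256))

  -- A common divisor g of D and Y is odd, and the two identities show g² ∣ 11.
  coprime-discriminant : ∀ D Y p q A B A′ B′ → Coprime p q → Coprime Y (+ 2) →
    A * (Y * Y) + B * (D * D) ≡ p * p * p * (p * p * p) * + 11 →
    A′ * (Y * Y) + B′ * (D * D) ≡ q * q * q * (q * q * q) * + 2816 →
    Coprime D Y
  coprime-discriminant D Y p q A B A′ B′ p⊥q (a , b , aY+2b≡1) eq eq′ with bézout D Y
  ... | g , (d , D≡) , (y , Y≡) , s , t , sD+tY≡g = s , t , trans sD+tY≡g (cong +_ (g≡1 (square-divides (+ g) {P} {Q} {A * (y * y) + B * (d * d)} {A′ * (y * y) + B′ * (d * d)} (coprime-⁶ p⊥q) g⊥2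
           (trans (sym eq) (multiple A B)) (trans (sym eq′) (multiple A′ B′)))))
    where
    P = p * p * p * (p * p * p)
    Q = q * q * q * (q * q * q)
    g⊥2 : Coprime (+ g) (+ 2)
    g⊥2 = a * y , b , trans (cong (_+ b * + 2) (trans (ℤ.*-assoc a y (+ g)) (cong (a *_) (sym Y≡)))) aY+2b≡1
    multiple : ∀ A B → A * (Y * Y) + B * (D * D) ≡ (A * (y * y) + B * (d * d)) * (+ g * + g)
    multiple A B = trans (cong₂ (λ Y D → A * (Y * Y) + B * (D * D)) Y≡ D≡) (pull A B y d (+ g))
    g≡1 : ∃[ u ] + 11 ≡ u * (+ g * + g) → g ≡ 1
    g≡1 (u , e) = square-divides-11 ∣ u ∣ g
      (trans (cong (∣ u ∣ ℕ.*_) (sym (ℤ.abs-* (+ g) (+ g)))) (trans (sym (ℤ.abs-* u (+ g * + g))) (cong ∣_∣ (sym e))))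

  sum-of-squares≡0 : ∀ x y → x * x + y * y ≡ 0ℤ → x ≡ 0ℤ
  sum-of-squares≡0 x y eq = [ (λ e → e) , (λ e → e) ]′ (ℤ.i*j≡0⇒i≡0∨j≡0 x (ℤ.≤-antisym xx≤0 (0≤-square x)))
    where
    cancel : ∀ a b → a ≡ a + b - b
    cancel = solve 2 (λ a b → a := a :+ b :- b)
    xx≤0 : x * x ≤ 0ℤ
    xx≤0 = subst (_≤ 0ℤ) (sym (trans (cancel (x * x) (y * y)) (trans (cong (_- y * y) eq) (ℤ.+-identityˡ (- (y * y))))))
      (ℤ.neg-mono-≤ (0≤-square y))

  abstract
    square-product : ∀ κ ξ → κ ⊗ κ ⊗ (ξ ⊗ ξ) ≡ κ ⊗ ξ ⊗ (κ ⊗ ξ)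
    square-product = S.solve 2 (λ κ ξ → κ S.:* κ S.:* (ξ S.:* ξ) S.:= κ S.:* ξ S.:* (κ S.:* ξ)) refl

  private
    abstract
      combine-δ : ∀ δ s t l ξ η → δ ⊗ (s ⊗ (η ⊗ η ⊕ l ⊗ (ξ ⊗ ξ)) ⊕ t ⊗ (ξ ⊗ η))
        ≡ s ⊗ (δ ⊗ (η ⊗ η) ⊕ l ⊗ (δ ⊗ (ξ ⊗ ξ))) ⊕ t ⊗ (δ ⊗ (ξ ⊗ η))
      combine-δ = S.solve 6 (λ δ s t l ξ η → δ S.:* (s S.:* (η S.:* η S.:+ l S.:* (ξ S.:* ξ)) S.:+ t S.:* (ξ S.:* η))
        S.:= s S.:* (δ S.:* (η S.:* η) S.:+ l S.:* (δ S.:* (ξ S.:* ξ))) S.:+ t S.:* (δ S.:* (ξ S.:* η))) refl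

      scaled-square-product : ∀ e κ ξ → e ⊗ (κ ⊗ κ) ⊗ (ξ ⊗ ξ) ≡ e ⊗ (κ ⊗ ξ ⊗ (κ ⊗ ξ))
      scaled-square-product = S.solve 3 (λ e κ ξ → e S.:* (κ S.:* κ) S.:* (ξ S.:* ξ) S.:= e S.:* (κ S.:* ξ S.:* (κ S.:* ξ))) refl

    scale-class : ∀ {α} δ ξ → α ≡ δ ⊗ (ξ ⊗ ξ) → SquareClass δ → SquareClass α
    scale-class δ ξ α≡ (κ , inj₁ δ≡) = κ ⊗ ξ , inj₁ (trans α≡ (trans (cong (_⊗ (ξ ⊗ ξ)) δ≡) (square-product κ ξ)))
    scale-class δ ξ α≡ (κ , inj₂ δ≡) = κ ⊗ ξ , inj₂ (trans α≡ (trans (cong (_⊗ (ξ ⊗ ξ)) δ≡) (scaled-square-product ε κ ξ)))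

    embed-combination : ∀ s t D Y → s * D + t * Y ≡ 1ℤ → embed s ⊗ embed D ⊕ embed t ⊗ embed Y ≡ 𝟏
    embed-combination s t D Y eq = trans (cong₂ _⊕_ (embed⊗ s (embed D)) (embed⊗ t (embed Y)))
      (O-ext eq (cong₂ _+_ (ℤ.*-zeroʳ s) (ℤ.*-zeroʳ t)) (cong₂ _+_ (ℤ.*-zeroʳ s) (ℤ.*-zeroʳ t)))

    -- The value d = -1 would make the sum x² + Y² vanish.
    positive-unit : ∀ u d x Y → u * d ≡ 1ℤ → d * (x * x) ≡ Y * Y → Y ≢ 0ℤ → d ≡ 1ℤ
    positive-unit u d x Y ud≡1 dxx≡YY Y≢0 with unit u d ud≡1
    ... | inj₁ d≡1 = d≡1
    ... | inj₂ refl = contradiction (sum-of-squares≡0 Y x (begin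
      Y * Y + x * x           ≡⟨ cong (_+ x * x) (sym dxx≡YY) ⟩
      -1ℤ * (x * x) + x * x   ≡⟨ cong (_+ x * x) (ℤ.-1*i≡-i (x * x)) ⟩
      - (x * x) + x * x       ≡⟨ ℤ.+-inverseˡ (x * x) ⟩
      0ℤ                      ∎)) Y≢0
      where open ≡-Reasoning

    -- Both D = β + λ′α and Y are multiples of δ, so the Bézout identity sD + tY = 1 displays an
    -- inverse of δ.
    content-unit : ∀ {α β} λ′ Y D δ ξ η s t → α ≡ δ ⊗ (ξ ⊗ ξ) → β ≡ δ ⊗ (η ⊗ η) → embed Y ≡ δ ⊗ (ξ ⊗ η) →
      β ⊕ λ′ ⊗ α ≡ embed D → s * D + t * Y ≡ 1ℤ → ∃[ κ ] δ ⊗ κ ≡ 𝟏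
    content-unit {α} {β} λ′ Y D δ ξ η s t α≡ β≡ Y≡ β+λα≡D sD+tY≡1 =
      embed s ⊗ (η ⊗ η ⊕ λ′ ⊗ (ξ ⊗ ξ)) ⊕ embed t ⊗ (ξ ⊗ η) ,
      trans (combine-δ δ (embed s) (embed t) λ′ ξ η)
        (trans (cong₂ (λ D Y → embed s ⊗ D ⊕ embed t ⊗ Y)
          (trans (cong₂ (λ b a → b ⊕ λ′ ⊗ a) (sym β≡) (sym α≡)) β+λα≡D) (sym Y≡))
        (embed-combination s t D Y sD+tY≡1))

  -- α and β have the common factor δ, which divides the coprime integers D and Y, so it is a unit.
  square-class : ∀ α β λ′ Y D → α ⊗ β ≡ embed Y ⊗ embed Y → norm α ≡ Y * Y → Y ≢ 0ℤ →
    β ⊕ λ′ ⊗ α ≡ embed D → Coprime D Y → SquareClass α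
  square-class α β λ′ Y D αβ≡YY Nα≡YY Y≢0 β+λα≡D (s , t , sD+tY≡1) =
    let δ , ξ , η , α≡ , β≡ , Y≡ = rankOne α β (embed Y) αβ≡YY
        κ , δκ≡1 = content-unit λ′ Y D δ ξ η s t α≡ β≡ Y≡ β+λα≡D sD+tY≡1
        Nκ*Nδ≡1 = trans (ℤ.*-comm (norm κ) (norm δ)) (trans (sym (norm-⊗ δ κ)) (cong norm δκ≡1))
        Nδ*sq = trans (cong (norm δ *_) (sym (norm-⊗ ξ ξ))) (trans (sym (norm-⊗ δ (ξ ⊗ ξ))) (trans (cong norm (sym α≡)) Nα≡YY))
    in scale-class δ ξ α≡ (norm≡1⇒squareClass δ (positive-unit (norm κ) (norm δ) (norm ξ) Y Nκ*Nδ≡1 Nδ*sq Y≢0))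

-- The elements n + mτ² attached to points of the conductor 11 curve.

module EllipticSquares where
  open import Data.Integer using (ℤ; +_; _+_; _*_; -_; _-_; 0ℤ; 1ℤ)
  import Data.Integer.Properties as ℤ
  open IntegerIdentity
  open import Data.Product using (_,_; ∃-syntax)
  open import Data.Sum using (inj₁; inj₂)
  open import Relation.Binary.PropositionalEquality
  open import Relation.Nullary using (contradiction)
  open CubicRing
  open IntegerCoprime using (Coprime; coprime-*ˡ; coprime-sym; unit)
  open Units
  open CubicEuclid
  open CubicSquares
  open LinearCombination ℤ.+-*-isCommutativeRing

  Odd : ℤ → Set
  Odd i = Coprime i (+ 2)

  odd≢even : ∀ {i} k → Odd i → i ≢ k * + 2
  odd≢even k (s , t , eq) refl with unit (s * k + t) (+ 2) (trans (solve 3 (λ s k t → (s :* k :+ t) :* con (+ 2) := s :* (k :* con (+ 2)) :+ t :* con (+ 2)) s k t) eq)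
  ... | inj₁ ()
  ... | inj₂ ()

  private
    abstract
      odd-shift : ∀ a b s t k → a ≡ b + k * + 2 → s * b + t * + 2 ≡ 1ℤ → s * a + (t - s * k) * + 2 ≡ 1ℤ
      odd-shift a b s t k e₁ e₂ = combine₂ s 1ℤ e₁ e₂ (solve 5 (λ a b s t k →
          s :* a :+ (t :- s :* k) :* con (+ 2) :- con 1ℤ
          := s :* (a :- (b :+ k :* con (+ 2))) :+ con 1ℤ :* (s :* b :+ t :* con (+ 2) :- con 1ℤ)) a b s t k)

    odd-cube+even : ∀ Y n k → Odd n → Y * Y ≡ n * n * n + k * + 2 → Odd Y
    odd-cube+even Y n k n-odd YY≡ with coprime-*ˡ {n * n} {n} {+ 2} (coprime-*ˡ {n} {n} {+ 2} n-odd n-odd) n-odd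
    ... | s , t , eq = s * Y , t - s * k , trans (cong (_+ (t - s * k) * + 2) (ℤ.*-assoc s Y Y)) (odd-shift (Y * Y) (n * n * n) s t k YY≡ eq)

    odd≢0 : ∀ {Y} → Odd Y → Y ≢ 0ℤ
    odd≢0 Y-odd Y≡0 = odd≢even 0ℤ Y-odd Y≡0

    abstract
      -- D is the derivative in n of the norm form F of n + mτ². This identity and `identity-m` are
      -- elimination identities for F and D: when F = Y², a common divisor g of Y and D has g²
      -- dividing 11n⁶ and 2816m⁶. The 11 comes from the discriminant -176 = -16 · 11 of F.
      identity-n : ∀ m n → let D = + 3 * (n * n) + + 8 * (n * m) + + 8 * (m * m) in
        (n * n * n * + 128 + n * n * m * + 400 + n * m * m * + 512 + m * m * m * + 256)
          * (n * n * n + + 4 * (n * n * m) + + 8 * (n * m * m) + + 4 * (m * m * m))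
        + (- (n * n * + 13) - n * m * + 32 - m * m * + 16) * (D * D) ≡ n * n * n * (n * n * n) * + 11
      identity-n = solve 2 (λ m n → let D = con (+ 3) :* (n :* n) :+ con (+ 8) :* (n :* m) :+ con (+ 8) :* (m :* m) in
        (n :* n :* n :* con (+ 128) :+ n :* n :* m :* con (+ 400) :+ n :* m :* m :* con (+ 512) :+ m :* m :* m :* con (+ 256)) :* (n :* n :* n :+ con (+ 4) :* (n :* n :* m) :+ con (+ 8) :* (n :* m :* m) :+ con (+ 4) :* (m :* m :* m)) :+ (:- (n :* n :* con (+ 13)) :- n :* m :* con (+ 32) :- m :* m :* con (+ 16)) :* (D :* D)
        := n :* n :* n :* (n :* n :* n) :* con (+ 11))

      identity-m : ∀ m n → let D = + 3 * (n * n) + + 8 * (n * m) + + 8 * (m * m) in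
        (- (n * n * n * + 432) - n * n * m * + 1728 - n * m * m * + 3456 - m * m * m * + 3392)
          * (n * n * n + + 4 * (n * n * m) + + 8 * (n * m * m) + + 4 * (m * m * m))
        + (n * n * + 48 + n * m * + 128 + m * m * + 256) * (D * D) ≡ m * m * m * (m * m * m) * + 2816
      identity-m = solve 2 (λ m n → let D = con (+ 3) :* (n :* n) :+ con (+ 8) :* (n :* m) :+ con (+ 8) :* (m :* m) in
        (:- (n :* n :* n :* con (+ 432)) :- n :* n :* m :* con (+ 1728) :- n :* m :* m :* con (+ 3456) :- m :* m :* m :* con (+ 3392)) :* (n :* n :* n :+ con (+ 4) :* (n :* n :* m) :+ con (+ 8) :* (n :* m :* m) :+ con (+ 4) :* (m :* m :* m)) :+ (n :* n :* con (+ 48) :+ n :* m :* con (+ 128) :+ m :* m :* con (+ 256)) :* (D :* D)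
        := m :* m :* m :* (m :* m :* m) :* con (+ 2816))

      -- The same elimination for the form G of the even case and its derivative D in m.
      identity-κ : ∀ m κ → let D = + 3 * (m * m) + κ * m * + 16 + κ * κ * + 16 in
        (κ * κ * κ * + 176 - κ * κ * m * + 432 - κ * m * m * + 216 - m * m * m * + 27)
          * (m * m * m + + 8 * (κ * m * m) + κ * κ * m * + 16 + κ * κ * κ * + 16)
        + (κ * m * + 16 + + 3 * (m * m)) * (D * D) ≡ κ * κ * κ * (κ * κ * κ) * + 2816
      identity-κ = solve 2 (λ m κ → let D = con (+ 3) :* (m :* m) :+ κ :* m :* con (+ 16) :+ κ :* κ :* con (+ 16) in
        (κ :* κ :* κ :* con (+ 176) :- κ :* κ :* m :* con (+ 432) :- κ :* m :* m :* con (+ 216) :- m :* m :* m :* con (+ 27)) :* (m :* m :* m :+ con (+ 8) :* (κ :* m :* m) :+ κ :* κ :* m :* con (+ 16) :+ κ :* κ :* κ :* con (+ 16)) :+ (κ :* m :* con (+ 16) :+ con (+ 3) :* (m :* m)) :* (D :* D)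
        := κ :* κ :* κ :* (κ :* κ :* κ) :* con (+ 2816))

      identity-m′ : ∀ m κ → let D = + 3 * (m * m) + κ * m * + 16 + κ * κ * + 16 in
        (- (κ * κ * κ * + 1536) - κ * κ * m * + 2816 - κ * m * m * + 1648 - m * m * m * + 304)
          * (m * m * m + + 8 * (κ * m * m) + κ * κ * m * + 16 + κ * κ * κ * + 16)
        + (κ * κ * + 96 + κ * m * + 80 + m * m * + 35) * (D * D) ≡ m * m * m * (m * m * m) * + 11
      identity-m′ = solve 2 (λ m κ → let D = con (+ 3) :* (m :* m) :+ κ :* m :* con (+ 16) :+ κ :* κ :* con (+ 16) in
        (:- (κ :* κ :* κ :* con (+ 1536)) :- κ :* κ :* m :* con (+ 2816) :- κ :* m :* m :* con (+ 1648) :- m :* m :* m :* con (+ 304)) :* (m :* m :* m :+ con (+ 8) :* (κ :* m :* m) :+ κ :* κ :* m :* con (+ 16) :+ κ :* κ :* κ :* con (+ 16)) :+ (κ :* κ :* con (+ 96) :+ κ :* m :* con (+ 80) :+ m :* m :* con (+ 35)) :* (D :* D)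
        := m :* m :* m :* (m :* m :* m) :* con (+ 11))

      even-part : ∀ m n → n * n * n + + 4 * (n * n * m) + + 8 * (n * m * m) + + 4 * (m * m * m)
        ≡ n * n * n + (+ 2 * (n * n * m) + + 4 * (n * m * m) + + 2 * (m * m * m)) * + 2
      even-part = solve 2 (λ m n →
        n :* n :* n :+ con (+ 4) :* (n :* n :* m) :+ con (+ 8) :* (n :* m :* m) :+ con (+ 4) :* (m :* m :* m)
        := n :* n :* n :+ (con (+ 2) :* (n :* n :* m) :+ con (+ 4) :* (n :* m :* m) :+ con (+ 2) :* (m :* m :* m)) :* con (+ 2))

      even-part′ : ∀ m κ → m * m * m + + 8 * (κ * m * m) + κ * κ * m * + 16 + κ * κ * κ * + 16
        ≡ m * m * m + (+ 4 * (κ * m * m) + κ * κ * m * + 8 + κ * κ * κ * + 8) * + 2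
      even-part′ = solve 2 (λ m κ →
        m :* m :* m :+ con (+ 8) :* (κ :* m :* m) :+ κ :* κ :* m :* con (+ 16) :+ κ :* κ :* κ :* con (+ 16)
        := m :* m :* m :+ (con (+ 4) :* (κ :* m :* m) :+ κ :* κ :* m :* con (+ 8) :+ κ :* κ :* κ :* con (+ 8)) :* con (+ 2))

      norm-α : ∀ m n → n * n * n + + 2 * (n * n * 0ℤ) + + 4 * (n * n * m) - 0ℤ - + 4 * (0ℤ * m)
        + + 4 * (m * m * m) + + 6 * (n * 0ℤ * m) + + 8 * (n * m * m) ≡ n * n * n + + 4 * (n * n * m) + + 8 * (n * m * m) + + 4 * (m * m * m)
      norm-α = solve 2 (λ m n →
        n :* n :* n :+ con (+ 2) :* (n :* n :* con 0ℤ) :+ con (+ 4) :* (n :* n :* m) :- con 0ℤ :- con (+ 4) :* (con 0ℤ :* m) :+ con (+ 4) :* (m :* m :* m) :+ con (+ 6) :* (n :* con 0ℤ :* m) :+ con (+ 8) :* (n :* m :* m)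
        := n :* n :* n :+ con (+ 4) :* (n :* n :* m) :+ con (+ 8) :* (n :* m :* m) :+ con (+ 4) :* (m :* m :* m))

      norm-α′ : ∀ m κ → let a = m + + 4 * κ; b = - (+ 2 * κ); c = 0ℤ in
        a * a * a + + 2 * (a * a * b) + + 4 * (a * a * c) - + 2 * (b * b * b) - + 4 * (b * b * c)
        + + 4 * (c * c * c) + + 6 * (a * b * c) + + 8 * (a * c * c)
        ≡ m * m * m + + 8 * (κ * m * m) + κ * κ * m * + 16 + κ * κ * κ * + 16
      norm-α′ = solve 2 (λ m κ → let a = m :+ con (+ 4) :* κ; b = :- (con (+ 2) :* κ); c = con 0ℤ in
        a :* a :* a :+ con (+ 2) :* (a :* a :* b) :+ con (+ 4) :* (a :* a :* c) :- con (+ 2) :* (b :* b :* b) :- con (+ 4) :* (b :* b :* c) :+ con (+ 4) :* (c :* c :* c) :+ con (+ 6) :* (a :* b :* c) :+ con (+ 8) :* (a :* c :* c)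
        := m :* m :* m :+ con (+ 8) :* (κ :* m :* m) :+ κ :* κ :* m :* con (+ 16) :+ κ :* κ :* κ :* con (+ 16))

    embed-square : ∀ {α} Y → norm α ≡ Y * Y → α ⊗ adj α ≡ embed Y ⊗ embed Y
    embed-square {α} Y Nα≡YY = trans (⊗-adj α) (trans (cong embed Nα≡YY)
      (sym (trans (embed⊗ Y (embed Y)) (O-ext refl (ℤ.*-zeroʳ Y) (ℤ.*-zeroʳ Y)))))

    abstract
      adj-mod-₀ : ∀ m n → n * n + + 2 * (n * 0ℤ) + + 4 * (n * m) + + 2 * (0ℤ * m) + + 4 * (m * m)
        + ((+ 2 * n + + 4 * m) * n - + 2 * (0ℤ * m + - m * 0ℤ) - + 4 * (- m * m))
        ≡ + 3 * (n * n) + + 8 * (n * m) + + 8 * (m * m)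
      adj-mod-₀ = solve 2 (λ m n →
        n :* n :+ con (+ 2) :* (n :* con 0ℤ) :+ con (+ 4) :* (n :* m) :+ con (+ 2) :* (con 0ℤ :* m) :+ con (+ 4) :* (m :* m) :+ ((con (+ 2) :* n :+ con (+ 4) :* m) :* n :- con (+ 2) :* (con 0ℤ :* m :+ :- m :* con 0ℤ) :- con (+ 4) :* (:- m :* m))
        := con (+ 3) :* (n :* n) :+ con (+ 8) :* (n :* m) :+ con (+ 8) :* (m :* m))
      adj-mod-₁ : ∀ m n → - (n * 0ℤ) - + 2 * (0ℤ * 0ℤ) - + 4 * (0ℤ * m) - + 2 * (m * m)
        + ((+ 2 * n + + 4 * m) * 0ℤ + 0ℤ * n - + 2 * (- m * m)) ≡ 0ℤ
      adj-mod-₁ = solve 2 (λ m n →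
        :- (n :* con 0ℤ) :- con (+ 2) :* (con 0ℤ :* con 0ℤ) :- con (+ 4) :* (con 0ℤ :* m) :- con (+ 2) :* (m :* m) :+ ((con (+ 2) :* n :+ con (+ 4) :* m) :* con 0ℤ :+ con 0ℤ :* n :- con (+ 2) :* (:- m :* m))
        := con 0ℤ)
      adj-mod-₂ : ∀ m n → 0ℤ * 0ℤ + + 2 * (0ℤ * m) - n * m
        + ((+ 2 * n + + 4 * m) * m + - m * n + 0ℤ * 0ℤ + + 2 * (0ℤ * m + - m * 0ℤ) + + 4 * (- m * m)) ≡ 0ℤ
      adj-mod-₂ = solve 2 (λ m n →
        con 0ℤ :* con 0ℤ :+ con (+ 2) :* (con 0ℤ :* m) :- n :* m :+ ((con (+ 2) :* n :+ con (+ 4) :* m) :* m :+ :- m :* n :+ con 0ℤ :* con 0ℤ :+ con (+ 2) :* (con 0ℤ :* m :+ :- m :* con 0ℤ) :+ con (+ 4) :* (:- m :* m))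
        := con 0ℤ)

      adj-mod′-₀ : ∀ m κ → let a = m + + 4 * κ; b = - (+ 2 * κ); c = 0ℤ; x = + 2 * m + + 4 * κ; y = + 2 * κ; z = 0ℤ in
        a * a + + 2 * (a * b) + + 4 * (a * c) + + 2 * (b * c) + + 4 * (c * c) + (x * a - + 2 * (y * c + z * b) - + 4 * (z * c))
        ≡ + 3 * (m * m) + κ * m * + 16 + κ * κ * + 16
      adj-mod′-₀ = solve 2 (λ m κ → let a = m :+ con (+ 4) :* κ; b = :- (con (+ 2) :* κ); c = con 0ℤ; x = con (+ 2) :* m :+ con (+ 4) :* κ; y = con (+ 2) :* κ; z = con 0ℤ in
        a :* a :+ con (+ 2) :* (a :* b) :+ con (+ 4) :* (a :* c) :+ con (+ 2) :* (b :* c) :+ con (+ 4) :* (c :* c) :+ (x :* a :- con (+ 2) :* (y :* c :+ z :* b) :- con (+ 4) :* (z :* c))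
        := con (+ 3) :* (m :* m) :+ κ :* m :* con (+ 16) :+ κ :* κ :* con (+ 16))
      adj-mod′-₁ : ∀ m κ → let a = m + + 4 * κ; b = - (+ 2 * κ); c = 0ℤ; x = + 2 * m + + 4 * κ; y = + 2 * κ; z = 0ℤ in
        - (a * b) - + 2 * (b * b) - + 4 * (b * c) - + 2 * (c * c) + (x * b + y * a - + 2 * (z * c)) ≡ 0ℤ
      adj-mod′-₁ = solve 2 (λ m κ → let a = m :+ con (+ 4) :* κ; b = :- (con (+ 2) :* κ); c = con 0ℤ; x = con (+ 2) :* m :+ con (+ 4) :* κ; y = con (+ 2) :* κ; z = con 0ℤ in
        :- (a :* b) :- con (+ 2) :* (b :* b) :- con (+ 4) :* (b :* c) :- con (+ 2) :* (c :* c) :+ (x :* b :+ y :* a :- con (+ 2) :* (z :* c))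
        := con 0ℤ)
      adj-mod′-₂ : ∀ m κ → let a = m + + 4 * κ; b = - (+ 2 * κ); c = 0ℤ; x = + 2 * m + + 4 * κ; y = + 2 * κ; z = 0ℤ in
        b * b + + 2 * (b * c) - a * c + (x * c + z * a + y * b + + 2 * (y * c + z * b) + + 4 * (z * c)) ≡ 0ℤ
      adj-mod′-₂ = solve 2 (λ m κ → let a = m :+ con (+ 4) :* κ; b = :- (con (+ 2) :* κ); c = con 0ℤ; x = con (+ 2) :* m :+ con (+ 4) :* κ; y = con (+ 2) :* κ; z = con 0ℤ in
        b :* b :+ con (+ 2) :* (b :* c) :- a :* c :+ (x :* c :+ z :* a :+ y :* b :+ con (+ 2) :* (y :* c :+ z :* b) :+ con (+ 4) :* (z :* c))
        := con 0ℤ)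

    -- Modulo α = n + mτ² the product of the two other conjugates is the derivative D of the norm
    -- form, a rational integer; so any common factor of α and adj α divides D.
    adj-mod : ∀ m n → adj ⟨ n , 0ℤ , m ⟩ ⊕ ⟨ + 2 * n + + 4 * m , 0ℤ , - m ⟩ ⊗ ⟨ n , 0ℤ , m ⟩
      ≡ embed (+ 3 * (n * n) + + 8 * (n * m) + + 8 * (m * m))
    adj-mod m n = O-ext (adj-mod-₀ m n) (adj-mod-₁ m n) (adj-mod-₂ m n)

    adj-mod′ : ∀ m κ → adj ⟨ m + + 4 * κ , - (+ 2 * κ) , 0ℤ ⟩ ⊕ ⟨ + 2 * m + + 4 * κ , + 2 * κ , 0ℤ ⟩ ⊗ ⟨ m + + 4 * κ , - (+ 2 * κ) , 0ℤ ⟩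
      ≡ embed (+ 3 * (m * m) + κ * m * + 16 + κ * κ * + 16)
    adj-mod′ m κ = O-ext (adj-mod′-₀ m κ) (adj-mod′-₁ m κ) (adj-mod′-₂ m κ)

    class : ∀ m n Y → Coprime m n → Odd n → n * n * n + + 4 * (n * n * m) + + 8 * (n * m * m) + + 4 * (m * m * m) ≡ Y * Y →
      SquareClass ⟨ n , 0ℤ , m ⟩
    class m n Y m⊥n n-odd F≡YY = square-class ⟨ n , 0ℤ , m ⟩ (adj ⟨ n , 0ℤ , m ⟩) ⟨ + 2 * n + + 4 * m , 0ℤ , - m ⟩ Y D
      (embed-square {⟨ n , 0ℤ , m ⟩} Y N≡YY) N≡YY (odd≢0 Y-odd) (adj-mod m n)
      (coprime-discriminant D Y n m A B A′ B′ (coprime-sym m⊥n) Y-odd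
        (trans (cong (λ i → A * i + B * (D * D)) (sym F≡YY)) (identity-n m n))
        (trans (cong (λ i → A′ * i + B′ * (D * D)) (sym F≡YY)) (identity-m m n)))
      where
      D A B A′ B′ : ℤ
      D = + 3 * (n * n) + + 8 * (n * m) + + 8 * (m * m)
      A = n * n * n * + 128 + n * n * m * + 400 + n * m * m * + 512 + m * m * m * + 256
      B = - (n * n * + 13) - n * m * + 32 - m * m * + 16
      A′ = - (n * n * n * + 432) - n * n * m * + 1728 - n * m * m * + 3456 - m * m * m * + 3392
      B′ = n * n * + 48 + n * m * + 128 + m * m * + 256
      N≡YY : norm ⟨ n , 0ℤ , m ⟩ ≡ Y * Y
      N≡YY = trans (norm-α m n) F≡YY
      Y-odd : Odd Y
      Y-odd = odd-cube+even Y n (+ 2 * (n * n * m) + + 4 * (n * m * m) + + 2 * (m * m * m)) n-odd (trans (sym F≡YY) (even-part m n))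

    -- For n = 4κ the element n + mτ² is divisible by τ², where τ has norm -2. The quotient is α = m
    -- + 4κ - 2κτ, whose norm G is odd, and it takes over the role of n + mτ².
    class′ : ∀ m κ Y → Coprime m κ → Odd m → m * m * m + + 8 * (κ * m * m) + κ * κ * m * + 16 + κ * κ * κ * + 16 ≡ Y * Y →
      SquareClass ⟨ m + + 4 * κ , - (+ 2 * κ) , 0ℤ ⟩
    class′ m κ Y m⊥κ m-odd G≡YY = square-class α (adj α) ⟨ + 2 * m + + 4 * κ , + 2 * κ , 0ℤ ⟩ Y D
      (embed-square {α} Y N≡YY) N≡YY (odd≢0 Y-odd) (adj-mod′ m κ)
      (coprime-discriminant D Y m κ A B A′ B′ m⊥κ Y-odd
        (trans (cong (λ i → A * i + B * (D * D)) (sym G≡YY)) (identity-m′ m κ))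
        (trans (cong (λ i → A′ * i + B′ * (D * D)) (sym G≡YY)) (identity-κ m κ)))
      where
      α : O
      α = ⟨ m + + 4 * κ , - (+ 2 * κ) , 0ℤ ⟩
      D A B A′ B′ : ℤ
      D = + 3 * (m * m) + κ * m * + 16 + κ * κ * + 16
      A = - (κ * κ * κ * + 1536) - κ * κ * m * + 2816 - κ * m * m * + 1648 - m * m * m * + 304
      B = κ * κ * + 96 + κ * m * + 80 + m * m * + 35
      A′ = κ * κ * κ * + 176 - κ * κ * m * + 432 - κ * m * m * + 216 - m * m * m * + 27
      B′ = κ * m * + 16 + + 3 * (m * m)
      N≡YY : norm α ≡ Y * Y
      N≡YY = trans (norm-α′ m κ) G≡YY
      Y-odd : Odd Y
      Y-odd = odd-cube+even Y m (+ 4 * (κ * m * m) + κ * κ * m * + 8 + κ * κ * κ * + 8) m-odd (trans (sym G≡YY) (even-part′ m κ))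

    abstract
      ε-multiple-₀ : ∀ P Q R n → n ≡ 1ℤ * P - + 2 * (- 1ℤ * R + 0ℤ * Q) - + 4 * (0ℤ * R) → 0ℤ ≡ 1ℤ * Q + - 1ℤ * P - + 2 * (0ℤ * R) →
        n ≡ Q + R * + 2
      ε-multiple-₀ P Q R n e₀ e₁ = combine₂ 1ℤ 1ℤ e₀ e₁ (solve 4 (λ P Q R n →
          n :- (Q :+ R :* con (+ 2))
          := con 1ℤ :* (n :- (con 1ℤ :* P :- con (+ 2) :* (:- con 1ℤ :* R :+ con 0ℤ :* Q) :- con (+ 4) :* (con 0ℤ :* R))) :+ con 1ℤ :* (con 0ℤ :- (con 1ℤ :* Q :+ :- con 1ℤ :* P :- con (+ 2) :* (con 0ℤ :* R)))) P Q R n)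

      ε-multiple-₁ : ∀ P Q R m κ → m + + 4 * κ ≡ 1ℤ * P - + 2 * (- 1ℤ * R + 0ℤ * Q) - + 4 * (0ℤ * R) →
        - (+ 2 * κ) ≡ 1ℤ * Q + - 1ℤ * P - + 2 * (0ℤ * R) →
        0ℤ ≡ 1ℤ * R + 0ℤ * P + - 1ℤ * Q + + 2 * (- 1ℤ * R + 0ℤ * Q) + + 4 * (0ℤ * R) →
        m ≡ - Q + - κ * + 2
      ε-multiple-₁ P Q R m κ e₀ e₁ e₂ = combine₃ 1ℤ 1ℤ (+ 2) e₀ e₁ e₂ (solve 5 (λ P Q R m κ →
          m :- (:- Q :+ :- κ :* con (+ 2))
          := con 1ℤ :* (m :+ con (+ 4) :* κ :- (con 1ℤ :* P :- con (+ 2) :* (:- con 1ℤ :* R :+ con 0ℤ :* Q) :- con (+ 4) :* (con 0ℤ :* R))) :+ con 1ℤ :* (:- (con (+ 2) :* κ) :- (con 1ℤ :* Q :+ :- con 1ℤ :* P :- con (+ 2) :* (con 0ℤ :* R))) :+ con (+ 2) :* (con 0ℤ :- (con 1ℤ :* R :+ con 0ℤ :* P :+ :- con 1ℤ :* Q :+ con (+ 2) :* (:- con 1ℤ :* R :+ con 0ℤ :* Q) :+ con (+ 4) :* (con 0ℤ :* R)))) P Q R m κ)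

      square-c₁ : ∀ u v w → u * v + v * u - + 2 * (w * w) ≡ (u * v - w * w) * + 2
      square-c₁ = solve 3 (λ u v w → u :* v :+ v :* u :- con (+ 2) :* (w :* w) := (u :* v :- w :* w) :* con (+ 2))

      double : ∀ k l → k * + 2 + l * + 2 ≡ (k + l) * + 2
      double = solve 2 (λ k l → k :* con (+ 2) :+ l :* con (+ 2) := (k :+ l) :* con (+ 2))
      double-neg : ∀ k l → - (k * + 2) + - l * + 2 ≡ (- k + - l) * + 2
      double-neg = solve 2 (λ k l → :- (k :* con (+ 2)) :+ :- l :* con (+ 2) := (:- k :+ :- l) :* con (+ 2))

    ε-multiple : ∀ β n m → ⟨ n , 0ℤ , m ⟩ ≡ ε ⊗ β → n ≡ O.c₁ β + O.c₂ β * + 2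
    ε-multiple ⟨ P , Q , R ⟩ n m eq = ε-multiple-₀ P Q R n (cong O.c₀ eq) (cong O.c₁ eq)

    ε-multiple′ : ∀ β m κ → ⟨ m + + 4 * κ , - (+ 2 * κ) , 0ℤ ⟩ ≡ ε ⊗ β → m ≡ - O.c₁ β + - κ * + 2
    ε-multiple′ ⟨ P , Q , R ⟩ m κ eq = ε-multiple-₁ P Q R m κ (cong O.c₀ eq) (cong O.c₁ eq) (cong O.c₂ eq)

    -- The coefficient of τ in a square is even, whereas in ε it is odd.
    even-c₁ : ∀ γ → ∃[ k ] O.c₁ (γ ⊗ γ) ≡ k * + 2
    even-c₁ ⟨ u , v , w ⟩ = u * v - w * w , square-c₁ u v w

    ε-obstruction : ∀ γ n m → Odd n → ⟨ n , 0ℤ , m ⟩ ≢ ε ⊗ (γ ⊗ γ)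
    ε-obstruction γ n m n-odd eq = let k , c₁≡ = even-c₁ γ in
      odd≢even (k + O.c₂ (γ ⊗ γ)) n-odd
        (trans (ε-multiple (γ ⊗ γ) n m eq) (trans (cong (_+ O.c₂ (γ ⊗ γ) * + 2) c₁≡) (double k (O.c₂ (γ ⊗ γ)))))

    ε-obstruction′ : ∀ γ m κ → Odd m → ⟨ m + + 4 * κ , - (+ 2 * κ) , 0ℤ ⟩ ≢ ε ⊗ (γ ⊗ γ)
    ε-obstruction′ γ m κ m-odd eq = let k , c₁≡ = even-c₁ γ in
      odd≢even (- k + - κ) m-odd
        (trans (ε-multiple′ (γ ⊗ γ) m κ eq) (trans (cong (λ i → - i + - κ * + 2) c₁≡) (double-neg k κ)))

    abstract
      τ²-₀ : ∀ m κ → 0ℤ * (m + + 4 * κ) - + 2 * (0ℤ * 0ℤ + 1ℤ * - (+ 2 * κ)) - + 4 * (1ℤ * 0ℤ) ≡ + 4 * κ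
      τ²-₀ = solve 2 (λ m κ →
        con 0ℤ :* (m :+ con (+ 4) :* κ) :- con (+ 2) :* (con 0ℤ :* con 0ℤ :+ con 1ℤ :* :- (con (+ 2) :* κ)) :- con (+ 4) :* (con 1ℤ :* con 0ℤ)
        := con (+ 4) :* κ)
      τ²-₁ : ∀ m κ → 0ℤ * - (+ 2 * κ) + 0ℤ * (m + + 4 * κ) - + 2 * (1ℤ * 0ℤ) ≡ 0ℤ
      τ²-₁ = solve 2 (λ m κ →
        con 0ℤ :* :- (con (+ 2) :* κ) :+ con 0ℤ :* (m :+ con (+ 4) :* κ) :- con (+ 2) :* (con 1ℤ :* con 0ℤ)
        := con 0ℤ)
      τ²-₂ : ∀ m κ → 0ℤ * 0ℤ + 1ℤ * (m + + 4 * κ) + 0ℤ * - (+ 2 * κ) + + 2 * (0ℤ * 0ℤ + 1ℤ * - (+ 2 * κ)) + + 4 * (1ℤ * 0ℤ) ≡ m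
      τ²-₂ = solve 2 (λ m κ →
        con 0ℤ :* con 0ℤ :+ con 1ℤ :* (m :+ con (+ 4) :* κ) :+ con 0ℤ :* :- (con (+ 2) :* κ) :+ con (+ 2) :* (con 0ℤ :* con 0ℤ :+ con 1ℤ :* :- (con (+ 2) :* κ)) :+ con (+ 4) :* (con 1ℤ :* con 0ℤ)
        := m)

    τ : O
    τ = ⟨ 0ℤ , 1ℤ , 0ℤ ⟩

    τ²⊗ : ∀ m κ → τ ⊗ τ ⊗ ⟨ m + + 4 * κ , - (+ 2 * κ) , 0ℤ ⟩ ≡ ⟨ + 4 * κ , 0ℤ , m ⟩
    τ²⊗ m κ = O-ext (τ²-₀ m κ) (τ²-₁ m κ) (τ²-₂ m κ)

    drop-ε : ∀ {α} → SquareClass α → (∀ γ → α ≢ ε ⊗ (γ ⊗ γ)) → ∃[ γ ] α ≡ γ ⊗ γ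
    drop-ε (γ , inj₁ α≡) _ = γ , α≡
    drop-ε (γ , inj₂ α≡) obstruction = contradiction α≡ (obstruction γ)

    multiply-τ : ∀ m κ → ∃[ γ ] ⟨ m + + 4 * κ , - (+ 2 * κ) , 0ℤ ⟩ ≡ γ ⊗ γ → ∃[ γ ] ⟨ + 4 * κ , 0ℤ , m ⟩ ≡ γ ⊗ γ
    multiply-τ m κ (γ , α≡) = τ ⊗ γ , trans (sym (τ²⊗ m κ)) (trans (cong (τ ⊗ τ ⊗_) α≡) (square-product τ γ))

  abstract
    odd-square : ∀ m n Y → Coprime m n → Odd n → n * n * n + + 4 * (n * n * m) + + 8 * (n * m * m) + + 4 * (m * m * m) ≡ Y * Y →
      ∃[ γ ] ⟨ n , 0ℤ , m ⟩ ≡ γ ⊗ γ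
    odd-square m n Y m⊥n n-odd F≡YY = drop-ε (class m n Y m⊥n n-odd F≡YY) (λ γ → ε-obstruction γ n m n-odd)

    even-square : ∀ m κ Y → Coprime m κ → Odd m → m * m * m + + 8 * (κ * m * m) + κ * κ * m * + 16 + κ * κ * κ * + 16 ≡ Y * Y →
      ∃[ γ ] ⟨ + 4 * κ , 0ℤ , m ⟩ ≡ γ ⊗ γ
    even-square m κ Y m⊥κ m-odd G≡YY = multiply-τ m κ (drop-ε (class′ m κ Y m⊥κ m-odd G≡YY) (λ γ → ε-obstruction′ γ m κ m-odd))

-- Halving a point on the conductor 11 curve.

module EllipticDescent where
  open import Data.Integer using (ℤ; +_; _+_; _*_; -_; _-_; 0ℤ; 1ℤ; -1ℤ; _≤_)
  open import Data.Integer.DivMod using (_/_; _%_; a≡a%n+[a/n]*n; n%d<d)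
  import Data.Integer.Properties as ℤ
  open IntegerIdentity
  open import Data.Nat.Base as ℕ using (ℕ; suc)
  import Data.Nat.Properties as ℕ
  open import Data.Product using (_,_; _×_; ∃-syntax; proj₁; proj₂)
  open import Data.Sum using (_⊎_; inj₁; inj₂)
  open import Relation.Binary.PropositionalEquality
  open import Relation.Nullary using (contradiction)
  open CubicRing using (O; ⟨_,_,_⟩; _⊗_)
  open IntegerOrder
  open IntegerCoprime
  open EllipticSquares
  open LinearCombination ℤ.+-*-isCommutativeRing

  parity : ∀ i → (∃[ k ] i ≡ k * + 2) ⊎ Odd i
  parity i with i % + 2 | a≡a%n+[a/n]*n i (+ 2) | n%d<d i (+ 2)
  ... | 0 | eq | _ = inj₁ (i / + 2 , trans eq (ℤ.+-identityˡ _))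
  ... | 1 | eq | _ = inj₂ (1ℤ , - (i / + 2) , odd-witness i (i / + 2) eq)
    where
    cancel : ∀ k → 1ℤ * (1ℤ + k * + 2) + - k * + 2 ≡ 1ℤ
    cancel = solve 1 (λ k → con 1ℤ :* (con 1ℤ :+ k :* con (+ 2)) :+ :- k :* con (+ 2) := con 1ℤ)
    odd-witness : ∀ i k → i ≡ 1ℤ + k * + 2 → 1ℤ * i + - k * + 2 ≡ 1ℤ
    odd-witness _ k refl = cancel k
  ... | suc (suc _) | _ | ℕ.s≤s (ℕ.s≤s ())

  odd-square-root : ∀ {Y} k → Y * Y ≡ k * + 2 → ∃[ y ] Y ≡ y * + 2
  odd-square-root {Y} k YY≡ with parity Y
  ... | inj₁ even = even
  ... | inj₂ Y-odd = contradiction YY≡ (odd≢even k (coprime-*ˡ {Y} {Y} {+ 2} Y-odd Y-odd))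

  -- A rational point with x = m/e² in lowest terms on Y² = 4x³ + 8x² + 4x + 1, with denominators
  -- cleared.
  record Solution (m e : ℤ) : Set where
    constructor solution
    field
      coprime : Coprime m e
      root : ℤ
      equation : let n = e * e in n * n * n + + 4 * (n * n * m) + + 8 * (n * m * m) + + 4 * (m * m * m) ≡ root * root

  private
    abstract
      quadruple : ∀ k → k * + 2 * (k * + 2) ≡ + 4 * (k * k)
      quadruple = solve 1 (λ k → k :* con (+ 2) :* (k :* con (+ 2)) := con (+ 4) :* (k :* k))

      cubic-at-4κ : ∀ m κ → let n = + 4 * κ in n * n * n + + 4 * (n * n * m) + + 8 * (n * m * m) + + 4 * (m * m * m)
        ≡ (m * m * m + + 8 * (κ * m * m) + κ * κ * m * + 16 + κ * κ * κ * + 16) * + 4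
      cubic-at-4κ = solve 2 (λ m κ → let n = con (+ 4) :* κ in
        n :* n :* n :+ con (+ 4) :* (n :* n :* m) :+ con (+ 8) :* (n :* m :* m) :+ con (+ 4) :* (m :* m :* m)
        := (m :* m :* m :+ con (+ 8) :* (κ :* m :* m) :+ κ :* κ :* m :* con (+ 16) :+ κ :* κ :* κ :* con (+ 16)) :* con (+ 4))

      quadruple′ : ∀ k → k * + 2 * (k * + 2) ≡ k * k * + 4
      quadruple′ = solve 1 (λ k → k :* con (+ 2) :* (k :* con (+ 2)) := k :* k :* con (+ 4))

      half : ∀ k → k * + 4 ≡ k * + 2 * + 2
      half = solve 1 (λ k → k :* con (+ 4) := k :* con (+ 2) :* con (+ 2))

    γ-even : ∀ m k Y → Coprime m (k * + 2) → (+ 4 * (k * k)) * (+ 4 * (k * k)) * (+ 4 * (k * k)) + + 4 * ((+ 4 * (k * k)) * (+ 4 * (k * k)) * m)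
      + + 8 * ((+ 4 * (k * k)) * m * m) + + 4 * (m * m * m) ≡ Y * Y → ∃[ γ ] ⟨ + 4 * (k * k) , 0ℤ , m ⟩ ≡ γ ⊗ γ
    γ-even m k Y (s , t , sm+t2k≡1) F≡YY = even-square m (k * k) y (coprime-*ʳ {m} {k} {k} m⊥k m⊥k) m-odd G≡yy
      where
      G = m * m * m + + 8 * (k * k * m * m) + k * k * (k * k) * m * + 16 + k * k * (k * k) * (k * k) * + 16
      4G≡YY : G * + 4 ≡ Y * Y
      4G≡YY = trans (sym (cubic-at-4κ m (k * k))) F≡YY
      half-Y : ∃[ y ] Y ≡ y * + 2
      half-Y = odd-square-root (G * + 2) (trans (sym 4G≡YY) (half G))
      y = proj₁ half-Y
      G≡yy : G ≡ y * y
      G≡yy = ℤ.*-cancelʳ-≡ G (y * y) (+ 4) (trans 4G≡YY (trans (cong₂ _*_ (proj₂ half-Y) (proj₂ half-Y)) (quadruple′ y)))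
      m-odd : Odd m
      m-odd = s , t * k , trans (cong (λ i → s * m + i) (ℤ.*-assoc t k (+ 2))) sm+t2k≡1
      m⊥k : Coprime m k
      m⊥k = s , t * + 2 , trans (cong (λ i → s * m + i) (trans (ℤ.*-assoc t (+ 2) k) (cong (t *_) (ℤ.*-comm (+ 2) k)))) sm+t2k≡1

  -- The class of n + mτ² modulo squares is the image of the point under the 2-descent map. Its
  -- triviality says that every rational point is twice another, which is what drives the descent.
  γ-exists : ∀ m e → Solution m e → ∃[ γ ] ⟨ e * e , 0ℤ , m ⟩ ≡ γ ⊗ γ
  γ-exists m e (solution m⊥e Y F≡YY) with parity e
  ... | inj₂ e-odd = odd-square m (e * e) Y (coprime-*ʳ {m} {e} {e} m⊥e m⊥e) (coprime-*ˡ {e} {e} {+ 2} e-odd e-odd) F≡YY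
  ... | inj₁ (k , refl) = subst (λ n → ∃[ γ ] ⟨ n , 0ℤ , m ⟩ ≡ γ ⊗ γ) (sym (quadruple k))
    (γ-even m k Y m⊥e (subst (λ n → n * n * n + + 4 * (n * n * m) + + 8 * (n * m * m) + + 4 * (m * m * m) ≡ Y * Y) (quadruple k) F≡YY))

  private
    abstract
      square-components : ∀ u v w n m → n ≡ u * u - + 2 * (v * w + w * v) - + 4 * (w * w) → 0ℤ ≡ u * v + v * u - + 2 * (w * w) →
        m ≡ u * w + w * u + v * v + + 2 * (v * w + w * v) + + 4 * (w * w) →
        u * v ≡ w * w × n ≡ u * u - + 4 * (v * w) - + 4 * (w * w) × m ≡ + 2 * (u * w) + v * v + + 4 * (v * w) + + 4 * (w * w)
      square-components u v w n m e₀ e₁ e₂ = ℤ.*-cancelʳ-≡ (u * v) (w * w) (+ 2) (combine₁ -1ℤ e₁ (i₁ u v w)) ,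
        trans e₀ (i₀ u v w) , trans e₂ (i₂ u v w)
        where
        i₁ : ∀ u v w → u * v * + 2 - w * w * + 2 ≡ -1ℤ * (0ℤ - (u * v + v * u - + 2 * (w * w)))
        i₁ = solve 3 (λ u v w →
          u :* v :* con (+ 2) :- w :* w :* con (+ 2)
          := con -1ℤ :* (con 0ℤ :- (u :* v :+ v :* u :- con (+ 2) :* (w :* w))))
        i₀ : ∀ u v w → u * u - + 2 * (v * w + w * v) - + 4 * (w * w) ≡ u * u - + 4 * (v * w) - + 4 * (w * w)
        i₀ = solve 3 (λ u v w →
          u :* u :- con (+ 2) :* (v :* w :+ w :* v) :- con (+ 4) :* (w :* w)
          := u :* u :- con (+ 4) :* (v :* w) :- con (+ 4) :* (w :* w))
        i₂ : ∀ u v w → u * w + w * u + v * v + + 2 * (v * w + w * v) + + 4 * (w * w) ≡ + 2 * (u * w) + v * v + + 4 * (v * w) + + 4 * (w * w)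
        i₂ = solve 3 (λ u v w →
          u :* w :+ w :* u :+ v :* v :+ con (+ 2) :* (v :* w :+ w :* v) :+ con (+ 4) :* (w :* w)
          := con (+ 2) :* (u :* w) :+ v :* v :+ con (+ 4) :* (v :* w) :+ con (+ 4) :* (w :* w))

      factor-n : ∀ δ g h → let u = δ * (g * g); v = δ * (h * h); w = δ * (g * h) in
        u * u - + 4 * (v * w) - + 4 * (w * w) ≡ g * (g * g * g - + 4 * (g * h * h) - + 4 * (h * h * h)) * (δ * δ)
      factor-n = solve 3 (λ δ g h → let u = δ :* (g :* g); v = δ :* (h :* h); w = δ :* (g :* h) in
        u :* u :- con (+ 4) :* (v :* w) :- con (+ 4) :* (w :* w)
        := g :* (g :* g :* g :- con (+ 4) :* (g :* h :* h) :- con (+ 4) :* (h :* h :* h)) :* (δ :* δ))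
      factor-m : ∀ δ g h → let u = δ * (g * g); v = δ * (h * h); w = δ * (g * h) in
        + 2 * (u * w) + v * v + + 4 * (v * w) + + 4 * (w * w) ≡ h * (+ 2 * (g * g * g) + h * h * h + + 4 * (g * h * h) + + 4 * (g * g * h)) * (δ * δ)
      factor-m = solve 3 (λ δ g h → let u = δ :* (g :* g); v = δ :* (h :* h); w = δ :* (g :* h) in
        con (+ 2) :* (u :* w) :+ v :* v :+ con (+ 4) :* (v :* w) :+ con (+ 4) :* (w :* w)
        := h :* (con (+ 2) :* (g :* g :* g) :+ h :* h :* h :+ con (+ 4) :* (g :* h :* h) :+ con (+ 4) :* (g :* g :* h)) :* (δ :* δ))

      negate-n : ∀ g h → g * (g * g * g - + 4 * (g * h * h) - + 4 * (h * h * h))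
        ≡ - g * (- g * - g * - g - + 4 * (- g * - h * - h) - + 4 * (- h * - h * - h))
      negate-n = solve 2 (λ g h →
        g :* (g :* g :* g :- con (+ 4) :* (g :* h :* h) :- con (+ 4) :* (h :* h :* h))
        := :- g :* (:- g :* :- g :* :- g :- con (+ 4) :* (:- g :* :- h :* :- h) :- con (+ 4) :* (:- h :* :- h :* :- h)))
      negate-m : ∀ g h → h * (+ 2 * (g * g * g) + h * h * h + + 4 * (g * h * h) + + 4 * (g * g * h))
        ≡ - h * (+ 2 * (- g * - g * - g) + - h * - h * - h + + 4 * (- g * - h * - h) + + 4 * (- g * - g * - h))
      negate-m = solve 2 (λ g h →
        h :* (con (+ 2) :* (g :* g :* g) :+ h :* h :* h :+ con (+ 4) :* (g :* h :* h) :+ con (+ 4) :* (g :* g :* h))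
        := :- h :* (con (+ 2) :* (:- g :* :- g :* :- g) :+ :- h :* :- h :* :- h :+ con (+ 4) :* (:- g :* :- h :* :- h) :+ con (+ 4) :* (:- g :* :- g :* :- h)))

  record Parametrised (m n : ℤ) : Set where
    constructor parametrised
    field
      g h : ℤ
      0≤g : 0ℤ ≤ g
      n≡ : n ≡ g * (g * g * g - + 4 * (g * h * h) - + 4 * (h * h * h))
      m≡ : m ≡ h * (+ 2 * (g * g * g) + h * h * h + + 4 * (g * h * h) + + 4 * (g * g * h))

  private
    make-nonnegative : ∀ {m n} g h → n ≡ g * (g * g * g - + 4 * (g * h * h) - + 4 * (h * h * h)) →
      m ≡ h * (+ 2 * (g * g * g) + h * h * h + + 4 * (g * h * h) + + 4 * (g * g * h)) → Parametrised m n
    make-nonnegative g h n≡ m≡ with ℤ.≤-total 0ℤ g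
    ... | inj₁ 0≤g = parametrised g h 0≤g n≡ m≡
    ... | inj₂ g≤0 = parametrised (- g) (- h) (ℤ.neg-mono-≤ g≤0) (trans n≡ (negate-n g h)) (trans m≡ (negate-m g h))

    square-unit : ∀ u δ → u * (δ * δ) ≡ 1ℤ → δ * δ ≡ 1ℤ
    square-unit u δ eq with unit u (δ * δ) eq
    ... | inj₁ δδ≡1 = δδ≡1
    ... | inj₂ δδ≡-1 = contradiction (subst (0ℤ ≤_) δδ≡-1 (0≤-square δ)) λ ()

  -- The coefficient 2(uv - w²) of τ in γ² has to vanish, and the rank-one lemma solves uv = w² by u
  -- = δg², v = δh², w = δgh. As δ² divides both m and n, it is 1.
  parametrise : ∀ m n → Coprime m n → ∃[ γ ] ⟨ n , 0ℤ , m ⟩ ≡ γ ⊗ γ → Parametrised m n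
  parametrise m n m⊥n (⟨ u , v , w ⟩ , eq) with square-components u v w n m (cong O.c₀ eq) (cong O.c₁ eq) (cong O.c₂ eq)
  ... | uv≡ww , n≡ , m≡ with rankOne u v w uv≡ww
  ...   | δ , g , h , refl , refl , refl = make-nonnegative g h
    (trans n≡′ (trans (cong (c *_) δδ≡1) (ℤ.*-identityʳ c))) (trans m≡′ (trans (cong (q *_) δδ≡1) (ℤ.*-identityʳ q)))
    where
    c = g * (g * g * g - + 4 * (g * h * h) - + 4 * (h * h * h))
    q = h * (+ 2 * (g * g * g) + h * h * h + + 4 * (g * h * h) + + 4 * (g * g * h))
    n≡′ : n ≡ c * (δ * δ)
    n≡′ = trans n≡ (factor-n δ g h)
    m≡′ : m ≡ q * (δ * δ)
    m≡′ = trans m≡ (factor-m δ g h)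
    δδ≡1 : δ * δ ≡ 1ℤ
    δδ≡1 = let u , e = coprime-divisor (δ * δ) q c m⊥n m≡′ n≡′ in square-unit u δ e

-- Infinite descent on the conductor 11 curve.

module EllipticMain where
  open import Data.Integer using (ℤ; +_; -[1+_]; _+_; _*_; -_; _-_; 0ℤ; 1ℤ; -1ℤ; ∣_∣; _≤_; _<_; +≤+)
  import Data.Integer.Properties as ℤ
  open IntegerIdentity
  open import Data.Nat.Base as ℕ using (ℕ; suc)
  open import Data.Nat.Induction using (<-wellFounded)
  import Data.Nat.Properties as ℕ
  open import Data.Product using (_,_; _×_; ∃-syntax; proj₁; proj₂)
  open import Data.Sum using (_⊎_; inj₁; inj₂; [_,_]′)
  open import Induction.WellFounded using (Acc; acc)
  open import Relation.Binary.PropositionalEquality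
  open import Relation.Nullary using (Dec; contradiction; yes; no)
  open IntegerOrder
  open IntegerCoprime
  open EllipticSquares
  open EllipticDescent
  open LinearCombination ℤ.+-*-isCommutativeRing

  private
    cofactor : ℤ → ℤ → ℤ
    cofactor g h = g * g * g - + 4 * (g * h * h) - + 4 * (h * h * h)

    abstract
      cofactor-mod-g : ∀ g h δ ξ η → g ≡ δ * (ξ * ξ) → g * g * g - + 4 * (g * h * h) - + 4 * (h * h * h) ≡ δ * (η * η) →
        h * h * h * + 4 ≡ (ξ * ξ * (g * g - + 4 * (h * h)) - η * η) * δ
      cofactor-mod-g g h δ ξ η e₁ e₂ = combine₂ (g * g - + 4 * (h * h)) -1ℤ e₁ e₂ (solve 5 (λ g h δ ξ η →
          h :* h :* h :* con (+ 4) :- (ξ :* ξ :* (g :* g :- con (+ 4) :* (h :* h)) :- η :* η) :* δ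
          := (g :* g :- con (+ 4) :* (h :* h)) :* (g :- δ :* (ξ :* ξ)) :+ con -1ℤ :* (g :* g :* g :- con (+ 4) :* (g :* h :* h) :- con (+ 4) :* (h :* h :* h) :- δ :* (η :* η))) g h δ ξ η)

      reassociate : ∀ s t δ ξ h → s * (ξ * ξ) * δ + t * h ≡ s * (δ * (ξ * ξ)) + t * h
      reassociate = solve 5 (λ s t δ ξ h → s :* (ξ :* ξ) :* δ :+ t :* h := s :* (δ :* (ξ :* ξ)) :+ t :* h)

      halve : ∀ ξ η h → let g = + 2 * (ξ * ξ) in g * g * g - + 4 * (g * h * h) - + 4 * (h * h * h) ≡ + 2 * (η * η) →
        η * η ≡ (+ 2 * (ξ * ξ * ξ * ξ * ξ * ξ) - + 2 * (ξ * ξ * h * h) - h * h * h) * + 2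
      halve ξ η h e = ℤ.*-cancelʳ-≡ (η * η) ((+ 2 * (ξ * ξ * ξ * ξ * ξ * ξ) - + 2 * (ξ * ξ * h * h) - h * h * h) * + 2) (+ 2) (combine₁ -1ℤ e (solve 3 (λ ξ η h → let g = con (+ 2) :* (ξ :* ξ) in
          η :* η :* con (+ 2) :- (con (+ 2) :* (ξ :* ξ :* ξ :* ξ :* ξ :* ξ) :- con (+ 2) :* (ξ :* ξ :* h :* h) :- h :* h :* h) :* con (+ 2) :* con (+ 2)
          := con -1ℤ :* (g :* g :* g :- con (+ 4) :* (g :* h :* h) :- con (+ 4) :* (h :* h :* h) :- con (+ 2) :* (η :* η))) ξ η h))
      halve-again : ∀ ξ y h → y * + 2 * (y * + 2) ≡ (+ 2 * (ξ * ξ * ξ * ξ * ξ * ξ) - + 2 * (ξ * ξ * h * h) - h * h * h) * + 2 →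
        h * h * h ≡ (ξ * ξ * ξ * ξ * ξ * ξ - ξ * ξ * h * h - y * y) * + 2
      halve-again ξ y h e = ℤ.*-cancelʳ-≡ (h * h * h) ((ξ * ξ * ξ * ξ * ξ * ξ - ξ * ξ * h * h - y * y) * + 2) (+ 2) (combine₁ 1ℤ e (solve 3 (λ ξ y h →
          h :* h :* h :* con (+ 2) :- (ξ :* ξ :* ξ :* ξ :* ξ :* ξ :- ξ :* ξ :* h :* h :- y :* y) :* con (+ 2) :* con (+ 2)
          := con 1ℤ :* (y :* con (+ 2) :* (y :* con (+ 2)) :- (con (+ 2) :* (ξ :* ξ :* ξ :* ξ :* ξ :* ξ) :- con (+ 2) :* (ξ :* ξ :* h :* h) :- h :* h :* h) :* con (+ 2))) ξ y h))
      odd-from-coprime : ∀ s t ξ h → s * (+ 2 * (ξ * ξ)) + t * h ≡ 1ℤ → t * h + s * (ξ * ξ) * + 2 ≡ 1ℤ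
      odd-from-coprime s t ξ h e = trans (solve 4 (λ s t ξ h → t :* h :+ s :* (ξ :* ξ) :* con (+ 2) := s :* (con (+ 2) :* (ξ :* ξ)) :+ t :* h) s t ξ h) e
      absorb-4 : ∀ ξ → + 4 * (ξ * ξ) ≡ + 2 * ξ * (+ 2 * ξ)
      absorb-4 = solve 1 (λ ξ → con (+ 4) :* (ξ :* ξ) := con (+ 2) :* ξ :* (con (+ 2) :* ξ))
      absorb-4′ : ∀ ξ η → + 4 * (ξ * η) ≡ + 2 * ξ * (+ 2 * η)
      absorb-4′ = solve 2 (λ ξ η → con (+ 4) :* (ξ :* η) := con (+ 2) :* ξ :* (con (+ 2) :* η))

    -- The equation makes η even and then h³ even, although h is coprime to the even number 2ξ².
    no-double : ∀ ξ η h → Coprime (+ 2 * (ξ * ξ)) h → cofactor (+ 2 * (ξ * ξ)) h ≢ + 2 * (η * η)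
    no-double ξ η h (s , t , e) eq = odd≢even (ξ * ξ * ξ * ξ * ξ * ξ - ξ * ξ * h * h - y * y) hhh-odd
        (halve-again ξ y h (trans (cong₂ _*_ (sym (proj₂ half)) (sym (proj₂ half))) (halve ξ η h eq)))
      where
      half : ∃[ y ] η ≡ y * + 2
      half = odd-square-root {η} (+ 2 * (ξ * ξ * ξ * ξ * ξ * ξ) - + 2 * (ξ * ξ * h * h) - h * h * h) (halve ξ η h eq)
      y = proj₁ half
      h-odd : Odd h
      h-odd = t , s * (ξ * ξ) , odd-from-coprime s t ξ h e
      hhh-odd : Odd (h * h * h)
      hhh-odd = coprime-*ˡ {h * h} {h} {+ 2} (coprime-*ˡ {h} {h} {+ 2} h-odd h-odd) h-odd

    divisor-of-4 : ∀ k d → k ℕ.* d ≡ 4 → d ≡ 1 ⊎ d ≡ 2 ⊎ d ≡ 4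
    divisor-of-4 k 0 e = contradiction (trans (sym (ℕ.*-zeroʳ k)) e) λ ()
    divisor-of-4 k 1 _ = inj₁ refl
    divisor-of-4 k 2 _ = inj₂ (inj₁ refl)
    divisor-of-4 0 3 ()
    divisor-of-4 1 3 ()
    divisor-of-4 (suc (suc k)) 3 ()
    divisor-of-4 k 4 _ = inj₂ (inj₂ refl)
    divisor-of-4 (suc k) (suc (suc (suc (suc (suc d))))) ()

  record SquareFactors (g h e : ℤ) : Set where
    constructor squareFactors
    field
      e₁ e₂ : ℤ
      g≡ : g ≡ e₁ * e₁
      c≡ : cofactor g h ≡ e₂ * e₂
      e≡ : e ≡ e₁ * e₂

  private
    nonpositive : ∀ n ξ → -[1+ n ] * (ξ * ξ) ≤ 0ℤ
    nonpositive n ξ = subst (_≤ 0ℤ) (ℤ.neg-distribˡ-* (+ suc n) (ξ * ξ)) (ℤ.neg-mono-≤ (0≤-* {+ suc n} (+≤+ ℕ.z≤n) (0≤-square ξ)))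

    square≡0 : ∀ e → e * e ≡ 0ℤ → e ≡ 0ℤ
    square≡0 e ee≡0 = [ (λ z → z) , (λ z → z) ]′ (ℤ.i*j≡0⇒i≡0∨j≡0 e ee≡0)

    -- The cofactor is -4h³ modulo g, and δ divides g and the cofactor while being coprime to h; so
    -- δ divides 4. It is positive because g is, the value 2 is excluded by `no-double`, and 4 is
    -- absorbed into ξ and η.
    factors : ∀ {g h e} δ ξ η → 0ℤ ≤ g → g ≢ 0ℤ → Coprime g h →
      g ≡ δ * (ξ * ξ) → cofactor g h ≡ δ * (η * η) → e ≡ δ * (ξ * η) → SquareFactors g h e
    factors -[1+ n ] ξ η 0≤g g≢0 _ g≡ _ _ = contradiction (ℤ.≤-antisym (subst (_≤ 0ℤ) (sym g≡) (nonpositive n ξ)) 0≤g) g≢0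
    factors {g} {h} {e} (+ d) ξ η 0≤g _ g⊥h@(s , t , sg+th≡1) g≡ c≡ e≡ with gauss {+ d} {h * h * h} {+ 4} (ξ * ξ * (g * g - + 4 * (h * h)) - η * η) δ⊥hhh (cofactor-mod-g g h (+ d) ξ η g≡ c≡)
      where
      δ⊥h : Coprime (+ d) h
      δ⊥h = s * (ξ * ξ) , t , trans (reassociate s t (+ d) ξ h) (trans (cong (λ i → s * i + t * h) (sym g≡)) sg+th≡1)
      δ⊥hhh : Coprime (+ d) (h * h * h)
      δ⊥hhh = coprime-*ʳ {+ d} {h * h} {h} (coprime-*ʳ {+ d} {h} {h} δ⊥h δ⊥h) δ⊥h
    ... | k , 4≡kδ with divisor-of-4 ∣ k ∣ d (trans (sym (ℤ.abs-* k (+ d))) (cong ∣_∣ (sym 4≡kδ)))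
    ... | inj₁ refl = squareFactors ξ η (trans g≡ (ℤ.*-identityˡ _)) (trans c≡ (ℤ.*-identityˡ _)) (trans e≡ (ℤ.*-identityˡ _))
    ... | inj₂ (inj₁ refl) = contradiction (subst (λ i → cofactor i h ≡ + 2 * (η * η)) g≡ c≡) (no-double ξ η h (subst (λ i → Coprime i h) g≡ g⊥h))
    ... | inj₂ (inj₂ refl) = squareFactors (+ 2 * ξ) (+ 2 * η) (trans g≡ (absorb-4 ξ)) (trans c≡ (absorb-4 η)) (trans e≡ (absorb-4′ ξ η))

  abstract
    square-factors : ∀ g h e → 0ℤ ≤ g → g ≢ 0ℤ → Coprime g h → e * e ≡ g * cofactor g h → SquareFactors g h e
    square-factors g h e 0≤g g≢0 g⊥h ee≡gc = let δ , ξ , η , g≡ , c≡ , e≡ = rankOne g (cofactor g h) e (sym ee≡gc) in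
      factors δ ξ η 0≤g g≢0 g⊥h g≡ c≡ e≡

  private
    q-factor : ℤ → ℤ → ℤ
    q-factor g h = + 2 * (g * g * g) + h * h * h + + 4 * (g * h * h) + + 4 * (g * g * h)

    -- Half of the point m/e² is the point -(h + g)/g.
    record Step (m e : ℤ) : Set where
      constructor step
      field
        g h : ℤ
        0≤g : 0ℤ ≤ g
        n≡ : e * e ≡ g * cofactor g h
        m≡ : m ≡ h * q-factor g h
        g⊥h : Coprime g h
        squares : SquareFactors g h e
      open SquareFactors squares public

    abstract
      bézout-gh : ∀ s t m e g h → m ≡ h * (+ 2 * (g * g * g) + h * h * h + + 4 * (g * h * h) + + 4 * (g * g * h)) →
        e * e ≡ g * (g * g * g - + 4 * (g * h * h) - + 4 * (h * h * h)) → s * m + t * (e * e) ≡ 1ℤ →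
        t * (g * g * g - + 4 * (g * h * h) - + 4 * (h * h * h)) * g + s * (+ 2 * (g * g * g) + h * h * h + + 4 * (g * h * h) + + 4 * (g * g * h)) * h ≡ 1ℤ
      bézout-gh s t m e g h m≡ n≡ eq = combine₃ (- s) (- t) 1ℤ m≡ n≡ eq (solve 6 (λ s t m e g h → let c = g :* g :* g :- con (+ 4) :* (g :* h :* h) :- con (+ 4) :* (h :* h :* h); q = con (+ 2) :* (g :* g :* g) :+ h :* h :* h :+ con (+ 4) :* (g :* h :* h) :+ con (+ 4) :* (g :* g :* h) in
          t :* c :* g :+ s :* q :* h :- con 1ℤ
          := :- s :* (m :- h :* q) :+ :- t :* (e :* e :- g :* c) :+ con 1ℤ :* (s :* m :+ t :* (e :* e) :- con 1ℤ)) s t m e g h)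

      -- In the variable -(h + g) the cofactor is the original cubic form again, and this closes the
      -- descent.
      next-equation : ∀ g h → let m = - (h + g) in
        g * g * g + + 4 * (g * g * m) + + 8 * (g * m * m) + + 4 * (m * m * m) ≡ g * g * g - + 4 * (g * h * h) - + 4 * (h * h * h)
      next-equation = solve 2 (λ g h → let m = :- (h :+ g) in
        g :* g :* g :+ con (+ 4) :* (g :* g :* m) :+ con (+ 8) :* (g :* m :* m) :+ con (+ 4) :* (m :* m :* m)
        := g :* g :* g :- con (+ 4) :* (g :* h :* h) :- con (+ 4) :* (h :* h :* h))

      next-bézout : ∀ s t g h e₁ → s * g + t * h ≡ 1ℤ → g ≡ e₁ * e₁ → - t * - (h + g) + (s - t) * e₁ * e₁ ≡ 1ℤ
      next-bézout s t g h e₁ eq g≡ = combine₂ 1ℤ (t - s) eq g≡ (solve 5 (λ s t g h e₁ →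
          :- t :* :- (h :+ g) :+ (s :- t) :* e₁ :* e₁ :- con 1ℤ
          := con 1ℤ :* (s :* g :+ t :* h :- con 1ℤ) :+ (t :- s) :* (g :- e₁ :* e₁)) s t g h e₁)

    abstract
      make-step : ∀ m e → e ≢ 0ℤ → Solution m e → Step m e
      make-step m e e≢0 sol@(solution m⊥e _ _) = step g h 0≤g n≡ m≡ g⊥h (square-factors g h e 0≤g g≢0 g⊥h n≡)
        where
        m⊥n : Coprime m (e * e)
        m⊥n = coprime-*ʳ {m} {e} {e} m⊥e m⊥e
        open Parametrised (parametrise m (e * e) m⊥n (γ-exists m e sol))
        g≢0 : g ≢ 0ℤ
        g≢0 g≡0 = e≢0 (square≡0 e (trans n≡ (cong (_* cofactor g h) g≡0)))
        g⊥h : Coprime g h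
        g⊥h = let s , t , eq = m⊥n in t * cofactor g h , s * q-factor g h , bézout-gh s t m e g h m≡ n≡ eq

    module _ {m e : ℤ} (st : Step m e) where
      open Step st

      M : ℤ
      M = - (h + g)

      next : Solution M e₁
      next = let s , t , eq = g⊥h in
        solution (- t , (s - t) * e₁ , next-bézout s t g h e₁ eq g≡) e₂
          (subst (λ n → n * n * n + + 4 * (n * n * M) + + 8 * (n * M * M) + + 4 * (M * M * M) ≡ e₂ * e₂) g≡ (trans (next-equation g h) c≡))

    Trivial : ℤ → ℤ → Set
    Trivial m n = m ≡ 0ℤ ⊎ m ≡ - n

    nonnegative-unit : ∀ u g → 0ℤ ≤ g → u * g ≡ 1ℤ → g ≡ 1ℤ
    nonnegative-unit u g 0≤g eq with unit u g eq
    ... | inj₁ g≡1 = g≡1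
    nonnegative-unit u g () eq | inj₂ refl

    abstract
      h≡-g : ∀ g h → - (h + g) ≡ 0ℤ → h ≡ - g
      h≡-g g h e = combine₁ -1ℤ e (solve 2 (λ g h → h :- :- g := con -1ℤ :* (:- (h :+ g) :- con 0ℤ)) g h)
      h≡0 : ∀ g h → - (h + g) ≡ - g → h ≡ 0ℤ
      h≡0 g h e = combine₁ -1ℤ e (solve 2 (λ g h → h :- con 0ℤ := con -1ℤ :* (:- (h :+ g) :- :- g)) g h)
      unit-g : ∀ s t g → s * g + t * - g ≡ 1ℤ → (s - t) * g ≡ 1ℤ
      unit-g s t g e = trans (solve 3 (λ s t g → (s :- t) :* g := s :* g :+ t :* :- g) s t g) e
      unit-g′ : ∀ s t g → s * g + t * 0ℤ ≡ 1ℤ → s * g ≡ 1ℤ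
      unit-g′ s t g e = trans (solve 3 (λ s t g → s :* g := s :* g :+ t :* con 0ℤ) s t g) e

    trivial-at : ∀ {m n g h g₀ h₀} → g ≡ g₀ → h ≡ h₀ → n ≡ g * cofactor g h → m ≡ h * q-factor g h →
      n ≡ g₀ * cofactor g₀ h₀ × m ≡ h₀ * q-factor g₀ h₀
    trivial-at refl refl n≡ m≡ = n≡ , m≡

    -- Coprimality of g and h makes g = 1 in both cases: M = 0 gives h = -1 and m = -e², while M =
    -- -g gives h = 0 and m = 0.
    conclude : ∀ {m e} (st : Step m e) → Trivial (M st) (Step.g st) → Trivial m (e * e)
    conclude (step g h 0≤g n≡ m≡ (s , t , eq) _) (inj₁ M≡0) =
      let h≡ = h≡-g g h M≡0
          g≡1 = nonnegative-unit (s - t) g 0≤g (unit-g s t g (subst (λ i → s * g + t * i ≡ 1ℤ) h≡ eq))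
          n≡1 , m≡-1 = trivial-at g≡1 (trans h≡ (cong -_ g≡1)) n≡ m≡
      in inj₂ (trans m≡-1 (cong -_ (sym n≡1)))
    conclude (step g h 0≤g n≡ m≡ (s , t , eq) _) (inj₂ M≡-g) =
      let h≡ = h≡0 g h M≡-g
          g≡1 = nonnegative-unit s g 0≤g (unit-g′ s t g (subst (λ i → s * g + t * i ≡ 1ℤ) h≡ eq))
          _ , m≡0 = trivial-at g≡1 h≡ n≡ m≡
      in inj₁ m≡0

    one-plus : ∀ {y} → Nonneg y → y + 1ℤ ≢ 0ℤ
    one-plus {+ n} _ eq = contradiction (trans (sym (ℕ.+-comm n 1)) (ℤ.+-injective eq)) λ ()
    one-plus { -[1+ n ]} (nonneg ()) _

    abstract
      -- (3h + 2g)²(g - 3h) ≥ 0 forces 11g³ ≤ 27 when the cofactor is 1.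
      cofactor≢1 : ∀ {g h} → Nonneg (g - + 2) → Nonneg (- h) → cofactor g h ≢ 1ℤ
      cofactor≢1 {g} {h} K J eq = one-plus
        (nat 4 *⁺ (sq (+ 3 * h + + 2 * g) *⁺ (nat 3 *⁺ J +⁺ (nat 2 +⁺ K))) +⁺ nat 60 +⁺ (K *⁺ nat 12 +⁺ K *⁺ K *⁺ nat 6 +⁺ K *⁺ K *⁺ K) *⁺ nat 11)
        (combine₁ (+ 27) eq (solve 2 (λ g h → let k = g :- con (+ 2); j = :- h in
          con (+ 4) :* ((con (+ 3) :* h :+ con (+ 2) :* g) :* (con (+ 3) :* h :+ con (+ 2) :* g) :* (con (+ 3) :* j :+ (con (+ 2) :+ k))) :+ con (+ 60) :+ (k :* con (+ 12) :+ k :* k :* con (+ 6) :+ k :* k :* k) :* con (+ 11) :+ con 1ℤ :- con 0ℤ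
          := con (+ 27) :* (g :* g :* g :- con (+ 4) :* (g :* h :* h) :- con (+ 4) :* (h :* h :* h) :- con 1ℤ)) g h))

      -- The left side is negative, whereas the parametrisation of the following step writes it as
      -- h′ times a positive number.
      opposite-signs : ∀ {g h g′ h′} → Nonneg g → Nonneg (h - 1ℤ) → Nonneg g′ → Nonneg (h′ - 1ℤ) → - (h + g) ≢ h′ * q-factor g′ h′
      opposite-signs {g} {h} {g′} {h′} G H G′ H′ eq = one-plus
        (P *⁺ (nat 2 *⁺ (G′ *⁺ G′ *⁺ G′) +⁺ P *⁺ P *⁺ P +⁺ nat 4 *⁺ (G′ *⁺ P *⁺ P) +⁺ nat 4 *⁺ (G′ *⁺ G′ *⁺ P)) +⁺ H +⁺ G)
        (combine₁ -1ℤ eq (identity g h g′ h′))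
        where
        P : Nonneg (h′ - 1ℤ + 1ℤ)
        P = H′ +⁺ nat 1
        identity : ∀ g h g′ h′ → let p = h′ - 1ℤ + 1ℤ in
          p * (+ 2 * (g′ * g′ * g′) + p * p * p + + 4 * (g′ * p * p) + + 4 * (g′ * g′ * p)) + (h - 1ℤ) + g + 1ℤ - 0ℤ
          ≡ -1ℤ * (- (h + g) - h′ * (+ 2 * (g′ * g′ * g′) + h′ * h′ * h′ + + 4 * (g′ * h′ * h′) + + 4 * (g′ * g′ * h′)))
        identity = solve 4 (λ g h g′ h′ → let p = h′ :- con 1ℤ :+ con 1ℤ in
          p :* (con (+ 2) :* (g′ :* g′ :* g′) :+ p :* p :* p :+ con (+ 4) :* (g′ :* p :* p) :+ con (+ 4) :* (g′ :* g′ :* p)) :+ (h :- con 1ℤ) :+ g :+ con 1ℤ :- con 0ℤ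
          := con -1ℤ :* (:- (h :+ g) :- h′ :* (con (+ 2) :* (g′ :* g′ :* g′) :+ h′ :* h′ :* h′ :+ con (+ 4) :* (g′ :* h′ :* h′) :+ con (+ 4) :* (g′ :* g′ :* h′))))

      cofactor-at-1 : ∀ h → 1ℤ * 1ℤ * 1ℤ - + 4 * (1ℤ * h * h) - + 4 * (h * h * h) ≡ 1ℤ → h * h * (h + 1ℤ) ≡ 0ℤ
      cofactor-at-1 h e = ℤ.*-cancelʳ-≡ (h * h * (h + 1ℤ)) 0ℤ (+ 4) (combine₁ -1ℤ e (solve 1 (λ h →
          h :* h :* (h :+ con 1ℤ) :* con (+ 4) :- con 0ℤ :* con (+ 4)
          := con -1ℤ :* (con 1ℤ :* con 1ℤ :* con 1ℤ :- con (+ 4) :* (con 1ℤ :* h :* h) :- con (+ 4) :* (h :* h :* h) :- con 1ℤ)) h))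

      M-at-1 : ∀ h → h + 1ℤ ≡ 0ℤ → - (h + 1ℤ) ≡ 0ℤ
      M-at-1 h e = cong -_ e

    positive-h : ∀ g h → Nonneg (g - + 2) → cofactor g h ≡ 1ℤ → Nonneg (h - 1ℤ)
    positive-h g h K c≡1 with 0ℤ ℤ.<? h
    ... | yes 0<h = nonneg (ℤ.i≤j⇒0≤j-i (ℤ.i<j⇒suc[i]≤j 0<h))
    ... | no 0≮h = contradiction c≡1 (cofactor≢1 {g} {h} K (nonneg (ℤ.neg-mono-≤ (ℤ.≮⇒≥ 0≮h))))

    trivial-at-1 : ∀ h → cofactor 1ℤ h ≡ 1ℤ → Trivial (- (h + 1ℤ)) 1ℤ
    trivial-at-1 h c≡1 with ℤ.i*j≡0⇒i≡0∨j≡0 (h * h) (cofactor-at-1 h c≡1)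
    ... | inj₂ h+1≡0 = inj₁ (M-at-1 h h+1≡0)
    ... | inj₁ hh≡0 = inj₂ (cong (λ i → - (i + 1ℤ)) (square≡0 h hh≡0))

    unit-square : ∀ e → ∣ e ∣ ≡ 1 → e * e ≡ 1ℤ
    unit-square (+ .1) refl = refl
    unit-square -[1+ 0 ] refl = refl

    -- Two consecutive steps that do not decrease e force g = 1.
    stationary : ∀ g h g′ h′ → 0ℤ ≤ g → g ≢ 0ℤ → g′ ≡ g → cofactor g h ≡ 1ℤ → cofactor g′ h′ ≡ 1ℤ → - (h + g) ≡ h′ * q-factor g′ h′ →
      Trivial (- (h + g)) g
    stationary (+ 0) h g′ h′ _ g≢0 _ _ _ _ = contradiction refl g≢0
    stationary (+ 1) h g′ h′ _ _ _ c≡1 _ _ = trivial-at-1 h c≡1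
    stationary g@(+ suc (suc k)) h g′ h′ _ _ g′≡g c≡1 c′≡1 M≡ =
      contradiction M≡ (opposite-signs {g} {h} {g′} {h′} (nat (suc (suc k))) (positive-h g h 2≤g c≡1) (subst Nonneg (sym g′≡g) (nat (suc (suc k))))
        (positive-h g′ h′ (subst (λ i → Nonneg (i - + 2)) (sym g′≡g) 2≤g) c′≡1))
      where
      2≤g : Nonneg (g - + 2)
      2≤g = nonneg (ℤ.i≤j⇒0≤j-i (+≤+ (ℕ.s≤s (ℕ.s≤s ℕ.z≤n))))

    ∣e∣ : ∀ {m e} (st : Step m e) → ∣ e ∣ ≡ ∣ Step.e₁ st ∣ ℕ.* ∣ Step.e₂ st ∣
    ∣e∣ st = trans (cong ∣_∣ (Step.e≡ st)) (ℤ.abs-* (Step.e₁ st) (Step.e₂ st))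

    e₁≢0 : ∀ {m e} (st : Step m e) → e ≢ 0ℤ → Step.e₁ st ≢ 0ℤ
    e₁≢0 st e≢0 e₁≡0 = e≢0 (trans (Step.e≡ st) (cong (_* Step.e₂ st) e₁≡0))

    e₁-smaller : ∀ {m e} (st : Step m e) → e ≢ 0ℤ → ∣ Step.e₂ st ∣ ≢ 1 → ∣ Step.e₁ st ∣ ℕ.< ∣ e ∣
    e₁-smaller {m} {e} st e≢0 ∣e₂∣≢1 = subst (∣ Step.e₁ st ∣ ℕ.<_) (sym (∣e∣ st)) (product-larger ∣ Step.e₁ st ∣ ∣ Step.e₂ st ∣
        (λ z → e₁≢0 st e≢0 (ℤ.∣i∣≡0⇒i≡0 z)) (λ z → e≢0 (ℤ.∣i∣≡0⇒i≡0 (trans (∣e∣ st) (trans (cong (∣ Step.e₁ st ∣ ℕ.*_) z) (ℕ.*-zeroʳ ∣ Step.e₁ st ∣))))) ∣e₂∣≢1)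
      where
      product-larger : ∀ m n → m ≢ 0 → n ≢ 0 → n ≢ 1 → m ℕ.< m ℕ.* n
      product-larger m 0 _ n≢0 _ = contradiction refl n≢0
      product-larger m 1 _ _ n≢1 = contradiction refl n≢1
      product-larger 0 (suc (suc n)) m≢0 _ _ = contradiction refl m≢0
      product-larger (suc m) (suc (suc n)) _ _ _ = ℕ.m<m*n (suc m) (suc (suc n)) (ℕ.s≤s (ℕ.s≤s ℕ.z≤n))

    stationary-steps : ∀ {m e} (st : Step m e) (st′ : Step (M st) (Step.e₁ st)) → e ≢ 0ℤ → ∣ Step.e₂ st ∣ ≡ 1 → ∣ Step.e₂ st′ ∣ ≡ 1 →
      Trivial (M st) (Step.g st)
    stationary-steps st st′ e≢0 u u′ = stationary g h g′ h′ 0≤g g≢0 g′≡g (trans c≡ (unit-square e₂ u)) (trans c′≡ (unit-square e₂′ u′)) m′≡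
      where
      open Step st
      open Step st′ using () renaming (g to g′; h to h′; e₁ to e₁′; e₂ to e₂′; g≡ to g′≡; c≡ to c′≡; e≡ to e′≡; m≡ to m′≡)
      g≢0 : g ≢ 0ℤ
      g≢0 g≡0 = e₁≢0 st e≢0 (square≡0 e₁ (trans (sym g≡) g≡0))
      interchange : ∀ a b → a * b * (a * b) ≡ a * a * (b * b)
      interchange = solve 2 (λ a b → a :* b :* (a :* b) := a :* a :* (b :* b))
      g′≡g : g′ ≡ g
      g′≡g = sym (trans g≡ (trans (cong₂ _*_ e′≡ e′≡) (trans (interchange e₁′ e₂′) (trans (cong (e₁′ * e₁′ *_) (unit-square e₂′ u′))
        (trans (ℤ.*-identityʳ _) (sym g′≡))))))

  -- From e = e₁e₂ the denominator drops unless e₂ = ±1. Halving permutes the torsion points and may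
  -- well be stationary, so two steps are inspected together: one of them lowers |e|, or both are
  -- stationary and `stationary` applies.
  trivial-solution : ∀ m e → e ≢ 0ℤ → Solution m e → m ≡ 0ℤ ⊎ m ≡ - (e * e)
  trivial-solution m e = go m e (<-wellFounded ∣ e ∣)
    where
    go : ∀ m e → Acc ℕ._<_ ∣ e ∣ → e ≢ 0ℤ → Solution m e → Trivial m (e * e)
    go m e (acc smaller) e≢0 sol = conclude st (trivial-next (∣ e₂ ∣ ℕ.≟ 1))
      where
      st = make-step m e e≢0 sol
      open Step st
      st′ = make-step (M st) e₁ (e₁≢0 st e≢0) (next st)
      descend : Trivial (M st) (e₁ * e₁) → Trivial (M st) g
      descend = subst (Trivial (M st)) (sym g≡)
      trivial-next : Dec (∣ e₂ ∣ ≡ 1) → Trivial (M st) g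
      trivial-next (no e₂≢1) = descend (go (M st) e₁ (smaller (e₁-smaller st e≢0 e₂≢1)) (e₁≢0 st e≢0) (next st))
      trivial-next (yes e₂≡1) with ∣ Step.e₂ st′ ∣ ℕ.≟ 1
      ... | yes e₂′≡1 = stationary-steps st st′ e≢0 e₂≡1 e₂′≡1
      ... | no e₂′≢1 = descend (conclude st′ (subst (Trivial (M st′)) (sym (Step.g≡ st′))
              (go (M st′) (Step.e₁ st′) (smaller (ℕ.<-≤-trans (e₁-smaller st′ (e₁≢0 st e≢0) e₂′≢1) (ℕ.≤-reflexive ∣e₁∣≡∣e∣)))
                (e₁≢0 st′ (e₁≢0 st e≢0)) (next st′))))
        where
        ∣e₁∣≡∣e∣ : ∣ e₁ ∣ ≡ ∣ e ∣
        ∣e₁∣≡∣e∣ = sym (trans (∣e∣ st) (trans (cong (∣ e₁ ∣ ℕ.*_) e₂≡1) (ℕ.*-identityʳ ∣ e₁ ∣)))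

  private
    abstract
      shift-cofactor : ∀ g m → let h = - (m + g) in
        g * g * g - + 4 * (g * h * h) - + 4 * (h * h * h) ≡ g * g * g + + 4 * (g * g * m) + + 8 * (g * m * m) + + 4 * (m * m * m)
      shift-cofactor = solve 2 (λ g m → let h = :- (m :+ g) in
        g :* g :* g :- con (+ 4) :* (g :* h :* h) :- con (+ 4) :* (h :* h :* h)
        := g :* g :* g :+ con (+ 4) :* (g :* g :* m) :+ con (+ 8) :* (g :* m :* m) :+ con (+ 4) :* (m :* m :* m))

      shift-bézout : ∀ s t g m → s * g + t * m ≡ 1ℤ → (s - t) * g + - t * - (m + g) ≡ 1ℤ
      shift-bézout s t g m e = trans (solve 4 (λ s t g m → (s :- t) :* g :+ :- t :* :- (m :+ g) := s :* g :+ t :* m) s t g m) e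

      root-bézout : ∀ s t m e₁ → s * (e₁ * e₁) + t * m ≡ 1ℤ → t * m + s * e₁ * e₁ ≡ 1ℤ
      root-bézout s t m e₁ e = trans (solve 4 (λ s t m e₁ → t :* m :+ s :* e₁ :* e₁ := s :* (e₁ :* e₁) :+ t :* m) s t m e₁) e

  abstract
    -- This is the homogeneous quartic model, in which g need not be a square beforehand.
    -- `square-factors` with h = -(m + g) splits it into a square g = e₁² and the cubic model.
    elliptic-integer : ∀ g m Y → 0ℤ ≤ g → g ≢ 0ℤ → Coprime g m →
      g * (g * g * g + + 4 * (g * g * m) + + 8 * (g * m * m) + + 4 * (m * m * m)) ≡ Y * Y → m ≡ 0ℤ ⊎ m ≡ - g
    elliptic-integer g m Y 0≤g g≢0 (s , t , sg+tm≡1) eq = subst (λ n → m ≡ 0ℤ ⊎ m ≡ - n) (sym g≡)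
        (trivial-solution m e₁ (λ e₁≡0 → g≢0 (trans g≡ (cong₂ _*_ e₁≡0 e₁≡0)))
          (solution (t , s * e₁ , root-bézout s t m e₁ (trans (cong (λ n → s * n + t * m) (sym g≡)) sg+tm≡1)) e₂
            (subst (λ n → n * n * n + + 4 * (n * n * m) + + 8 * (n * m * m) + + 4 * (m * m * m) ≡ e₂ * e₂) g≡ (trans (sym (shift-cofactor g m)) c≡))))
      where
      open SquareFactors (square-factors g (- (m + g)) Y 0≤g g≢0 (s - t , - t , shift-bézout s t g m sg+tm≡1)
        (trans (sym eq) (cong (g *_) (sym (shift-cofactor g m)))))

-- Factorisation lemmas for descents on quartics.

module Quartics where
  open import Data.Integer using (ℤ; +_; _+_; _*_; -_; _-_; 0ℤ; 1ℤ; -1ℤ; _≤_)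
  import Data.Integer.Properties as ℤ
  open import Data.Integer.DivMod using (_/_; _%_; a≡a%n+[a/n]*n; n%d<d)
  open IntegerIdentity
  open import Data.Nat.Base as ℕ using (ℕ; suc)
  import Data.Nat.Properties as ℕ
  open import Data.Product using (_,_; _×_; ∃-syntax)
  open import Data.Sum using (_⊎_; inj₁; inj₂)
  open import Relation.Binary.PropositionalEquality
  open import Relation.Nullary using (contradiction)
  open IntegerOrder
  open IntegerCoprime
  open EllipticSquares using (Odd; odd≢even)
  open EllipticDescent using (parity)
  open LinearCombination ℤ.+-*-isCommutativeRing

  Even : ℤ → Set
  Even i = ∃[ k ] i ≡ k * + 2

  private
    abstract
      four-numbers-eq : ∀ g s t y η → g * s * y ≡ g * t * η → g * (s * y - t * η) ≡ 0ℤ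
      four-numbers-eq g s t y η e = combine₁ 1ℤ e (solve 5 (λ g s t y η → g :* (s :* y :- t :* η) :- con 0ℤ := con 1ℤ :* (g :* s :* y :- g :* t :* η)) g s t y η)

      bézout-cofactor : ∀ g s t i′ j′ → s * (i′ * g) + t * (j′ * g) ≡ g → g * (s * i′ + t * j′ - 1ℤ) ≡ 0ℤ
      bézout-cofactor g s t i′ j′ e = combine₁ 1ℤ e (solve 5 (λ g s t i′ j′ →
          g :* (s :* i′ :+ t :* j′ :- con 1ℤ) :- con 0ℤ := con 1ℤ :* (s :* (i′ :* g) :+ t :* (j′ :* g) :- g)) g s t i′ j′)

    cancel-≡0 : ∀ g i → g ≢ 0ℤ → g * i ≡ 0ℤ → i ≡ 0ℤ
    cancel-≡0 g i g≢0 gi≡0 with ℤ.i*j≡0⇒i≡0∨j≡0 g gi≡0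
    ... | inj₁ g≡0 = contradiction g≡0 g≢0
    ... | inj₂ i≡0 = i≡0

  abstract
    coprime-parts : ∀ i j → i ≢ 0ℤ → ∃[ g ] ∃[ i′ ] ∃[ j′ ] i ≡ i′ * g × j ≡ j′ * g × Coprime i′ j′ × g ≢ 0ℤ
    coprime-parts i j i≢0 = let g , (i′ , i≡) , (j′ , j≡) , s , t , eq = bézout i j
                                g≢0 : + g ≢ 0ℤ
                                g≢0 g≡0 = i≢0 (trans i≡ (trans (cong (i′ *_) g≡0) (ℤ.*-zeroʳ i′)))
      in + g , i′ , j′ , i≡ , j≡ ,
         (s , t , ℤ.i-j≡0⇒i≡j _ 1ℤ (cancel-≡0 (+ g) (s * i′ + t * j′ - 1ℤ) g≢0
           (bézout-cofactor (+ g) s t i′ j′ (trans (cong₂ (λ i j → s * i + t * j) (sym i≡) (sym j≡)) eq)))) ,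
         g≢0

    -- The number a is a greatest common divisor of x and ξ; after its removal Gauss's lemma
    -- produces d.
    four-numbers : ∀ x y ξ η → x ≢ 0ℤ → x * y ≡ ξ * η →
      ∃[ a ] ∃[ b ] ∃[ c ] ∃[ d ] x ≡ a * b × y ≡ c * d × ξ ≡ a * c × η ≡ b * d × Coprime b c
    four-numbers x y ξ η x≢0 xy≡ξη =
      let g , s , t , x≡ , ξ≡ , s⊥t , g≢0 = coprime-parts x ξ x≢0
          sy≡tη : s * y ≡ t * η
          sy≡tη = ℤ.i-j≡0⇒i≡j (s * y) (t * η) (cancel-≡0 g (s * y - t * η) g≢0 (four-numbers-eq g s t y η
            (trans (cong (_* y) (trans (ℤ.*-comm g s) (sym x≡))) (trans xy≡ξη (cong (_* η) (trans ξ≡ (ℤ.*-comm t g)))))))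
          u , η≡us = gauss {s} {t} {η} y s⊥t (trans (sym sy≡tη) (ℤ.*-comm s y))
          s≢0 : s ≢ 0ℤ
          s≢0 s≡0 = x≢0 (trans x≡ (cong (_* g) s≡0))
      in g , s , t , u , trans x≡ (ℤ.*-comm s g) ,
         ℤ.i-j≡0⇒i≡j y (t * u) (cancel-≡0 s (y - t * u) s≢0 (last s y t u η sy≡tη η≡us)) ,
         trans ξ≡ (ℤ.*-comm t g) , trans η≡us (ℤ.*-comm u s) , s⊥t
      where
      last : ∀ s y t u η → s * y ≡ t * η → η ≡ u * s → s * (y - t * u) ≡ 0ℤ
      last s y t u η e e′ = combine₂ 1ℤ t e e′ (solve 5 (λ s y t u η → s :* (y :- t :* u) :- con 0ℤ := con 1ℤ :* (s :* y :- t :* η) :+ t :* (η :- u :* s)) s y t u η)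

    coprime-add : ∀ {x w} k → Coprime x w → Coprime x (w + k * x)
    coprime-add {x} {w} k (s , t , e) = s - t * k , t , trans (solve 5 (λ x w k s t → (s :- t :* k) :* x :+ t :* (w :+ k :* x) := s :* x :+ t :* w) x w k s t) e

    -- After division by the common divisor of D and Z, the square d² divides z² and is coprime to
    -- it, so d² = 1.
    square-quotient : ∀ D Q Z → D ≢ 0ℤ → D * D * Q ≡ Z * Z → ∃[ w ] Q ≡ w * w
    square-quotient D Q Z D≢0 eq =
      let g , d , z , D≡ , Z≡ , d⊥z , g≢0 = coprime-parts D Z D≢0
          ddQ≡zz : d * d * Q ≡ z * z
          ddQ≡zz = ℤ.i-j≡0⇒i≡j (d * d * Q) (z * z) (cancel-≡0 g (d * d * Q - z * z) g≢0 (cancel-≡0 g (g * (d * d * Q - z * z)) g≢0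
            (reduce g d z Q (trans (cong (λ i → i * i * Q) (sym D≡)) (trans eq (cong (λ i → i * i) Z≡))))))
          zz⊥dd = coprime-*ˡ {z} {z} {d * d} (coprime-*ʳ {z} {d} {d} (coprime-sym d⊥z) (coprime-sym d⊥z)) (coprime-*ʳ {z} {d} {d} (coprime-sym d⊥z) (coprime-sym d⊥z))
          u , e = coprime-divisor (d * d) Q 1ℤ zz⊥dd (trans (sym ddQ≡zz) (ℤ.*-comm (d * d) Q)) (sym (ℤ.*-identityˡ (d * d)))
          dd≡1 = positive (d * d) (unit u (d * d) e) (0≤-square d)
      in z , trans (sym (ℤ.*-identityˡ Q)) (trans (cong (_* Q) (sym dd≡1)) ddQ≡zz)
      where
      positive : ∀ i → i ≡ 1ℤ ⊎ i ≡ -1ℤ → 0ℤ ≤ i → i ≡ 1ℤ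
      positive i (inj₁ i≡1) _ = i≡1
      positive .(-1ℤ) (inj₂ refl) ()
      reduce : ∀ g d z Q → d * g * (d * g) * Q ≡ z * g * (z * g) → g * (g * (d * d * Q - z * z)) ≡ 0ℤ
      reduce g d z Q e = combine₁ 1ℤ e (solve 4 (λ g d z Q →
          g :* (g :* (d :* d :* Q :- z :* z)) :- con 0ℤ := con 1ℤ :* (d :* g :* (d :* g) :* Q :- z :* g :* (z :* g))) g d z Q)

  odd-form : ∀ {i} → Odd i → ∃[ k ] i ≡ k * + 2 + 1ℤ
  odd-form {i} i-odd with i % + 2 | a≡a%n+[a/n]*n i (+ 2) | n%d<d i (+ 2)
  ... | 0 | eq | _ = contradiction (trans eq (ℤ.+-identityˡ _)) (odd≢even (i / + 2) i-odd)
  ... | 1 | eq | _ = i / + 2 , trans eq (ℤ.+-comm 1ℤ (i / + 2 * + 2))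
  ... | suc (suc _) | _ | ℕ.s≤s (ℕ.s≤s ())

  abstract
    sum-of-odd-squares : ∀ i k j → (i * + 2 + 1ℤ) * (i * + 2 + 1ℤ) + (k * + 2 + 1ℤ) * (k * + 2 + 1ℤ) ≡ j * + 4 →
      1ℤ ≡ (j - (i * i + i + k * k + k)) * + 2
    sum-of-odd-squares i k j e = ℤ.*-cancelʳ-≡ 1ℤ ((j - (i * i + i + k * k + k)) * + 2) (+ 2) (combine₁ 1ℤ e (solve 3 (λ i k j →
        con 1ℤ :* con (+ 2) :- (j :- (i :* i :+ i :+ k :* k :+ k)) :* con (+ 2) :* con (+ 2)
        := con 1ℤ :* ((i :* con (+ 2) :+ con 1ℤ) :* (i :* con (+ 2) :+ con 1ℤ) :+ (k :* con (+ 2) :+ con 1ℤ) :* (k :* con (+ 2) :+ con 1ℤ) :- j :* con (+ 4))) i k j))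

    half-difference : ∀ i k C → (k * + 2 + 1ℤ) * (k * + 2 + 1ℤ) - (i * + 2 + 1ℤ) * (i * + 2 + 1ℤ) ≡ + 4 * (C * C) →
      (k - i) * (k + i + 1ℤ) ≡ C * C
    half-difference i k C e = ℤ.*-cancelʳ-≡ ((k - i) * (k + i + 1ℤ)) (C * C) (+ 4) (combine₁ 1ℤ e (solve 3 (λ i k C →
        (k :- i) :* (k :+ i :+ con 1ℤ) :* con (+ 4) :- C :* C :* con (+ 4)
        := con 1ℤ :* ((k :* con (+ 2) :+ con 1ℤ) :* (k :* con (+ 2) :+ con 1ℤ) :- (i :* con (+ 2) :+ con 1ℤ) :* (i :* con (+ 2) :+ con 1ℤ) :- con (+ 4) :* (C :* C))) i k C))

    half-sum : ∀ i k δ g h → k - i ≡ δ * (g * g) → k + i + 1ℤ ≡ δ * (h * h) → k * + 2 + 1ℤ ≡ (g * g + h * h) * δ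
    half-sum i k δ g h e e′ = combine₂ 1ℤ 1ℤ e e′ (solve 5 (λ i k δ g h →
        k :* con (+ 2) :+ con 1ℤ :- (g :* g :+ h :* h) :* δ
        := con 1ℤ :* (k :- i :- δ :* (g :* g)) :+ con 1ℤ :* (k :+ i :+ con 1ℤ :- δ :* (h :* h))) i k δ g h)

    half-minus : ∀ i k δ g h → k - i ≡ δ * (g * g) → k + i + 1ℤ ≡ δ * (h * h) → i * + 2 + 1ℤ ≡ (h * h - g * g) * δ
    half-minus i k δ g h e e′ = combine₂ -1ℤ 1ℤ e e′ (solve 5 (λ i k δ g h →
        i :* con (+ 2) :+ con 1ℤ :- (h :* h :- g :* g) :* δ
        := con -1ℤ :* (k :- i :- δ :* (g :* g)) :+ con 1ℤ :* (k :+ i :+ con 1ℤ :- δ :* (h :* h))) i k δ g h)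

    bézout-gh : ∀ s t δ g h → s * ((g * g + h * h) * δ) + t * (δ * (g * h)) ≡ 1ℤ → (s * δ * g + t * δ * h) * g + s * δ * h * h ≡ 1ℤ
    bézout-gh s t δ g h e = trans (solve 5 (λ s t δ g h →
        (s :* δ :* g :+ t :* δ :* h) :* g :+ s :* δ :* h :* h
        := s :* ((g :* g :+ h :* h) :* δ) :+ t :* (δ :* (g :* h))) s t δ g h) e

    both-even : ∀ a b δ → (b * + 2 * (b * + 2) - a * + 2 * (a * + 2)) * δ ≡ (b * b - a * a) * δ * + 2 * + 2
    both-even = solve 3 (λ a b δ →
      (b :* con (+ 2) :* (b :* con (+ 2)) :- a :* con (+ 2) :* (a :* con (+ 2))) :* δ
      := (b :* b :- a :* a) :* δ :* con (+ 2) :* con (+ 2))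
    both-odd : ∀ a b δ → ((b * + 2 + 1ℤ) * (b * + 2 + 1ℤ) - (a * + 2 + 1ℤ) * (a * + 2 + 1ℤ)) * δ ≡ (b * b - a * a + b - a) * δ * + 2 * + 2
    both-odd = solve 3 (λ a b δ →
      ((b :* con (+ 2) :+ con 1ℤ) :* (b :* con (+ 2) :+ con 1ℤ) :- (a :* con (+ 2) :+ con 1ℤ) :* (a :* con (+ 2) :+ con 1ℤ)) :* δ
      := (b :* b :- a :* a :+ b :- a) :* δ :* con (+ 2) :* con (+ 2))

  -- Two odd squares add up to 2 modulo 4.
  odd+odd : ∀ {a b} j → Odd a → Odd b → a * a + b * b ≢ j * + 4
  odd+odd j a-odd b-odd e with odd-form a-odd | odd-form b-odd
  ... | i , refl | k , refl = odd≢even (j - (i * i + i + k * k + k)) (1ℤ , 0ℤ , refl) (sum-of-odd-squares i k j e)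

  sign : ∀ u δ → u * δ ≡ 1ℤ → δ * δ ≡ 1ℤ
  sign u δ e with unit u δ e
  ... | inj₁ refl = refl
  ... | inj₂ refl = refl

  OppositeParity : ℤ → ℤ → Set
  OppositeParity g h = (Odd g × Even h) ⊎ (Even g × Odd h)

  opposite-parity : ∀ g h δ → Odd ((h * h - g * g) * δ) → OppositeParity g h
  opposite-parity g h δ odd with parity g | parity h
  ... | inj₁ g-even | inj₂ h-odd = inj₂ (g-even , h-odd)
  ... | inj₂ g-odd | inj₁ h-even = inj₁ (g-odd , h-even)
  ... | inj₁ (a , refl) | inj₁ (b , refl) = contradiction (both-even a b δ) (odd≢even ((b * b - a * a) * δ * + 2) odd)
  ... | inj₂ g-odd | inj₂ h-odd with odd-form g-odd | odd-form h-odd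
  ...   | a , refl | b , refl = contradiction (both-odd a b δ) (odd≢even ((b * b - a * a + b - a) * δ * + 2) odd)

  -- The classical parametrisation of the Pythagorean triple A² + (2C)² = B², with a sign δ.
  record DifferenceOfSquares (A B C : ℤ) : Set where
    constructor differenceOfSquares
    field
      g h δ : ℤ
      δδ≡1 : δ * δ ≡ 1ℤ
      A≡ : A ≡ (h * h - g * g) * δ
      B≡ : B ≡ (g * g + h * h) * δ
      C≡ : C ≡ δ * (g * h)
      g⊥h : Coprime g h
      opposite : OppositeParity g h

  abstract
    -- The halves (B - A)/2 and (B + A)/2 are integers with product C², so the rank-one lemma
    -- applies. The common factor δ divides the coprime B and C and is a sign.
    difference-of-squares : ∀ {A B C} → Odd A → Odd B → B * B - A * A ≡ + 4 * (C * C) → Coprime B C → DifferenceOfSquares A B C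
    difference-of-squares {A} {B} {C} A-odd B-odd eq B⊥C@(s , t , e) =
      let i , A≡ = odd-form A-odd
          k , B≡ = odd-form B-odd
          δ , g , h , α≡ , β≡ , C≡ = rankOne (k - i) (k + i + 1ℤ) C (half-difference i k C (trans (cong₂ (λ B A → B * B - A * A) (sym B≡) (sym A≡)) eq))
          B≡′ = trans B≡ (half-sum i k δ g h α≡ β≡)
          A≡′ = trans A≡ (half-minus i k δ g h α≡ β≡)
          u , uδ≡1 = coprime-divisor δ (g * g + h * h) (g * h) B⊥C B≡′ (trans C≡ (ℤ.*-comm δ (g * h)))
      in differenceOfSquares g h δ (sign u δ uδ≡1) A≡′ B≡′ C≡
           (s * δ * g + t * δ * h , s * δ * h , bézout-gh s t δ g h (trans (cong₂ (λ B C → s * B + t * C) (sym B≡′) (sym C≡)) e))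
           (opposite-parity g h δ (subst Odd A≡′ A-odd))

-- The 2-coverings of x⁴ ± x²y² + y⁴ = z².

module QuarticDescent where
  open import Data.Integer using (ℤ; +_; -[1+_]; _+_; _*_; -_; _-_; 0ℤ; 1ℤ; -1ℤ; ∣_∣; _≤_; _<_)
  import Data.Integer.Properties as ℤ
  open IntegerIdentity
  open import Data.Nat.Base as ℕ using (ℕ; suc)
  import Data.Nat.Properties as ℕ
  open import Data.Product using (_,_; _×_; ∃-syntax)
  open import Data.Sum using (_⊎_; inj₁; inj₂; [_,_]′)
  open import Relation.Binary.PropositionalEquality
  open import Relation.Nullary using (contradiction)
  open IntegerOrder
  open IntegerCoprime
  open EllipticSquares using (Odd; odd≢even)
  open Quartics
  open LinearCombination ℤ.+-*-isCommutativeRing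

  odd-factorˡ : ∀ {a b} → Odd (a * b) → Odd a
  odd-factorˡ {a} {b} (s , t , e) = s * b , t , trans (cong (_+ t * + 2) (solve 3 (λ s a b → s :* b :* a := s :* (a :* b)) s a b)) e

  odd-factorʳ : ∀ {a b} → Odd (a * b) → Odd b
  odd-factorʳ {a} {b} odd = odd-factorˡ {b} {a} (subst Odd (ℤ.*-comm a b) odd)

  abstract
    factor-coprime : ∀ s t a b c d → s * (a * b) + t * (c * d) ≡ 1ℤ → s * b * a + t * c * d ≡ 1ℤ
    factor-coprime s t a b c d e = trans (solve 6 (λ s t a b c d → s :* b :* a :+ t :* c :* d := s :* (a :* b) :+ t :* (c :* d)) s t a b c d) e

    four-numbers-σ : ∀ σ a b c d → a * b * (a * b) + + 4 * σ * (c * d * (c * d)) ≡ σ * (a * c * (a * c)) + b * d * (b * d) →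
      a * a * (b * b - σ * (c * c)) ≡ (b * b - + 4 * σ * (c * c)) * (d * d)
    four-numbers-σ σ a b c d e = combine₁ 1ℤ e (solve 5 (λ σ a b c d →
        a :* a :* (b :* b :- σ :* (c :* c)) :- (b :* b :- con (+ 4) :* σ :* (c :* c)) :* (d :* d)
        := con 1ℤ :* (a :* b :* (a :* b) :+ con (+ 4) :* σ :* (c :* d :* (c :* d)) :- (σ :* (a :* c :* (a :* c)) :+ b :* d :* (b :* d)))) σ a b c d)

    cancel-dd : ∀ a b c d k σ → a * a * (b * b - σ * (c * c)) ≡ (b * b - + 4 * σ * (c * c)) * (d * d) → b * b - σ * (c * c) ≡ k * (d * d) →
      d * d * (b * b - + 4 * σ * (c * c) - k * (a * a)) ≡ 0ℤ
    cancel-dd a b c d k σ e e′ = combine₂ -1ℤ (a * a) e e′ (solve 6 (λ a b c d k σ →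
        d :* d :* (b :* b :- con (+ 4) :* σ :* (c :* c) :- k :* (a :* a)) :- con 0ℤ
        := con -1ℤ :* (a :* a :* (b :* b :- σ :* (c :* c)) :- (b :* b :- con (+ 4) :* σ :* (c :* c)) :* (d :* d)) :+ a :* a :* (b :* b :- σ :* (c :* c) :- k :* (d :* d))) a b c d k σ)

    -- Eliminating b² or c² from the two equations shows that k divides 3b² and 3σc², while b² and
    -- c² are coprime.
    k∣3 : ∀ s t σ a b c d k → s * (b * b) + t * (c * c) ≡ 1ℤ → σ * σ ≡ 1ℤ → b * b - σ * (c * c) ≡ k * (d * d) →
      b * b - + 4 * σ * (c * c) ≡ k * (a * a) → (s * (+ 4 * (d * d) - a * a) + t * σ * (d * d - a * a)) * k ≡ + 3
    k∣3 s t σ a b c d k e σσ e₂ e₁ = combine₃ (+ 3) (+ 3 * t * (c * c)) 1ℤ e σσ (k∣3′ s t σ a b c d k e₂ e₁) (identity s t σ a b c d k)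
      where
      k∣3′ : ∀ s t σ a b c d k → b * b - σ * (c * c) ≡ k * (d * d) → b * b - + 4 * σ * (c * c) ≡ k * (a * a) →
        (s * (+ 4 * (d * d) - a * a) + t * σ * (d * d - a * a)) * k ≡ s * (+ 3 * (b * b)) + t * σ * (+ 3 * σ * (c * c))
      k∣3′ s t σ a b c d k e₂ e₁ = combine₂ (- (+ 4 * s + t * σ)) (s + t * σ) e₂ e₁ (solve 8 (λ s t σ a b c d k →
          (s :* (con (+ 4) :* (d :* d) :- a :* a) :+ t :* σ :* (d :* d :- a :* a)) :* k :- (s :* (con (+ 3) :* (b :* b)) :+ t :* σ :* (con (+ 3) :* σ :* (c :* c)))
          := :- (con (+ 4) :* s :+ t :* σ) :* (b :* b :- σ :* (c :* c) :- k :* (d :* d)) :+ (s :+ t :* σ) :* (b :* b :- con (+ 4) :* σ :* (c :* c) :- k :* (a :* a))) s t σ a b c d k)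
      identity : ∀ s t σ a b c d k → let u = (s * (+ 4 * (d * d) - a * a) + t * σ * (d * d - a * a)) * k in
        u - + 3 ≡ + 3 * (s * (b * b) + t * (c * c) - 1ℤ) + + 3 * t * (c * c) * (σ * σ - 1ℤ)
          + 1ℤ * (u - (s * (+ 3 * (b * b)) + t * σ * (+ 3 * σ * (c * c))))
      identity = solve 8 (λ s t σ a b c d k → let u = (s :* (con (+ 4) :* (d :* d) :- a :* a) :+ t :* σ :* (d :* d :- a :* a)) :* k in
        u :- con (+ 3)
        := con (+ 3) :* (s :* (b :* b) :+ t :* (c :* c) :- con 1ℤ) :+ con (+ 3) :* t :* (c :* c) :* (σ :* σ :- con 1ℤ) :+ con 1ℤ :* (u :- (s :* (con (+ 3) :* (b :* b)) :+ t :* σ :* (con (+ 3) :* σ :* (c :* c)))))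

    k≡-1 : ∀ σ a b c → b * b - + 4 * σ * (c * c) ≡ -1ℤ * (a * a) → a * a + b * b ≡ σ * (c * c) * + 4
    k≡-1 σ a b c e = combine₁ 1ℤ e (solve 4 (λ σ a b c →
        a :* a :+ b :* b :- σ :* (c :* c) :* con (+ 4)
        := con 1ℤ :* (b :* b :- con (+ 4) :* σ :* (c :* c) :- con -1ℤ :* (a :* a))) σ a b c)
    k≡3 : ∀ σ a b c → b * b - + 4 * σ * (c * c) ≡ + 3 * (a * a) → a * a + b * b ≡ (a * a + σ * (c * c)) * + 4
    k≡3 σ a b c e = combine₁ 1ℤ e (solve 4 (λ σ a b c →
        a :* a :+ b :* b :- (a :* a :+ σ :* (c :* c)) :* con (+ 4)
        := con 1ℤ :* (b :* b :- con (+ 4) :* σ :* (c :* c) :- con (+ 3) :* (a :* a))) σ a b c)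

  divisor-of-3 : ∀ u k → u * k ≡ + 3 → k ≡ 1ℤ ⊎ k ≡ -1ℤ ⊎ k ≡ + 3 ⊎ k ≡ - + 3
  divisor-of-3 u k e = cases k (natural ∣ u ∣ ∣ k ∣ (trans (sym (ℤ.abs-* u k)) (cong ∣_∣ e)))
    where
    natural : ∀ m n → m ℕ.* n ≡ 3 → n ≡ 1 ⊎ n ≡ 3
    natural m 0 e = contradiction (trans (sym (ℕ.*-zeroʳ m)) e) λ ()
    natural m 1 _ = inj₁ refl
    natural 0 2 ()
    natural 1 2 ()
    natural (suc (suc m)) 2 ()
    natural m 3 _ = inj₂ refl
    natural (suc m) (suc (suc (suc (suc n)))) ()
    cases : ∀ k → ∣ k ∣ ≡ 1 ⊎ ∣ k ∣ ≡ 3 → k ≡ 1ℤ ⊎ k ≡ -1ℤ ⊎ k ≡ + 3 ⊎ k ≡ - + 3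
    cases (+ .1) (inj₁ refl) = inj₁ refl
    cases -[1+ 0 ] (inj₁ refl) = inj₂ (inj₁ refl)
    cases (+ .3) (inj₂ refl) = inj₂ (inj₂ (inj₁ refl))
    cases -[1+ 2 ] (inj₂ refl) = inj₂ (inj₂ (inj₂ refl))

  -- The 2-descent on x⁴ + σx²y² + y⁴ = z² leaves the two values k = 1 and k = -3.
  record Torsor (σ x y₁ : ℤ) : Set where
    constructor torsor
    field
      a b c d k : ℤ
      k≡ : k ≡ 1ℤ ⊎ k ≡ - + 3
      x≡ : x ≡ a * b
      y≡ : y₁ ≡ c * d
      b⊥c : Coprime b c
      a⊥d : Coprime a d
      a-odd : Odd a
      b-odd : Odd b
      eq₁ : b * b - + 4 * σ * (c * c) ≡ k * (a * a)
      eq₂ : b * b - σ * (c * c) ≡ k * (d * d)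

  abstract
    -- In the four numbers the relation reads a²(b² - σc²) = d²(b² - 4σc²) with a and d coprime, so
    -- the brackets are kd² and ka². Here k divides 3, and for k = -1 and k = 3 the sum a² + b² of
    -- two odd squares would be divisible by 4.
    make-torsor : ∀ σ x y₁ ξ η → σ * σ ≡ 1ℤ → Odd x → Coprime x y₁ → y₁ ≢ 0ℤ → x * y₁ ≡ ξ * η →
      x * x + + 4 * σ * (y₁ * y₁) ≡ σ * (ξ * ξ) + η * η → Torsor σ x y₁
    make-torsor σ x y₁ ξ η σσ x-odd (s , t , e) y₁≢0 xy≡ξη sum =
      let a , b , c , d , x≡ , y≡ , ξ≡ , η≡ , b⊥c = four-numbers x y₁ ξ η (odd≢even 0ℤ x-odd) xy≡ξη
          a⊥d : Coprime a d
          a⊥d = s * b , t * c , factor-coprime s t a b c d (trans (cong₂ (λ x y → s * x + t * y) (sym x≡) (sym y≡)) e)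
          ab-odd = subst Odd x≡ x-odd
          relation = four-numbers-σ σ a b c d (trans (cong₂ (λ x y → x * x + + 4 * σ * (y * y)) (sym x≡) (sym y≡))
            (trans sum (cong₂ (λ ξ η → σ * (ξ * ξ) + η * η) ξ≡ η≡)))
          d≢0 : d ≢ 0ℤ
          d≢0 d≡0 = y₁≢0 (trans y≡ (trans (cong (c *_) d≡0) (ℤ.*-zeroʳ c)))
          dd⊥aa = coprime-*ˡ {d} {d} {a * a} (coprime-*ʳ {d} {a} {a} (coprime-sym a⊥d) (coprime-sym a⊥d)) (coprime-*ʳ {d} {a} {a} (coprime-sym a⊥d) (coprime-sym a⊥d))
          k , eq₂ = gauss {d * d} {a * a} (b * b - + 4 * σ * (c * c)) dd⊥aa relation
          eq₁ = ℤ.i-j≡0⇒i≡j (b * b - + 4 * σ * (c * c)) (k * (a * a)) (nonzero-product d d≢0 (b * b - + 4 * σ * (c * c) - k * (a * a)) (cancel-dd a b c d k σ relation eq₂))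
          s′ , t′ , e′ = coprime-*ˡ {b} {b} {c * c} (coprime-*ʳ {b} {c} {c} b⊥c b⊥c) (coprime-*ʳ {b} {c} {c} b⊥c b⊥c)
      in torsor a b c d k (select a b c d k (odd-factorˡ {a} {b} ab-odd) (odd-factorʳ {a} {b} ab-odd) eq₁
           (divisor-of-3 (s′ * (+ 4 * (d * d) - a * a) + t′ * σ * (d * d - a * a)) k (k∣3 s′ t′ σ a b c d k e′ σσ eq₂ eq₁)))
           x≡ y≡ b⊥c a⊥d (odd-factorˡ {a} {b} ab-odd) (odd-factorʳ {a} {b} ab-odd) eq₁ eq₂
      where
      nonzero-product : ∀ d → d ≢ 0ℤ → ∀ i → d * d * i ≡ 0ℤ → i ≡ 0ℤ
      nonzero-product d d≢0 i e with ℤ.i*j≡0⇒i≡0∨j≡0 (d * d) e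
      ... | inj₂ i≡0 = i≡0
      ... | inj₁ dd≡0 = contradiction ([ (λ z → z) , (λ z → z) ]′ (ℤ.i*j≡0⇒i≡0∨j≡0 d dd≡0)) d≢0
      select : ∀ a b c (d : ℤ) k → Odd a → Odd b → b * b - + 4 * σ * (c * c) ≡ k * (a * a) →
        k ≡ 1ℤ ⊎ k ≡ -1ℤ ⊎ k ≡ + 3 ⊎ k ≡ - + 3 → k ≡ 1ℤ ⊎ k ≡ - + 3
      select a b c d k _ _ _ (inj₁ k≡1) = inj₁ k≡1
      select a b c d k a-odd b-odd e (inj₂ (inj₁ refl)) = contradiction (k≡-1 σ a b c e) (odd+odd (σ * (c * c)) a-odd b-odd)
      select a b c d k a-odd b-odd e (inj₂ (inj₂ (inj₁ refl))) = contradiction (k≡3 σ a b c e) (odd+odd (a * a + σ * (c * c)) a-odd b-odd)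
      select a b c d k _ _ _ (inj₂ (inj₂ (inj₂ k≡-3))) = inj₂ k≡-3

  abstract
    k≡1 : ∀ σ a b c → b * b - + 4 * σ * (c * c) ≡ 1ℤ * (a * a) → a * a ≡ b * b - + 4 * σ * (c * c)
    k≡1 σ a b c e = trans (sym (ℤ.*-identityˡ (a * a))) (sym e)

    ⁺1 : ∀ a b c → b * b - + 4 * 1ℤ * (c * c) ≡ 1ℤ * (a * a) → b * b - a * a ≡ + 4 * (c * c)
    ⁺1 a b c e = combine₁ 1ℤ e (solve 3 (λ a b c →
        b :* b :- a :* a :- con (+ 4) :* (c :* c)
        := con 1ℤ :* (b :* b :- con (+ 4) :* con 1ℤ :* (c :* c) :- con 1ℤ :* (a :* a))) a b c)
    ⁺1′ : ∀ b c d → b * b - 1ℤ * (c * c) ≡ 1ℤ * (d * d) → d * d ≡ b * b - c * c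
    ⁺1′ b c d e = combine₁ -1ℤ e (solve 3 (λ b c d → d :* d :- (b :* b :- c :* c) := con -1ℤ :* (b :* b :- con 1ℤ :* (c :* c) :- con 1ℤ :* (d :* d))) b c d)
    ⁺3 : ∀ a b c d → b * b - + 4 * 1ℤ * (c * c) ≡ - + 3 * (a * a) → b * b - 1ℤ * (c * c) ≡ - + 3 * (d * d) → a * a - b * b ≡ + 4 * (d * d)
    ⁺3 a b c d e e′ = ℤ.*-cancelʳ-≡ (a * a - b * b) (+ 4 * (d * d)) (+ 3) (combine₂ 1ℤ (- + 4) e e′ (solve 4 (λ a b c d →
        (a :* a :- b :* b) :* con (+ 3) :- con (+ 4) :* (d :* d) :* con (+ 3)
        := con 1ℤ :* (b :* b :- con (+ 4) :* con 1ℤ :* (c :* c) :- :- con (+ 3) :* (a :* a)) :+ :- con (+ 4) :* (b :* b :- con 1ℤ :* (c :* c) :- :- con (+ 3) :* (d :* d))) a b c d))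
    ⁺3′ : ∀ a b c d → b * b - + 4 * 1ℤ * (c * c) ≡ - + 3 * (a * a) → b * b - 1ℤ * (c * c) ≡ - + 3 * (d * d) → c * c ≡ a * a - d * d
    ⁺3′ a b c d e e′ = ℤ.*-cancelʳ-≡ (c * c) (a * a - d * d) (+ 3) (combine₂ -1ℤ 1ℤ e e′ (solve 4 (λ a b c d →
        c :* c :* con (+ 3) :- (a :* a :- d :* d) :* con (+ 3)
        := con -1ℤ :* (b :* b :- con (+ 4) :* con 1ℤ :* (c :* c) :- :- con (+ 3) :* (a :* a)) :+ con 1ℤ :* (b :* b :- con 1ℤ :* (c :* c) :- :- con (+ 3) :* (d :* d))) a b c d))
    ⁻1 : ∀ a b c → b * b - + 4 * -1ℤ * (c * c) ≡ 1ℤ * (a * a) → a * a - b * b ≡ + 4 * (c * c)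
    ⁻1 a b c e = combine₁ -1ℤ e (solve 3 (λ a b c →
        a :* a :- b :* b :- con (+ 4) :* (c :* c)
        := con -1ℤ :* (b :* b :- con (+ 4) :* con -1ℤ :* (c :* c) :- con 1ℤ :* (a :* a))) a b c)
    ⁻1′ : ∀ b c d → b * b - -1ℤ * (c * c) ≡ 1ℤ * (d * d) → d * d ≡ b * b + c * c
    ⁻1′ b c d e = combine₁ -1ℤ e (solve 3 (λ b c d → d :* d :- (b :* b :+ c :* c) := con -1ℤ :* (b :* b :- con -1ℤ :* (c :* c) :- con 1ℤ :* (d :* d))) b c d)
    ⁻1-coprime : ∀ s t a b c → s * (b * b) + t * c ≡ 1ℤ → b * b - + 4 * -1ℤ * (c * c) ≡ 1ℤ * (a * a) → s * a * a + (t - s * + 4 * c) * c ≡ 1ℤ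
    ⁻1-coprime s t a b c e e′ = combine₂ 1ℤ (- s) e e′ (solve 5 (λ s t a b c →
        s :* a :* a :+ (t :- s :* con (+ 4) :* c) :* c :- con 1ℤ
        := con 1ℤ :* (s :* (b :* b) :+ t :* c :- con 1ℤ) :+ :- s :* (b :* b :- con (+ 4) :* con -1ℤ :* (c :* c) :- con 1ℤ :* (a :* a))) s t a b c)
    ⁻3 : ∀ a b c → b * b - + 4 * -1ℤ * (c * c) ≡ - + 3 * (a * a) → + 4 * (c * c) + + 3 * (a * a) ≡ - (b * b)
    ⁻3 a b c e = combine₁ 1ℤ e (solve 3 (λ a b c →
        con (+ 4) :* (c :* c) :+ con (+ 3) :* (a :* a) :- :- (b :* b)
        := con 1ℤ :* (b :* b :- con (+ 4) :* con -1ℤ :* (c :* c) :- :- con (+ 3) :* (a :* a))) a b c)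

    next⁺ : ∀ δ g h → δ * δ ≡ 1ℤ → let B = (g * g + h * h) * δ; C = δ * (g * h) in
      B * B - C * C ≡ g * g * (g * g) + 1ℤ * (g * g * (h * h)) + h * h * (h * h)
    next⁺ δ g h δδ = combine₁ (g * g * (g * g) + g * g * (h * h) + h * h * (h * h)) δδ (solve 3 (λ δ g h → let B = (g :* g :+ h :* h) :* δ; C = δ :* (g :* h) in
        B :* B :- C :* C :- (g :* g :* (g :* g) :+ con 1ℤ :* (g :* g :* (h :* h)) :+ h :* h :* (h :* h))
        := (g :* g :* (g :* g) :+ g :* g :* (h :* h) :+ h :* h :* (h :* h)) :* (δ :* δ :- con 1ℤ)) δ g h)
    next⁻ : ∀ δ g h → δ * δ ≡ 1ℤ → let A = (h * h - g * g) * δ; C = δ * (g * h) in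
      A * A + C * C ≡ g * g * (g * g) + -1ℤ * (g * g * (h * h)) + h * h * (h * h)
    next⁻ δ g h δδ = combine₁ (g * g * (g * g) - g * g * (h * h) + h * h * (h * h)) δδ (solve 3 (λ δ g h → let A = (h :* h :- g :* g) :* δ; C = δ :* (g :* h) in
        A :* A :+ C :* C :- (g :* g :* (g :* g) :+ con -1ℤ :* (g :* g :* (h :* h)) :+ h :* h :* (h :* h))
        := (g :* g :* (g :* g) :- g :* g :* (h :* h) :+ h :* h :* (h :* h)) :* (δ :* δ :- con 1ℤ)) δ g h)
    swap : ∀ σ g h → g * g * (g * g) + σ * (g * g * (h * h)) + h * h * (h * h) ≡ h * h * (h * h) + σ * (h * h * (g * g)) + g * g * (g * g)
    swap = solve 3 (λ σ g h →
      g :* g :* (g :* g) :+ σ :* (g :* g :* (h :* h)) :+ h :* h :* (h :* h)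
      := h :* h :* (h :* h) :+ σ :* (h :* h :* (g :* g)) :+ g :* g :* (g :* g))

  record QuarticPoint (σ x y : ℤ) : Set where
    constructor quarticPoint
    field
      x-odd : Odd x
      y-even : Even y
      x⊥y : Coprime x y
      root : ℤ
      equation : x * x * (x * x) + σ * (x * x * (y * y)) + y * y * (y * y) ≡ root * root

  orient : ∀ σ g h E → OppositeParity g h → Coprime g h → g * g * (g * g) + σ * (g * g * (h * h)) + h * h * (h * h) ≡ E * E →
    QuarticPoint σ g h ⊎ QuarticPoint σ h g
  orient σ g h E (inj₁ (g-odd , h-even)) g⊥h e = inj₁ (quarticPoint g-odd h-even g⊥h E e)
  orient σ g h E (inj₂ (g-even , h-odd)) g⊥h e = inj₂ (quarticPoint h-odd g-even (coprime-sym g⊥h) E (trans (sym (swap σ g h)) e))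

  ∣product∣ : ∀ δ g h → δ * δ ≡ 1ℤ → ∣ δ * (g * h) ∣ ≡ ∣ g ∣ ℕ.* ∣ h ∣
  ∣product∣ δ g h δδ≡1 = trans (ℤ.abs-* δ (g * h)) (trans (cong₂ ℕ._*_ (ℕ.m*n≡1⇒m≡1 ∣ δ ∣ ∣ δ ∣ (trans (sym (ℤ.abs-* δ δ)) (cong ∣_∣ δδ≡1))) (ℤ.abs-* g h)) (ℕ.*-identityˡ _))

  Bounded : ℤ → ℤ → Set
  Bounded σ C = ∃[ x′ ] ∃[ y′ ] QuarticPoint σ x′ y′ × y′ ≢ 0ℤ × ∣ y′ ∣ ℕ.≤ ∣ C ∣

  bounded : ∀ σ {A B C} E → C ≢ 0ℤ → (D : DifferenceOfSquares A B C) →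
    (let open DifferenceOfSquares D in g * g * (g * g) + σ * (g * g * (h * h)) + h * h * (h * h) ≡ E * E) → Bounded σ C
  bounded σ {C = C} E C≢0 D eq with orient σ g h E opposite g⊥h eq
    where open DifferenceOfSquares D
  ... | inj₁ point = g , h , point , h≢0 , subst (∣ h ∣ ℕ.≤_) (sym ∣C∣) (ℕ.m≤n*m ∣ h ∣ ∣ g ∣ {{ℕ.≢-nonZero (λ z → g≢0 (ℤ.∣i∣≡0⇒i≡0 z))}})
    where
    open DifferenceOfSquares D
    ∣C∣ = trans (cong ∣_∣ C≡) (∣product∣ δ g h δδ≡1)
    g≢0 : g ≢ 0ℤ
    g≢0 refl = C≢0 (trans C≡ (ℤ.*-zeroʳ δ))
    h≢0 : h ≢ 0ℤ
    h≢0 refl = C≢0 (trans C≡ (trans (cong (δ *_) (ℤ.*-zeroʳ g)) (ℤ.*-zeroʳ δ)))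
  ... | inj₂ point = h , g , point , g≢0 , subst (∣ g ∣ ℕ.≤_) (sym ∣C∣) (ℕ.m≤m*n ∣ g ∣ ∣ h ∣ {{ℕ.≢-nonZero (λ z → h≢0 (ℤ.∣i∣≡0⇒i≡0 z))}})
    where
    open DifferenceOfSquares D
    ∣C∣ = trans (cong ∣_∣ C≡) (∣product∣ δ g h δδ≡1)
    g≢0 : g ≢ 0ℤ
    g≢0 refl = C≢0 (trans C≡ (ℤ.*-zeroʳ δ))
    h≢0 : h ≢ 0ℤ
    h≢0 refl = C≢0 (trans C≡ (trans (cong (δ *_) (ℤ.*-zeroʳ g)) (ℤ.*-zeroʳ δ)))

  -- In the parameters of the triple, B² - C² is again g⁴ + g²h² + h⁴, so g and h give a new point;
  -- it is bounded because gh = ±C. For `next-point⁻` the same holds of A² + C² = g⁴ - g²h² + h⁴.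
  next-point⁺ : ∀ {A B C} E → C ≢ 0ℤ → DifferenceOfSquares A B C → E * E ≡ B * B - C * C → Bounded 1ℤ C
  next-point⁺ {A} {B} {C} E C≢0 D eq = bounded 1ℤ E C≢0 D
    (trans (sym (next⁺ δ g h δδ≡1)) (trans (cong₂ (λ B C → B * B - C * C) (sym B≡) (sym C≡)) (sym eq)))
    where open DifferenceOfSquares D

  next-point⁻ : ∀ {A B C} E → C ≢ 0ℤ → DifferenceOfSquares A B C → E * E ≡ A * A + C * C → Bounded -1ℤ C
  next-point⁻ {A} {B} {C} E C≢0 D eq = bounded -1ℤ E C≢0 D
    (trans (sym (next⁻ δ g h δδ≡1)) (trans (cong₂ (λ A C → A * A + C * C) (sym A≡) (sym C≡)) (sym eq)))
    where open DifferenceOfSquares D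

  factor-bound : ∀ c d y y₁ → y ≢ 0ℤ → y ≡ y₁ * + 2 → y₁ ≡ c * d → (c ≢ 0ℤ × ∣ c ∣ ℕ.< ∣ y ∣) × (d ≢ 0ℤ × ∣ d ∣ ℕ.< ∣ y ∣)
  factor-bound c d y y₁ y≢0 y≡ y₁≡ = (c≢0 , bound c d c≢0 d≢0 refl) , (d≢0 , bound d c d≢0 c≢0 (ℤ.*-comm d c))
    where
    c≢0 : c ≢ 0ℤ
    c≢0 refl = y≢0 (trans y≡ (cong (_* + 2) y₁≡))
    d≢0 : d ≢ 0ℤ
    d≢0 refl = y≢0 (trans y≡ (cong (_* + 2) (trans y₁≡ (ℤ.*-zeroʳ c))))
    natural : ∀ m n → m ≢ 0 → n ≢ 0 → m ℕ.< m ℕ.* n ℕ.* 2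
    natural 0 _ m≢0 _ = contradiction refl m≢0
    natural _ 0 _ n≢0 = contradiction refl n≢0
    natural (suc m) (suc n) _ _ = ℕ.≤-<-trans (ℕ.m≤m*n (suc m) (suc n)) (ℕ.m<m*n (suc m ℕ.* suc n) 2 (ℕ.s≤s (ℕ.s≤s ℕ.z≤n)))
    bound : ∀ a b → a ≢ 0ℤ → b ≢ 0ℤ → a * b ≡ c * d → ∣ a ∣ ℕ.< ∣ y ∣
    bound a b a≢0 b≢0 e = subst (∣ a ∣ ℕ.<_) (sym (trans (cong ∣_∣ (trans y≡ (cong (_* + 2) (trans y₁≡ (sym e))))) (trans (ℤ.abs-* (a * b) (+ 2)) (cong (ℕ._* 2) (ℤ.abs-* a b)))))
      (natural ∣ a ∣ ∣ b ∣ (λ z → a≢0 (ℤ.∣i∣≡0⇒i≡0 z)) (λ z → b≢0 (ℤ.∣i∣≡0⇒i≡0 z)))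

-- Infinite descent for x odd and y even.

module QuarticMain where
  open import Data.Integer using (ℤ; +_; _+_; _*_; -_; _-_; 0ℤ; 1ℤ; -1ℤ; ∣_∣; _≤_; _<_)
  import Data.Integer.Properties as ℤ
  open IntegerIdentity
  open import Data.Nat.Base as ℕ using (ℕ)
  open import Data.Nat.Induction using (<-wellFounded)
  import Data.Nat.Properties as ℕ
  open import Data.Product using (_,_; _×_; ∃-syntax; proj₁; proj₂)
  open import Data.Sum using (_⊎_; inj₁; inj₂)
  open import Data.Empty using (⊥; ⊥-elim)
  open import Induction.WellFounded using (Acc; acc)
  open import Relation.Binary.PropositionalEquality
  open import Relation.Nullary using (contradiction; yes; no)
  open IntegerOrder
  open IntegerCoprime
  open EllipticSquares using (Odd; odd≢even)
  open EllipticDescent using (parity)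
  open CubicSquares using (sum-of-squares≡0)
  open Quartics
  open QuarticDescent
  open LinearCombination ℤ.+-*-isCommutativeRing

  abstract
    -- For σ = 1 one has (x² + y²)² - z² = x²y²; the two factors are (x² + y² ∓ z)/2 and multiply to
    -- (xy/2)².
    αβ⁺ : ∀ i l y₁ → let x = i * + 2 + 1ℤ; y = y₁ * + 2; z = l * + 2 + 1ℤ in
      x * x * (x * x) + 1ℤ * (x * x * (y * y)) + y * y * (y * y) ≡ z * z →
      (+ 2 * (i * i) + + 2 * i - l + + 2 * (y₁ * y₁)) * (+ 2 * (i * i) + + 2 * i + l + 1ℤ + + 2 * (y₁ * y₁)) ≡ x * y₁ * (x * y₁)
    αβ⁺ i l y₁ e = ℤ.*-cancelʳ-≡ ((+ 2 * (i * i) + + 2 * i - l + + 2 * (y₁ * y₁)) * (+ 2 * (i * i) + + 2 * i + l + 1ℤ + + 2 * (y₁ * y₁)))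
        ((i * + 2 + 1ℤ) * y₁ * ((i * + 2 + 1ℤ) * y₁)) (+ 4) (combine₁ 1ℤ e (solve 3 (λ i l y₁ → let x = i :* con (+ 2) :+ con 1ℤ; y = y₁ :* con (+ 2); z = l :* con (+ 2) :+ con 1ℤ in
        (con (+ 2) :* (i :* i) :+ con (+ 2) :* i :- l :+ con (+ 2) :* (y₁ :* y₁)) :* (con (+ 2) :* (i :* i) :+ con (+ 2) :* i :+ l :+ con 1ℤ :+ con (+ 2) :* (y₁ :* y₁)) :* con (+ 4) :- x :* y₁ :* (x :* y₁) :* con (+ 4)
        := con 1ℤ :* (x :* x :* (x :* x) :+ con 1ℤ :* (x :* x :* (y :* y)) :+ y :* y :* (y :* y) :- z :* z)) i l y₁))

    -- For σ = -1 one has z² - (x² - y²)² = x²y²; the two factors are (z ∓ (x² - y²))/2.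
    αβ⁻ : ∀ i l y₁ → let x = i * + 2 + 1ℤ; y = y₁ * + 2; z = l * + 2 + 1ℤ in
      x * x * (x * x) + -1ℤ * (x * x * (y * y)) + y * y * (y * y) ≡ z * z →
      (l - + 2 * (i * i) - + 2 * i + + 2 * (y₁ * y₁)) * (l + 1ℤ + + 2 * (i * i) + + 2 * i - + 2 * (y₁ * y₁)) ≡ x * y₁ * (x * y₁)
    αβ⁻ i l y₁ e = ℤ.*-cancelʳ-≡ ((l - + 2 * (i * i) - + 2 * i + + 2 * (y₁ * y₁)) * (l + 1ℤ + + 2 * (i * i) + + 2 * i - + 2 * (y₁ * y₁)))
        ((i * + 2 + 1ℤ) * y₁ * ((i * + 2 + 1ℤ) * y₁)) (+ 4) (combine₁ -1ℤ e (solve 3 (λ i l y₁ → let x = i :* con (+ 2) :+ con 1ℤ; y = y₁ :* con (+ 2); z = l :* con (+ 2) :+ con 1ℤ in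
        (l :- con (+ 2) :* (i :* i) :- con (+ 2) :* i :+ con (+ 2) :* (y₁ :* y₁)) :* (l :+ con 1ℤ :+ con (+ 2) :* (i :* i) :+ con (+ 2) :* i :- con (+ 2) :* (y₁ :* y₁)) :* con (+ 4) :- x :* y₁ :* (x :* y₁) :* con (+ 4)
        := con -1ℤ :* (x :* x :* (x :* x) :+ con -1ℤ :* (x :* x :* (y :* y)) :+ y :* y :* (y :* y) :- z :* z)) i l y₁))

    sum⁺ : ∀ i l y₁ → + 2 * (i * i) + + 2 * i + l + 1ℤ + + 2 * (y₁ * y₁) + 1ℤ * (+ 2 * (i * i) + + 2 * i - l + + 2 * (y₁ * y₁))
      ≡ (i * + 2 + 1ℤ) * (i * + 2 + 1ℤ) + + 4 * 1ℤ * (y₁ * y₁)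
    sum⁺ = solve 3 (λ i l y₁ →
      con (+ 2) :* (i :* i) :+ con (+ 2) :* i :+ l :+ con 1ℤ :+ con (+ 2) :* (y₁ :* y₁) :+ con 1ℤ :* (con (+ 2) :* (i :* i) :+ con (+ 2) :* i :- l :+ con (+ 2) :* (y₁ :* y₁))
      := (i :* con (+ 2) :+ con 1ℤ) :* (i :* con (+ 2) :+ con 1ℤ) :+ con (+ 4) :* con 1ℤ :* (y₁ :* y₁))
    sum⁻ : ∀ i l y₁ → l + 1ℤ + + 2 * (i * i) + + 2 * i - + 2 * (y₁ * y₁) + -1ℤ * (l - + 2 * (i * i) - + 2 * i + + 2 * (y₁ * y₁))
      ≡ (i * + 2 + 1ℤ) * (i * + 2 + 1ℤ) + + 4 * -1ℤ * (y₁ * y₁)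
    sum⁻ = solve 3 (λ i l y₁ →
      l :+ con 1ℤ :+ con (+ 2) :* (i :* i) :+ con (+ 2) :* i :- con (+ 2) :* (y₁ :* y₁) :+ con -1ℤ :* (l :- con (+ 2) :* (i :* i) :- con (+ 2) :* i :+ con (+ 2) :* (y₁ :* y₁))
      := (i :* con (+ 2) :+ con 1ℤ) :* (i :* con (+ 2) :+ con 1ℤ) :+ con (+ 4) :* con -1ℤ :* (y₁ :* y₁))

    factor-w : ∀ σ δ ξ η → δ * (η * η) + σ * (δ * (ξ * ξ)) ≡ (σ * (ξ * ξ) + η * η) * δ
    factor-w = solve 4 (λ σ δ ξ η → δ :* (η :* η) :+ σ :* (δ :* (ξ :* ξ)) := (σ :* (ξ :* ξ) :+ η :* η) :* δ)

    odd-root : ∀ σ x y₁ l → let y = y₁ * + 2 in x * x * (x * x) + σ * (x * x * (y * y)) + y * y * (y * y) ≡ l * + 2 * (l * + 2) →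
      x * x * (x * x) ≡ (+ 2 * (l * l) - + 2 * σ * (x * x * (y₁ * y₁)) - + 8 * (y₁ * y₁ * (y₁ * y₁))) * + 2
    odd-root σ x y₁ l e = combine₁ 1ℤ e (solve 4 (λ σ x y₁ l → let y = y₁ :* con (+ 2) in
        x :* x :* (x :* x) :- (con (+ 2) :* (l :* l) :- con (+ 2) :* σ :* (x :* x :* (y₁ :* y₁)) :- con (+ 8) :* (y₁ :* y₁ :* (y₁ :* y₁))) :* con (+ 2)
        := con 1ℤ :* (x :* x :* (x :* x) :+ σ :* (x :* x :* (y :* y)) :+ y :* y :* (y :* y) :- l :* con (+ 2) :* (l :* con (+ 2)))) σ x y₁ l)

    half-coprime : ∀ s t x y₁ → s * x + t * (y₁ * + 2) ≡ 1ℤ → s * x + t * + 2 * y₁ ≡ 1ℤ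
    half-coprime s t x y₁ e = trans (solve 4 (λ s t x y₁ → s :* x :+ t :* con (+ 2) :* y₁ := s :* x :+ t :* (y₁ :* con (+ 2))) s t x y₁) e

    rotate : ∀ ξ η → -1ℤ * (ξ * η) ≡ - η * ξ
    rotate = solve 2 (λ ξ η → con -1ℤ :* (ξ :* η) := :- η :* ξ)
    rotate-w : ∀ ξ η → (-1ℤ * (ξ * ξ) + η * η) * -1ℤ ≡ -1ℤ * (- η * - η) + ξ * ξ
    rotate-w = solve 2 (λ ξ η → (con -1ℤ :* (ξ :* ξ) :+ η :* η) :* con -1ℤ := con -1ℤ :* (:- η :* :- η) :+ ξ :* ξ)
    negative-w : ∀ x y ξ η → x * x + + 4 * 1ℤ * (y * y) ≡ (1ℤ * (ξ * ξ) + η * η) * -1ℤ → x * x ≡ - (+ 4 * (y * y) + ξ * ξ + η * η)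
    negative-w x y ξ η e = combine₁ 1ℤ e (solve 4 (λ x y ξ η →
        x :* x :- :- (con (+ 4) :* (y :* y) :+ ξ :* ξ :+ η :* η)
        := con 1ℤ :* (x :* x :+ con (+ 4) :* con 1ℤ :* (y :* y) :- (con 1ℤ :* (ξ :* ξ) :+ η :* η) :* con -1ℤ)) x y ξ η)

    w-comm : ∀ σ x y₁ → + 4 * σ * (y₁ * y₁) + x * x ≡ x * x + + 4 * σ * (y₁ * y₁)
    w-comm σ x y₁ = ℤ.+-comm (+ 4 * σ * (y₁ * y₁)) (x * x)
    w-assoc : ∀ σ x y₁ → x * x + + 4 * σ * y₁ * y₁ ≡ x * x + + 4 * σ * (y₁ * y₁)
    w-assoc σ x y₁ = cong (λ i → x * x + i) (ℤ.*-assoc (+ 4 * σ) y₁ y₁)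

  square-nonpositive : ∀ x {r} → Nonneg r → x * x ≡ - r → x ≡ 0ℤ
  square-nonpositive x {r} (nonneg 0≤r) e = sum-of-squares≡0 x 0ℤ (trans (ℤ.+-identityʳ (x * x))
    (ℤ.≤-antisym (subst (_≤ 0ℤ) (sym e) (ℤ.neg-mono-≤ 0≤r)) (0≤-square x)))

  coprime-w : ∀ σ x y₁ → σ * σ ≡ 1ℤ → Odd x → Coprime x y₁ → Coprime (x * y₁) (x * x + + 4 * σ * (y₁ * y₁))
  coprime-w σ x y₁ σσ x-odd x⊥y = coprime-*ˡ {x} {y₁} x⊥w y⊥w
    where
    x⊥σ : Coprime x σ
    x⊥σ = 0ℤ , σ , trans (ℤ.+-identityˡ (σ * σ)) σσ
    x⊥4 : Coprime x (+ 4)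
    x⊥4 = coprime-*ʳ {x} {+ 2} {+ 2} x-odd x-odd
    x⊥w : Coprime x (x * x + + 4 * σ * (y₁ * y₁))
    x⊥w = subst (Coprime x) (w-comm σ x y₁) (coprime-add {x} x (coprime-*ʳ {x} {+ 4 * σ} {y₁ * y₁} (coprime-*ʳ {x} {+ 4} {σ} x⊥4 x⊥σ) (coprime-*ʳ {x} {y₁} {y₁} x⊥y x⊥y)))
    y⊥w : Coprime y₁ (x * x + + 4 * σ * (y₁ * y₁))
    y⊥w = subst (Coprime y₁) (w-assoc σ x y₁) (coprime-add {y₁} (+ 4 * σ * y₁) (coprime-*ʳ {y₁} {x} {x} (coprime-sym x⊥y) (coprime-sym x⊥y)))

  Splitting : ℤ → ℤ → ℤ → Set
  Splitting σ x y₁ = ∃[ ξ ] ∃[ η ] x * y₁ ≡ ξ * η × x * x + + 4 * σ * (y₁ * y₁) ≡ σ * (ξ * ξ) + η * η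

  -- The common factor δ of α and β divides xy₁ and x² + 4σy₁², which are coprime, so δ = ±1. The
  -- sign -1 is left to the argument `negative`, because it is impossible for σ = 1 but can be
  -- absorbed for σ = -1.
  split-with : ∀ σ x y₁ α β → σ * σ ≡ 1ℤ → Odd x → Coprime x y₁ → α * β ≡ x * y₁ * (x * y₁) → β + σ * α ≡ x * x + + 4 * σ * (y₁ * y₁) →
    (∀ ξ η → x * y₁ ≡ -1ℤ * (ξ * η) → x * x + + 4 * σ * (y₁ * y₁) ≡ (σ * (ξ * ξ) + η * η) * -1ℤ → Splitting σ x y₁) → Splitting σ x y₁
  split-with σ x y₁ α β σσ x-odd x⊥y αβ≡ β+σα≡ negative with rankOne α β (x * y₁) αβ≡
  ... | δ , ξ , η , α≡ , β≡ , xy≡ = choose (unit (proj₁ δ-unit) δ (proj₂ δ-unit))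
    where
    w≡ : x * x + + 4 * σ * (y₁ * y₁) ≡ (σ * (ξ * ξ) + η * η) * δ
    w≡ = trans (sym β+σα≡) (trans (cong₂ (λ β α → β + σ * α) β≡ α≡) (factor-w σ δ ξ η))
    δ-unit : ∃[ u ] u * δ ≡ 1ℤ
    δ-unit = coprime-divisor δ (ξ * η) (σ * (ξ * ξ) + η * η) (coprime-w σ x y₁ σσ x-odd x⊥y) (trans xy≡ (ℤ.*-comm δ (ξ * η))) w≡
    choose : δ ≡ 1ℤ ⊎ δ ≡ -1ℤ → Splitting σ x y₁
    choose (inj₁ δ≡1) = ξ , η , trans xy≡ (trans (cong (_* (ξ * η)) δ≡1) (ℤ.*-identityˡ (ξ * η))) ,
      trans w≡ (trans (cong ((σ * (ξ * ξ) + η * η) *_) δ≡1) (ℤ.*-identityʳ (σ * (ξ * ξ) + η * η)))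
    choose (inj₂ δ≡-1) = negative ξ η (trans xy≡ (cong (_* (ξ * η)) δ≡-1)) (trans w≡ (cong ((σ * (ξ * ξ) + η * η) *_) δ≡-1))

  root-odd : ∀ σ x y₁ z → Odd x → x * x * (x * x) + σ * (x * x * (y₁ * + 2 * (y₁ * + 2))) + y₁ * + 2 * (y₁ * + 2) * (y₁ * + 2 * (y₁ * + 2)) ≡ z * z → Odd z
  root-odd σ x y₁ z x-odd e with parity z
  ... | inj₂ z-odd = z-odd
  ... | inj₁ (l , refl) = contradiction (odd-root σ x y₁ l e) (odd≢even (+ 2 * (l * l) - + 2 * σ * (x * x * (y₁ * y₁)) - + 8 * (y₁ * y₁ * (y₁ * y₁)))
      (coprime-*ˡ {x * x} {x * x} {+ 2} (coprime-*ˡ {x} {x} {+ 2} x-odd x-odd) (coprime-*ˡ {x} {x} {+ 2} x-odd x-odd)))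

  splitting⁺ : ∀ i l y₁ → let x = i * + 2 + 1ℤ; y = y₁ * + 2; z = l * + 2 + 1ℤ in Odd x → Coprime x y₁ →
    x * x * (x * x) + 1ℤ * (x * x * (y * y)) + y * y * (y * y) ≡ z * z → Splitting 1ℤ x y₁
  splitting⁺ i l y₁ x-odd x⊥y e = split-with 1ℤ (i * + 2 + 1ℤ) y₁ (+ 2 * (i * i) + + 2 * i - l + + 2 * (y₁ * y₁)) (+ 2 * (i * i) + + 2 * i + l + 1ℤ + + 2 * (y₁ * y₁)) refl x-odd x⊥y (αβ⁺ i l y₁ e) (sum⁺ i l y₁) impossible
    where
    x = i * + 2 + 1ℤ
    impossible : ∀ ξ η → x * y₁ ≡ -1ℤ * (ξ * η) → x * x + + 4 * 1ℤ * (y₁ * y₁) ≡ (1ℤ * (ξ * ξ) + η * η) * -1ℤ → Splitting 1ℤ x y₁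
    impossible ξ η _ w≡ = contradiction (square-nonpositive x (nat 4 *⁺ sq y₁ +⁺ sq ξ +⁺ sq η) (negative-w x y₁ ξ η w≡)) (odd≢even 0ℤ x-odd)

  splitting⁻ : ∀ i l y₁ → let x = i * + 2 + 1ℤ; y = y₁ * + 2; z = l * + 2 + 1ℤ in Odd x → Coprime x y₁ →
    x * x * (x * x) + -1ℤ * (x * x * (y * y)) + y * y * (y * y) ≡ z * z → Splitting -1ℤ x y₁
  splitting⁻ i l y₁ x-odd x⊥y e = split-with -1ℤ (i * + 2 + 1ℤ) y₁ (l - + 2 * (i * i) - + 2 * i + + 2 * (y₁ * y₁)) (l + 1ℤ + + 2 * (i * i) + + 2 * i - + 2 * (y₁ * y₁)) refl x-odd x⊥y (αβ⁻ i l y₁ e) (sum⁻ i l y₁)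
    -- Replacing (ξ , η) by (-η , ξ) changes the sign of both ξη and η² - ξ².
    (λ ξ η xy≡ w≡ → - η , ξ , trans xy≡ (rotate ξ η) , trans w≡ (rotate-w ξ η))

  abstract
    quartic-torsor : ∀ σ → σ * σ ≡ 1ℤ →
      (∀ i l y₁ → let x = i * + 2 + 1ℤ; y = y₁ * + 2; z = l * + 2 + 1ℤ in Odd x → Coprime x y₁ →
        x * x * (x * x) + σ * (x * x * (y * y)) + y * y * (y * y) ≡ z * z → Splitting σ x y₁) →
      ∀ {x y} → QuarticPoint σ x y → y ≢ 0ℤ → ∃[ y₁ ] y ≡ y₁ * + 2 × Torsor σ x y₁
    quartic-torsor σ σσ splitting {x} {y} (quarticPoint x-odd (y₁ , refl) (s , t , e) z eq) y≢0 =
      let i , x≡ = odd-form x-odd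
          l , z≡ = odd-form (root-odd σ x y₁ z x-odd eq)
          y = y₁ * + 2
          x⊥y₁ : Coprime x y₁
          x⊥y₁ = s , t * + 2 , half-coprime s t x y₁ e
          y₁≢0 : y₁ ≢ 0ℤ
          y₁≢0 y₁≡0 = y≢0 (cong (_* + 2) y₁≡0)
          ξ , η , xy≡ξη , w≡ = subst (λ x → Splitting σ x y₁) (sym x≡)
            (splitting i l y₁ (subst Odd x≡ x-odd) (subst (λ x → Coprime x y₁) x≡ x⊥y₁)
              (trans (cong (λ x → x * x * (x * x) + σ * (x * x * (y * y)) + y * y * (y * y)) (sym x≡)) (trans eq (cong₂ _*_ z≡ z≡))))
      in y₁ , refl , make-torsor σ x y₁ ξ η σσ x-odd x⊥y₁ y₁≢0 xy≡ξη w≡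

  Smaller : ℤ → ℤ → Set
  Smaller σ y = ∃[ x′ ] ∃[ y′ ] QuarticPoint σ x′ y′ × y′ ≢ 0ℤ × ∣ y′ ∣ ℕ.< ∣ y ∣

  shrink : ∀ {σ C y} → ∣ C ∣ ℕ.< ∣ y ∣ → Bounded σ C → Smaller σ y
  shrink C<y (x′ , y′ , point , y′≢0 , y′≤C) = x′ , y′ , point , y′≢0 , ℕ.≤-<-trans y′≤C C<y

  no-point : ∀ σ → (∀ {x y} → QuarticPoint σ x y → y ≢ 0ℤ → Smaller σ y) → ∀ {x y} → QuarticPoint σ x y → y ≡ 0ℤ
  no-point σ smaller {x} {y} point with y ℤ.≟ 0ℤ
  ... | yes y≡0 = y≡0
  ... | no y≢0 = ⊥-elim (go x y (<-wellFounded ∣ y ∣) point y≢0)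
    where
    go : ∀ x y → Acc ℕ._<_ ∣ y ∣ → QuarticPoint σ x y → y ≢ 0ℤ → ⊥
    go x y (acc rec) point y≢0 = let x′ , y′ , point′ , y′≢0 , y′<y = smaller point y≢0 in go x′ y′ (rec y′<y) point′ y′≢0

  -- Each k yields a Pythagorean triple: b² - a² = 4c² with d² = b² - c² for k = 1, and a² - b² =
  -- 4d² with c² = a² - d² for k = -3. As y = 2cd, both c and d are smaller than y in absolute
  -- value.
  torsor-smaller⁺ : ∀ {x y} y₁ → y ≢ 0ℤ → y ≡ y₁ * + 2 → Torsor 1ℤ x y₁ → Smaller 1ℤ y
  torsor-smaller⁺ {x} {y} y₁ y≢0 y≡ (torsor a b c d _ (inj₁ refl) _ y₁≡ b⊥c _ a-odd b-odd eq₁ eq₂) =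
    let (c≢0 , c<y) , _ = factor-bound c d y y₁ y≢0 y≡ y₁≡
    in shrink {1ℤ} {c} {y} c<y (next-point⁺ d c≢0 (difference-of-squares {a} {b} {c} a-odd b-odd (⁺1 a b c eq₁) b⊥c) (⁺1′ b c d eq₂))
  torsor-smaller⁺ {x} {y} y₁ y≢0 y≡ (torsor a b c d _ (inj₂ refl) _ y₁≡ _ a⊥d a-odd b-odd eq₁ eq₂) =
    let _ , (d≢0 , d<y) = factor-bound c d y y₁ y≢0 y≡ y₁≡
    in shrink {1ℤ} {d} {y} d<y (next-point⁺ c d≢0 (difference-of-squares {b} {a} {d} b-odd a-odd (⁺3 a b c d eq₁ eq₂) a⊥d) (⁺3′ a b c d eq₁ eq₂))

  -- For k = 1 the triple is a² - b² = 4c² with d² = b² + c². For k = -3 the definite expression 4c²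
  -- + 3a² would equal -b².
  torsor-smaller⁻ : ∀ {x y} y₁ → y ≢ 0ℤ → y ≡ y₁ * + 2 → Torsor -1ℤ x y₁ → Smaller -1ℤ y
  torsor-smaller⁻ {x} {y} y₁ y≢0 y≡ (torsor a b c d _ (inj₁ refl) _ y₁≡ b⊥c _ a-odd b-odd eq₁ eq₂) =
    let (c≢0 , c<y) , _ = factor-bound c d y y₁ y≢0 y≡ y₁≡
        s , t , e = coprime-*ˡ {b} {b} {c} b⊥c b⊥c
    in shrink { -1ℤ} {c} {y} c<y (next-point⁻ d c≢0 (difference-of-squares {b} {a} {c} b-odd a-odd (⁻1 a b c eq₁)
         (s * a , t - s * + 4 * c , ⁻1-coprime s t a b c e eq₁)) (⁻1′ b c d eq₂))
  torsor-smaller⁻ y₁ y≢0 y≡ (torsor a b c d _ (inj₂ refl) _ y₁≡ b⊥c _ a-odd b-odd eq₁ eq₂) =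
    contradiction (square-nonpositive b (nat 4 *⁺ sq c +⁺ nat 3 *⁺ sq a) (flip (⁻3 a b c eq₁))) (odd≢even 0ℤ b-odd)
    where
    flip : ∀ {r i} → r ≡ - i → i ≡ - r
    flip refl = sym (ℤ.neg-involutive _)

  no-point⁺ : ∀ {x y} → QuarticPoint 1ℤ x y → y ≡ 0ℤ
  no-point⁺ = no-point 1ℤ λ point y≢0 → let y₁ , y≡ , t = quartic-torsor 1ℤ refl splitting⁺ point y≢0 in torsor-smaller⁺ y₁ y≢0 y≡ t

  no-point⁻ : ∀ {x y} → QuarticPoint -1ℤ x y → y ≡ 0ℤ
  no-point⁻ = no-point -1ℤ λ point y≢0 → let y₁ , y≡ , t = quartic-torsor -1ℤ refl splitting⁻ point y≢0 in torsor-smaller⁻ y₁ y≢0 y≡ t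

  even-both : ∀ {x y} → Coprime x y → Even x → Even y → ⊥
  even-both (s , t , e) (a , refl) (b , refl) = odd≢even (s * a + t * b) (1ℤ , 0ℤ , refl) (trans (sym e) (solve 4 (λ s t a b → s :* (a :* con (+ 2)) :+ t :* (b :* con (+ 2)) := (s :* a :+ t :* b) :* con (+ 2)) s t a b))

  abstract
    -- With x, y and z odd the left side is 3 modulo 4 and the right side is 1.
    three-mod-four : ∀ i j l → let x = i * + 2 + 1ℤ; y = j * + 2 + 1ℤ; z = l * + 2 + 1ℤ in
      x * x * (x * x) + 1ℤ * (x * x * (y * y)) + y * y * (y * y) ≡ z * z →
      ∃[ k ] 1ℤ ≡ k * + 2
    three-mod-four i j l e = (l * l + l - (+ 2 * ((i * i + i) * (i * i + i) * + 2 + i * i + i) + ((i * i + i) * + 4 * (j * j + j) + i * i + i + j * j + j) + + 2 * ((j * j + j) * (j * j + j) * + 2 + j * j + j))) , ℤ.*-cancelʳ-≡ 1ℤ ((l * l + l - (+ 2 * ((i * i + i) * (i * i + i) * + 2 + i * i + i) + ((i * i + i) * + 4 * (j * j + j) + i * i + i + j * j + j) + + 2 * ((j * j + j) * (j * j + j) * + 2 + j * j + j))) * + 2) (+ 2) (combine₁ 1ℤ e (solve 3 (λ i j l → let x = i :* con (+ 2) :+ con 1ℤ; y = j :* con (+ 2) :+ con 1ℤ; z = l :* con (+ 2) :+ con 1ℤ in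
        con 1ℤ :* con (+ 2) :- (l :* l :+ l :- (con (+ 2) :* ((i :* i :+ i) :* (i :* i :+ i) :* con (+ 2) :+ i :* i :+ i) :+ ((i :* i :+ i) :* con (+ 4) :* (j :* j :+ j) :+ i :* i :+ i :+ j :* j :+ j) :+ con (+ 2) :* ((j :* j :+ j) :* (j :* j :+ j) :* con (+ 2) :+ j :* j :+ j))) :* con (+ 2) :* con (+ 2)
        := con 1ℤ :* (x :* x :* (x :* x) :+ con 1ℤ :* (x :* x :* (y :* y)) :+ y :* y :* (y :* y) :- z :* z)) i j l))

-- All integral solutions of x⁴ ± x²y² + y⁴ = z².

module QuarticFinal where
  open import Data.Integer using (ℤ; +_; _+_; _*_; -_; _-_; 0ℤ; 1ℤ; -1ℤ)
  import Data.Integer.Properties as ℤ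
  open IntegerIdentity
  open import Data.Product using (_,_; ∃-syntax)
  open import Data.Sum using (_⊎_; inj₁; inj₂; [_,_]′)
  open import Data.Empty using (⊥; ⊥-elim)
  open import Relation.Binary.PropositionalEquality
  open import Relation.Nullary using (yes; no)
  open IntegerCoprime
  open EllipticSquares using (Odd; odd≢even)
  open EllipticDescent using (parity)
  open Quartics
  open QuarticDescent
  open QuarticMain
  open LinearCombination ℤ.+-*-isCommutativeRing

  private
    abstract
      odd-quartic⁺ : ∀ i j l → let x = i * + 2 + 1ℤ; y = j * + 2 + 1ℤ; z = l * + 2 in
        x * x * (x * x) + 1ℤ * (x * x * (y * y)) + y * y * (y * y) ≡ z * z →
        ∃[ k ] 1ℤ ≡ k * + 2
      odd-quartic⁺ i j l e = (+ 2 * (l * l) - (+ 8 * ((i * i + i) * (i * i + i)) + + 4 * (i * i + i) + + 8 * ((j * j + j) * (j * j + j)) + + 4 * (j * j + j)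
          + + 8 * ((i * i + i) * (j * j + j)) + + 2 * (i * i + i) + + 2 * (j * j + j) + 1ℤ)) , combine₁ 1ℤ e (solve 3 (λ i j l → let x = i :* con (+ 2) :+ con 1ℤ; y = j :* con (+ 2) :+ con 1ℤ; z = l :* con (+ 2) in
          con 1ℤ :- (con (+ 2) :* (l :* l) :- (con (+ 8) :* ((i :* i :+ i) :* (i :* i :+ i)) :+ con (+ 4) :* (i :* i :+ i) :+ con (+ 8) :* ((j :* j :+ j) :* (j :* j :+ j)) :+ con (+ 4) :* (j :* j :+ j) :+ con (+ 8) :* ((i :* i :+ i) :* (j :* j :+ j)) :+ con (+ 2) :* (i :* i :+ i) :+ con (+ 2) :* (j :* j :+ j) :+ con 1ℤ)) :* con (+ 2)
          := con 1ℤ :* (x :* x :* (x :* x) :+ con 1ℤ :* (x :* x :* (y :* y)) :+ y :* y :* (y :* y) :- z :* z)) i j l)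

      odd-quartic⁻ : ∀ i j l → let x = i * + 2 + 1ℤ; y = j * + 2 + 1ℤ; z = l * + 2 in
        x * x * (x * x) + -1ℤ * (x * x * (y * y)) + y * y * (y * y) ≡ z * z →
        ∃[ k ] 1ℤ ≡ k * + 2
      odd-quartic⁻ i j l e = (+ 2 * (l * l) - (+ 8 * ((i * i + i) * (i * i + i)) + + 4 * (i * i + i) + + 8 * ((j * j + j) * (j * j + j)) + + 4 * (j * j + j)
          - + 8 * ((i * i + i) * (j * j + j)) - + 2 * (i * i + i) - + 2 * (j * j + j))) , combine₁ 1ℤ e (solve 3 (λ i j l → let x = i :* con (+ 2) :+ con 1ℤ; y = j :* con (+ 2) :+ con 1ℤ; z = l :* con (+ 2) in
          con 1ℤ :- (con (+ 2) :* (l :* l) :- (con (+ 8) :* ((i :* i :+ i) :* (i :* i :+ i)) :+ con (+ 4) :* (i :* i :+ i) :+ con (+ 8) :* ((j :* j :+ j) :* (j :* j :+ j)) :+ con (+ 4) :* (j :* j :+ j) :- con (+ 8) :* ((i :* i :+ i) :* (j :* j :+ j)) :- con (+ 2) :* (i :* i :+ i) :- con (+ 2) :* (j :* j :+ j))) :* con (+ 2)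
          := con 1ℤ :* (x :* x :* (x :* x) :+ con -1ℤ :* (x :* x :* (y :* y)) :+ y :* y :* (y :* y) :- z :* z)) i j l)

      -- The identity x⁴ - x²y² + y⁴ = (xy)² + (x² - y²)² makes the product of (z - xy)/2 and (z +
      -- xy)/2 equal to the square of γ = (x² - y²)/2.
      αβ≡γγ : ∀ i j l → let x = i * + 2 + 1ℤ; y = j * + 2 + 1ℤ; z = l * + 2 + 1ℤ; γ = + 2 * (i * i + i - j * j - j) in
        x * x * (x * x) + -1ℤ * (x * x * (y * y)) + y * y * (y * y) ≡ z * z →
        (l - + 2 * (i * j) - i - j) * (l + 1ℤ + + 2 * (i * j) + i + j) ≡ γ * γ
      αβ≡γγ i j l e = ℤ.*-cancelʳ-≡ ((l - + 2 * (i * j) - i - j) * (l + 1ℤ + + 2 * (i * j) + i + j))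
          (+ 2 * (i * i + i - j * j - j) * (+ 2 * (i * i + i - j * j - j))) (+ 4) (combine₁ -1ℤ e (solve 3 (λ i j l → let x = i :* con (+ 2) :+ con 1ℤ; y = j :* con (+ 2) :+ con 1ℤ; z = l :* con (+ 2) :+ con 1ℤ; γ = con (+ 2) :* (i :* i :+ i :- j :* j :- j) in
          (l :- con (+ 2) :* (i :* j) :- i :- j) :* (l :+ con 1ℤ :+ con (+ 2) :* (i :* j) :+ i :+ j) :* con (+ 4) :- γ :* γ :* con (+ 4)
          := con -1ℤ :* (x :* x :* (x :* x) :+ con -1ℤ :* (x :* x :* (y :* y)) :+ y :* y :* (y :* y) :- z :* z)) i j l))

      β-α : ∀ i j l δ ξ η → l - + 2 * (i * j) - i - j ≡ δ * (ξ * ξ) → l + 1ℤ + + 2 * (i * j) + i + j ≡ δ * (η * η) →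
        (i * + 2 + 1ℤ) * (j * + 2 + 1ℤ) ≡ (η * η - ξ * ξ) * δ
      β-α i j l δ ξ η e e′ = combine₂ -1ℤ 1ℤ e e′ (solve 6 (λ i j l δ ξ η →
          (i :* con (+ 2) :+ con 1ℤ) :* (j :* con (+ 2) :+ con 1ℤ) :- (η :* η :- ξ :* ξ) :* δ
          := con -1ℤ :* (l :- con (+ 2) :* (i :* j) :- i :- j :- δ :* (ξ :* ξ)) :+ con 1ℤ :* (l :+ con 1ℤ :+ con (+ 2) :* (i :* j) :+ i :+ j :- δ :* (η :* η))) i j l δ ξ η)

      γ-double : ∀ i j → let x = i * + 2 + 1ℤ; y = j * + 2 + 1ℤ in -1ℤ * (y * y) + x * x ≡ + 2 * (i * i + i - j * j - j) * + 2
      γ-double = solve 2 (λ i j → let x = i :* con (+ 2) :+ con 1ℤ; y = j :* con (+ 2) :+ con 1ℤ in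
        con -1ℤ :* (y :* y) :+ x :* x := con (+ 2) :* (i :* i :+ i :- j :* j :- j) :* con (+ 2))

      γ-double′ : ∀ i j → let x = i * + 2 + 1ℤ; y = j * + 2 + 1ℤ in x * x + - y * y ≡ + 2 * (i * i + i - j * j - j) * + 2
      γ-double′ = solve 2 (λ i j → let x = i :* con (+ 2) :+ con 1ℤ; y = j :* con (+ 2) :+ con 1ℤ in
        x :* x :+ :- y :* y := con (+ 2) :* (i :* i :+ i :- j :* j :- j) :* con (+ 2))

      γ-double″ : ∀ i j → let x = i * + 2 + 1ℤ; y = j * + 2 + 1ℤ in x * x - y * y ≡ + 2 * (i * i + i - j * j - j) * + 2
      γ-double″ = solve 2 (λ i j → let x = i :* con (+ 2) :+ con 1ℤ; y = j :* con (+ 2) :+ con 1ℤ in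
        x :* x :- y :* y := con (+ 2) :* (i :* i :+ i :- j :* j :- j) :* con (+ 2))

      half-sum-squares : ∀ i j → let x = i * + 2 + 1ℤ; y = j * + 2 + 1ℤ; γ = + 2 * (i * i + i - j * j - j); E = + 2 * (i * i + i + j * j + j) + 1ℤ in
        E * E ≡ x * y * (x * y) + γ * γ
      half-sum-squares = solve 2 (λ i j → let x = i :* con (+ 2) :+ con 1ℤ; y = j :* con (+ 2) :+ con 1ℤ; γ = con (+ 2) :* (i :* i :+ i :- j :* j :- j); E = con (+ 2) :* (i :* i :+ i :+ j :* j :+ j) :+ con 1ℤ in
        E :* E := x :* y :* (x :* y) :+ γ :* γ)

      bézout-ξη : ∀ s t δ ξ η → s * ((η * η - ξ * ξ) * δ) + t * (δ * (ξ * η)) ≡ 1ℤ → (t * δ * η - s * δ * ξ) * ξ + s * δ * η * η ≡ 1ℤ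
      bézout-ξη s t δ ξ η e = trans (solve 5 (λ s t δ ξ η →
          (t :* δ :* η :- s :* δ :* ξ) :* ξ :+ s :* δ :* η :* η
          := s :* ((η :* η :- ξ :* ξ) :* δ) :+ t :* (δ :* (ξ :* η))) s t δ ξ η) e

    orient-zero : ∀ σ → (∀ {x y} → QuarticPoint σ x y → y ≡ 0ℤ) → ∀ ξ η E → OppositeParity ξ η → Coprime ξ η →
      ξ * ξ * (ξ * ξ) + σ * (ξ * ξ * (η * η)) + η * η * (η * η) ≡ E * E → ξ ≡ 0ℤ ⊎ η ≡ 0ℤ
    orient-zero σ zero ξ η E opp ξ⊥η e with orient σ ξ η E opp ξ⊥η e
    ... | inj₁ point = inj₂ (zero point)
    ... | inj₂ point = inj₁ (zero point)

    no-half : ∃[ k ] 1ℤ ≡ k * + 2 → ⊥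
    no-half (k , e) = odd≢even k (1ℤ , 0ℤ , refl) e

    both-odd⁺ : ∀ i j z → let x = i * + 2 + 1ℤ; y = j * + 2 + 1ℤ in
      x * x * (x * x) + 1ℤ * (x * x * (y * y)) + y * y * (y * y) ≡ z * z → Even z ⊎ (∃[ l ] z ≡ l * + 2 + 1ℤ) → ⊥
    both-odd⁺ i j _ e (inj₁ (l , refl)) = no-half (odd-quartic⁺ i j l e)
    both-odd⁺ i j _ e (inj₂ (l , refl)) = no-half (three-mod-four i j l e)

    parity-form : ∀ z → Even z ⊎ (∃[ l ] z ≡ l * + 2 + 1ℤ)
    parity-form z = [ inj₁ , (λ z-odd → inj₂ (odd-form z-odd)) ]′ (parity z)

    -- For E = (x² + y²)/2 one has E² = (xy)² + γ², which in ξ and η is ξ⁴ - ξ²η² + η⁴. Since ξ and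
    -- η are coprime of opposite parity, the case already settled forces ξη = 0, hence γ = 0.
    reduce-odd : ∀ i j l δ ξ η → let x = i * + 2 + 1ℤ; y = j * + 2 + 1ℤ in Coprime x y → Odd x → Odd y →
      l - + 2 * (i * j) - i - j ≡ δ * (ξ * ξ) → l + 1ℤ + + 2 * (i * j) + i + j ≡ δ * (η * η) → + 2 * (i * i + i - j * j - j) ≡ δ * (ξ * η) → x * x ≡ y * y
    reduce-odd i j l δ ξ η x⊥y x-odd y-odd α≡ β≡ γ≡ =
      ℤ.i-j≡0⇒i≡j (x * x) (y * y) (trans (γ-double″ i j) (cong (_* + 2) (trans γ≡ (trans (cong (δ *_) ξη≡0) (ℤ.*-zeroʳ δ)))))
      where
      x y γ E : ℤ
      x = i * + 2 + 1ℤ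
      y = j * + 2 + 1ℤ
      γ = + 2 * (i * i + i - j * j - j)
      E = + 2 * (i * i + i + j * j + j) + 1ℤ
      xy≡ : x * y ≡ (η * η - ξ * ξ) * δ
      xy≡ = β-α i j l δ ξ η α≡ β≡
      xy⊥2γ : Coprime (x * y) (γ * + 2)
      xy⊥2γ = coprime-*ˡ {x} {y}
        (subst (Coprime x) (γ-double i j) (coprime-add {x} x (coprime-*ʳ {x} { -1ℤ} {y * y} (0ℤ , -1ℤ , refl) (coprime-*ʳ {x} {y} {y} x⊥y x⊥y))))
        (subst (Coprime y) (γ-double′ i j) (coprime-add {y} (- y) (coprime-*ʳ {y} {x} {x} (coprime-sym x⊥y) (coprime-sym x⊥y))))
      xy⊥γ : Coprime (x * y) γ
      xy⊥γ = let s , t , e′ = xy⊥2γ in s , t * + 2 , trans (cong (λ k → s * (x * y) + k) (trans (ℤ.*-assoc t (+ 2) γ) (cong (t *_) (ℤ.*-comm (+ 2) γ)))) e′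
      δδ≡1 : δ * δ ≡ 1ℤ
      δδ≡1 = let u , e′ = coprime-divisor δ (η * η - ξ * ξ) (ξ * η) xy⊥γ xy≡ (trans γ≡ (ℤ.*-comm δ (ξ * η))) in sign u δ e′
      ξ⊥η : Coprime ξ η
      ξ⊥η = let s , t , e′ = xy⊥γ in t * δ * η - s * δ * ξ , s * δ * η ,
        bézout-ξη s t δ ξ η (trans (cong₂ (λ a b → s * a + t * b) (sym xy≡) (sym γ≡)) e′)
      quartic : ξ * ξ * (ξ * ξ) + -1ℤ * (ξ * ξ * (η * η)) + η * η * (η * η) ≡ E * E
      quartic = trans (sym (next⁻ δ ξ η δδ≡1)) (trans (cong₂ (λ a b → a * a + b * b) (sym xy≡) (sym γ≡)) (sym (half-sum-squares i j)))
      ξη≡0 : ξ * η ≡ 0ℤ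
      ξη≡0 = [ cong (_* η) , (λ η≡0 → trans (cong (ξ *_) η≡0) (ℤ.*-zeroʳ ξ)) ]′
        (orient-zero -1ℤ no-point⁻ ξ η E (opposite-parity ξ η δ (subst Odd xy≡ (coprime-*ˡ {x} {y} {+ 2} x-odd y-odd))) ξ⊥η quartic)

    both-odd⁻ : ∀ i j z → let x = i * + 2 + 1ℤ; y = j * + 2 + 1ℤ in Coprime x y → Odd x → Odd y →
      x * x * (x * x) + -1ℤ * (x * x * (y * y)) + y * y * (y * y) ≡ z * z → Even z ⊎ (∃[ l ] z ≡ l * + 2 + 1ℤ) → x * x ≡ y * y
    both-odd⁻ i j _ x⊥y x-odd y-odd e (inj₁ (l , refl)) = ⊥-elim (no-half (odd-quartic⁻ i j l e))
    both-odd⁻ i j _ x⊥y x-odd y-odd e (inj₂ (l , refl)) =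
      let δ , ξ , η , α≡ , β≡ , γ≡ = rankOne (l - + 2 * (i * j) - i - j) (l + 1ℤ + + 2 * (i * j) + i + j) (+ 2 * (i * i + i - j * j - j)) (αβ≡γγ i j l e)
      in reduce-odd i j l δ ξ η x⊥y x-odd y-odd α≡ β≡ γ≡

    coprime⁺ : ∀ x y z → Coprime x y → x * x * (x * x) + 1ℤ * (x * x * (y * y)) + y * y * (y * y) ≡ z * z → x ≡ 0ℤ ⊎ y ≡ 0ℤ
    coprime⁺ x y z x⊥y e with parity x | parity y
    ... | inj₁ x-even | inj₁ y-even = ⊥-elim (even-both x⊥y x-even y-even)
    ... | inj₁ x-even | inj₂ y-odd = orient-zero 1ℤ no-point⁺ x y z (inj₂ (x-even , y-odd)) x⊥y e
    ... | inj₂ x-odd | inj₁ y-even = orient-zero 1ℤ no-point⁺ x y z (inj₁ (x-odd , y-even)) x⊥y e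
    ... | inj₂ x-odd | inj₂ y-odd with odd-form x-odd | odd-form y-odd
    ...   | i , refl | j , refl = ⊥-elim (both-odd⁺ i j z e (parity-form z))

    coprime⁻ : ∀ x y z → Coprime x y → x * x * (x * x) + -1ℤ * (x * x * (y * y)) + y * y * (y * y) ≡ z * z → (x ≡ 0ℤ ⊎ y ≡ 0ℤ) ⊎ x * x ≡ y * y
    coprime⁻ x y z x⊥y e with parity x | parity y
    ... | inj₁ x-even | inj₁ y-even = ⊥-elim (even-both x⊥y x-even y-even)
    ... | inj₁ x-even | inj₂ y-odd = inj₁ (orient-zero -1ℤ no-point⁻ x y z (inj₂ (x-even , y-odd)) x⊥y e)
    ... | inj₂ x-odd | inj₁ y-even = inj₁ (orient-zero -1ℤ no-point⁻ x y z (inj₁ (x-odd , y-even)) x⊥y e)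
    ... | inj₂ x-odd | inj₂ y-odd with odd-form x-odd | odd-form y-odd
    ...   | i , refl | j , refl = inj₂ (both-odd⁻ i j z x⊥y x-odd y-odd e (parity-form z))

    abstract
      scale-quartic : ∀ σ x y g z → let X = x * g; Y = y * g in X * X * (X * X) + σ * (X * X * (Y * Y)) + Y * Y * (Y * Y) ≡ z * z →
        g * g * (g * g) * (x * x * (x * x) + σ * (x * x * (y * y)) + y * y * (y * y)) ≡ z * z
      scale-quartic σ x y g z e = trans (solve 4 (λ σ x y g → let X = x :* g; Y = y :* g in
          g :* g :* (g :* g) :* (x :* x :* (x :* x) :+ σ :* (x :* x :* (y :* y)) :+ y :* y :* (y :* y))
          := X :* X :* (X :* X) :+ σ :* (X :* X :* (Y :* Y)) :+ Y :* Y :* (Y :* Y)) σ x y g) e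

      scale-square : ∀ x y g → x * x ≡ y * y → x * g * (x * g) ≡ y * g * (y * g)
      scale-square x y g e = combine₁ (g * g) e (solve 3 (λ x y g → x :* g :* (x :* g) :- y :* g :* (y :* g) := g :* g :* (x :* x :- y :* y)) x y g)

    square≢0 : ∀ g → g ≢ 0ℤ → g * g ≢ 0ℤ
    square≢0 g g≢0 gg≡0 = [ g≢0 , g≢0 ]′ (ℤ.i*j≡0⇒i≡0∨j≡0 g gg≡0)

  abstract
    quartic⁺ : ∀ X Y Z → X * X * (X * X) + 1ℤ * (X * X * (Y * Y)) + Y * Y * (Y * Y) ≡ Z * Z → X ≡ 0ℤ ⊎ Y ≡ 0ℤ
    quartic⁺ X Y Z e with X ℤ.≟ 0ℤ
    ... | yes X≡0 = inj₁ X≡0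
    ... | no X≢0 with coprime-parts X Y X≢0
    ...   | g , x , y , refl , refl , x⊥y , g≢0 with square-quotient (g * g) (x * x * (x * x) + 1ℤ * (x * x * (y * y)) + y * y * (y * y)) Z (square≢0 g g≢0) (scale-quartic 1ℤ x y g Z e)
    ...     | w , e′ with coprime⁺ x y w x⊥y e′
    ...       | inj₁ refl = inj₁ refl
    ...       | inj₂ refl = inj₂ refl

    quartic⁻ : ∀ X Y Z → X * X * (X * X) + -1ℤ * (X * X * (Y * Y)) + Y * Y * (Y * Y) ≡ Z * Z → (X ≡ 0ℤ ⊎ Y ≡ 0ℤ) ⊎ X * X ≡ Y * Y
    quartic⁻ X Y Z e with X ℤ.≟ 0ℤ
    ... | yes X≡0 = inj₁ (inj₁ X≡0)
    ... | no X≢0 with coprime-parts X Y X≢0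
    ...   | g , x , y , refl , refl , x⊥y , g≢0 with square-quotient (g * g) (x * x * (x * x) + -1ℤ * (x * x * (y * y)) + y * y * (y * y)) Z (square≢0 g g≢0) (scale-quartic -1ℤ x y g Z e)
    ...     | w , e′ with coprime⁻ x y w x⊥y e′
    ...       | inj₁ (inj₁ refl) = inj₁ (inj₁ refl)
    ...       | inj₁ (inj₂ refl) = inj₁ (inj₂ refl)
    ...       | inj₂ xx≡yy = inj₂ (scale-square x y g xx≡yy)

-- Passage between ℤ and ℚ.

module RationalBase where
  open import Data.Integer as ℤ using (ℤ; +_; 0ℤ; 1ℤ)
  import Data.Integer.Properties as ℤ
  open Polynomial public
  open IntegerIdentity using () renaming (solve to ℤ-solve)
  open import Data.Nat.Base as ℕ using (ℕ)
  open import Data.Product using (_,_; _×_; ∃-syntax)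
  open import Data.Rational using (ℚ; _+_; _*_; -_; _-_; 0ℚ; 1ℚ; 1/_; toℚᵘ; _≤_; _<_; ≢-nonZero; nonNegative; nonPositive; mkℚ)
  import Data.Rational.Properties as ℚ
  import Data.Rational.Unnormalised as ℚᵘ
  import Data.Rational.Unnormalised.Properties as ℚᵘ
  open import Data.Sum using (_⊎_; inj₁; inj₂)
  open import Data.List.Base using ([]; _∷_; map)
  open import Relation.Binary.PropositionalEquality
  open import Relation.Nullary using (contradiction; yes; no)
  open import Defs using (ℤ→ℚ)
  open IntegerCoprime using (Coprime)
  open Quartics using (square-quotient; coprime-parts)

  divide : ∀ x y → y ≢ 0ℚ → ∃[ l ] x ≡ l * y
  divide x y y≢0 = x * 1/ y , (begin
    x                   ≡⟨ ℚ.*-identityʳ x ⟨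
    x * 1ℚ              ≡⟨ cong (x *_) (ℚ.*-inverseˡ y) ⟨
    x * (1/ y * y)      ≡⟨ ℚ.*-assoc x (1/ y) y ⟨
    x * 1/ y * y        ∎)
    where
    open ≡-Reasoning
    instance _ = ≢-nonZero y≢0

  product≡0 : ∀ x y → x * y ≡ 0ℚ → x ≡ 0ℚ ⊎ y ≡ 0ℚ
  product≡0 x y xy≡0 with x ℚ.≟ 0ℚ
  ... | yes x≡0 = inj₁ x≡0
  ... | no x≢0 = let l , 1≡lx = divide 1ℚ x x≢0 in inj₂ (begin
    y            ≡⟨ ℚ.*-identityˡ y ⟨
    1ℚ * y       ≡⟨ cong (_* y) 1≡lx ⟩
    l * x * y    ≡⟨ ℚ.*-assoc l x y ⟩
    l * (x * y)  ≡⟨ cong (l *_) xy≡0 ⟩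
    l * 0ℚ       ≡⟨ ℚ.*-zeroʳ l ⟩
    0ℚ           ∎)
    where open ≡-Reasoning

  cancel : ∀ x y → x ≢ 0ℚ → x * y ≡ 0ℚ → y ≡ 0ℚ
  cancel x y x≢0 xy≡0 with product≡0 x y xy≡0
  ... | inj₁ x≡0 = contradiction x≡0 x≢0
  ... | inj₂ y≡0 = y≡0

  square≡0 : ∀ x → x * x ≡ 0ℚ → x ≡ 0ℚ
  square≡0 x xx≡0 with product≡0 x x xx≡0
  ... | inj₁ x≡0 = x≡0
  ... | inj₂ x≡0 = x≡0

  0≤square : ∀ x → 0ℚ ≤ x * x
  0≤square x with ℚ.≤-total 0ℚ x
  ... | inj₁ 0≤x = subst (_≤ x * x) (ℚ.*-zeroʳ x) (ℚ.*-monoˡ-≤-nonNeg x {{nonNegative 0≤x}} 0≤x)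
  ... | inj₂ x≤0 = subst (_≤ x * x) (ℚ.*-zeroʳ x) (ℚ.*-monoˡ-≤-nonPos x {{nonPositive x≤0}} x≤0)

  sum-of-squares≢ : ∀ x y c → 0ℚ < c → x * x + y * y + c ≢ 0ℚ
  sum-of-squares≢ x y c 0<c eq = ℚ.<-irrefl (sym eq) (ℚ.<-respˡ-≡ (ℚ.+-identityˡ 0ℚ) (ℚ.+-mono-≤-< (subst (_≤ x * x + y * y) (ℚ.+-identityˡ 0ℚ) (ℚ.+-mono-≤ (0≤square x) (0≤square y))) 0<c))

  private
    toℚᵘ-ι : ∀ n → toℚᵘ (ℤ→ℚ n) ℚᵘ.≃ ℚᵘ.mkℚᵘ n 0
    toℚᵘ-ι n = ℚ.toℚᵘ-fromℚᵘ (ℚᵘ.mkℚᵘ n 0)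

  private
    fraction-sum : ∀ m n → (m ℤ.+ n) ℤ.* 1ℤ ≡ (m ℤ.* 1ℤ ℤ.+ n ℤ.* 1ℤ) ℤ.* 1ℤ
    fraction-sum = ℤ-solve 2 (λ m n → (m :+ n) :* con 1ℤ := (m :* con 1ℤ :+ n :* con 1ℤ) :* con 1ℤ)

  ι-+ : ∀ m n → ℤ→ℚ (m ℤ.+ n) ≡ ℤ→ℚ m + ℤ→ℚ n
  ι-+ m n = ℚ.toℚᵘ-injective (ℚᵘ.≃-trans (toℚᵘ-ι (m ℤ.+ n))
    (ℚᵘ.≃-trans {j = ℚᵘ.mkℚᵘ m 0 ℚᵘ.+ ℚᵘ.mkℚᵘ n 0} (ℚᵘ.*≡* (fraction-sum m n))
    (ℚᵘ.≃-sym (ℚᵘ.≃-trans (ℚ.toℚᵘ-homo-+ (ℤ→ℚ m) (ℤ→ℚ n)) (ℚᵘ.+-cong (toℚᵘ-ι m) (toℚᵘ-ι n))))))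

  ι-* : ∀ m n → ℤ→ℚ (m ℤ.* n) ≡ ℤ→ℚ m * ℤ→ℚ n
  ι-* m n = ℚ.toℚᵘ-injective (ℚᵘ.≃-trans (toℚᵘ-ι (m ℤ.* n))
    (ℚᵘ.≃-sym (ℚᵘ.≃-trans (ℚ.toℚᵘ-homo-* (ℤ→ℚ m) (ℤ→ℚ n)) (ℚᵘ.*-cong (toℚᵘ-ι m) (toℚᵘ-ι n)))))

  ι-neg : ∀ m → ℤ→ℚ (ℤ.- m) ≡ - ℤ→ℚ m
  ι-neg m = ℚ.toℚᵘ-injective (ℚᵘ.≃-trans (toℚᵘ-ι (ℤ.- m))
    (ℚᵘ.≃-sym (ℚᵘ.≃-trans (ℚ.toℚᵘ-homo‿- (ℤ→ℚ m)) (ℚᵘ.-‿cong (toℚᵘ-ι m)))))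

  ι-injective : ∀ {m n} → ℤ→ℚ m ≡ ℤ→ℚ n → m ≡ n
  ι-injective {m} {n} eq with ℚᵘ.≃-trans (ℚᵘ.≃-sym (toℚᵘ-ι m)) (ℚᵘ.≃-trans (ℚ.toℚᵘ-cong eq) (toℚᵘ-ι n))
  ... | ℚᵘ.*≡* m1≡n1 = trans (sym (ℤ.*-identityʳ m)) (trans m1≡n1 (ℤ.*-identityʳ n))

  open PolynomialIdentity ℤ→ℚ ℚ.+-*-isCommutativeRing ι-+ ι-* ι-neg public

  ι-lookup : ∀ i ρ → ℤ→ℚ (IntegerIdentity.⟦ var i ⟧ ρ) ≡ ⟦ var i ⟧ (map ℤ→ℚ ρ)
  ι-lookup i [] = refl
  ι-lookup ℕ.zero (x ∷ ρ) = refl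
  ι-lookup (ℕ.suc i) (x ∷ ρ) = ι-lookup i ρ

  -- This lets a homogenised equation be established over ℚ and then read back over ℤ.
  ι-eval : ∀ e ρ → ℤ→ℚ (IntegerIdentity.⟦ e ⟧ ρ) ≡ ⟦ e ⟧ (map ℤ→ℚ ρ)
  ι-eval (var i) ρ = ι-lookup i ρ
  ι-eval (con c) ρ = refl
  ι-eval (a :+ b) ρ = trans (ι-+ (IntegerIdentity.⟦ a ⟧ ρ) (IntegerIdentity.⟦ b ⟧ ρ)) (cong₂ _+_ (ι-eval a ρ) (ι-eval b ρ))
  ι-eval (a :* b) ρ = trans (ι-* (IntegerIdentity.⟦ a ⟧ ρ) (IntegerIdentity.⟦ b ⟧ ρ)) (cong₂ _*_ (ι-eval a ρ) (ι-eval b ρ))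
  ι-eval (a :- b) ρ = trans (ι-+ (IntegerIdentity.⟦ a ⟧ ρ) (ℤ.- IntegerIdentity.⟦ b ⟧ ρ)) (cong₂ _+_ (ι-eval a ρ) (trans (ι-neg (IntegerIdentity.⟦ b ⟧ ρ)) (cong -_ (ι-eval b ρ))))
  ι-eval (:- a) ρ = trans (ι-neg (IntegerIdentity.⟦ a ⟧ ρ)) (cong -_ (ι-eval a ρ))

  ι≢0 : ∀ {n} → n ≢ 0ℤ → ℤ→ℚ n ≢ 0ℚ
  ι≢0 n≢0 eq = n≢0 (ι-injective eq)

  fraction : ∀ q → ∃[ m ] ∃[ n ] n ≢ 0ℤ × q * ℤ→ℚ n ≡ ℤ→ℚ m
  fraction q@(mkℚ m d _) = m , + ℕ.suc d , (λ ()) , ℚ.toℚᵘ-injective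
    (ℚᵘ.≃-trans (ℚ.toℚᵘ-homo-* q (ℤ→ℚ (+ ℕ.suc d)))
    (ℚᵘ.≃-trans (ℚᵘ.*-cong (ℚᵘ.≃-refl {ℚᵘ.mkℚᵘ m d}) (toℚᵘ-ι (+ ℕ.suc d)))
    (ℚᵘ.≃-trans {j = ℚᵘ.mkℚᵘ m 0} (ℚᵘ.*≡* (clear m d)) (ℚᵘ.≃-sym (toℚᵘ-ι m)))))
    where
    clear : ∀ m d → m ℤ.* + ℕ.suc d ℤ.* 1ℤ ≡ m ℤ.* (+ ℕ.suc d ℤ.* 1ℤ)
    clear m d = ℤ.*-assoc m (+ ℕ.suc d) 1ℤ

  private
    abstract
      reduce-fraction : ∀ q a b g → q * (b * g) ≡ a * g → g * (q * b - a) ≡ 0ℚ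
      reduce-fraction q a b g eq = trans (solve 4 (λ q a b g → g :* (q :* b :- a) := q :* (b :* g) :- a :* g) q a b g) (trans (cong (_- a * g) eq) (ℚ.+-inverseʳ (a * g)))

      square-cleared : ∀ y n m N → y * n ≡ m → y * y ≡ N → n * n * N ≡ m * m
      square-cleared y n m N refl refl = solve 2 (λ y n → n :* n :* (y :* y) := y :* n :* (y :* n)) y n

  a-b≡0⇒a≡b : ∀ a b → a - b ≡ 0ℚ → a ≡ b
  a-b≡0⇒a≡b a b e = trans (sym (ℚ.+-identityʳ a)) (trans (cong (λ i → a + i) (sym (ℚ.+-inverseˡ b)))
      (trans (sym (ℚ.+-assoc a (- b) b)) (trans (cong (_+ b) e) (ℚ.+-identityˡ b))))

  reduced-fraction : ∀ q → ∃[ a ] ∃[ b ] b ≢ 0ℤ × Coprime b a × q * ℤ→ℚ b ≡ ℤ→ℚ a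
  reduced-fraction q =
    let m , n , n≢0 , qn≡m = fraction q
        g , b , a , n≡ , m≡ , b⊥a , g≢0 = coprime-parts n m n≢0
        b≢0 : b ≢ 0ℤ
        b≢0 b≡0 = n≢0 (trans n≡ (cong (ℤ._* g) b≡0))
    in a , b , b≢0 , b⊥a , a-b≡0⇒a≡b (q * ℤ→ℚ b) (ℤ→ℚ a) (cancel (ℤ→ℚ g) (q * ℤ→ℚ b - ℤ→ℚ a) (ι≢0 g≢0)
         (reduce-fraction q (ℤ→ℚ a) (ℤ→ℚ b) (ℤ→ℚ g)
           (trans (cong (q *_) (sym (trans (cong ℤ→ℚ n≡) (ι-* b g)))) (trans qn≡m (trans (cong ℤ→ℚ m≡) (ι-* a g))))))

  -- Clearing the denominator n of y gives n²N = m², and `square-quotient` removes n².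
  integer-square : ∀ N y → y * y ≡ ℤ→ℚ N → ∃[ w ] N ≡ w ℤ.* w
  integer-square N y yy≡N =
    let m , n , n≢0 , yn≡m = fraction y
    in square-quotient n N m n≢0 (ι-injective (trans (ι-* (n ℤ.* n) N) (trans (cong (_* ℤ→ℚ N) (ι-* n n))
         (trans (square-cleared y (ℤ→ℚ n) (ℤ→ℚ m) (ℤ→ℚ N) yn≡m yy≡N) (sym (ι-* m m))))))

-- Rational points of y² = q⁴ + 2q² - 4q + 1.

module RationalCurves where
  open import Data.Integer as ℤ using (ℤ; +_; 0ℤ; 1ℤ)
  import Data.Integer.Properties as ℤ
  open IntegerIdentity using () renaming (solve to ℤ-solve)
  open import Data.Nat.Base as ℕ using (ℕ)
  import Data.Nat.Properties as ℕ
  open import Data.Product using (_,_)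
  open import Data.Rational using (ℚ; _+_; _*_; -_; _-_; 0ℚ; 1ℚ; _/_)
  import Data.Rational.Properties as ℚ
  open import Data.Sum using (_⊎_; inj₁; inj₂)
  open import Data.List.Base using ([]; _∷_)
  open import Relation.Binary.PropositionalEquality
  open import Relation.Nullary using (contradiction; yes; no)
  open import Defs using (ℤ→ℚ)
  open IntegerCoprime using (Coprime)
  open EllipticMain using (elliptic-integer)
  open RationalBase
  open LinearCombination ℚ.+-*-isCommutativeRing

  ι : ℤ → ℚ
  ι = ℤ→ℚ

  2ℚ 3ℚ 4ℚ : ℚ
  2ℚ = + 2 / 1
  3ℚ = + 3 / 1
  4ℚ = + 4 / 1

  private
    x₀ x₁ : Poly
    x₀ = var 0
    x₁ = var 1

    -- a⁴ + 2a²b² - 4ab³ + b⁴, factored as the product of g = a - b and its cofactor.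
    E₂ : Poly
    E₂ = (x₀ :- x₁) :* ((x₀ :- x₁) :* (x₀ :- x₁) :* (x₀ :- x₁) :+ con (+ 4) :* ((x₀ :- x₁) :* (x₀ :- x₁) :* x₁)
         :+ con (+ 8) :* ((x₀ :- x₁) :* x₁ :* x₁) :+ con (+ 4) :* (x₁ :* x₁ :* x₁))

    abstract
      E₂-homogenise : ∀ q y a b → q * b ≡ a → y * y ≡ q * q * q * q + 2ℚ * (q * q) - 4ℚ * q + 1ℚ →
        b * b * y * (b * b * y) ≡ (a - b) * ((a - b) * (a - b) * (a - b) + (+ 4 / 1) * ((a - b) * (a - b) * b)
          + (+ 8 / 1) * ((a - b) * b * b) + (+ 4 / 1) * (b * b * b))
      E₂-homogenise q y _ b refl e = combine₁ (b * b * b * b) e (solve 3 (λ q y b → let a = q :* b in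
          b :* b :* y :* (b :* b :* y) :- (a :- b) :* ((a :- b) :* (a :- b) :* (a :- b) :+ con (+ 4) :* ((a :- b) :* (a :- b) :* b) :+ con (+ 8) :* ((a :- b) :* b :* b) :+ con (+ 4) :* (b :* b :* b))
          := b :* b :* b :* b :* (y :* y :- (q :* q :* q :* q :+ con (+ 2) :* (q :* q) :- con (+ 4) :* q :+ con 1ℤ))) q y b)

    difference-coprime : ∀ a b → Coprime b a → Coprime (a ℤ.- b) b
    difference-coprime a b (s , t , e) = t , s ℤ.+ t , trans (ℤ-solve 4 (λ a b s t → t :* (a :- b) :+ (s :+ t) :* b := s :* b :+ t :* a) a b s t) e

    cofactor-form : ℤ → ℤ → ℤ
    cofactor-form g m = g ℤ.* (g ℤ.* g ℤ.* g ℤ.+ + 4 ℤ.* (g ℤ.* g ℤ.* m) ℤ.+ + 8 ℤ.* (g ℤ.* m ℤ.* m) ℤ.+ + 4 ℤ.* (m ℤ.* m ℤ.* m))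

    abstract
      negate-form : ∀ g m → g ℤ.* (g ℤ.* g ℤ.* g ℤ.+ + 4 ℤ.* (g ℤ.* g ℤ.* m) ℤ.+ + 8 ℤ.* (g ℤ.* m ℤ.* m) ℤ.+ + 4 ℤ.* (m ℤ.* m ℤ.* m))
        ≡ ℤ.- g ℤ.* (ℤ.- g ℤ.* ℤ.- g ℤ.* ℤ.- g ℤ.+ + 4 ℤ.* (ℤ.- g ℤ.* ℤ.- g ℤ.* ℤ.- m) ℤ.+ + 8 ℤ.* (ℤ.- g ℤ.* ℤ.- m ℤ.* ℤ.- m) ℤ.+ + 4 ℤ.* (ℤ.- m ℤ.* ℤ.- m ℤ.* ℤ.- m))
      negate-form = ℤ-solve 2 (λ g m →
        g :* (g :* g :* g :+ con (+ 4) :* (g :* g :* m) :+ con (+ 8) :* (g :* m :* m) :+ con (+ 4) :* (m :* m :* m))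
        := :- g :* (:- g :* :- g :* :- g :+ con (+ 4) :* (:- g :* :- g :* :- m) :+ con (+ 8) :* (:- g :* :- m :* :- m) :+ con (+ 4) :* (:- m :* :- m :* :- m)))

      neg-coprime : ∀ s t g m → s ℤ.* g ℤ.+ t ℤ.* m ≡ 1ℤ → ℤ.- s ℤ.* ℤ.- g ℤ.+ ℤ.- t ℤ.* ℤ.- m ≡ 1ℤ
      neg-coprime s t g m e = trans (ℤ-solve 4 (λ s t g m → :- s :* :- g :+ :- t :* :- m := s :* g :+ t :* m) s t g m) e

    elliptic-integer′ : ∀ g m Y → g ≢ 0ℤ → Coprime g m → cofactor-form g m ≡ Y ℤ.* Y → m ≡ 0ℤ ⊎ m ≡ ℤ.- g
    elliptic-integer′ g m Y g≢0 g⊥m@(s , t , e) eq with ℤ.≤-total 0ℤ g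
    ... | inj₁ 0≤g = elliptic-integer g m Y 0≤g g≢0 g⊥m eq
    ... | inj₂ g≤0 with elliptic-integer (ℤ.- g) (ℤ.- m) Y (ℤ.neg-mono-≤ g≤0) (λ e → g≢0 (ℤ.neg-injective e)) (ℤ.- s , ℤ.- t , neg-coprime s t g m e) (trans (sym (negate-form g m)) eq)
    ...   | inj₁ -m≡0 = inj₁ (ℤ.neg-injective -m≡0)
    ...   | inj₂ -m≡--g = inj₂ (ℤ.neg-injective -m≡--g)

    -- With g = a - b and m = b, the case g = 0 is q = 1. Otherwise the integral solutions are m =
    -- -g, which is q = 0, and m = 0, which corresponds to the points at infinity and is excluded by
    -- b ≠ 0.
    elliptic-fraction : ∀ q a b w → b ≢ 0ℤ → q * ι b ≡ ι a → Coprime b a → cofactor-form (a ℤ.- b) b ≡ w ℤ.* w → q ≡ 0ℚ ⊎ q ≡ 1ℚ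
    elliptic-fraction q a b w b≢0 qb≡a b⊥a eq with (a ℤ.- b) ℤ.≟ 0ℤ
    ... | yes a-b≡0 = inj₂ (a-b≡0⇒a≡b q 1ℚ (cancel (ι b) (q - 1ℚ) (ι≢0 b≢0) (at-one q (ι b) (trans qb≡a (cong ι (ℤ.i-j≡0⇒i≡j a b a-b≡0))))))
      where
      at-one : ∀ q b → q * b ≡ b → b * (q - 1ℚ) ≡ 0ℚ
      at-one q b e = combine₁ 1ℚ e (solve 2 (λ q b → b :* (q :- con 1ℤ) :- con 0ℤ := con 1ℤ :* (q :* b :- b)) q b)
    ... | no a-b≢0 with elliptic-integer′ (a ℤ.- b) b w a-b≢0 (difference-coprime a b b⊥a) eq
    ...   | inj₁ b≡0 = contradiction b≡0 b≢0
    ...   | inj₂ b≡-a+b = inj₁ (cancel (ι b) q (ι≢0 b≢0) (trans (ℚ.*-comm (ι b) q) (trans qb≡a (cong ι (a≡0 a b b≡-a+b)))))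
      where
      a≡0 : ∀ a b → b ≡ ℤ.- (a ℤ.- b) → a ≡ 0ℤ
      a≡0 a b e = trans (ℤ-solve 2 (λ a b → a := b :- (:- (a :- b))) a b) (trans (cong (ℤ._- (ℤ.- (a ℤ.- b))) e) (ℤ.+-inverseʳ (ℤ.- (a ℤ.- b))))

  abstract
    elliptic-rational : ∀ q y → y * y ≡ q * q * q * q + 2ℚ * (q * q) - 4ℚ * q + 1ℚ → q ≡ 0ℚ ⊎ q ≡ 1ℚ
    elliptic-rational q y e =
      let a , b , b≢0 , b⊥a , qb≡a = reduced-fraction q
          w , eq = integer-square (IntegerIdentity.⟦ E₂ ⟧ (a ∷ b ∷ [])) (ι b * ι b * y)
            (trans (E₂-homogenise q y (ι a) (ι b) qb≡a e) (sym (ι-eval E₂ (a ∷ b ∷ []))))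
      in elliptic-fraction q a b w b≢0 qb≡a b⊥a eq

-- Rational points on the curve of conductor 24.

module RationalQuartics where
  open import Data.Integer as ℤ using (ℤ; +_; -[1+_]; 0ℤ; 1ℤ; -1ℤ)
  import Data.Integer.Properties as ℤ
  open import Data.Nat.Base as ℕ using (ℕ)
  import Data.Nat.Properties as ℕ
  open import Data.Product using (_,_; ∃-syntax; proj₁; proj₂)
  open import Data.Rational using (ℚ; _+_; _*_; -_; _-_; 0ℚ; 1ℚ; _/_; _<_; _<?_)
  import Data.Rational.Properties as ℚ
  open import Data.Sum using (_⊎_; inj₁; inj₂; [_,_]′)
  open import Data.List.Base using ([]; _∷_)
  open import Relation.Binary.PropositionalEquality
  open import Relation.Nullary using (contradiction)
  open import Relation.Nullary.Decidable using (toWitness)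
  open import Data.Unit.Base using (tt)
  open QuarticFinal using (quartic⁺; quartic⁻)
  open RationalBase
  open RationalCurves using (ι; 2ℚ; 3ℚ; 4ℚ)
  open LinearCombination ℚ.+-*-isCommutativeRing

  x₀ x₁ : Poly
  x₀ = var 0
  x₁ = var 1

  quartic-expr : ℤ → Poly
  quartic-expr σ = x₀ :* x₀ :* (x₀ :* x₀) :+ con σ :* (x₀ :* x₀ :* (x₁ :* x₁)) :+ x₁ :* x₁ :* (x₁ :* x₁)

  abstract
    homogenise : ∀ σ s p z S P d e → s * d ≡ S → p * e ≡ P → s * s * (s * s) + σ * (s * s * (p * p)) + p * p * (p * p) ≡ z * z →
      d * e * (d * e) * z * (d * e * (d * e) * z)
      ≡ S * e * (S * e) * (S * e * (S * e)) + σ * (S * e * (S * e) * (P * d * (P * d))) + P * d * (P * d) * (P * d * (P * d))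
    homogenise σ s p z _ _ d e refl refl eq = combine₁ (- (d * e * (d * e) * (d * e * (d * e)))) eq (solve 6 (λ σ s p z d e → let S = s :* d; P = p :* e in
        d :* e :* (d :* e) :* z :* (d :* e :* (d :* e) :* z) :- (S :* e :* (S :* e) :* (S :* e :* (S :* e)) :+ σ :* (S :* e :* (S :* e) :* (P :* d :* (P :* d))) :+ P :* d :* (P :* d) :* (P :* d :* (P :* d)))
        := :- (d :* e :* (d :* e) :* (d :* e :* (d :* e))) :* (s :* s :* (s :* s) :+ σ :* (s :* s :* (p :* p)) :+ p :* p :* (p :* p) :- z :* z)) σ s p z d e)

    clear-zero : ∀ s d e S → s * d ≡ S → S * e ≡ 0ℚ → d * (e * s) ≡ 0ℚ
    clear-zero s d e _ refl eq = trans (solve 3 (λ s d e → d :* (e :* s) := s :* d :* e) s d e) eq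

    clear-squares : ∀ s p d e S P → s * d ≡ S → p * e ≡ P → S * e * (S * e) ≡ P * d * (P * d) → d * (d * (e * (e * (s * s - p * p)))) ≡ 0ℚ
    clear-squares s p d e _ _ refl refl eq = combine₁ 1ℚ eq (solve 4 (λ s p d e →
        d :* (d :* (e :* (e :* (s :* s :- p :* p)))) :- con 0ℤ
        := con 1ℤ :* (s :* d :* e :* (s :* d :* e) :- p :* e :* d :* (p :* e :* d))) s p d e)

  module _ (s p : ℚ) where
    private
      fs = fraction s
      fp = fraction p
      S = proj₁ fs
      d = proj₁ (proj₂ fs)
      P = proj₁ fp
      e = proj₁ (proj₂ fp)
      d≢0 = ι≢0 (proj₁ (proj₂ (proj₂ fs)))
      e≢0 = ι≢0 (proj₁ (proj₂ (proj₂ fp)))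
      sd≡S = proj₂ (proj₂ (proj₂ fs))
      pe≡P = proj₂ (proj₂ (proj₂ fp))

    integral : ∀ σ z → s * s * (s * s) + ι σ * (s * s * (p * p)) + p * p * (p * p) ≡ z * z →
      ∃[ w ] IntegerIdentity.⟦ quartic-expr σ ⟧ (S ℤ.* e ∷ P ℤ.* d ∷ []) ≡ w ℤ.* w
    integral σ z eq = integer-square _ (ι d * ι e * (ι d * ι e) * z)
      (trans (homogenise (ι σ) s p z (ι S) (ι P) (ι d) (ι e) sd≡S pe≡P eq)
        (trans (cong₂ (λ X Y → X * X * (X * X) + ι σ * (X * X * (Y * Y)) + Y * Y * (Y * Y)) (sym (ι-* S e)) (sym (ι-* P d)))
          (sym (ι-eval (quartic-expr σ) (S ℤ.* e ∷ P ℤ.* d ∷ [])))))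

    s-zero : S ℤ.* e ≡ 0ℤ → s ≡ 0ℚ
    s-zero Se≡0 = cancel (ι e) s e≢0 (cancel (ι d) (ι e * s) d≢0 (clear-zero s (ι d) (ι e) (ι S) sd≡S (trans (sym (ι-* S e)) (cong ι Se≡0))))

    p-zero : P ℤ.* d ≡ 0ℤ → p ≡ 0ℚ
    p-zero Pd≡0 = cancel (ι d) p d≢0 (cancel (ι e) (ι d * p) e≢0 (clear-zero p (ι e) (ι d) (ι P) pe≡P (trans (sym (ι-* P d)) (cong ι Pd≡0))))

    squares-equal : S ℤ.* e ℤ.* (S ℤ.* e) ≡ P ℤ.* d ℤ.* (P ℤ.* d) → s * s ≡ p * p
    squares-equal eq = a-b≡0⇒a≡b (s * s) (p * p) (cancel (ι e) _ e≢0 (cancel (ι e) _ e≢0 (cancel (ι d) _ d≢0 (cancel (ι d) _ d≢0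
      (clear-squares s p (ι d) (ι e) (ι S) (ι P) sd≡S pe≡P
        (trans (cong₂ _*_ (sym (ι-* S e)) (sym (ι-* S e))) (trans (sym (ι-* (S ℤ.* e) (S ℤ.* e))) (trans (cong ι eq) (trans (ι-* (P ℤ.* d) (P ℤ.* d)) (cong₂ _*_ (ι-* P d) (ι-* P d)))))))))))

    abstract
      quarticℚ⁺ : ∀ z → s * s * (s * s) + ι 1ℤ * (s * s * (p * p)) + p * p * (p * p) ≡ z * z → s ≡ 0ℚ ⊎ p ≡ 0ℚ
      quarticℚ⁺ z eq = let w , e′ = integral 1ℤ z eq in
        [ (λ h → inj₁ (s-zero h)) , (λ h → inj₂ (p-zero h)) ]′ (quartic⁺ (S ℤ.* e) (P ℤ.* d) w e′)

      quarticℚ⁻ : ∀ z → s * s * (s * s) + ι -1ℤ * (s * s * (p * p)) + p * p * (p * p) ≡ z * z → (s ≡ 0ℚ ⊎ p ≡ 0ℚ) ⊎ s * s ≡ p * p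
      quarticℚ⁻ z eq = let w , e′ = integral -1ℤ z eq in
        [ (λ h → inj₁ ([ (λ h → inj₁ (s-zero h)) , (λ h → inj₂ (p-zero h)) ]′ h)) , (λ h → inj₂ (squares-equal h)) ]′ (quartic⁻ (S ℤ.* e) (P ℤ.* d) w e′)

  three-not-square : ∀ (w : ℤ) → + 3 ≢ w ℤ.* w
  three-not-square w e = natural ℤ.∣ w ∣ (trans (cong ℤ.∣_∣ e) (ℤ.abs-* w w))
    where
    natural : ∀ n → 3 ≢ n ℕ.* n
    natural 0 ()
    natural 1 ()
    natural (ℕ.suc (ℕ.suc n)) e = contradiction (subst (4 ℕ.≤_) (sym e) (ℕ.*-mono-≤ {2} {2 ℕ.+ n} {2} {2 ℕ.+ n} (ℕ.m≤m+n 2 n) (ℕ.m≤m+n 2 n))) λ { (ℕ.s≤s (ℕ.s≤s (ℕ.s≤s ()))) }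

  √3-irrational : ∀ p → p * p ≢ 3ℚ
  √3-irrational p e = let w , 3≡ww = integer-square (+ 3) p e in three-not-square w 3≡ww

  positive : ∀ {c} → {{_ : Relation.Nullary.Decidable.True (0ℚ <? c)}} → 0ℚ < c
  positive {{t}} = toWitness t

  abstract
    -- The factor p² + 1 carries the extra square 0 · 0 so that it has the shape of
    -- `sum-of-squares≢`.
    √-cases : ∀ p → (p * p - 1ℚ) * (p * p - 1ℚ) ≡ 4ℚ → (p * p - 3ℚ) * (p * p + 0ℚ * 0ℚ + 1ℚ) ≡ 0ℚ
    √-cases p e = combine₁ 1ℚ e (solve 1 (λ p →
        (p :* p :- con (+ 3)) :* (p :* p :+ con 0ℤ :* con 0ℤ :+ con 1ℤ) :- con 0ℤ
        := con 1ℤ :* ((p :* p :- con 1ℤ) :* (p :* p :- con 1ℤ) :- con (+ 4))) p)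

    -- For x = s² - p² the hypothesis says x² = 2(p² + s²) + 3, and then 16(s⁴ - s²p² + p⁴) = (x² +
    -- 3)². Geometrically this is a map of degree 2 onto the quartic.
    24a-quartic : ∀ p s → ((p + s) * (p + s) - 1ℚ) * ((p - s) * (p - s) - 1ℚ) ≡ 4ℚ →
      let S = 2ℚ * s; P = 2ℚ * p; x = s * s - p * p in
      S * S * (S * S) + (-[1+ 0 ] / 1) * (S * S * (P * P)) + P * P * (P * P) ≡ (x * x + 3ℚ) * (x * x + 3ℚ)
    24a-quartic p s e = combine₁ (6ℚ - x * x - 2ℚ * (p * p + s * s) - 3ℚ) e (identity p s)
      where
      x 6ℚ : ℚ
      x = s * s - p * p
      6ℚ = + 6 / 1
      identity : ∀ p s → let S = 2ℚ * s; P = 2ℚ * p; x = s * s - p * p in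
        S * S * (S * S) + (-[1+ 0 ] / 1) * (S * S * (P * P)) + P * P * (P * P) - (x * x + 3ℚ) * (x * x + 3ℚ)
        ≡ ((+ 6 / 1) - x * x - 2ℚ * (p * p + s * s) - 3ℚ) * (((p + s) * (p + s) - 1ℚ) * ((p - s) * (p - s) - 1ℚ) - 4ℚ)
      identity = solve 2 (λ p s → let S = con (+ 2) :* s; P = con (+ 2) :* p; x = s :* s :- p :* p in
        S :* S :* (S :* S) :+ con -1ℤ :* (S :* S :* (P :* P)) :+ P :* P :* (P :* P) :- (x :* x :+ con (+ 3)) :* (x :* x :+ con (+ 3))
        := (con (+ 6) :- x :* x :- con (+ 2) :* (p :* p :+ s :* s) :- con (+ 3)) :* (((p :+ s) :* (p :+ s) :- con 1ℤ) :* ((p :- s) :* (p :- s) :- con 1ℤ) :- con (+ 4)))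

    at-s≡0 : ∀ p → ((p + 0ℚ) * (p + 0ℚ) - 1ℚ) * ((p - 0ℚ) * (p - 0ℚ) - 1ℚ) ≡ (p * p - 1ℚ) * (p * p - 1ℚ)
    at-s≡0 = solve 1 (λ p →
      ((p :+ con 0ℤ) :* (p :+ con 0ℤ) :- con 1ℤ) :* ((p :- con 0ℤ) :* (p :- con 0ℤ) :- con 1ℤ)
      := (p :* p :- con 1ℤ) :* (p :* p :- con 1ℤ))
    at-p≡0 : ∀ s → ((0ℚ + s) * (0ℚ + s) - 1ℚ) * ((0ℚ - s) * (0ℚ - s) - 1ℚ) ≡ (s * s - 1ℚ) * (s * s - 1ℚ)
    at-p≡0 = solve 1 (λ s →
      ((con 0ℤ :+ s) :* (con 0ℤ :+ s) :- con 1ℤ) :* ((con 0ℤ :- s) :* (con 0ℤ :- s) :- con 1ℤ)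
      := (s :* s :- con 1ℤ) :* (s :* s :- con 1ℤ))
    at-x≡0 : ∀ p s → ((p + s) * (p + s) - 1ℚ) * ((p - s) * (p - s) - 1ℚ) ≡ 4ℚ → 2ℚ * s * (2ℚ * s) ≡ 2ℚ * p * (2ℚ * p) →
      4ℚ * s * (4ℚ * s) + 4ℚ * p * (4ℚ * p) + (+ 24 / 1) ≡ 0ℚ
    at-x≡0 p s e e′ = combine₂ (- (+ 8 / 1)) (2ℚ * (s * s - p * p)) e e′ (solve 2 (λ p s →
        con (+ 4) :* s :* (con (+ 4) :* s) :+ con (+ 4) :* p :* (con (+ 4) :* p) :+ con (+ 24) :- con 0ℤ
        := :- con (+ 8) :* (((p :+ s) :* (p :+ s) :- con 1ℤ) :* ((p :- s) :* (p :- s) :- con 1ℤ) :- con (+ 4)) :+ con (+ 2) :* (s :* s :- p :* p) :* (con (+ 2) :* s :* (con (+ 2) :* s) :- con (+ 2) :* p :* (con (+ 2) :* p))) p s)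

  half≡0 : ∀ s → 2ℚ * s ≡ 0ℚ → s ≡ 0ℚ
  half≡0 s = cancel 2ℚ s λ ()

  no-square : ∀ p → (p * p - 1ℚ) * (p * p - 1ℚ) ≢ 4ℚ
  no-square p e = [ (λ pp-3≡0 → √3-irrational p (a-b≡0⇒a≡b (p * p) 3ℚ pp-3≡0)) , sum-of-squares≢ p 0ℚ 1ℚ positive ]′
    (product≡0 (p * p - 3ℚ) (p * p + 0ℚ * 0ℚ + 1ℚ) (√-cases p e))

  -- In A = 1 + p + s and B = 1 + p - s this is A(A - 2)B(B - 2); set equal to 4, it defines a curve
  -- of conductor 24.
  24a : ℚ → ℚ → ℚ
  24a p s = ((p + s) * (p + s) - 1ℚ) * ((p - s) * (p - s) - 1ℚ)

  -- None of the trivial points of the quartic lifts to this curve: s = 0 or p = 0 would need a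
  -- rational root of 3 or -1, and s² = p² would make a sum of squares equal to -24.
  no-24a : ∀ p s → 24a p s ≢ 4ℚ
  no-24a p s e = [ [ (λ 2s≡0 → no-square p (trans (sym (at-s≡0 p)) (subst (λ s → 24a p s ≡ 4ℚ) (half≡0 s 2s≡0) e)))
                   , (λ 2p≡0 → no-square s (trans (sym (at-p≡0 s)) (subst (λ p → 24a p s ≡ 4ℚ) (half≡0 p 2p≡0) e))) ]′
                 , (λ squares → sum-of-squares≢ (4ℚ * s) (4ℚ * p) (+ 24 / 1) positive (at-x≡0 p s e squares)) ]′
    (quarticℚ⁻ (2ℚ * s) (2ℚ * p) ((s * s - p * p) * (s * s - p * p) + 3ℚ) (24a-quartic p s e))

  abstract
    -- With B = 2Q/X, p = (X + B)/2 - 1 and s = (X - B)/2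
    to-24a : ∀ X Q l → 1ℚ ≡ l * X → (X - 2ℚ) * Q * (Q - X) ≡ X → let h = + 1 / 2; B = 2ℚ * Q * l; p = h * (X + B) - 1ℚ; s = h * (X - B) in
      ((p + s) * (p + s) - 1ℚ) * ((p - s) * (p - s) - 1ℚ) ≡ 4ℚ
    to-24a X Q l e e′ = trans (cong₂ (λ m n → (m * m - 1ℚ) * (n * n - 1ℚ)) (sum h X B refl) (difference h X B refl))
      (combine₂ (- (4ℚ * (X - 2ℚ) * Q * Q * l) - 4ℚ) (4ℚ * l) e e′ (solve 3 (λ X Q l → let B = con (+ 2) :* Q :* l in
        ((X :- con 1ℤ) :* (X :- con 1ℤ) :- con 1ℤ) :* ((B :- con 1ℤ) :* (B :- con 1ℤ) :- con 1ℤ) :- con (+ 4)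
        := (:- (con (+ 4) :* (X :- con (+ 2)) :* Q :* Q :* l) :- con (+ 4)) :* (con 1ℤ :- l :* X) :+ con (+ 4) :* l :* ((X :- con (+ 2)) :* Q :* (Q :- X) :- X)) X Q l))
      where
      h B : ℚ
      h = + 1 / 2
      B = 2ℚ * Q * l
      sum : ∀ h X B → h + h ≡ 1ℚ → h * (X + B) - 1ℚ + h * (X - B) ≡ X - 1ℚ
      sum h X B e = combine₁ X e (solve 3 (λ h X B → h :* (X :+ B) :- con 1ℤ :+ h :* (X :- B) :- (X :- con 1ℤ) := X :* (h :+ h :- con 1ℤ)) h X B)
      difference : ∀ h X B → h + h ≡ 1ℚ → h * (X + B) - 1ℚ - h * (X - B) ≡ B - 1ℚ
      difference h X B e = combine₁ B e (solve 3 (λ h X B → h :* (X :+ B) :- con 1ℤ :- h :* (X :- B) :- (B :- con 1ℤ) := B :* (h :+ h :- con 1ℤ)) h X B)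

-- Quadratic points of the quartic.

module RationalPoints where
  open import Data.Integer as ℤ using (ℤ; +_; 0ℤ; 1ℤ)
  import Data.Integer.Properties as ℤ
  open import Data.Nat.Base as ℕ using (ℕ)
  import Data.Nat.Properties as ℕ
  open import Data.Product using (_,_)
  open import Data.Rational using (ℚ; _+_; _*_; -_; _-_; 0ℚ; 1ℚ; _/_)
  import Data.Rational.Properties as ℚ
  open import Data.Sum using (_⊎_; inj₁; inj₂; [_,_]′)
  open import Relation.Binary.PropositionalEquality
  open import Relation.Nullary using (contradiction; yes; no)
  open RationalBase
  open RationalCurves using (2ℚ; 4ℚ; elliptic-rational)
  open RationalQuartics using (no-24a; to-24a)
  open LinearCombination ℚ.+-*-isCommutativeRing

  no-24a-fraction : ∀ X Q → X ≢ 0ℚ → (X - 2ℚ) * Q * (Q - X) ≢ X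
  no-24a-fraction X Q X≢0 e = let l , 1≡lX = divide 1ℚ X X≢0; h = + 1 / 2; B = 2ℚ * Q * l in
    no-24a (h * (X + B) - 1ℚ) (h * (X - B)) (to-24a X Q l 1≡lX e)

  private
    abstract
      -- The choice of κ is forced by the factorisation y² - (x⁴ + 2x² - 4x + 1) = (x² - tx + n)(2ex
      -- + κ) on the parabola y = x² + ex + k. This lemma and `relation-X⁰` compare the coefficients
      -- of x and of 1.
      relation-X¹ : ∀ t n l h → l * l * t + 2ℚ * l * h ≡ t * t * t - 2ℚ * t * n + 2ℚ * t - 4ℚ →
        let e = l - t; k = h + n; κ = e * e + 2ℚ * k - 2ℚ + 2ℚ * e * t in 2ℚ * e * k + 4ℚ ≡ 2ℚ * e * n - t * κ
      relation-X¹ t n l h eq = combine₁ 1ℚ eq (solve 4 (λ t n l h → let e = l :- t; k = h :+ n; κ = e :* e :+ con (+ 2) :* k :- con (+ 2) :+ con (+ 2) :* e :* t in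
          con (+ 2) :* e :* k :+ con (+ 4) :- (con (+ 2) :* e :* n :- t :* κ)
          := con 1ℤ :* (l :* l :* t :+ con (+ 2) :* l :* h :- (t :* t :* t :- con (+ 2) :* t :* n :+ con (+ 2) :* t :- con (+ 4)))) t n l h)

      relation-X⁰ : ∀ t n l h → h * h - l * l * n ≡ n * n - t * t * n - 2ℚ * n + 1ℚ →
        let e = l - t; k = h + n; κ = e * e + 2ℚ * k - 2ℚ + 2ℚ * e * t in k * k - 1ℚ ≡ n * κ
      relation-X⁰ t n l h eq = combine₁ 1ℚ eq (solve 4 (λ t n l h → let e = l :- t; k = h :+ n; κ = e :* e :+ con (+ 2) :* k :- con (+ 2) :+ con (+ 2) :* e :* t in
          k :* k :- con 1ℤ :- n :* κ
          := con 1ℤ :* (h :* h :- l :* l :* n :- (n :* n :- t :* t :* n :- con (+ 2) :* n :+ con 1ℤ))) t n l h)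

      third-point : ∀ X t n e k → let κ = e * e + 2ℚ * k - 2ℚ + 2ℚ * e * t in
        2ℚ * e * k + 4ℚ ≡ 2ℚ * e * n - t * κ → k * k - 1ℚ ≡ n * κ → - κ ≡ X * (2ℚ * e) →
        let y = X * X + e * X + k in y * y ≡ X * X * X * X + 2ℚ * (X * X) - 4ℚ * X + 1ℚ
      third-point X t n e k e₁ e₀ eκ = combine₃ X 1ℚ (- (X * X - t * X + n)) e₁ e₀ eκ (solve 5 (λ X t n e k → let κ = e :* e :+ con (+ 2) :* k :- con (+ 2) :+ con (+ 2) :* e :* t; y = X :* X :+ e :* X :+ k in
          y :* y :- (X :* X :* X :* X :+ con (+ 2) :* (X :* X) :- con (+ 4) :* X :+ con 1ℤ)
          := X :* (con (+ 2) :* e :* k :+ con (+ 4) :- (con (+ 2) :* e :* n :- t :* κ)) :+ con 1ℤ :* (k :* k :- con 1ℤ :- n :* κ) :+ :- (X :* X :- t :* X :+ n) :* (:- κ :- X :* (con (+ 2) :* e))) X t n e k)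

      factor-e≡0 : ∀ t n e k → e ≡ 0ℚ → let κ = e * e + 2ℚ * k - 2ℚ + 2ℚ * e * t in k * k - 1ℚ ≡ n * κ → (k - 1ℚ) * (k + 1ℚ - 2ℚ * n) ≡ 0ℚ
      factor-e≡0 t n _ k refl e₀ = combine₁ 1ℚ e₀ (solve 3 (λ t n k →
          (k :- con 1ℤ) :* (k :+ con 1ℤ :- con (+ 2) :* n) :- con 0ℤ
          := con 1ℤ :* (k :* k :- con 1ℤ :- n :* (con 0ℤ :* con 0ℤ :+ con (+ 2) :* k :- con (+ 2) :+ con (+ 2) :* con 0ℤ :* t))) t n k)

      e≡0,k≡1 : ∀ t n e k → e ≡ 0ℚ → k - 1ℚ ≡ 0ℚ → let κ = e * e + 2ℚ * k - 2ℚ + 2ℚ * e * t in 2ℚ * e * k + 4ℚ ≡ 2ℚ * e * n - t * κ → 4ℚ ≡ 0ℚ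
      e≡0,k≡1 t n _ k refl k-1≡0 e₁ = combine₂ 1ℚ (- (2ℚ * t)) e₁ k-1≡0 (solve 3 (λ t n k →
          con (+ 4) :- con 0ℤ
          := con 1ℤ :* (con (+ 2) :* con 0ℤ :* k :+ con (+ 4) :- (con (+ 2) :* con 0ℤ :* n :- t :* (con 0ℤ :* con 0ℤ :+ con (+ 2) :* k :- con (+ 2) :+ con (+ 2) :* con 0ℤ :* t))) :+ :- (con (+ 2) :* t) :* (k :- con 1ℤ :- con 0ℤ)) t n k)

      e≡0,k≡2n-1 : ∀ t n e k → e ≡ 0ℚ → k + 1ℚ - 2ℚ * n ≡ 0ℚ → let κ = e * e + 2ℚ * k - 2ℚ + 2ℚ * e * t in 2ℚ * e * k + 4ℚ ≡ 2ℚ * e * n - t * κ →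
        4ℚ * ((n - 1ℚ) * t + 1ℚ) ≡ 0ℚ
      e≡0,k≡2n-1 t n _ k refl ek e₁ = combine₂ 1ℚ (- (2ℚ * t)) e₁ ek (solve 3 (λ t n k →
          con (+ 4) :* ((n :- con 1ℤ) :* t :+ con 1ℤ) :- con 0ℤ
          := con 1ℤ :* (con (+ 2) :* con 0ℤ :* k :+ con (+ 4) :- (con (+ 2) :* con 0ℤ :* n :- t :* (con 0ℤ :* con 0ℤ :+ con (+ 2) :* k :- con (+ 2) :+ con (+ 2) :* con 0ℤ :* t))) :+ :- (con (+ 2) :* t) :* (k :+ con 1ℤ :- con (+ 2) :* n :- con 0ℤ)) t n k)

      X≡0⇒κ≡0 : ∀ κ X e → - κ ≡ X * (2ℚ * e) → X ≡ 0ℚ → κ ≡ 0ℚ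
      X≡0⇒κ≡0 κ _ e eκ refl = combine₁ (- 1ℚ) eκ (solve 2 (λ κ e → κ :- con 0ℤ := :- con 1ℤ :* (:- κ :- con 0ℤ :* (con (+ 2) :* e))) κ e)

      k²≡1 : ∀ k n κ → k * k - 1ℚ ≡ n * κ → κ ≡ 0ℚ → (k - 1ℚ) * (k + 1ℚ) ≡ 0ℚ
      k²≡1 k n _ e refl = combine₁ 1ℚ e (solve 2 (λ k n → (k :- con 1ℤ) :* (k :+ con 1ℤ) :- con 0ℤ := con 1ℤ :* (k :* k :- con 1ℤ :- n :* con 0ℤ)) k n)

      k≡1⇒factor : ∀ t e k → k ≡ 1ℚ → e * e + 2ℚ * k - 2ℚ + 2ℚ * e * t ≡ 0ℚ → e * (e + 2ℚ * t) ≡ 0ℚ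
      k≡1⇒factor t e _ refl κ≡0 = combine₁ 1ℚ κ≡0 (solve 2 (λ t e →
          e :* (e :+ con (+ 2) :* t) :- con 0ℤ
          := con 1ℤ :* (e :* e :+ con (+ 2) :* con 1ℤ :- con (+ 2) :+ con (+ 2) :* e :* t :- con 0ℤ)) t e)

      k≡1⇒ : ∀ t n e k → k ≡ 1ℚ → let κ = e * e + 2ℚ * k - 2ℚ + 2ℚ * e * t in
        2ℚ * e * k + 4ℚ ≡ 2ℚ * e * n - t * κ → κ ≡ 0ℚ → e + 2ℚ * t ≡ 0ℚ → 4ℚ * ((n - 1ℚ) * t + 1ℚ) ≡ 0ℚ
      k≡1⇒ t n e _ refl e₁ κ≡0 e+2t≡0 = combine₃ 1ℚ (- t) (2ℚ * (n - 1ℚ)) e₁ κ≡0 e+2t≡0 (solve 3 (λ t n e → let κ = e :* e :+ con (+ 2) :* con 1ℤ :- con (+ 2) :+ con (+ 2) :* e :* t in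
          con (+ 4) :* ((n :- con 1ℤ) :* t :+ con 1ℤ) :- con 0ℤ
          := con 1ℤ :* (con (+ 2) :* e :* con 1ℤ :+ con (+ 4) :- (con (+ 2) :* e :* n :- t :* κ)) :+ :- t :* (κ :- con 0ℤ) :+ con (+ 2) :* (n :- con 1ℤ) :* (e :+ con (+ 2) :* t :- con 0ℤ)) t n e)

      k≡-1⇒ : ∀ t n e k → k ≡ - 1ℚ → let κ = e * e + 2ℚ * k - 2ℚ + 2ℚ * e * t in
        2ℚ * e * k + 4ℚ ≡ 2ℚ * e * n - t * κ → κ ≡ 0ℚ → 4ℚ * (e * (t * (n + 1ℚ) - (n * n + 2ℚ * n))) ≡ 0ℚ
      k≡-1⇒ t n e _ refl e₁ κ≡0 = combine₂ (2ℚ * (n + 1ℚ) + e) (2ℚ * (n + 1ℚ) - (2ℚ * (n + 1ℚ) + e) * t) e₁ κ≡0 (solve 3 (λ t n e → let κ = e :* e :+ con (+ 2) :* :- con 1ℤ :- con (+ 2) :+ con (+ 2) :* e :* t in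
          con (+ 4) :* (e :* (t :* (n :+ con 1ℤ) :- (n :* n :+ con (+ 2) :* n))) :- con 0ℤ
          := (con (+ 2) :* (n :+ con 1ℤ) :+ e) :* (con (+ 2) :* e :* :- con 1ℤ :+ con (+ 4) :- (con (+ 2) :* e :* n :- t :* κ)) :+ (con (+ 2) :* (n :+ con 1ℤ) :- (con (+ 2) :* (n :+ con 1ℤ) :+ e) :* t) :* (κ :- con 0ℤ)) t n e)

      X≡1⇒y≡0 : ∀ X e k → X ≡ 1ℚ → let y = X * X + e * X + k in y * y ≡ X * X * X * X + 2ℚ * (X * X) - 4ℚ * X + 1ℚ →
        (k - (- 1ℚ - e)) * (k - (- 1ℚ - e)) ≡ 0ℚ
      X≡1⇒y≡0 _ e k refl eq = combine₁ 1ℚ eq (solve 2 (λ e k → let y = con 1ℤ :* con 1ℤ :+ e :* con 1ℤ :+ k in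
          (k :- (:- con 1ℤ :- e)) :* (k :- (:- con 1ℤ :- e)) :- con 0ℤ
          := con 1ℤ :* (y :* y :- (con 1ℤ :* con 1ℤ :* con 1ℤ :* con 1ℤ :+ con (+ 2) :* (con 1ℤ :* con 1ℤ) :- con (+ 4) :* con 1ℤ :+ con 1ℤ))) e k)

      X≡1⇒factor : ∀ t n X e k → X ≡ 1ℚ → k ≡ - 1ℚ - e → let κ = e * e + 2ℚ * k - 2ℚ + 2ℚ * e * t in
        k * k - 1ℚ ≡ n * κ → - κ ≡ X * (2ℚ * e) → e * (e + 2ℚ + 2ℚ * n) ≡ 0ℚ
      X≡1⇒factor t n _ e _ refl refl e₀ eκ = combine₂ 1ℚ (- n) e₀ eκ (solve 3 (λ t n e → let k = :- con 1ℤ :- e; κ = e :* e :+ con (+ 2) :* k :- con (+ 2) :+ con (+ 2) :* e :* t in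
          e :* (e :+ con (+ 2) :+ con (+ 2) :* n) :- con 0ℤ
          := con 1ℤ :* (k :* k :- con 1ℤ :- n :* κ) :+ :- n :* (:- κ :- con 1ℤ :* (con (+ 2) :* e))) t n e)

      X≡1⇒ : ∀ t n X e k → X ≡ 1ℚ → k ≡ - 1ℚ - e → let κ = e * e + 2ℚ * k - 2ℚ + 2ℚ * e * t in
        2ℚ * e * k + 4ℚ ≡ 2ℚ * e * n - t * κ → - κ ≡ X * (2ℚ * e) → e + 2ℚ + 2ℚ * n ≡ 0ℚ → 4ℚ * (t * (n + 1ℚ) - (n * n + 2ℚ * n)) ≡ 0ℚ
      X≡1⇒ t n _ e _ refl refl e₁ eκ ee = combine₃ 1ℚ t (2ℚ * t + 2ℚ * (e - (n + 1ℚ))) e₁ eκ ee (solve 3 (λ t n e → let k = :- con 1ℤ :- e; κ = e :* e :+ con (+ 2) :* k :- con (+ 2) :+ con (+ 2) :* e :* t in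
          con (+ 4) :* (t :* (n :+ con 1ℤ) :- (n :* n :+ con (+ 2) :* n)) :- con 0ℤ
          := con 1ℤ :* (con (+ 2) :* e :* k :+ con (+ 4) :- (con (+ 2) :* e :* n :- t :* κ)) :+ t :* (:- κ :- con 1ℤ :* (con (+ 2) :* e)) :+ (con (+ 2) :* t :+ con (+ 2) :* (e :- (n :+ con 1ℤ))) :* (e :+ con (+ 2) :+ con (+ 2) :* n :- con 0ℤ)) t n e)

    2≢0 : 2ℚ ≢ 0ℚ
    2≢0 ()

    4≢0 : 4ℚ ≢ 0ℚ
    4≢0 ()

    twice≢0 : ∀ e → e ≢ 0ℚ → 2ℚ * e ≢ 0ℚ
    twice≢0 e e≢0 eq = e≢0 (cancel 2ℚ e 2≢0 eq)

    a+1≡0⇒ : ∀ k → k + 1ℚ ≡ 0ℚ → k ≡ - 1ℚ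
    a+1≡0⇒ k e = a-b≡0⇒a≡b k (- 1ℚ) e

  -- The first equation belongs to parabolas without a further finite intersection or with (0 , 1)
  -- as the further point, the second to those through (0 , -1) or (1 , 0).
  Obstruction : ℚ → ℚ → Set
  Obstruction t n = (n - 1ℚ) * t + 1ℚ ≡ 0ℚ ⊎ t * (n + 1ℚ) - (n * n + 2ℚ * n) ≡ 0ℚ

  -- If q ∉ ℚ has trace t and norm n and y = h + l q satisfies y² = q⁴ + 2q² − 4q + 1, then the parabola y = h + l x + (x² − t x + n)
  -- meets the curve in q, its conjugate and at most one further finite point, which is rational and hence has x ∈ {0, 1}.
  quadratic-point : ∀ t n l h → l * l * t + 2ℚ * l * h ≡ t * t * t - 2ℚ * t * n + 2ℚ * t - 4ℚ →
    h * h - l * l * n ≡ n * n - t * t * n - 2ℚ * n + 1ℚ → Obstruction t n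
  quadratic-point t n l h h₁ h₀ = split (e ℚ.≟ 0ℚ)
    where
    e k κ : ℚ
    e = l - t
    k = h + n
    κ = e * e + 2ℚ * k - 2ℚ + 2ℚ * e * t
    e₁ : 2ℚ * e * k + 4ℚ ≡ 2ℚ * e * n - t * κ
    e₁ = relation-X¹ t n l h h₁
    e₀ : k * k - 1ℚ ≡ n * κ
    e₀ = relation-X⁰ t n l h h₀
    fourth₁ : 4ℚ * ((n - 1ℚ) * t + 1ℚ) ≡ 0ℚ → Obstruction t n
    fourth₁ eq = inj₁ (cancel 4ℚ ((n - 1ℚ) * t + 1ℚ) 4≢0 eq)
    fourth₂ : 4ℚ * (t * (n + 1ℚ) - (n * n + 2ℚ * n)) ≡ 0ℚ → Obstruction t n
    fourth₂ eq = inj₂ (cancel 4ℚ (t * (n + 1ℚ) - (n * n + 2ℚ * n)) 4≢0 eq)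
    vertical : e ≡ 0ℚ → Obstruction t n
    vertical e≡0 =
      [ (λ k-1≡0 → contradiction (e≡0,k≡1 t n e k e≡0 k-1≡0 e₁) 4≢0)
      , (λ k≡2n-1 → fourth₁ (e≡0,k≡2n-1 t n e k e≡0 k≡2n-1 e₁)) ]′
        (product≡0 (k - 1ℚ) (k + 1ℚ - 2ℚ * n) (factor-e≡0 t n e k e≡0 e₀))
    module _ (e≢0 : e ≢ 0ℚ) where
      at-0 : κ ≡ 0ℚ → Obstruction t n
      at-0 κ≡0 =
        [ (λ k-1≡0 → let k≡1 = a-b≡0⇒a≡b k 1ℚ k-1≡0 in
            fourth₁ (k≡1⇒ t n e k k≡1 e₁ κ≡0 (cancel e (e + 2ℚ * t) e≢0 (k≡1⇒factor t e k k≡1 κ≡0))))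
        , (λ k+1≡0 → let Z = t * (n + 1ℚ) - (n * n + 2ℚ * n) in
            inj₂ (cancel e Z e≢0 (cancel 4ℚ (e * Z) 4≢0 (k≡-1⇒ t n e k (a+1≡0⇒ k k+1≡0) e₁ κ≡0)))) ]′
          (product≡0 (k - 1ℚ) (k + 1ℚ) (k²≡1 k n κ e₀ κ≡0))
      at-1 : ∀ X → - κ ≡ X * (2ℚ * e) → X ≡ 1ℚ → Obstruction t n
      at-1 X eκ X≡1 = let k≡ = a-b≡0⇒a≡b k (- 1ℚ - e) (square≡0 (k - (- 1ℚ - e)) (X≡1⇒y≡0 X e k X≡1 (third-point X t n e k e₁ e₀ eκ)))
        in fourth₂ (X≡1⇒ t n X e k X≡1 k≡ e₁ eκ (cancel e (e + 2ℚ + 2ℚ * n) e≢0 (X≡1⇒factor t n X e k X≡1 k≡ e₀ eκ)))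
      third : ∀ X → - κ ≡ X * (2ℚ * e) → Obstruction t n
      third X eκ = [ (λ X≡0 → at-0 (X≡0⇒κ≡0 κ X e eκ X≡0)) , at-1 X eκ ]′
        (elliptic-rational X (X * X + e * X + k) (third-point X t n e k e₁ e₀ eκ))
      oblique : Obstruction t n
      oblique = let X , eκ = divide (- κ) (2ℚ * e) (twice≢0 e e≢0) in third X eκ
    split : _ → Obstruction t n
    split (yes e≡0) = vertical e≡0
    split (no e≢0) = oblique e≢0

-- Two binary quartics whose product is a square.

module SquareProduct where
  open import Data.Integer as ℤ using (ℤ; +_; 1ℤ; -1ℤ; _+_; _*_; _-_; -_)
  import Data.Integer.Properties as ℤ
  open IntegerIdentity
  open import Data.Product using (_,_; ∃-syntax)
  open import Data.Sum using (_⊎_; inj₁; inj₂; [_,_]′)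
  open import Data.Empty using (⊥)
  open import Relation.Binary.PropositionalEquality
  open import Relation.Nullary using (contradiction)
  open IntegerCoprime
  open EllipticSquares using (Odd; odd≢even)
  open EllipticDescent using (parity; odd-square-root)
  open Quartics using (coprime-add; odd-form; Even; sign)
  open QuarticMain using (even-both)
  open LinearCombination ℤ.+-*-isCommutativeRing

  G₁ G₂ : ℤ → ℤ → ℤ
  G₁ a b = (a * a + b * b) * (a * a - + 4 * a * b + b * b)
  G₂ a b = a * a * (a * a) + + 2 * (a * a * (b * b)) - + 4 * (a * b * (b * b)) + b * b * (b * b)

  abstract
    G₁-sym : ∀ a b → G₁ a b ≡ G₁ b a
    G₁-sym a b = solve 2 (λ a b →
        (a :* a :+ b :* b) :* (a :* a :- con (+ 4) :* a :* b :+ b :* b)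
        := (b :* b :+ a :* a) :* (b :* b :- con (+ 4) :* b :* a :+ a :* a)) a b

    G₁-mod : ∀ a b k i → a ≡ i * k → G₁ a b ≡ b * b * (b * b) + (a * a * a - + 4 * a * a * b + + 2 * a * b * b - + 4 * b * b * b) * i * k
    G₁-mod _ b k i refl = solve 3 (λ b k i → let a = i :* k in
        (a :* a :+ b :* b) :* (a :* a :- con (+ 4) :* a :* b :+ b :* b)
        := b :* b :* (b :* b) :+ (a :* a :* a :- con (+ 4) :* a :* a :* b :+ con (+ 2) :* a :* b :* b :- con (+ 4) :* b :* b :* b) :* i :* k) b k i

    G₂-G₁ : ∀ a b δ ξ η → G₁ a b ≡ δ * (ξ * ξ) → G₂ a b ≡ δ * (η * η) → a * (a * (a * (b * + 4))) ≡ (η * η - ξ * ξ) * δ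
    G₂-G₁ a b δ ξ η e₁ e₂ = combine₂ (- 1ℤ) 1ℤ e₁ e₂ (solve 5 (λ a b δ ξ η →
        a :* (a :* (a :* (b :* con (+ 4)))) :- (η :* η :- ξ :* ξ) :* δ
        := :- con 1ℤ :* ((a :* a :+ b :* b) :* (a :* a :- con (+ 4) :* a :* b :+ b :* b) :- δ :* (ξ :* ξ)) :+ con 1ℤ :* (a :* a :* (a :* a) :+ con (+ 2) :* (a :* a :* (b :* b)) :- con (+ 4) :* (a :* b :* (b :* b)) :+ b :* b :* (b :* b) :- δ :* (η :* η))) a b δ ξ η)

    coprime-G₁ : ∀ {a b} k i → a ≡ i * k → Coprime k b → Coprime k (G₁ a b)
    coprime-G₁ {a} {b} k i a≡ k⊥b = subst (Coprime k) (sym (G₁-mod a b k i a≡))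
      (coprime-add {k} {b * b * (b * b)} ((a * a * a - + 4 * a * a * b + + 2 * a * b * b - + 4 * b * b * b) * i)
        (coprime-*ʳ {k} {b * b} {b * b} k⊥bb k⊥bb))
      where
      k⊥bb : Coprime k (b * b)
      k⊥bb = coprime-*ʳ {k} {b} {b} k⊥b k⊥b

  coprime-factorˡ : ∀ {k x} y → Coprime k (x * y) → Coprime x k
  coprime-factorˡ {k} {x} y (s , t , e) = t * y , s , trans (solve 5 (λ s t k x y → t :* y :* x :+ s :* k := s :* k :+ t :* (x :* y)) s t k x y) e

  private
    abstract
      both-odd : ∀ a b i j ε ξ → a ≡ i * + 2 + 1ℤ → b ≡ j * + 2 + 1ℤ → ε * ε ≡ 1ℤ → G₁ a b ≡ + 2 * ε * (ξ * ξ) →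
        let m = (i * i + i + j * j + j) * + 2 + 1ℤ in ξ * ξ ≡ ε * (m * (m - a * b * + 2)) * + 2
      both-odd _ _ i j ε ξ refl refl εε e = ℤ.*-cancelʳ-≡ (ξ * ξ) _ (+ 2) (combine₂ (- ε) (- (+ 2 * (ξ * ξ))) e εε (solve 4 (λ i j ε ξ → let a = i :* con (+ 2) :+ con 1ℤ; b = j :* con (+ 2) :+ con 1ℤ; m = (i :* i :+ i :+ j :* j :+ j) :* con (+ 2) :+ con 1ℤ in
          ξ :* ξ :* con (+ 2) :- ε :* (m :* (m :- a :* b :* con (+ 2))) :* con (+ 2) :* con (+ 2)
          := :- ε :* ((a :* a :+ b :* b) :* (a :* a :- con (+ 4) :* a :* b :+ b :* b) :- con (+ 2) :* ε :* (ξ :* ξ)) :+ :- (con (+ 2) :* (ξ :* ξ)) :* (ε :* ε :- con 1ℤ)) i j ε ξ))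

      halve : ∀ ξ y ε M → ε * ε ≡ 1ℤ → ξ ≡ y * + 2 → ξ * ξ ≡ ε * M * + 2 → M ≡ ε * (y * y) * + 2
      halve _ y ε M εε refl e = ℤ.*-cancelʳ-≡ M _ (+ 2) (combine₂ (- ε) (- (M * + 2)) e εε (solve 3 (λ y ε M →
          M :* con (+ 2) :- ε :* (y :* y) :* con (+ 2) :* con (+ 2)
          := :- ε :* (y :* con (+ 2) :* (y :* con (+ 2)) :- ε :* M :* con (+ 2)) :+ :- (M :* con (+ 2)) :* (ε :* ε :- con 1ℤ)) y ε M))

      even-value : ∀ ε ξ → + 2 * ε * (ξ * ξ) ≡ ε * (ξ * ξ) * + 2
      even-value = solve 2 (λ ε ξ → con (+ 2) :* ε :* (ξ :* ξ) := ε :* (ξ :* ξ) :* con (+ 2))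

    odd-m : ∀ k → Odd (k * + 2 + 1ℤ)
    odd-m k = 1ℤ , - k , solve 1 (λ k → con 1ℤ :* (k :* con (+ 2) :+ con 1ℤ) :+ :- k :* con (+ 2) := con 1ℤ) k

    odd-m′ : ∀ k c → Odd (k * + 2 + 1ℤ - c * + 2)
    odd-m′ k c = 1ℤ , c - k , solve 2 (λ k c → con 1ℤ :* (k :* con (+ 2) :+ con 1ℤ :- c :* con (+ 2)) :+ (c :- k) :* con (+ 2) := con 1ℤ) k c

    mixed-parity : ∀ a b ε ξ → Even a → Odd b → G₁ a b ≢ + 2 * ε * (ξ * ξ)
    mixed-parity a b ε ξ (i , a≡) b-odd e =
      odd≢even (ε * (ξ * ξ)) (coprime-sym (coprime-G₁ (+ 2) i a≡ (coprime-sym b-odd))) (trans e (even-value ε ξ))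

    odd-parities : ∀ a b ε ξ → ε * ε ≡ 1ℤ → Odd a → Odd b → G₁ a b ≢ + 2 * ε * (ξ * ξ)
    odd-parities a b ε ξ εε a-odd b-odd e =
      let i , a≡ = odd-form a-odd
          j , b≡ = odd-form b-odd
          k = i * i + i + j * j + j
          m = k * + 2 + 1ℤ
          m′ = m - a * b * + 2
          ξξ≡ = both-odd a b i j ε ξ a≡ b≡ εε e
          y , ξ≡ = odd-square-root {ξ} (ε * (m * m′)) ξξ≡
      in odd≢even (ε * (y * y)) (coprime-*ˡ {m} {m′} {+ 2} (odd-m k) (odd-m′ k (a * b))) (halve ξ y ε (m * m′) εε ξ≡ ξξ≡)

    -- If exactly one of a and b is odd, then `G₁` is odd; if both are, it is 4 times an odd number.
    -- In either case 2 divides it to an even power.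
    not-twice-square : ∀ a b ε ξ → Coprime b a → ε * ε ≡ 1ℤ → G₁ a b ≢ + 2 * ε * (ξ * ξ)
    not-twice-square a b ε ξ b⊥a εε e = [ a-even , a-odd ]′ (parity a)
      where
      a-even : Even a → ⊥
      a-even ea = [ (λ eb → even-both b⊥a eb ea) , (λ ob → mixed-parity a b ε ξ ea ob e) ]′ (parity b)
      a-odd : Odd a → ⊥
      a-odd oa = [ (λ eb → mixed-parity b a ε ξ eb oa (trans (G₁-sym b a) e)) , (λ ob → odd-parities a b ε ξ εε oa ob e) ]′ (parity b)

    abstract
      times-±1 : ∀ x δ → δ ≡ 1ℤ → δ * x ≡ x
      times-±1 x _ refl = ℤ.*-identityˡ x

      times--1 : ∀ x δ → δ ≡ -1ℤ → δ * x ≡ - x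
      times--1 x _ refl = ℤ.-1*i≡-i x

      twice-δ : ∀ δ δ′ x → δ ≡ δ′ * + 2 → δ * x ≡ + 2 * δ′ * x
      twice-δ _ δ′ x refl = cong (_* x) (ℤ.*-comm δ′ (+ 2))

      four-δ : ∀ δ δ′ δ″ ξ → δ ≡ δ′ * + 2 → δ′ ≡ δ″ * + 2 → δ * (ξ * ξ) ≡ δ″ * (+ 2 * ξ * (+ 2 * ξ))
      four-δ _ _ δ″ ξ refl refl = solve 2 (λ δ″ ξ → δ″ :* con (+ 2) :* con (+ 2) :* (ξ :* ξ) := δ″ :* (con (+ 2) :* ξ :* (con (+ 2) :* ξ))) δ″ ξ

      cancel-2 : ∀ m k δ δ′ → δ ≡ δ′ * + 2 → m * + 2 ≡ k * δ → m ≡ k * δ′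
      cancel-2 m k _ δ′ refl e = ℤ.*-cancelʳ-≡ m (k * δ′) (+ 2) (trans e (sym (ℤ.*-assoc k δ′ (+ 2))))

    odd-divisor : ∀ k δ → Odd δ → + 2 ≡ k * δ → ∃[ u ] u * δ ≡ 1ℤ
    odd-divisor k δ δ-odd 2≡ = let u , 1≡ = gauss {δ} {+ 2} {1ℤ} k δ-odd 2≡ in u , sym 1≡

  PlusMinusSquare : ℤ → Set
  PlusMinusSquare n = ∃[ v ] (n ≡ v * v ⊎ n ≡ - (v * v))

  private
    signed : ∀ u δ x → u * δ ≡ 1ℤ → PlusMinusSquare (δ * (x * x))
    signed u δ x e = x , [ (λ δ≡1 → inj₁ (times-±1 (x * x) δ δ≡1)) , (λ δ≡-1 → inj₂ (times--1 (x * x) δ δ≡-1)) ]′ (unit u δ e)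

    -- As a divisor of 4, δ is ±1 or ±4, which give plus or minus a square, or ±2, which
    -- `not-twice-square` excludes.
    square-class : ∀ a b δ ξ k → Coprime b a → G₁ a b ≡ δ * (ξ * ξ) → + 4 ≡ k * δ → PlusMinusSquare (G₁ a b)
    square-class a b δ ξ k b⊥a e 4≡ = [ even , odd ]′ (parity δ)
      where
      Goal : Set
      Goal = PlusMinusSquare (G₁ a b)
      odd : Odd δ → Goal
      odd δ-odd = let k′ , 2≡ = gauss {δ} {+ 2} {+ 2} k δ-odd 4≡; u , uδ≡1 = odd-divisor k′ δ δ-odd 2≡
        in subst PlusMinusSquare (sym e) (signed u δ ξ uδ≡1)
      even : Even δ → Goal
      even (δ′ , δ≡) = [ four , two ]′ (parity δ′)
        where
        2≡ : + 2 ≡ k * δ′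
        2≡ = cancel-2 (+ 2) k δ δ′ δ≡ 4≡
        four : Even δ′ → Goal
        four (δ″ , δ′≡) = subst PlusMinusSquare (sym (trans e (four-δ δ δ′ δ″ ξ δ≡ δ′≡)))
          (signed k δ″ (+ 2 * ξ) (sym (cancel-2 1ℤ k δ′ δ″ δ′≡ 2≡)))
        two : Odd δ′ → Goal
        two δ′-odd = let u , uδ′≡1 = odd-divisor k δ′ δ′-odd 2≡ in
          contradiction (trans e (twice-δ δ δ′ (ξ * ξ) δ≡)) (not-twice-square a b δ′ ξ b⊥a (sign u δ′ uδ′≡1))

  -- G₂ − G₁ = 4a³b while G₁ is prime to ab, so the common square class of G₁ and G₂ divides 4.
  G₁-square : ∀ a b W → Coprime b a → G₁ a b * G₂ a b ≡ W * W → PlusMinusSquare (G₁ a b)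
  G₁-square a b W b⊥a e =
    let δ , ξ , η , G₁≡ , G₂≡ , _ = rankOne (G₁ a b) (G₂ a b) W e
        δ⊥a = coprime-factorˡ {a} {δ} (ξ * ξ) (subst (Coprime a) G₁≡ (coprime-G₁ a 1ℤ (sym (ℤ.*-identityˡ a)) (coprime-sym b⊥a)))
        δ⊥b = coprime-factorˡ {b} {δ} (ξ * ξ) (subst (Coprime b) (trans (G₁-sym b a) G₁≡) (coprime-G₁ b 1ℤ (sym (ℤ.*-identityˡ b)) b⊥a))
        k₁ , e₁ = gauss {δ} {a} {a * (a * (b * + 4))} (η * η - ξ * ξ) δ⊥a (G₂-G₁ a b δ ξ η G₁≡ G₂≡)
        k₂ , e₂ = gauss {δ} {a} {a * (b * + 4)} k₁ δ⊥a e₁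
        k₃ , e₃ = gauss {δ} {a} {b * + 4} k₂ δ⊥a e₂
        k₄ , e₄ = gauss {δ} {b} {+ 4} k₃ δ⊥b e₃
    in square-class a b δ ξ k₄ b⊥a G₁≡ e₄

-- The square product for rational arguments.

module RationalSquareProduct where
  open import Data.Integer as ℤ using (ℤ; +_; 0ℤ; 1ℤ)
  open import Data.Product using (_,_; ∃-syntax)
  open import Data.Rational using (ℚ; _+_; _*_; -_; _-_; 0ℚ; 1ℚ)
  import Data.Rational.Properties as ℚ
  open import Data.Sum using (_⊎_; inj₁; inj₂; [_,_]′)
  open import Data.List.Base using ([]; _∷_)
  open import Relation.Binary.PropositionalEquality
  open RationalBase
  open RationalCurves using (ι; 2ℚ; 4ℚ)
  open SquareProduct using (G₁; G₂; G₁-square; PlusMinusSquare)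
  open LinearCombination ℚ.+-*-isCommutativeRing

  private
    a b G₁-expr G₂-expr : Poly
    a = var 0
    b = var 1
    G₁-expr = (a :* a :+ b :* b) :* (a :* a :- con (+ 4) :* a :* b :+ b :* b)
    G₂-expr = a :* a :* (a :* a) :+ con (+ 2) :* (a :* a :* (b :* b)) :- con (+ 4) :* (a :* b :* (b :* b)) :+ b :* b :* (b :* b)

    abstract
      homogenise : ∀ q w A B → q * B ≡ A → (q * q + 1ℚ) * (q * q - (q + q + (q + q)) + 1ℚ) * (q * q * (q * q) + (q * q + q * q) - (q + q + (q + q)) + 1ℚ) ≡ w * w →
        B * B * (B * B) * w * (B * B * (B * B) * w)
        ≡ (A * A + B * B) * (A * A - 4ℚ * A * B + B * B) * (A * A * (A * A) + 2ℚ * (A * A * (B * B)) - 4ℚ * (A * B * (B * B)) + B * B * (B * B))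
      homogenise q w _ B refl e = combine₁ (- (B * B * (B * B) * (B * B * (B * B)))) e (solve 3 (λ q w B → let A = q :* B in
          B :* B :* (B :* B) :* w :* (B :* B :* (B :* B) :* w) :- (A :* A :+ B :* B) :* (A :* A :- con (+ 4) :* A :* B :+ B :* B) :* (A :* A :* (A :* A) :+ con (+ 2) :* (A :* A :* (B :* B)) :- con (+ 4) :* (A :* B :* (B :* B)) :+ B :* B :* (B :* B))
          := :- (B :* B :* (B :* B) :* (B :* B :* (B :* B))) :* ((q :* q :+ con 1ℤ) :* (q :* q :- (q :+ q :+ (q :+ q)) :+ con 1ℤ) :* (q :* q :* (q :* q) :+ (q :* q :+ q :* q) :- (q :+ q :+ (q :+ q)) :+ con 1ℤ) :- w :* w)) q w B)

      dehomogenise : ∀ q A B V v σ → q * B ≡ A → V ≡ v * (B * B) → (A * A + B * B) * (A * A - 4ℚ * A * B + B * B) ≡ σ * (V * V) →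
        B * (B * (B * (B * ((q * q + 1ℚ) * (q * q - (q + q + (q + q)) + 1ℚ) - σ * (v * v))))) ≡ 0ℚ
      dehomogenise q _ B _ v σ refl refl e = combine₁ 1ℚ e (solve 4 (λ q B v σ → let A = q :* B; V = v :* (B :* B) in
          B :* (B :* (B :* (B :* ((q :* q :+ con 1ℤ) :* (q :* q :- (q :+ q :+ (q :+ q)) :+ con 1ℤ) :- σ :* (v :* v))))) :- con 0ℤ
          := con 1ℤ :* ((A :* A :+ B :* B) :* (A :* A :- con (+ 4) :* A :* B :+ B :* B) :- σ :* (V :* V))) q B v σ)

      minus : ∀ x → - x ≡ - 1ℚ * x
      minus = solve 1 (λ x → :- x := :- con 1ℤ :* x)

  square-product : ∀ q w → (q * q + 1ℚ) * (q * q - (q + q + (q + q)) + 1ℚ) * (q * q * (q * q) + (q * q + q * q) - (q + q + (q + q)) + 1ℚ) ≡ w * w →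
    ∃[ v ] ((q * q + 1ℚ) * (q * q - (q + q + (q + q)) + 1ℚ) ≡ 1ℚ * (v * v) ⊎ (q * q + 1ℚ) * (q * q - (q + q + (q + q)) + 1ℚ) ≡ - 1ℚ * (v * v))
  square-product q w e = finish (reduced-fraction q)
    where
    G : ℚ
    G = (q * q + 1ℚ) * (q * q - (q + q + (q + q)) + 1ℚ)
    Goal : Set
    Goal = ∃[ v ] (G ≡ 1ℚ * (v * v) ⊎ G ≡ - 1ℚ * (v * v))
    finish : _ → Goal
    finish (a′ , b′ , b≢0 , b⊥a , qb≡a) =
      let A = ι a′; B = ι b′; B≢0 = ι≢0 b≢0
          W , GG≡ = integer-square (G₁ a′ b′ ℤ.* G₂ a′ b′) (B * B * (B * B) * w)
            (trans (homogenise q w A B qb≡a e) (sym (ι-eval (G₁-expr :* G₂-expr) (a′ ∷ b′ ∷ []))))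
      in from-integer A B qb≡a B≢0 (ι-eval G₁-expr (a′ ∷ b′ ∷ [])) (G₁-square a′ b′ W b⊥a GG≡)
      where
      from-integer : ∀ A B {n} → q * B ≡ A → B ≢ 0ℚ → ι n ≡ (A * A + B * B) * (A * A - 4ℚ * A * B + B * B) → PlusMinusSquare n → Goal
      from-integer A B {n} qB≡A B≢0 ιn≡ (V , n≡) =
        let v , V≡ = divide (ι V) (B * B) (λ BB≡0 → B≢0 (square≡0 B BB≡0))
        in v , [ (λ n≡VV → inj₁ (signed v V≡ 1ℚ (trans (cong ι n≡VV) (trans (ι-* V V) (sym (ℚ.*-identityˡ (ι V * ι V)))))))
               , (λ n≡-VV → inj₂ (signed v V≡ (- 1ℚ) (trans (cong ι n≡-VV) (trans (ι-neg (V ℤ.* V)) (trans (cong -_ (ι-* V V)) (minus (ι V * ι V))))))) ]′ n≡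
        where
        signed : ∀ v → ι V ≡ v * (B * B) → ∀ σ → ι n ≡ σ * (ι V * ι V) → G ≡ σ * (v * v)
        signed v V≡ σ ιn≡σVV = let Z = G - σ * (v * v) in a-b≡0⇒a≡b G (σ * (v * v))
          (cancel B Z B≢0 (cancel B (B * Z) B≢0 (cancel B (B * (B * Z)) B≢0 (cancel B (B * (B * (B * Z))) B≢0
            (dehomogenise q A B (ι V) v σ qB≡A V≡ (trans (sym ιn≡) ιn≡σVV))))))

-- Algebraic relations among the points of the graph.

module OrbitIdentities {A : Set} {_+_ _*_ : A → A → A} { -_ : A → A} (φ : ℤ → A)
  (isCommutativeRing : IsCommutativeRing _≡_ _+_ _*_ -_ (φ 0ℤ) (φ 1ℤ))
  (φ-+ : ∀ m n → φ (m ℤ.+ n) ≡ φ m + φ n) (φ-* : ∀ m n → φ (m ℤ.* n) ≡ φ m * φ n)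
  (φ-neg : ∀ m → φ (ℤ.- m) ≡ - φ m) where
  open Polynomial
  open LinearCombination isCommutativeRing

  open PolynomialIdentity φ isCommutativeRing φ-+ φ-* φ-neg

  infixl 6 _-_
  _-_ : A → A → A
  x - y = x + (- y)

  one : A
  one = φ 1ℤ

  double : A → A
  double x = x + x

  quartic : A → A
  quartic q = ((((q * q) * (q * q)) + double (q * q)) - double (double q)) + one

  private
    :double : Poly → Poly
    :double x = x :+ x
    :one : Poly
    :one = con 1ℤ

  abstract
    equal-images : ∀ x y z c → (x * x) + c ≡ z → (y * y) + c ≡ z → (x - y) * (x + y) ≡ φ 0ℤ
    equal-images x y z c ex ey = combine₂ one (- one) ex ey (solve 4 (λ x y z c →
      (x :- y) :* (x :+ y) :- con 0ℤ := :one :* (x :* x :+ c :- z) :+ :- :one :* (y :* y :+ c :- z)) x y z c)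

    fixed-points : ∀ x y c → (x * x) + c ≡ x → (y * y) + c ≡ y → (x - y) * ((x + y) - one) ≡ φ 0ℤ
    fixed-points x y c ex ey = combine₂ one (- one) ex ey (solve 3 (λ x y c →
      (x :- y) :* (x :+ y :- :one) :- con 0ℤ := :one :* (x :* x :+ c :- x) :+ :- :one :* (y :* y :+ c :- y)) x y c)

    square-of-negative : ∀ s → (- s) * (- s) ≡ s * s
    square-of-negative = solve 1 (λ s → :- s :* :- s := s :* s)

    second-tail : ∀ a a' b' → a' + b' ≡ φ 0ℤ → (a + a') - one ≡ φ 0ℤ → b' ≡ a - one
    second-tail a a' b' e e' = combine₂ one (- one) e e' (solve 3 (λ a a' b' →
      b' :- (a :- :one) := :one :* (a' :+ b' :- con 0ℤ) :+ :- :one :* (a :+ a' :- :one :- con 0ℤ)) a a' b')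

    p²≡ : ∀ a b p c → (a * a) + c ≡ a → a + b ≡ φ 0ℤ → (p * p) + c ≡ b → p * p ≡ (a * a) - double a
    p²≡ a b p c ea eb ep = combine₃ one (- one) one ep ea eb (solve 4 (λ a b p c →
      p :* p :- (a :* a :- :double a) := :one :* (p :* p :+ c :- b) :+ :- :one :* (a :* a :+ c :- a) :+ :one :* (a :+ b :- con 0ℤ)) a b p c)

    s²≡ : ∀ a b' s c → (a * a) + c ≡ a → b' ≡ a - one → (s * s) + c ≡ b' → s * s ≡ (a * a) - one
    s²≡ a b' s c ea eb es = combine₃ one (- one) one es ea eb (solve 4 (λ a b' s c →
      s :* s :- (a :* a :- :one) := :one :* (s :* s :+ c :- b') :+ :- :one :* (a :* a :+ c :- a) :+ :one :* (b' :- (a :- :one))) a b' s c)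

    r²≡ : ∀ a p r c → (a * a) + c ≡ a → (r * r) + c ≡ p → r * r ≡ (p - a) + (a * a)
    r²≡ a p r c ea er = combine₂ one (- one) er ea (solve 4 (λ a p r c →
      r :* r :- (p :- a :+ a :* a) := :one :* (r :* r :+ c :- p) :+ :- :one :* (a :* a :+ c :- a)) a p r c)

  -- Each of the following is a combination of E = p² − (a² − 2a), which vanishes, with the equations for s² and r²;
  -- N₂ comes from 2qa = 2q − q² − 1 + E.
  module _ (a p : A) (p² : p * p ≡ (a * a) - double a) where
    private
      q E N₂ : A
      q = (one + p) - a
      E = (p * p) - ((a * a) - double a)
      N₂ = double ((double q - (q * q)) - one) + E
      :q :E :N₂ : Poly → Poly → Poly
      :q a p = :one :+ p :- a
      :E a p = p :* p :- (a :* a :- :double a)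
      :N₂ a p = :double (:double (:q a p) :- :q a p :* :q a p :- :one) :+ :E a p

    abstract
      -- Used to see that q is nonzero and that p is rational as soon as q is.
      q²≡ : q * q ≡ one + double (q * p)
      q²≡ = combine₁ (- one) p² (solve 2 (λ a p → :q a p :* :q a p :- (:one :+ :double (:q a p :* p)) := :- :one :* :E a p) a p)

      y²≡ : ∀ r → r * r ≡ (p - a) + (a * a) → double (q * r) * double (q * r) ≡ quartic q
      y²≡ r r² = combine₂ (double (q * q) + double (q * q)) N₂ r² p² (solve 3 (λ a p r → let q = :q a p in
        :double (q :* r) :* :double (q :* r) :- (q :* q :* (q :* q) :+ :double (q :* q) :- :double (:double q) :+ :one)
        := (:double (q :* q) :+ :double (q :* q)) :* (r :* r :- (p :- a :+ a :* a)) :+ :N₂ a p :* :E a p) a p r)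

      module _ (s : A) (s² : s * s ≡ (a * a) - one) where
        -- Only s² enters the hypothesis, so the same lemma applied to -s gives the relation for B.
        A-relation : let u = (one + p) + s in ((u - double one) * q) * (q - u) ≡ u
        A-relation = combine₂ (q - ((one + p) + s)) (- q) p² s² (solve 3 (λ a p s → let q = :q a p; u = :one :+ p :+ s in
          (u :- :double :one) :* q :* (q :- u) :- u := (q :- u) :* :E a p :+ :- q :* (s :* s :- (a :* a :- :one))) a p s)

        AB≡2q : ((one + p) + s) * ((one + p) - s) ≡ double q
        AB≡2q = combine₂ one (- one) p² s² (solve 3 (λ a p s →
          (:one :+ p :+ s) :* (:one :+ p :- s) :- :double (:q a p) := :one :* :E a p :+ :- :one :* (s :* s :- (a :* a :- :one))) a p s)

        x²≡ : double (q * s) * double (q * s) ≡ ((q * q) + one) * (((q * q) - double (double q)) + one)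
        x²≡ = combine₂ (double (q * q) + double (q * q)) N₂ s² p² (solve 3 (λ a p s → let q = :q a p in
          :double (q :* s) :* :double (q :* s) :- (q :* q :+ :one) :* (q :* q :- :double (:double q) :+ :one)
          := (:double (q :* q) :+ :double (q :* q)) :* (s :* s :- (a :* a :- :one)) :+ :N₂ a p :* :E a p) a p s)

-- Arithmetic of ℚ(√d).

module QuadraticField where
  open import Algebra.Structures using (IsCommutativeRing)
  open import Data.Integer as ℤ using (ℤ; 0ℤ; 1ℤ)
  open import Data.Product using (_,_; proj₁; proj₂)
  open import Data.Rational using (ℚ; _+_; _*_; -_; _-_; 0ℚ; 1ℚ)
  import Data.Rational.Properties as ℚ
  open import Data.Sum using (_⊎_; inj₁; inj₂; [_,_]′)
  open import Relation.Binary.PropositionalEquality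
  open import Relation.Nullary using (contradiction; yes; no)
  open import Defs using (ℤ→ℚ; K; addK; mulK; embed; NonSquare)
  open RationalBase
  open LinearCombination ℚ.+-*-isCommutativeRing

  negK : (d : ℤ) → K d → K d
  negK d (x₀ , x₁) = (- x₀ , - x₁)

  φ : (d : ℤ) → ℤ → K d
  φ d n = embed d (ℤ→ℚ n)

  private
    abstract
      assoc₀ : ∀ D x₀ x₁ y₀ y₁ z₀ z₁ → (x₀ * y₀ + D * (x₁ * y₁)) * z₀ + D * ((x₀ * y₁ + x₁ * y₀) * z₁)
        ≡ x₀ * (y₀ * z₀ + D * (y₁ * z₁)) + D * (x₁ * (y₀ * z₁ + y₁ * z₀))
      assoc₀ = solve 7 (λ D x₀ x₁ y₀ y₁ z₀ z₁ →
        (x₀ :* y₀ :+ D :* (x₁ :* y₁)) :* z₀ :+ D :* ((x₀ :* y₁ :+ x₁ :* y₀) :* z₁)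
        := x₀ :* (y₀ :* z₀ :+ D :* (y₁ :* z₁)) :+ D :* (x₁ :* (y₀ :* z₁ :+ y₁ :* z₀)))

      assoc₁ : ∀ D x₀ x₁ y₀ y₁ z₀ z₁ → (x₀ * y₀ + D * (x₁ * y₁)) * z₁ + (x₀ * y₁ + x₁ * y₀) * z₀
        ≡ x₀ * (y₀ * z₁ + y₁ * z₀) + x₁ * (y₀ * z₀ + D * (y₁ * z₁))
      assoc₁ = solve 7 (λ D x₀ x₁ y₀ y₁ z₀ z₁ →
        (x₀ :* y₀ :+ D :* (x₁ :* y₁)) :* z₁ :+ (x₀ :* y₁ :+ x₁ :* y₀) :* z₀
        := x₀ :* (y₀ :* z₁ :+ y₁ :* z₀) :+ x₁ :* (y₀ :* z₀ :+ D :* (y₁ :* z₁)))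

      comm₀ : ∀ D x₀ x₁ y₀ y₁ → x₀ * y₀ + D * (x₁ * y₁) ≡ y₀ * x₀ + D * (y₁ * x₁)
      comm₀ = solve 5 (λ D x₀ x₁ y₀ y₁ → x₀ :* y₀ :+ D :* (x₁ :* y₁) := y₀ :* x₀ :+ D :* (y₁ :* x₁))

      comm₁ : ∀ x₀ x₁ y₀ y₁ → x₀ * y₁ + x₁ * y₀ ≡ y₀ * x₁ + y₁ * x₀
      comm₁ = solve 4 (λ x₀ x₁ y₀ y₁ → x₀ :* y₁ :+ x₁ :* y₀ := y₀ :* x₁ :+ y₁ :* x₀)

      unit₀ : ∀ D x₀ x₁ → 1ℚ * x₀ + D * (0ℚ * x₁) ≡ x₀
      unit₀ = solve 3 (λ D x₀ x₁ → con 1ℤ :* x₀ :+ D :* (con 0ℤ :* x₁) := x₀)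

      unit₁ : ∀ x₀ x₁ → 1ℚ * x₁ + 0ℚ * x₀ ≡ x₁
      unit₁ = solve 2 (λ x₀ x₁ → con 1ℤ :* x₁ :+ con 0ℤ :* x₀ := x₁)

      distrib₀ : ∀ D x₀ x₁ y₀ y₁ z₀ z₁ → x₀ * (y₀ + z₀) + D * (x₁ * (y₁ + z₁)) ≡ x₀ * y₀ + D * (x₁ * y₁) + (x₀ * z₀ + D * (x₁ * z₁))
      distrib₀ = solve 7 (λ D x₀ x₁ y₀ y₁ z₀ z₁ →
        x₀ :* (y₀ :+ z₀) :+ D :* (x₁ :* (y₁ :+ z₁)) := x₀ :* y₀ :+ D :* (x₁ :* y₁) :+ (x₀ :* z₀ :+ D :* (x₁ :* z₁)))

      distrib₁ : ∀ x₀ x₁ y₀ y₁ z₀ z₁ → x₀ * (y₁ + z₁) + x₁ * (y₀ + z₀) ≡ x₀ * y₁ + x₁ * y₀ + (x₀ * z₁ + x₁ * z₀)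
      distrib₁ = solve 6 (λ x₀ x₁ y₀ y₁ z₀ z₁ → x₀ :* (y₁ :+ z₁) :+ x₁ :* (y₀ :+ z₀) := x₀ :* y₁ :+ x₁ :* y₀ :+ (x₀ :* z₁ :+ x₁ :* z₀))

      rational₀ : ∀ D x y → x * y ≡ x * y + D * (0ℚ * 0ℚ)
      rational₀ = solve 3 (λ D x y → x :* y := x :* y :+ D :* (con 0ℤ :* con 0ℤ))

      rational₁ : ∀ x y → 0ℚ ≡ x * 0ℚ + 0ℚ * y
      rational₁ = solve 2 (λ x y → con 0ℤ := x :* con 0ℤ :+ con 0ℤ :* y)

  module _ (d : ℤ) where
    private
      D : ℚ
      D = ℤ→ℚ d

    *-commK : ∀ x y → mulK d x y ≡ mulK d y x
    *-commK (x₀ , x₁) (y₀ , y₁) = cong₂ _,_ (comm₀ D x₀ x₁ y₀ y₁) (comm₁ x₀ x₁ y₀ y₁)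

    *-identityˡK : ∀ x → mulK d (φ d 1ℤ) x ≡ x
    *-identityˡK (x₀ , x₁) = cong₂ _,_ (unit₀ D x₀ x₁) (unit₁ x₀ x₁)

    *-distribˡK : ∀ x y z → mulK d x (addK d y z) ≡ addK d (mulK d x y) (mulK d x z)
    *-distribˡK (x₀ , x₁) (y₀ , y₁) (z₀ , z₁) = cong₂ _,_ (distrib₀ D x₀ x₁ y₀ y₁ z₀ z₁) (distrib₁ x₀ x₁ y₀ y₁ z₀ z₁)

    K-isCommutativeRing : IsCommutativeRing _≡_ (addK d) (mulK d) (negK d) (φ d 0ℤ) (φ d 1ℤ)
    K-isCommutativeRing = record
      { isRing = record
        { +-isAbelianGroup = record
          { isGroup = record
            { isMonoid = record
              { isSemigroup = record
                { isMagma = record { isEquivalence = isEquivalence ; ∙-cong = cong₂ (addK d) }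
                ; assoc = λ (x₀ , x₁) (y₀ , y₁) (z₀ , z₁) → cong₂ _,_ (ℚ.+-assoc x₀ y₀ z₀) (ℚ.+-assoc x₁ y₁ z₁)
                }
              ; identity = (λ (x₀ , x₁) → cong₂ _,_ (ℚ.+-identityˡ x₀) (ℚ.+-identityˡ x₁))
                         , (λ (x₀ , x₁) → cong₂ _,_ (ℚ.+-identityʳ x₀) (ℚ.+-identityʳ x₁))
              }
            ; inverse = (λ (x₀ , x₁) → cong₂ _,_ (ℚ.+-inverseˡ x₀) (ℚ.+-inverseˡ x₁))
                      , (λ (x₀ , x₁) → cong₂ _,_ (ℚ.+-inverseʳ x₀) (ℚ.+-inverseʳ x₁))
            ; ⁻¹-cong = cong (negK d)
            }
          ; comm = λ (x₀ , x₁) (y₀ , y₁) → cong₂ _,_ (ℚ.+-comm x₀ y₀) (ℚ.+-comm x₁ y₁)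
          }
        ; *-cong = cong₂ (mulK d)
        ; *-assoc = λ (x₀ , x₁) (y₀ , y₁) (z₀ , z₁) → cong₂ _,_ (assoc₀ D x₀ x₁ y₀ y₁ z₀ z₁) (assoc₁ D x₀ x₁ y₀ y₁ z₀ z₁)
        ; *-identity = *-identityˡK , λ x → trans (*-commK x (φ d 1ℤ)) (*-identityˡK x)
        ; distrib = *-distribˡK , λ x y z → trans (*-commK (addK d y z) x)
            (trans (*-distribˡK x y z) (cong₂ (addK d) (*-commK x y) (*-commK x z)))
        }
      ; *-comm = *-commK
      }

    φ-+ : ∀ m n → φ d (m ℤ.+ n) ≡ addK d (φ d m) (φ d n)
    φ-+ m n = cong (_, 0ℚ) (ι-+ m n)

    φ-* : ∀ m n → φ d (m ℤ.* n) ≡ mulK d (φ d m) (φ d n)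
    φ-* m n = cong₂ _,_ (trans (ι-* m n) (rational₀ D (ℤ→ℚ m) (ℤ→ℚ n))) (rational₁ (ℤ→ℚ m) (ℤ→ℚ n))

    φ-neg : ∀ m → φ d (ℤ.- m) ≡ negK d (φ d m)
    φ-neg m = cong (_, 0ℚ) (ι-neg m)

  module _ (d : ℤ) (non-square : NonSquare d) where
    private
      D : ℚ
      D = ℤ→ℚ d
      abstract
        leading : ∀ D x₀ x₁ l → x₀ * x₀ ≡ D * (x₁ * x₁) → x₀ ≡ l * x₁ → x₁ * (x₁ * (l * l - D)) ≡ 0ℚ
        leading D _ x₁ l e refl = combine₁ 1ℚ e (solve 3 (λ D x₁ l → x₁ :* (x₁ :* (l :* l :- D)) :- con 0ℤ := con 1ℤ :* (l :* x₁ :* (l :* x₁) :- D :* (x₁ :* x₁))) D x₁ l)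

        square-of-zero : ∀ D x₀ x₁ → x₀ * x₀ ≡ D * (x₁ * x₁) → x₁ ≡ 0ℚ → x₀ * x₀ ≡ 0ℚ
        square-of-zero D x₀ _ e refl = trans e (ℚ.*-zeroʳ D)

        norm-times₀ : ∀ D x₀ x₁ y₀ y₁ → x₀ * y₀ + D * (x₁ * y₁) ≡ 0ℚ → x₀ * y₁ + x₁ * y₀ ≡ 0ℚ → (x₀ * x₀ - D * (x₁ * x₁)) * y₀ ≡ 0ℚ
        norm-times₀ D x₀ x₁ y₀ y₁ e₀ e₁ = combine₂ x₀ (- (D * x₁)) e₀ e₁ (solve 5 (λ D x₀ x₁ y₀ y₁ →
            (x₀ :* x₀ :- D :* (x₁ :* x₁)) :* y₀ :- con 0ℤ
            := x₀ :* (x₀ :* y₀ :+ D :* (x₁ :* y₁) :- con 0ℤ) :+ :- (D :* x₁) :* (x₀ :* y₁ :+ x₁ :* y₀ :- con 0ℤ)) D x₀ x₁ y₀ y₁)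

        norm-times₁ : ∀ D x₀ x₁ y₀ y₁ → x₀ * y₀ + D * (x₁ * y₁) ≡ 0ℚ → x₀ * y₁ + x₁ * y₀ ≡ 0ℚ → (x₀ * x₀ - D * (x₁ * x₁)) * y₁ ≡ 0ℚ
        norm-times₁ D x₀ x₁ y₀ y₁ e₀ e₁ = combine₂ (- x₁) x₀ e₀ e₁ (solve 5 (λ D x₀ x₁ y₀ y₁ →
            (x₀ :* x₀ :- D :* (x₁ :* x₁)) :* y₁ :- con 0ℤ
            := :- x₁ :* (x₀ :* y₀ :+ D :* (x₁ :* y₁) :- con 0ℤ) :+ x₀ :* (x₀ :* y₁ :+ x₁ :* y₀ :- con 0ℤ)) D x₀ x₁ y₀ y₁)

    -- Otherwise x₀/x₁ would be a rational square root of d.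
    proportional : ∀ x₀ x₁ → x₀ * x₀ ≡ D * (x₁ * x₁) → x₁ ≡ 0ℚ
    proportional x₀ x₁ e with x₁ ℚ.≟ 0ℚ
    ... | yes x₁≡0 = x₁≡0
    ... | no x₁≢0 = let l , x₀≡ = divide x₀ x₁ x₁≢0; Z = l * l - D in
      contradiction (a-b≡0⇒a≡b (l * l) D (cancel x₁ Z x₁≢0 (cancel x₁ (x₁ * Z) x₁≢0 (leading D x₀ x₁ l e x₀≡)))) (non-square l)

    norm≡0 : ∀ x₀ x₁ → x₀ * x₀ - D * (x₁ * x₁) ≡ 0ℚ → (x₀ , x₁) ≡ (0ℚ , 0ℚ)
    norm≡0 x₀ x₁ e = cong₂ _,_ (square≡0 x₀ (square-of-zero D x₀ x₁ x₀²≡ (proportional x₀ x₁ x₀²≡))) (proportional x₀ x₁ x₀²≡)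
      where
      x₀²≡ : x₀ * x₀ ≡ D * (x₁ * x₁)
      x₀²≡ = a-b≡0⇒a≡b (x₀ * x₀) (D * (x₁ * x₁)) e

    -- Multiplying by the conjugate of x shows that the norm of x annihilates both coordinates of y.
    productK≡0 : ∀ x y → mulK d x y ≡ φ d 0ℤ → x ≡ φ d 0ℤ ⊎ y ≡ φ d 0ℤ
    productK≡0 (x₀ , x₁) (y₀ , y₁) e =
      [ (λ N≡0 → inj₁ (norm≡0 x₀ x₁ N≡0))
      , (λ y₀≡0 → [ (λ N≡0 → inj₁ (norm≡0 x₀ x₁ N≡0)) , (λ y₁≡0 → inj₂ (cong₂ _,_ y₀≡0 y₁≡0)) ]′
          (product≡0 (x₀ * x₀ - D * (x₁ * x₁)) y₁ (norm-times₁ D x₀ x₁ y₀ y₁ (cong proj₁ e) (cong proj₂ e)))) ]′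
        (product≡0 (x₀ * x₀ - D * (x₁ * x₁)) y₀ (norm-times₀ D x₀ x₁ y₀ y₁ (cong proj₁ e) (cong proj₂ e)))

-- The case q ∉ ℚ.

module IrrationalPoints where
  open import Data.Integer as ℤ using (ℤ; +_; 0ℤ; 1ℤ)
  open import Data.Product using (_,_; proj₁; proj₂)
  open import Data.Rational using (ℚ; _+_; _*_; -_; _-_; 0ℚ; 1ℚ)
  import Data.Rational.Properties as ℚ
  open import Data.Sum using ([_,_]′)
  open import Data.Empty using (⊥)
  open import Data.Unit.Base using (tt)
  open import Relation.Binary.PropositionalEquality
  open import Relation.Nullary using (contradiction; yes; no)
  open import Defs using (ℤ→ℚ; K; mulK; NonSquare)
  open RationalBase
  open RationalCurves using (ι; 2ℚ; 3ℚ; 4ℚ)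
  open RationalQuartics using (positive)
  open RationalPoints
  open QuadraticField
  open LinearCombination ℚ.+-*-isCommutativeRing

  7ℚ 8ℚ 15ℚ : ℚ
  7ℚ = ι (+ 7)
  8ℚ = ι (+ 8)
  15ℚ = ι (+ 15)

  abstract
    rational-A₀ : ∀ D q₀ q₁ a₀ a₁ → a₁ ≡ 0ℚ → let v₀ = a₀ - (1ℚ + 1ℚ); v₁ = a₁ - (0ℚ + 0ℚ); w₀ = v₀ * q₀ + D * (v₁ * q₁); w₁ = v₀ * q₁ + v₁ * q₀ in
      w₀ * (q₀ - a₀) + D * (w₁ * (q₁ - a₁)) ≡ a₀ → (a₀ - 2ℚ) * (q₀ * q₀ + D * (q₁ * q₁) - a₀ * q₀) ≡ a₀
    rational-A₀ D q₀ q₁ a₀ _ refl e = combine₁ 1ℚ e (solve 4 (λ D q₀ q₁ a₀ → let a₁ = con 0ℤ; v₀ = a₀ :- (con 1ℤ :+ con 1ℤ); v₁ = a₁ :- (con 0ℤ :+ con 0ℤ); w₀ = v₀ :* q₀ :+ D :* (v₁ :* q₁); w₁ = v₀ :* q₁ :+ v₁ :* q₀ in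
        (a₀ :- con (+ 2)) :* (q₀ :* q₀ :+ D :* (q₁ :* q₁) :- a₀ :* q₀) :- a₀
        := con 1ℤ :* (w₀ :* (q₀ :- a₀) :+ D :* (w₁ :* (q₁ :- a₁)) :- a₀)) D q₀ q₁ a₀)

  private
    abstract
      -- With y = h + lq and q² = tq - n the equation of the curve splits into its coefficients of q
      -- and of 1; the first is extracted here, the second in `line₀`.
      line₁ : ∀ D q₀ q₁ y₀ y₁ l h → y₁ ≡ l * q₁ → y₀ ≡ h + l * q₀ →
        let u₀ = q₀ * q₀ + D * (q₁ * q₁); u₁ = q₀ * q₁ + q₁ * q₀; t = q₀ + q₀; n = q₀ * q₀ - D * (q₁ * q₁) in
        y₀ * y₁ + y₁ * y₀ ≡ u₀ * u₁ + u₁ * u₀ + (u₁ + u₁) - (q₁ + q₁ + (q₁ + q₁)) + 0ℚ →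
        q₁ * (l * l * t + 2ℚ * l * h - (t * t * t - 2ℚ * t * n + 2ℚ * t - 4ℚ)) ≡ 0ℚ
      line₁ D q₀ q₁ _ _ l h refl refl e = combine₁ 1ℚ e (solve 5 (λ D q₀ q₁ l h → let y₁ = l :* q₁; y₀ = h :+ l :* q₀; u₀ = q₀ :* q₀ :+ D :* (q₁ :* q₁); u₁ = q₀ :* q₁ :+ q₁ :* q₀; t = q₀ :+ q₀; n = q₀ :* q₀ :- D :* (q₁ :* q₁) in
          q₁ :* (l :* l :* t :+ con (+ 2) :* l :* h :- (t :* t :* t :- con (+ 2) :* t :* n :+ con (+ 2) :* t :- con (+ 4))) :- con 0ℤ
          := con 1ℤ :* (y₀ :* y₁ :+ y₁ :* y₀ :- (u₀ :* u₁ :+ u₁ :* u₀ :+ (u₁ :+ u₁) :- (q₁ :+ q₁ :+ (q₁ :+ q₁)) :+ con 0ℤ))) D q₀ q₁ l h)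

      line₀ : ∀ D q₀ q₁ y₀ y₁ l h → y₁ ≡ l * q₁ → y₀ ≡ h + l * q₀ →
        let u₀ = q₀ * q₀ + D * (q₁ * q₁); u₁ = q₀ * q₁ + q₁ * q₀; t = q₀ + q₀; n = q₀ * q₀ - D * (q₁ * q₁) in
        y₀ * y₀ + D * (y₁ * y₁) ≡ u₀ * u₀ + D * (u₁ * u₁) + (u₀ + u₀) - (q₀ + q₀ + (q₀ + q₀)) + 1ℚ →
        l * l * t + 2ℚ * l * h ≡ t * t * t - 2ℚ * t * n + 2ℚ * t - 4ℚ →
        h * h - l * l * n ≡ n * n - t * t * n - 2ℚ * n + 1ℚ
      line₀ D q₀ q₁ _ _ l h refl refl e e₁ = combine₂ 1ℚ (- q₀) e e₁ (solve 5 (λ D q₀ q₁ l h → let y₁ = l :* q₁; y₀ = h :+ l :* q₀; u₀ = q₀ :* q₀ :+ D :* (q₁ :* q₁); u₁ = q₀ :* q₁ :+ q₁ :* q₀; t = q₀ :+ q₀; n = q₀ :* q₀ :- D :* (q₁ :* q₁) in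
          h :* h :- l :* l :* n :- (n :* n :- t :* t :* n :- con (+ 2) :* n :+ con 1ℤ)
          := con 1ℤ :* (y₀ :* y₀ :+ D :* (y₁ :* y₁) :- (u₀ :* u₀ :+ D :* (u₁ :* u₁) :+ (u₀ :+ u₀) :- (q₀ :+ q₀ :+ (q₀ :+ q₀)) :+ con 1ℤ)) :+ :- q₀ :* (l :* l :* t :+ con (+ 2) :* l :* h :- (t :* t :* t :- con (+ 2) :* t :* n :+ con (+ 2) :* t :- con (+ 4)))) D q₀ q₁ l h)

      intercept : ∀ y₀ l q₀ → y₀ ≡ y₀ - l * q₀ + l * q₀
      intercept = solve 3 (λ y₀ l q₀ → y₀ := y₀ :- l :* q₀ :+ l :* q₀)

      rational-A₁ : ∀ D q₀ q₁ a₀ a₁ → a₁ ≡ 0ℚ → let v₀ = a₀ - (1ℚ + 1ℚ); v₁ = a₁ - (0ℚ + 0ℚ); w₀ = v₀ * q₀ + D * (v₁ * q₁); w₁ = v₀ * q₁ + v₁ * q₀ in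
        w₀ * (q₁ - a₁) + w₁ * (q₀ - a₀) ≡ a₁ → (a₀ - 2ℚ) * (q₁ * (q₀ + q₀ - a₀)) ≡ 0ℚ
      rational-A₁ D q₀ q₁ a₀ _ refl e = combine₁ 1ℚ e (solve 4 (λ D q₀ q₁ a₀ → let a₁ = con 0ℤ; v₀ = a₀ :- (con 1ℤ :+ con 1ℤ); v₁ = a₁ :- (con 0ℤ :+ con 0ℤ); w₀ = v₀ :* q₀ :+ D :* (v₁ :* q₁); w₁ = v₀ :* q₁ :+ v₁ :* q₀ in
          (a₀ :- con (+ 2)) :* (q₁ :* (q₀ :+ q₀ :- a₀)) :- con 0ℤ
          := con 1ℤ :* (w₀ :* (q₁ :- a₁) :+ w₁ :* (q₀ :- a₀) :- a₁)) D q₀ q₁ a₀)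

      A≡2⇒ : ∀ a M → (a - 2ℚ) * M ≡ a → a - 2ℚ ≡ 0ℚ → 2ℚ ≡ 0ℚ
      A≡2⇒ a M e e′ = combine₂ (- 1ℚ) (M - 1ℚ) e e′ (solve 2 (λ a M →
          con (+ 2) :- con 0ℤ
          := :- con 1ℤ :* ((a :- con (+ 2)) :* M :- a) :+ (M :- con 1ℤ) :* (a :- con (+ 2) :- con 0ℤ)) a M)

      A-norm : ∀ D q₀ q₁ a → (a - 2ℚ) * (q₀ * q₀ + D * (q₁ * q₁) - a * q₀) ≡ a → q₀ + q₀ - a ≡ 0ℚ → (a - 2ℚ) * (q₀ * q₀ - D * (q₁ * q₁)) + a ≡ 0ℚ
      A-norm D q₀ q₁ a e t≡a = combine₂ (- 1ℚ) ((a - 2ℚ) * q₀) e t≡a (solve 4 (λ D q₀ q₁ a →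
          (a :- con (+ 2)) :* (q₀ :* q₀ :- D :* (q₁ :* q₁)) :+ a :- con 0ℤ
          := :- con 1ℤ :* ((a :- con (+ 2)) :* (q₀ :* q₀ :+ D :* (q₁ :* q₁) :- a :* q₀) :- a) :+ (a :- con (+ 2)) :* q₀ :* (q₀ :+ q₀ :- a :- con 0ℤ)) D q₀ q₁ a)

      drop-A : ∀ m n a → a ≡ 0ℚ → m * n + a ≡ 0ℚ → m * n ≡ 0ℚ
      drop-A m n _ refl e = trans (sym (ℚ.+-identityʳ (m * n))) e

      A-obstruction₁ : ∀ a t n → (n - 1ℚ) * t + 1ℚ ≡ 0ℚ → (a - 2ℚ) * n + a ≡ 0ℚ → t - a ≡ 0ℚ →
        (4ℚ * a - 3ℚ) * (4ℚ * a - 3ℚ) + 0ℚ * 0ℚ + 7ℚ ≡ 0ℚ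
      A-obstruction₁ a t n e₁ e₂ e₃ = combine₃ (- 8ℚ * (a - 2ℚ)) (8ℚ * t) (8ℚ * (2ℚ - 2ℚ * a)) e₁ e₂ e₃ (solve 3 (λ a t n →
          (con (+ 4) :* a :- con (+ 3)) :* (con (+ 4) :* a :- con (+ 3)) :+ con 0ℤ :* con 0ℤ :+ con (+ 7) :- con 0ℤ
          := :- con (+ 8) :* (a :- con (+ 2)) :* ((n :- con 1ℤ) :* t :+ con 1ℤ :- con 0ℤ) :+ con (+ 8) :* t :* ((a :- con (+ 2)) :* n :+ a :- con 0ℤ) :+ con (+ 8) :* (con (+ 2) :- con (+ 2) :* a) :* (t :- a :- con 0ℤ)) a t n)

      A-obstruction₂ : ∀ a t n → t * (n + 1ℚ) - (n * n + 2ℚ * n) ≡ 0ℚ → (a - 2ℚ) * n + a ≡ 0ℚ → t - a ≡ 0ℚ → a * a ≡ 0ℚ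
      A-obstruction₂ a t n e₁ e₂ e₃ = combine₃ (- ((a - 2ℚ) * (a - 2ℚ))) (t * (a - 2ℚ) - ((a - 2ℚ) * n + a) + 2ℚ * a - 2ℚ * (a - 2ℚ)) (- (2ℚ * (a - 2ℚ))) e₁ e₂ e₃ (solve 3 (λ a t n →
          a :* a :- con 0ℤ
          := :- ((a :- con (+ 2)) :* (a :- con (+ 2))) :* (t :* (n :+ con 1ℤ) :- (n :* n :+ con (+ 2) :* n) :- con 0ℤ) :+ (t :* (a :- con (+ 2)) :- ((a :- con (+ 2)) :* n :+ a) :+ con (+ 2) :* a :- con (+ 2) :* (a :- con (+ 2))) :* ((a :- con (+ 2)) :* n :+ a :- con 0ℤ) :+ :- (con (+ 2) :* (a :- con (+ 2))) :* (t :- a :- con 0ℤ)) a t n)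

  -- `U` X + `V` is the remainder of the cubic (X - 2)(βX + ε)(βX + ε - X) - X modulo X² - tX + n,
  -- the minimal polynomial of the quadratic point.
  U V : ℚ → ℚ → ℚ → ℚ → ℚ
  U β ε t n = β * (β - 1ℚ) * (t * t - n) + (ε * (2ℚ * β - 1ℚ) - 2ℚ * (β * (β - 1ℚ))) * t + (ε * ε - 2ℚ * ε * (2ℚ * β - 1ℚ) - 1ℚ)
  V β ε t n = - (β * (β - 1ℚ) * t * n) - (ε * (2ℚ * β - 1ℚ) - 2ℚ * (β * (β - 1ℚ))) * n - 2ℚ * (ε * ε)

  private
    abstract
      irrational-A₁ : ∀ D a₀ a₁ q₀ q₁ β ε → q₁ ≡ β * a₁ → q₀ ≡ ε + β * a₀ →
        let v₀ = a₀ - (1ℚ + 1ℚ); v₁ = a₁ - (0ℚ + 0ℚ); w₀ = v₀ * q₀ + D * (v₁ * q₁); w₁ = v₀ * q₁ + v₁ * q₀ in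
        w₀ * (q₁ - a₁) + w₁ * (q₀ - a₀) ≡ a₁ → a₁ * U β ε (a₀ + a₀) (a₀ * a₀ - D * (a₁ * a₁)) ≡ 0ℚ
      irrational-A₁ D a₀ a₁ _ _ β ε refl refl e = combine₁ 1ℚ e (solve 5 (λ D a₀ a₁ β ε → let q₁ = β :* a₁; q₀ = ε :+ β :* a₀; t = a₀ :+ a₀; n = a₀ :* a₀ :- D :* (a₁ :* a₁); v₀ = a₀ :- (con 1ℤ :+ con 1ℤ); v₁ = a₁ :- (con 0ℤ :+ con 0ℤ); w₀ = v₀ :* q₀ :+ D :* (v₁ :* q₁); w₁ = v₀ :* q₁ :+ v₁ :* q₀ in
          a₁ :* (β :* (β :- con 1ℤ) :* (t :* t :- n) :+ (ε :* (con (+ 2) :* β :- con 1ℤ) :- con (+ 2) :* (β :* (β :- con 1ℤ))) :* t :+ (ε :* ε :- con (+ 2) :* ε :* (con (+ 2) :* β :- con 1ℤ) :- con 1ℤ)) :- con 0ℤ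
          := con 1ℤ :* (w₀ :* (q₁ :- a₁) :+ w₁ :* (q₀ :- a₀) :- a₁)) D a₀ a₁ β ε)

      irrational-A₀ : ∀ D a₀ a₁ q₀ q₁ β ε → q₁ ≡ β * a₁ → q₀ ≡ ε + β * a₀ →
        let v₀ = a₀ - (1ℚ + 1ℚ); v₁ = a₁ - (0ℚ + 0ℚ); w₀ = v₀ * q₀ + D * (v₁ * q₁); w₁ = v₀ * q₁ + v₁ * q₀; t = a₀ + a₀; n = a₀ * a₀ - D * (a₁ * a₁) in
        w₀ * (q₀ - a₀) + D * (w₁ * (q₁ - a₁)) ≡ a₀ → U β ε t n ≡ 0ℚ → V β ε t n ≡ 0ℚ
      irrational-A₀ D a₀ a₁ _ _ β ε refl refl e U≡0 = combine₂ 1ℚ (- a₀) e U≡0 (solve 5 (λ D a₀ a₁ β ε → let q₁ = β :* a₁; q₀ = ε :+ β :* a₀; t = a₀ :+ a₀; n = a₀ :* a₀ :- D :* (a₁ :* a₁); v₀ = a₀ :- (con 1ℤ :+ con 1ℤ); v₁ = a₁ :- (con 0ℤ :+ con 0ℤ); w₀ = v₀ :* q₀ :+ D :* (v₁ :* q₁); w₁ = v₀ :* q₁ :+ v₁ :* q₀ in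
          :- (β :* (β :- con 1ℤ) :* t :* n) :- (ε :* (con (+ 2) :* β :- con 1ℤ) :- con (+ 2) :* (β :* (β :- con 1ℤ))) :* n :- con (+ 2) :* (ε :* ε) :- con 0ℤ
          := con 1ℤ :* (w₀ :* (q₀ :- a₀) :+ D :* (w₁ :* (q₁ :- a₁)) :- a₀) :+ :- a₀ :* (β :* (β :- con 1ℤ) :* (t :* t :- n) :+ (ε :* (con (+ 2) :* β :- con 1ℤ) :- con (+ 2) :* (β :* (β :- con 1ℤ))) :* t :+ (ε :* ε :- con (+ 2) :* ε :* (con (+ 2) :* β :- con 1ℤ) :- con 1ℤ) :- con 0ℤ)) D a₀ a₁ β ε)

      third-root : ∀ β ε t n X → - (ε * (2ℚ * β - 1ℚ) - 2ℚ * (β * (β - 1ℚ)) + β * (β - 1ℚ) * t) ≡ X * (β * (β - 1ℚ)) → U β ε t n ≡ 0ℚ → V β ε t n ≡ 0ℚ →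
        (X - 2ℚ) * (β * X + ε) * (β * X + ε - X) ≡ X
      third-root β ε t n X e U≡0 V≡0 = combine₃ (- (X * X - t * X + n)) X 1ℚ e U≡0 V≡0 (solve 5 (λ β ε t n X →
          (X :- con (+ 2)) :* (β :* X :+ ε) :* (β :* X :+ ε :- X) :- X
          := :- (X :* X :- t :* X :+ n) :* (:- (ε :* (con (+ 2) :* β :- con 1ℤ) :- con (+ 2) :* (β :* (β :- con 1ℤ)) :+ β :* (β :- con 1ℤ) :* t) :- X :* (β :* (β :- con 1ℤ))) :+ X :* (β :* (β :- con 1ℤ) :* (t :* t :- n) :+ (ε :* (con (+ 2) :* β :- con 1ℤ) :- con (+ 2) :* (β :* (β :- con 1ℤ))) :* t :+ (ε :* ε :- con (+ 2) :* ε :* (con (+ 2) :* β :- con 1ℤ) :- con 1ℤ) :- con 0ℤ) :+ con 1ℤ :* (:- (β :* (β :- con 1ℤ) :* t :* n) :- (ε :* (con (+ 2) :* β :- con 1ℤ) :- con (+ 2) :* (β :* (β :- con 1ℤ))) :* n :- con (+ 2) :* (ε :* ε) :- con 0ℤ)) β ε t n X)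

      root-0 : ∀ β ε t n X → X ≡ 0ℚ → - (ε * (2ℚ * β - 1ℚ) - 2ℚ * (β * (β - 1ℚ)) + β * (β - 1ℚ) * t) ≡ X * (β * (β - 1ℚ)) → V β ε t n ≡ 0ℚ → 2ℚ * (ε * ε) ≡ 0ℚ
      root-0 β ε t n _ refl e V≡0 = combine₂ n (- 1ℚ) e V≡0 (solve 4 (λ β ε t n →
          con (+ 2) :* (ε :* ε) :- con 0ℤ
          := n :* (:- (ε :* (con (+ 2) :* β :- con 1ℤ) :- con (+ 2) :* (β :* (β :- con 1ℤ)) :+ β :* (β :- con 1ℤ) :* t) :- con 0ℤ :* (β :* (β :- con 1ℤ))) :+ :- con 1ℤ :* (:- (β :* (β :- con 1ℤ) :* t :* n) :- (ε :* (con (+ 2) :* β :- con 1ℤ) :- con (+ 2) :* (β :* (β :- con 1ℤ))) :* n :- con (+ 2) :* (ε :* ε) :- con 0ℤ)) β ε t n)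

      β≡1-U : ∀ β ε t n → β ≡ 1ℚ → U β ε t n ≡ 0ℚ → ε * t + ε * ε - 2ℚ * ε - 1ℚ ≡ 0ℚ
      β≡1-U _ ε t n refl e = combine₁ 1ℚ e (solve 3 (λ ε t n → let β = con 1ℤ in
          ε :* t :+ ε :* ε :- con (+ 2) :* ε :- con 1ℤ :- con 0ℤ
          := con 1ℤ :* (β :* (β :- con 1ℤ) :* (t :* t :- n) :+ (ε :* (con (+ 2) :* β :- con 1ℤ) :- con (+ 2) :* (β :* (β :- con 1ℤ))) :* t :+ (ε :* ε :- con (+ 2) :* ε :* (con (+ 2) :* β :- con 1ℤ) :- con 1ℤ) :- con 0ℤ)) ε t n)

      β≡1-V : ∀ β ε t n → β ≡ 1ℚ → V β ε t n ≡ 0ℚ → ε * (n + 2ℚ * ε) ≡ 0ℚ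
      β≡1-V _ ε t n refl e = combine₁ (- 1ℚ) e (solve 3 (λ ε t n → let β = con 1ℤ in
          ε :* (n :+ con (+ 2) :* ε) :- con 0ℤ
          := :- con 1ℤ :* (:- (β :* (β :- con 1ℤ) :* t :* n) :- (ε :* (con (+ 2) :* β :- con 1ℤ) :- con (+ 2) :* (β :* (β :- con 1ℤ))) :* n :- con (+ 2) :* (ε :* ε) :- con 0ℤ)) ε t n)

      ε≡0⇒ : ∀ ε t → ε ≡ 0ℚ → ε * t + ε * ε - 2ℚ * ε - 1ℚ ≡ 0ℚ → 1ℚ ≡ 0ℚ
      ε≡0⇒ _ t refl e = combine₁ (- 1ℚ) e (solve 1 (λ t →
          con 1ℤ :- con 0ℤ
          := :- con 1ℤ :* (con 0ℤ :* t :+ con 0ℤ :* con 0ℤ :- con (+ 2) :* con 0ℤ :- con 1ℤ :- con 0ℤ)) t)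

      norm≡1 : ∀ D a₀ a₁ q₀ q₁ β ε → β ≡ 1ℚ → q₁ ≡ β * a₁ → q₀ ≡ ε + β * a₀ →
        ε * (a₀ + a₀) + ε * ε - 2ℚ * ε - 1ℚ ≡ 0ℚ → a₀ * a₀ - D * (a₁ * a₁) + 2ℚ * ε ≡ 0ℚ → q₀ * q₀ - D * (q₁ * q₁) ≡ 1ℚ
      norm≡1 D a₀ a₁ _ _ _ ε refl refl refl e e′ = combine₂ 1ℚ 1ℚ e e′ (solve 4 (λ D a₀ a₁ ε → let q₁ = con 1ℤ :* a₁; q₀ = ε :+ con 1ℤ :* a₀ in
          q₀ :* q₀ :- D :* (q₁ :* q₁) :- con 1ℤ
          := con 1ℤ :* (ε :* (a₀ :+ a₀) :+ ε :* ε :- con (+ 2) :* ε :- con 1ℤ :- con 0ℤ) :+ con 1ℤ :* (a₀ :* a₀ :- D :* (a₁ :* a₁) :+ con (+ 2) :* ε :- con 0ℤ)) D a₀ a₁ ε)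

      norm-1-obstruction₁ : ∀ t n → n ≡ 1ℚ → (n - 1ℚ) * t + 1ℚ ≡ 0ℚ → 1ℚ ≡ 0ℚ
      norm-1-obstruction₁ t _ refl e = combine₁ 1ℚ e (solve 1 (λ t → con 1ℤ :- con 0ℤ := con 1ℤ :* ((con 1ℤ :- con 1ℤ) :* t :+ con 1ℤ :- con 0ℤ)) t)

      norm-1-obstruction₂ : ∀ β ε a₀ q₀ n → n ≡ 1ℚ → β ≡ 1ℚ → q₀ ≡ ε + β * a₀ → let t = q₀ + q₀ in
        t * (n + 1ℚ) - (n * n + 2ℚ * n) ≡ 0ℚ → ε * (a₀ + a₀) + ε * ε - 2ℚ * ε - 1ℚ ≡ 0ℚ →
        (4ℚ * ε + 1ℚ) * (4ℚ * ε + 1ℚ) + 0ℚ * 0ℚ + 15ℚ ≡ 0ℚ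
      norm-1-obstruction₂ _ ε a₀ _ _ refl refl refl e e′ = combine₂ (8ℚ * ε) (- (8ℚ * 2ℚ)) e e′ (solve 2 (λ ε a₀ → let q₀ = ε :+ con 1ℤ :* a₀; t = q₀ :+ q₀ in
          (con (+ 4) :* ε :+ con 1ℤ) :* (con (+ 4) :* ε :+ con 1ℤ) :+ con 0ℤ :* con 0ℤ :+ con (+ 15) :- con 0ℤ
          := con (+ 8) :* ε :* (t :* (con 1ℤ :+ con 1ℤ) :- (con 1ℤ :* con 1ℤ :+ con (+ 2) :* con 1ℤ) :- con 0ℤ) :+ :- (con (+ 8) :* con (+ 2)) :* (ε :* (a₀ :+ a₀) :+ ε :* ε :- con (+ 2) :* ε :- con 1ℤ :- con 0ℤ)) ε a₀)

      proportional₀ : ∀ D a₀ a₁ b₀ b₁ q₀ q₁ β ε → ε ≡ 0ℚ → q₁ ≡ β * a₁ → q₀ ≡ ε + β * a₀ →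
        a₀ * b₀ + D * (a₁ * b₁) ≡ q₀ + q₀ → a₀ * (b₀ - 2ℚ * β) + D * (a₁ * b₁) ≡ 0ℚ
      proportional₀ D a₀ a₁ b₀ b₁ _ _ β _ refl refl refl e = combine₁ 1ℚ e (solve 6 (λ D a₀ a₁ b₀ b₁ β → let q₀ = con 0ℤ :+ β :* a₀ in
          a₀ :* (b₀ :- con (+ 2) :* β) :+ D :* (a₁ :* b₁) :- con 0ℤ
          := con 1ℤ :* (a₀ :* b₀ :+ D :* (a₁ :* b₁) :- (q₀ :+ q₀))) D a₀ a₁ b₀ b₁ β)

      proportional₁ : ∀ a₀ a₁ b₀ b₁ q₁ β → q₁ ≡ β * a₁ → a₀ * b₁ + a₁ * b₀ ≡ q₁ + q₁ → a₀ * b₁ + a₁ * (b₀ - 2ℚ * β) ≡ 0ℚ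
      proportional₁ a₀ a₁ b₀ b₁ _ β refl e = combine₁ 1ℚ e (solve 5 (λ a₀ a₁ b₀ b₁ β → let q₁ = β :* a₁ in
          a₀ :* b₁ :+ a₁ :* (b₀ :- con (+ 2) :* β) :- con 0ℤ := con 1ℤ :* (a₀ :* b₁ :+ a₁ :* b₀ :- (q₁ :+ q₁))) a₀ a₁ b₀ b₁ β)

  module _ (d : ℤ) (non-square : NonSquare d) where
    private
      D : ℚ
      D = ℤ→ℚ d
      module O = OrbitIdentities (φ d) (K-isCommutativeRing d) (φ-+ d) (φ-* d) (φ-neg d)
      norm : ℚ → ℚ → ℚ
      norm x₀ x₁ = x₀ * x₀ - D * (x₁ * x₁)

    irrational-obstruction : ∀ q₀ q₁ y → q₁ ≢ 0ℚ → mulK d y y ≡ O.quartic (q₀ , q₁) → Obstruction (q₀ + q₀) (norm q₀ q₁)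
    irrational-obstruction q₀ q₁ (y₀ , y₁) q₁≢0 e =
      let l , y₁≡ = divide y₁ q₁ q₁≢0
          h = y₀ - l * q₀
          t = q₀ + q₀
          n = norm q₀ q₁
          y₀≡ = intercept y₀ l q₀
          L = l * l * t + 2ℚ * l * h
          R = t * t * t - 2ℚ * t * n + 2ℚ * t - 4ℚ
          e₁ = a-b≡0⇒a≡b L R (cancel q₁ (L - R) q₁≢0 (line₁ D q₀ q₁ y₀ y₁ l h y₁≡ y₀≡ (cong proj₂ e)))
      in quadratic-point t n l h e₁ (line₀ D q₀ q₁ y₀ y₁ l h y₁≡ y₀≡ (cong proj₁ e) e₁)

    A-Relation : K d → K d → Set
    A-Relation q u = mulK d (mulK d (u O.- O.double O.one) q) (q O.- u) ≡ u

    private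
      norm≢0 : ∀ x₀ x₁ → x₁ ≢ 0ℚ → norm x₀ x₁ ≢ 0ℚ
      norm≢0 x₀ x₁ x₁≢0 e = x₁≢0 (cong proj₂ (norm≡0 d non-square x₀ x₁ e))

      2≢0 : 2ℚ ≢ 0ℚ
      2≢0 ()

      1≢0 : 1ℚ ≢ 0ℚ
      1≢0 ()

    -- For rational A the relation is the quadratic (A - 2)x² - A(A - 2)x - A for q, so q has trace
    -- A and norm -A/(A - 2), with A ≠ 0. The first obstruction then becomes (4A - 3)² + 7 = 0 and
    -- the second A² = 0.
    irrational-q,rational-A : ∀ q₀ q₁ y a₀ a₁ → q₁ ≢ 0ℚ → mulK d y y ≡ O.quartic (q₀ , q₁) → A-Relation (q₀ , q₁) (a₀ , a₁) → a₁ ≢ 0ℚ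
    irrational-q,rational-A q₀ q₁ y a₀ a₁ q₁≢0 ey eA a₁≡0 = [ first , second ]′ (irrational-obstruction q₀ q₁ y q₁≢0 ey)
      where
      e₀ : (a₀ - 2ℚ) * (q₀ * q₀ + D * (q₁ * q₁) - a₀ * q₀) ≡ a₀
      e₀ = rational-A₀ D q₀ q₁ a₀ a₁ a₁≡0 (cong proj₁ eA)
      a₀≢2 : a₀ - 2ℚ ≢ 0ℚ
      a₀≢2 e = 2≢0 (A≡2⇒ a₀ (q₀ * q₀ + D * (q₁ * q₁) - a₀ * q₀) e₀ e)
      t≡a₀ : q₀ + q₀ - a₀ ≡ 0ℚ
      t≡a₀ = cancel q₁ (q₀ + q₀ - a₀) q₁≢0 (cancel (a₀ - 2ℚ) (q₁ * (q₀ + q₀ - a₀)) a₀≢2 (rational-A₁ D q₀ q₁ a₀ a₁ a₁≡0 (cong proj₂ eA)))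
      n≡ : (a₀ - 2ℚ) * norm q₀ q₁ + a₀ ≡ 0ℚ
      n≡ = A-norm D q₀ q₁ a₀ e₀ t≡a₀
      a₀≢0 : a₀ ≢ 0ℚ
      a₀≢0 a₀≡0 = norm≢0 q₀ q₁ q₁≢0 (cancel (a₀ - 2ℚ) (norm q₀ q₁) a₀≢2 (drop-A (a₀ - 2ℚ) (norm q₀ q₁) a₀ a₀≡0 n≡))
      first : (norm q₀ q₁ - 1ℚ) * (q₀ + q₀) + 1ℚ ≡ 0ℚ → ⊥
      first e = sum-of-squares≢ (4ℚ * a₀ - 3ℚ) 0ℚ 7ℚ positive (A-obstruction₁ a₀ (q₀ + q₀) (norm q₀ q₁) e n≡ t≡a₀)
      second : (q₀ + q₀) * (norm q₀ q₁ + 1ℚ) - (norm q₀ q₁ * norm q₀ q₁ + 2ℚ * norm q₀ q₁) ≡ 0ℚ → ⊥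
      second e = a₀≢0 (square≡0 a₀ (A-obstruction₂ a₀ (q₀ + q₀) (norm q₀ q₁) e n≡ t≡a₀))

    -- u satisfies, besides its quadratic equation, the cubic obtained from the relation with q = βu + ε; the third root is rational.
    irrational-A : ∀ q₀ q₁ y u₀ u₁ b → q₁ ≢ 0ℚ → u₁ ≢ 0ℚ → mulK d y y ≡ O.quartic (q₀ , q₁) → A-Relation (q₀ , q₁) (u₀ , u₁) →
      mulK d (u₀ , u₁) b ≡ O.double (q₀ , q₁) → proj₂ b ≡ 0ℚ
    irrational-A q₀ q₁ y u₀ u₁ (b₀ , b₁) q₁≢0 u₁≢0 ey eA eB =
      let β , q₁≡ = divide q₁ u₁ u₁≢0 in with-slope β (q₀ - β * u₀) q₁≡ (intercept q₀ β u₀)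
      where
      t n : ℚ
      t = u₀ + u₀
      n = norm u₀ u₁
      with-slope : ∀ β ε → q₁ ≡ β * u₁ → q₀ ≡ ε + β * u₀ → b₁ ≡ 0ℚ
      with-slope β ε q₁≡ q₀≡ = split (β * (β - 1ℚ) ℚ.≟ 0ℚ)
        where
        U≡0 : U β ε t n ≡ 0ℚ
        U≡0 = cancel u₁ (U β ε t n) u₁≢0 (irrational-A₁ D u₀ u₁ q₀ q₁ β ε q₁≡ q₀≡ (cong proj₂ eA))
        V≡0 : V β ε t n ≡ 0ℚ
        V≡0 = irrational-A₀ D u₀ u₁ q₀ q₁ β ε q₁≡ q₀≡ (cong proj₁ eA) U≡0
        κ : ℚ
        κ = ε * (2ℚ * β - 1ℚ) - 2ℚ * (β * (β - 1ℚ)) + β * (β - 1ℚ) * t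
        -- For ε = 0 one has q = βu, and ub = 2q yields the rational value b = 2β.
        conclude : ε ≡ 0ℚ → b₁ ≡ 0ℚ
        conclude ε≡0 =
          [ (λ u≡0 → contradiction (cong proj₂ u≡0) u₁≢0) , cong proj₂ ]′ (productK≡0 d non-square (u₀ , u₁) (b₀ - 2ℚ * β , b₁)
            (cong₂ _,_ (proportional₀ D u₀ u₁ b₀ b₁ q₀ q₁ β ε ε≡0 q₁≡ q₀≡ (cong proj₁ eB)) (proportional₁ u₀ u₁ b₀ b₁ q₁ β q₁≡ (cong proj₂ eB))))
        with-root : ∀ X → - κ ≡ X * (β * (β - 1ℚ)) → b₁ ≡ 0ℚ
        with-root X e = decide (X ℚ.≟ 0ℚ)
          where
          decide : _ → b₁ ≡ 0ℚ
          decide (yes X≡0) = conclude (square≡0 ε (cancel 2ℚ (ε * ε) 2≢0 (root-0 β ε t n X X≡0 e V≡0)))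
          -- The third root X and Q = βX + ε would form a rational point of the cubic curve with X ≠
          -- 0.
          decide (no X≢0) = contradiction (third-root β ε t n X e U≡0 V≡0) (no-24a-fraction X (β * X + ε) X≢0)
        β≢0 : β ≢ 0ℚ
        β≢0 β≡0 = q₁≢0 (trans q₁≡ (trans (cong (_* u₁) β≡0) (ℚ.*-zeroˡ u₁)))
        -- For β = 1 the cubic loses its leading term; the two remaining coefficient equations force
        -- q to have norm 1, which contradicts both obstructions.
        β≢1 : β ≢ 1ℚ
        β≢1 β≡1 = [ (λ e → 1≢0 (norm-1-obstruction₁ (q₀ + q₀) (norm q₀ q₁) N≡1 e))
                  , (λ e → sum-of-squares≢ (4ℚ * ε + 1ℚ) 0ℚ 15ℚ positive (norm-1-obstruction₂ β ε u₀ q₀ (norm q₀ q₁) N≡1 β≡1 q₀≡ e U₁)) ]′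
          (irrational-obstruction q₀ q₁ y q₁≢0 ey)
          where
          U₁ : ε * t + ε * ε - 2ℚ * ε - 1ℚ ≡ 0ℚ
          U₁ = β≡1-U β ε t n β≡1 U≡0
          N≡1 : norm q₀ q₁ ≡ 1ℚ
          N≡1 = norm≡1 D u₀ u₁ q₀ q₁ β ε β≡1 q₁≡ q₀≡ U₁
            (cancel ε (n + 2ℚ * ε) (λ ε≡0 → 1≢0 (ε≡0⇒ ε t ε≡0 U₁)) (β≡1-V β ε t n β≡1 V≡0))
        split : _ → b₁ ≡ 0ℚ
        split (yes e) = [ (λ β≡0 → contradiction β≡0 β≢0) , (λ β-1≡0 → contradiction (a-b≡0⇒a≡b β 1ℚ β-1≡0) β≢1) ]′ (product≡0 β (β - 1ℚ) e)
        split (no g₃≢0) = let X , e = divide (- κ) (β * (β - 1ℚ)) g₃≢0 in with-root X e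

    -- The first of the two factors is irrational, hence the second is rational by `irrational-A`;
    -- but the second satisfies the same relation and must be irrational as well.
    irrational-q : ∀ q₀ q₁ y u v → q₁ ≢ 0ℚ → mulK d y y ≡ O.quartic (q₀ , q₁) → A-Relation (q₀ , q₁) u → A-Relation (q₀ , q₁) v →
      mulK d u v ≢ O.double (q₀ , q₁)
    irrational-q q₀ q₁ y (u₀ , u₁) (v₀ , v₁) q₁≢0 ey eu ev euv =
      irrational-q,rational-A q₀ q₁ y v₀ v₁ q₁≢0 ey ev
        (irrational-A q₀ q₁ y u₀ u₁ (v₀ , v₁) q₁≢0 (irrational-q,rational-A q₀ q₁ y u₀ u₁ q₁≢0 ey eu) ey eu euv)

-- The case q ∈ ℚ and the conclusion for the graph.

module PreperiodicGraph where
  open import Data.Empty using (⊥)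
  open import Data.Integer as ℤ using (ℤ; +_; 0ℤ; 1ℤ)
  open import Data.Product using (_,_; proj₁; proj₂)
  open import Data.Rational using (ℚ; _+_; _*_; -_; _-_; 0ℚ; 1ℚ)
  import Data.Rational.Properties as ℚ
  open import Data.Sum using (inj₁; inj₂; [_,_]′)
  open import Relation.Binary.PropositionalEquality
  open import Relation.Nullary using (¬_; contradiction; yes; no)
  open import Defs using (ℤ→ℚ; K; addK; mulK; NonSquare; V₁; next₁; ContainsG₁; module V₁; module ContainsG₁)
  open RationalBase
  open RationalCurves using (ι; 2ℚ; 4ℚ; elliptic-rational)
  open RationalQuartics using (quarticℚ⁺)
  open RationalPoints using (no-24a-fraction)
  open RationalSquareProduct using (square-product)
  open QuadraticField
  open IrrationalPoints using (rational-A₀; irrational-q)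
  open LinearCombination ℚ.+-*-isCommutativeRing

  private
    abstract
      p₁-vanishes : ∀ q₀ q₁ p₀ p₁ → q₁ ≡ 0ℚ → q₀ * q₁ + q₁ * q₀ ≡ 0ℚ + (q₀ * p₁ + q₁ * p₀ + (q₀ * p₁ + q₁ * p₀)) → 2ℚ * (q₀ * p₁) ≡ 0ℚ
      p₁-vanishes q₀ _ p₀ p₁ refl e = combine₁ (- 1ℚ) e (solve 3 (λ q₀ p₀ p₁ → con (+ 2) :* (q₀ :* p₁) :- con 0ℤ
        := :- con 1ℤ :* (q₀ :* con 0ℤ :+ con 0ℤ :* q₀ :- (con 0ℤ :+ (q₀ :* p₁ :+ con 0ℤ :* p₀ :+ (q₀ :* p₁ :+ con 0ℤ :* p₀))))) q₀ p₀ p₁)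

      a₁-vanishes : ∀ p₁ a₁ → p₁ ≡ 0ℚ → 0ℚ + p₁ - a₁ ≡ 0ℚ → a₁ ≡ 0ℚ
      a₁-vanishes _ a₁ refl e = combine₁ (- 1ℚ) e (solve 1 (λ a₁ → a₁ :- con 0ℤ := :- con 1ℤ :* (con 0ℤ :+ con 0ℤ :- a₁ :- con 0ℤ)) a₁)

      q₀-nonzero : ∀ D q₀ q₁ p₀ p₁ → q₀ ≡ 0ℚ → q₁ ≡ 0ℚ → q₀ * q₀ + D * (q₁ * q₁) ≡ 1ℚ + (q₀ * p₀ + D * (q₁ * p₁) + (q₀ * p₀ + D * (q₁ * p₁))) → 1ℚ ≡ 0ℚ
      q₀-nonzero D _ _ p₀ p₁ refl refl e = combine₁ (- 1ℚ) e (solve 3 (λ D p₀ p₁ → let m = con 0ℤ :* p₀ :+ D :* (con 0ℤ :* p₁) in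
        con 1ℤ :- con 0ℤ := :- con 1ℤ :* (con 0ℤ :* con 0ℤ :+ D :* (con 0ℤ :* con 0ℤ) :- (con 1ℤ :+ (m :+ m)))) D p₀ p₁)

      s-product : ∀ a₀ s₀ s₁ → s₀ * s₁ + s₁ * s₀ ≡ a₀ * 0ℚ + 0ℚ * a₀ - 0ℚ → 2ℚ * (s₀ * s₁) ≡ 0ℚ
      s-product a₀ s₀ s₁ e = combine₁ 1ℚ e (solve 3 (λ a₀ s₀ s₁ → con (+ 2) :* (s₀ :* s₁) :- con 0ℤ
        := con 1ℤ :* (s₀ :* s₁ :+ s₁ :* s₀ :- (a₀ :* con 0ℤ :+ con 0ℤ :* a₀ :- con 0ℤ))) a₀ s₀ s₁)

      r-product : ∀ a₀ r₀ r₁ → r₀ * r₁ + r₁ * r₀ ≡ 0ℚ - 0ℚ + (a₀ * 0ℚ + 0ℚ * a₀) → 2ℚ * (r₀ * r₁) ≡ 0ℚ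
      r-product a₀ r₀ r₁ e = combine₁ 1ℚ e (solve 3 (λ a₀ r₀ r₁ → con (+ 2) :* (r₀ :* r₁) :- con 0ℤ
        := con 1ℤ :* (r₀ :* r₁ :+ r₁ :* r₀ :- (con 0ℤ :- con 0ℤ :+ (a₀ :* con 0ℤ :+ con 0ℤ :* a₀)))) a₀ r₀ r₁)

      rational-relation : ∀ D q u → (u - 2ℚ) * (q * q + D * (0ℚ * 0ℚ) - u * q) ≡ u → (u - 2ℚ) * q * (q - u) ≡ u
      rational-relation D q u e = combine₁ 1ℚ e (solve 3 (λ D q u → (u :- con (+ 2)) :* q :* (q :- u) :- u
        := con 1ℤ :* ((u :- con (+ 2)) :* (q :* q :+ D :* (con 0ℤ :* con 0ℤ) :- u :* q) :- u)) D q u)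

      relation-at-0 : ∀ q u → u ≡ 0ℚ → (u - 2ℚ) * q * (q - u) ≡ u → 2ℚ * (q * q) ≡ 0ℚ
      relation-at-0 q _ refl e = combine₁ (- 1ℚ) e (solve 1 (λ q → con (+ 2) :* (q :* q) :- con 0ℤ
        := :- con 1ℤ :* ((con 0ℤ :- con (+ 2)) :* q :* (q :- con 0ℤ) :- con 0ℤ)) q)

      y-rational : ∀ D q r₀ r₁ → r₁ ≡ 0ℚ → let m₀ = q * r₀ + D * (0ℚ * r₁); m₁ = q * r₁ + 0ℚ * r₀; u₀ = q * q + D * (0ℚ * 0ℚ); u₁ = q * 0ℚ + 0ℚ * q in
        (m₀ + m₀) * (m₀ + m₀) + D * ((m₁ + m₁) * (m₁ + m₁)) ≡ u₀ * u₀ + D * (u₁ * u₁) + (u₀ + u₀) - (q + q + (q + q)) + 1ℚ →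
        2ℚ * (q * r₀) * (2ℚ * (q * r₀)) ≡ q * q * q * q + 2ℚ * (q * q) - 4ℚ * q + 1ℚ
      y-rational D q r₀ _ refl e = combine₁ 1ℚ e (solve 3 (λ D q r₀ →
        let o = con 0ℤ; m₀ = q :* r₀ :+ D :* (o :* o); m₁ = q :* o :+ o :* r₀; u₀ = q :* q :+ D :* (o :* o); u₁ = q :* o :+ o :* q in
        con (+ 2) :* (q :* r₀) :* (con (+ 2) :* (q :* r₀)) :- (q :* q :* q :* q :+ con (+ 2) :* (q :* q) :- con (+ 4) :* q :+ con 1ℤ)
        := con 1ℤ :* ((m₀ :+ m₀) :* (m₀ :+ m₀) :+ D :* ((m₁ :+ m₁) :* (m₁ :+ m₁))
             :- (u₀ :* u₀ :+ D :* (u₁ :* u₁) :+ (u₀ :+ u₀) :- (q :+ q :+ (q :+ q)) :+ con 1ℤ))) D q r₀)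

      y-at-1 : ∀ q r → q ≡ 1ℚ → 2ℚ * (q * r) * (2ℚ * (q * r)) ≡ q * q * q * q + 2ℚ * (q * q) - 4ℚ * q + 1ℚ → 4ℚ * (r * r) ≡ 0ℚ
      y-at-1 _ r refl e = combine₁ 1ℚ e (solve 1 (λ r → let q = con 1ℤ in con (+ 4) :* (r :* r) :- con 0ℤ
        := con 1ℤ :* (con (+ 2) :* (q :* r) :* (con (+ 2) :* (q :* r)) :- (q :* q :* q :* q :+ con (+ 2) :* (q :* q) :- con (+ 4) :* q :+ con 1ℤ))) r)

      y-irrational : ∀ D q r₀ r₁ → r₀ ≡ 0ℚ → let m₀ = q * r₀ + D * (0ℚ * r₁); m₁ = q * r₁ + 0ℚ * r₀; u₀ = q * q + D * (0ℚ * 0ℚ); u₁ = q * 0ℚ + 0ℚ * q in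
        (m₀ + m₀) * (m₀ + m₀) + D * ((m₁ + m₁) * (m₁ + m₁)) ≡ u₀ * u₀ + D * (u₁ * u₁) + (u₀ + u₀) - (q + q + (q + q)) + 1ℚ →
        q * q * (q * q) + (q * q + q * q) - (q + q + (q + q)) + 1ℚ ≡ 4ℚ * (q * q) * (D * (r₁ * r₁))
      y-irrational D q _ r₁ refl e = combine₁ (- 1ℚ) e (solve 3 (λ D q r₁ →
        let o = con 0ℤ; m₀ = q :* o :+ D :* (o :* r₁); m₁ = q :* r₁ :+ o :* o; u₀ = q :* q :+ D :* (o :* o); u₁ = q :* o :+ o :* q in
        q :* q :* (q :* q) :+ (q :* q :+ q :* q) :- (q :+ q :+ (q :+ q)) :+ con 1ℤ :- con (+ 4) :* (q :* q) :* (D :* (r₁ :* r₁))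
        := :- con 1ℤ :* ((m₀ :+ m₀) :* (m₀ :+ m₀) :+ D :* ((m₁ :+ m₁) :* (m₁ :+ m₁))
             :- (u₀ :* u₀ :+ D :* (u₁ :* u₁) :+ (u₀ :+ u₀) :- (q :+ q :+ (q :+ q)) :+ con 1ℤ))) D q r₁)

      x-irrational : ∀ D q s₀ s₁ → s₀ ≡ 0ℚ → let m₀ = q * s₀ + D * (0ℚ * s₁); m₁ = q * s₁ + 0ℚ * s₀; u₀ = q * q + D * (0ℚ * 0ℚ); u₁ = q * 0ℚ + 0ℚ * q in
        (m₀ + m₀) * (m₀ + m₀) + D * ((m₁ + m₁) * (m₁ + m₁)) ≡ (u₀ + 1ℚ) * (u₀ - (q + q + (q + q)) + 1ℚ) + D * ((u₁ + 0ℚ) * (u₁ - 0ℚ + 0ℚ)) →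
        (q * q + 1ℚ) * (q * q - (q + q + (q + q)) + 1ℚ) ≡ 4ℚ * (q * q) * (D * (s₁ * s₁))
      x-irrational D q _ s₁ refl e = combine₁ (- 1ℚ) e (solve 3 (λ D q s₁ →
        let o = con 0ℤ; m₀ = q :* o :+ D :* (o :* s₁); m₁ = q :* s₁ :+ o :* o; u₀ = q :* q :+ D :* (o :* o); u₁ = q :* o :+ o :* q in
        (q :* q :+ con 1ℤ) :* (q :* q :- (q :+ q :+ (q :+ q)) :+ con 1ℤ) :- con (+ 4) :* (q :* q) :* (D :* (s₁ :* s₁))
        := :- con 1ℤ :* ((m₀ :+ m₀) :* (m₀ :+ m₀) :+ D :* ((m₁ :+ m₁) :* (m₁ :+ m₁))
             :- ((u₀ :+ con 1ℤ) :* (u₀ :- (q :+ q :+ (q :+ q)) :+ con 1ℤ) :+ D :* ((u₁ :+ o) :* (u₁ :- o :+ o))))) D q s₁)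

      product-is-square : ∀ D q r s → 4ℚ * (q * q) * (D * (s * s)) * (4ℚ * (q * q) * (D * (r * r))) ≡ 4ℚ * (q * q) * (D * (s * r)) * (4ℚ * (q * q) * (D * (s * r)))
      product-is-square = solve 4 (λ D q r s → con (+ 4) :* (q :* q) :* (D :* (s :* s)) :* (con (+ 4) :* (q :* q) :* (D :* (r :* r)))
        := con (+ 4) :* (q :* q) :* (D :* (s :* r)) :* (con (+ 4) :* (q :* q) :* (D :* (s :* r))))

      positive-sign : ∀ D q s G v l → G ≡ 4ℚ * (q * q) * (D * (s * s)) → G ≡ 1ℚ * (v * v) → v ≡ l * (2ℚ * (q * s)) →
        let m = 2ℚ * (q * s) in m * (m * (l * l - D)) ≡ 0ℚ
      positive-sign D q s G _ l e e′ refl = combine₂ 1ℚ (- 1ℚ) e e′ (solve 5 (λ D q s G l → let m = con (+ 2) :* (q :* s); v = l :* m in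
        m :* (m :* (l :* l :- D)) :- con 0ℤ := con 1ℤ :* (G :- con (+ 4) :* (q :* q) :* (D :* (s :* s))) :+ :- con 1ℤ :* (G :- con 1ℤ :* (v :* v))) D q s G l)

      negative-sign : ∀ D q s G v S → G ≡ 4ℚ * (q * q) * (D * (s * s)) → G ≡ - 1ℚ * (v * v) → v ≡ S * (2ℚ * q) →
        4ℚ * (q * (q * (S * S + D * (s * s)))) ≡ 0ℚ
      negative-sign D q s G _ S e e′ refl = combine₂ (- 1ℚ) 1ℚ e e′ (solve 5 (λ D q s G S → let v = S :* (con (+ 2) :* q) in
        con (+ 4) :* (q :* (q :* (S :* S :+ D :* (s :* s)))) :- con 0ℤ
        := :- con 1ℤ :* (G :- con (+ 4) :* (q :* q) :* (D :* (s :* s))) :+ con 1ℤ :* (G :- :- con 1ℤ :* (v :* v))) D q s G S)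

      S²≡ : ∀ D a S s₀ s₁ → s₀ ≡ 0ℚ → S * S + D * (s₁ * s₁) ≡ 0ℚ → s₀ * s₀ + D * (s₁ * s₁) ≡ a * a + D * (0ℚ * 0ℚ) - 1ℚ → S * S ≡ 1ℚ - a * a
      S²≡ D a S _ s₁ refl e e′ = combine₂ 1ℚ (- 1ℚ) e e′ (solve 4 (λ D a S s₁ → S :* S :- (con 1ℤ :- a :* a)
        := con 1ℤ :* (S :* S :+ D :* (s₁ :* s₁) :- con 0ℤ) :+ :- con 1ℤ :* (con 0ℤ :* con 0ℤ :+ D :* (s₁ :* s₁) :- (a :* a :+ D :* (con 0ℤ :* con 0ℤ) :- con 1ℤ))) D a S s₁)

      p²-rational : ∀ D a p → p * p + D * (0ℚ * 0ℚ) ≡ a * a + D * (0ℚ * 0ℚ) - (a + a) → p * p ≡ a * a - (a + a)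
      p²-rational D a p e = combine₁ 1ℚ e (solve 3 (λ D a p → p :* p :- (a :* a :- (a :+ a))
        := con 1ℤ :* (p :* p :+ D :* (con 0ℤ :* con 0ℤ) :- (a :* a :+ D :* (con 0ℤ :* con 0ℤ) :- (a :+ a)))) D a p)

      -- The sum S² + p² is 1 - 2a, and (1 - 2a)² - (1 - a²)(a² - 2a) is the square of a² - a + 1.
      quartic-point : ∀ a S p → S * S ≡ 1ℚ - a * a → p * p ≡ a * a - (a + a) →
        S * S * (S * S) + ι 1ℤ * (S * S * (p * p)) + p * p * (p * p) ≡ (a * a - a + 1ℚ) * (a * a - a + 1ℚ)
      quartic-point a S p e e′ = combine₂ (S * S + (1ℚ - a * a) + p * p) (1ℚ - a * a + p * p + (a * a - (a + a))) e e′ (solve 3 (λ a S p →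
        S :* S :* (S :* S) :+ con 1ℤ :* (S :* S :* (p :* p)) :+ p :* p :* (p :* p) :- (a :* a :- a :+ con 1ℤ) :* (a :* a :- a :+ con 1ℤ)
        := (S :* S :+ (con 1ℤ :- a :* a) :+ p :* p) :* (S :* S :- (con 1ℤ :- a :* a))
          :+ (con 1ℤ :- a :* a :+ p :* p :+ (a :* a :- (a :+ a))) :* (p :* p :- (a :* a :- (a :+ a)))) a S p)

      S-vanishes : ∀ D S s → S ≡ 0ℚ → S * S + D * (s * s) ≡ 0ℚ → 0ℚ * 0ℚ ≡ D * (s * s)
      S-vanishes D _ s refl e = combine₁ (- 1ℚ) e (solve 2 (λ D s → con 0ℤ :* con 0ℤ :- D :* (s :* s)
        := :- con 1ℤ :* (con 0ℤ :* con 0ℤ :+ D :* (s :* s) :- con 0ℤ)) D s)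

    2≢0 : 2ℚ ≢ 0ℚ
    2≢0 ()

    4≢0 : 4ℚ ≢ 0ℚ
    4≢0 ()

    1≢0 : 1ℚ ≢ 0ℚ
    1≢0 ()

  module _ (d : ℤ) (non-square : NonSquare d) where
    private
      D : ℚ
      D = ℤ→ℚ d
      module O = OrbitIdentities (φ d) (K-isCommutativeRing d) (φ-+ d) (φ-* d) (φ-neg d)

    module _ (a p s r : K d) (p² : mulK d p p ≡ mulK d a a O.- O.double a) (s² : mulK d s s ≡ mulK d a a O.- O.one)
      (r² : mulK d r r ≡ addK d (p O.- a) (mulK d a a)) where

      q-irrational : proj₂ (addK d O.one p O.- a) ≢ 0ℚ → ⊥
      q-irrational q₁≢0 = irrational-q d non-square (proj₁ q) (proj₂ q) (O.double (mulK d q r)) (addK d (addK d O.one p) s) (addK d O.one p O.- s) q₁≢0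
        (O.y²≡ a p p² r r²) (O.A-relation a p p² s s²)
        (O.A-relation a p p² (negK d s) (trans (O.square-of-negative s) s²)) (O.AB≡2q a p p² s s²)
        where
        q : K d
        q = addK d O.one p O.- a

    q-rational : ∀ a₀ a₁ p₀ p₁ s₀ s₁ r₀ r₁ → a₁ ≡ 0ℚ → p₁ ≡ 0ℚ → let a = (a₀ , a₁); p = (p₀ , p₁); s = (s₀ , s₁); r = (r₀ , r₁) in
      p ≢ φ d 0ℤ → s ≢ φ d 0ℤ → r ≢ φ d 0ℤ → proj₁ (addK d O.one p O.- a) ≢ 0ℚ →
      mulK d p p ≡ mulK d a a O.- O.double a → mulK d s s ≡ mulK d a a O.- O.one → mulK d r r ≡ addK d (p O.- a) (mulK d a a) → ⊥
    q-rational a₀ _ p₀ _ s₀ s₁ r₀ r₁ refl refl p≢0 s≢0 r≢0 q≢0 p² s² r² =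
      [ s-irrational , s-rational ]′ (product≡0 s₀ s₁ (cancel 2ℚ (s₀ * s₁) 2≢0 (s-product a₀ s₀ s₁ (cong proj₂ s²))))
      where
      a p s r : K d
      a = a₀ , 0ℚ
      p = p₀ , 0ℚ
      s = s₀ , s₁
      r = r₀ , r₁
      q u : ℚ
      q = 1ℚ + p₀ - a₀
      u = 1ℚ + p₀ + s₀
      s-rational : s₁ ≡ 0ℚ → ⊥
      s-rational s₁≡0 = no-24a-fraction u q u≢0 e
        where
        e : (u - 2ℚ) * q * (q - u) ≡ u
        e = rational-relation D q u (rational-A₀ D q 0ℚ u (0ℚ + 0ℚ + s₁) (cong (λ x → 0ℚ + 0ℚ + x) s₁≡0) (cong proj₁ (O.A-relation a p p² s s²)))
        u≢0 : u ≢ 0ℚ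
        u≢0 u≡0 = q≢0 (square≡0 q (cancel 2ℚ (q * q) 2≢0 (relation-at-0 q u u≡0 e)))
      s-irrational : s₀ ≡ 0ℚ → ⊥
      s-irrational s₀≡0 = [ r-irrational , r-rational ]′ (product≡0 r₀ r₁ (cancel 2ℚ (r₀ * r₁) 2≢0 (r-product a₀ r₀ r₁ (cong proj₂ r²))))
        where
        s₁≢0 : s₁ ≢ 0ℚ
        s₁≢0 s₁≡0 = s≢0 (cong₂ _,_ s₀≡0 s₁≡0)
        r-rational : r₁ ≡ 0ℚ → ⊥
        r-rational r₁≡0 = [ q≢0 , (λ q≡1 → r≢0 (cong₂ _,_ (square≡0 r₀ (cancel 4ℚ (r₀ * r₀) 4≢0 (y-at-1 q r₀ q≡1 y²))) r₁≡0)) ]′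
          (elliptic-rational q (2ℚ * (q * r₀)) y²)
          where
          y² : 2ℚ * (q * r₀) * (2ℚ * (q * r₀)) ≡ q * q * q * q + 2ℚ * (q * q) - 4ℚ * q + 1ℚ
          y² = y-rational D q r₀ r₁ r₁≡0 (cong proj₁ (O.y²≡ a p p² r r²))
        r-irrational : r₀ ≡ 0ℚ → ⊥
        -- Now (2qs)² and (2qr)² are both 4q²d times a rational square, and their product is the
        -- square of 4q²d s₁r₁.
        r-irrational r₀≡0 = decide (square-product q (4ℚ * (q * q) * (D * (s₁ * r₁)))
            (trans (cong₂ _*_ G≡ (y-irrational D q r₀ r₁ r₀≡0 (cong proj₁ (O.y²≡ a p p² r r²)))) (product-is-square D q r₁ s₁)))
          where
          G : ℚ
          G = (q * q + 1ℚ) * (q * q - (q + q + (q + q)) + 1ℚ)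
          G≡ : G ≡ 4ℚ * (q * q) * (D * (s₁ * s₁))
          G≡ = x-irrational D q s₀ s₁ s₀≡0 (cong proj₁ (O.x²≡ a p p² s s²))
          qs≢0 : 2ℚ * (q * s₁) ≢ 0ℚ
          qs≢0 e = s₁≢0 (cancel q s₁ q≢0 (cancel 2ℚ (q * s₁) 2≢0 e))
          plus : ∀ v → G ≡ 1ℚ * (v * v) → ⊥
          -- Here v² = d(2qs₁)², so v/(2qs₁) would be a rational square root of d.
          plus v e = let m = 2ℚ * (q * s₁); l , v≡ = divide v m qs≢0; Z = l * l - D in
            non-square l (a-b≡0⇒a≡b (l * l) D (cancel m Z qs≢0 (cancel m (m * Z) qs≢0 (positive-sign D q s₁ G v l G≡ e v≡))))
          minus : ∀ v → G ≡ - 1ℚ * (v * v) → ⊥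
          -- The number S = v/(2q) satisfies S² = -d s₁² = -s², which brings in the quartic with the
          -- plus sign.
          minus v e = let S , v≡ = divide v (2ℚ * q) (λ 2q≡0 → q≢0 (cancel 2ℚ q 2≢0 2q≡0)) in with-root S v≡
            where
            with-root : ∀ S → v ≡ S * (2ℚ * q) → ⊥
            with-root S v≡ =
              [ (λ S≡0 → s₁≢0 (proportional d non-square 0ℚ s₁ (S-vanishes D S s₁ S≡0 Z≡0)))
              , (λ p₀≡0 → p≢0 (cong₂ _,_ p₀≡0 refl)) ]′
              (quarticℚ⁺ S p₀ (a₀ * a₀ - a₀ + 1ℚ) (quartic-point a₀ S p₀ (S²≡ D a₀ S s₀ s₁ s₀≡0 Z≡0 (cong proj₁ s²)) (p²-rational D a₀ p₀ (cong proj₁ p²))))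
              where
              Z : ℚ
              Z = S * S + D * (s₁ * s₁)
              Z≡0 : Z ≡ 0ℚ
              Z≡0 = cancel q Z q≢0 (cancel q (q * Z) q≢0 (cancel 4ℚ (q * (q * Z)) 4≢0 (negative-sign D q s₁ G v S G≡ e v≡)))
          decide : _ → ⊥
          decide (v , inj₁ e) = plus v e
          decide (v , inj₂ e) = minus v e

    no-orbits : ∀ a p s r → p ≢ φ d 0ℤ → s ≢ φ d 0ℤ → r ≢ φ d 0ℤ →
      mulK d p p ≡ mulK d a a O.- O.double a → mulK d s s ≡ mulK d a a O.- O.one → mulK d r r ≡ addK d (p O.- a) (mulK d a a) → ⊥
    no-orbits a@(a₀ , a₁) p@(p₀ , p₁) s r p≢0 s≢0 r≢0 p² s² r² = decide (q₁ ℚ.≟ 0ℚ)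
      where
      q₀ q₁ : ℚ
      q₀ = 1ℚ + p₀ - a₀
      q₁ = 0ℚ + p₁ - a₁
      q² : mulK d (q₀ , q₁) (q₀ , q₁) ≡ addK d O.one (O.double (mulK d (q₀ , q₁) p))
      q² = O.q²≡ a p p²
      rational : q₁ ≡ 0ℚ → ⊥
      rational q₁≡0 = q-rational a₀ a₁ p₀ p₁ (proj₁ s) (proj₂ s) (proj₁ r) (proj₂ r) (a₁-vanishes p₁ a₁ p₁≡0 q₁≡0) p₁≡0 p≢0 s≢0 r≢0 q₀≢0 p² s² r²
        where
        q₀≢0 : q₀ ≢ 0ℚ
        q₀≢0 q₀≡0 = 1≢0 (q₀-nonzero D q₀ q₁ p₀ p₁ q₀≡0 q₁≡0 (cong proj₁ q²))
        p₁≡0 : p₁ ≡ 0ℚ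
        p₁≡0 = cancel q₀ p₁ q₀≢0 (cancel 2ℚ (q₀ * p₁) 2≢0 (p₁-vanishes q₀ q₁ p₀ p₁ q₁≡0 (cong proj₂ q²)))
      decide : _ → ⊥
      decide (yes q₁≡0) = rational q₁≡0
      decide (no q₁≢0) = q-irrational a p s r p² s² r² q₁≢0

    private
      difference≡0 : ∀ x y → x O.- y ≡ φ d 0ℤ → x ≡ y
      difference≡0 (x₀ , x₁) (y₀ , y₁) e = cong₂ _,_ (a-b≡0⇒a≡b x₀ y₀ (cong proj₁ e)) (a-b≡0⇒a≡b x₁ y₁ (cong proj₂ e))

      opposite-of-0 : ∀ x y → addK d x y ≡ φ d 0ℤ → x ≡ φ d 0ℤ → x ≡ y
      opposite-of-0 _ (y₀ , y₁) e refl = cong₂ _,_ (trans (sym (cong proj₁ e)) (ℚ.+-identityˡ y₀)) (trans (sym (cong proj₂ e)) (ℚ.+-identityˡ y₁))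

    -- Injectivity supplies the signs b = -a and b' = -a', the sum a + a' = 1 of the two fixed
    -- points, and the nonvanishing of p, s and r.
    no-G₁ : ∀ c → ¬ ContainsG₁ d c
    no-G₁ c g = no-orbits (z a) (z p) (z s) (z r) (nonzero p p̄ (λ ()) refl) (nonzero s s̄ (λ ()) refl) (nonzero r r̄ (λ ()) refl)
        (O.p²≡ (z a) (z b) (z p) c (edges a) (opposite a b (λ ()) refl) (edges p))
        (O.s²≡ (z a) (z b') (z s) c (edges a)
          (O.second-tail (z a) (z a') (z b') (opposite a' b' (λ ()) refl) fixed-sum) (edges s))
        (O.r²≡ (z a) (z p) (z r) c (edges a) (edges r))
      where
      open V₁
      open ContainsG₁ g using (inj; edges) renaming (ι to z)
      opposite : ∀ v w → v ≢ w → next₁ v ≡ next₁ w → addK d (z v) (z w) ≡ φ d 0ℤ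
      opposite v w v≢w next≡ = [ (λ e → contradiction (inj (difference≡0 (z v) (z w) e)) v≢w) , (λ e → e) ]′
        (productK≡0 d non-square (z v O.- z w) (addK d (z v) (z w))
          (O.equal-images (z v) (z w) (z (next₁ w)) c (trans (edges v) (cong z next≡)) (edges w)))
      -- Two distinct points with the same image are negatives of each other, so neither of them is
      -- 0.
      nonzero : ∀ v w → v ≢ w → next₁ v ≡ next₁ w → z v ≢ φ d 0ℤ
      nonzero v w v≢w next≡ zv≡0 = v≢w (inj (opposite-of-0 (z v) (z w) (opposite v w v≢w next≡) zv≡0))
      fixed-sum : addK d (z a) (z a') O.- O.one ≡ φ d 0ℤ
      fixed-sum = [ (λ e → contradiction (inj (difference≡0 (z a) (z a') e)) λ ()) , (λ e → e) ]′
        (productK≡0 d non-square (z a O.- z a') (addK d (z a) (z a') O.- O.one) (O.fixed-points (z a) (z a') c (edges a) (edges a')))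

open import Defs
open import Data.Integer using (ℤ)
open import Relation.Nullary using (¬_)

theorem5p2 : ∀ (d : ℤ) → NonSquare d → ∀ (c : K d) → ¬ ContainsG₁ d c
theorem5p2 = PreperiodicGraph.no-G₁
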